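{- The following are equivalent: (1) There exists a proper class of strong cardinals. (2) $\mathbf{\Sigma}_2$-$\mathrm{PRP}$. (3) $\mathbf{\Pi}_1$-$\mathrm{PRP}$. (4) $\mathbf{\Sigma}_2$-$\mathrm{SWVP}$. (5) $\mathbf{\Pi}_1$-$\mathrm{SWVP}$. (6) $\mathbf{\Sigma}_2$-$\mathrm{WVP}$. (7) $\mathbf{\Pi}_1$-$\mathrm{WVP}$.
   Context: We work in ZFC; $\Sigma_n,\Pi_n$ refer to the Levy hierarchy, and "class" means definable class. Graphs. A graph is a structure $\langle G,E_G\rangle$ with $G$ a non-empty set and $E_G$ a binary relation on $G$. A homomorphism $h:G\to H$ is a map such that $xE_Gy$ implies $h(x)E_Hh(y)$. For a set $S$ of graphs, $\prod S$ is the structure whose universe is the set of all functions $f$ with domain $S$ such that $f(\mathcal{A})$ belongs to the universe of $\mathcal{A}$ for every $\mathcal{A}\in S$, with the relation defined pointwise. Boldface principles. Let $\Gamma$ be one of $\Sigma_m,\Pi_m$, $m>0$, and let $\mathbf{\Gamma}$ denote the corresponding boldface class: $\mathbf{\Gamma}$-definable means definable by a $\Gamma$ formula with arbitrary sets as parameters. - $\mathbf{\Gamma}$-$\mathrm{PRP}$ (Product Reflection Principle): for every $\mathbf{\Gamma}$-definable proper class $\mathcal{C}$ of graphs there is a subset $S$ of $\mathcal{C}$ such that for every $G$ in $\mathcal{C}$ there is a homomorphism $\prod S\to G$. - $\mathbf{\Gamma}$-$\mathrm{WVP}$ (Weak Vopěnka Principle): there is no $\mathbf{\Gamma}$-definable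 sequence $\langle G_\alpha:\alpha\in\mathrm{OR}\rangle$ of graphs such that for every $\alpha\leq\beta$ there exists exactly one homomorphism $G_\beta\to G_\alpha$, and there is no homomorphism $G_\alpha\to G_\beta$ whenever $\alpha<\beta$. - $\mathbf{\Gamma}$-$\mathrm{SWVP}$ (Semi-Weak Vopěnka Principle): the same as $\mathbf{\Gamma}$-$\mathrm{WVP}$, with "exactly one homomorphism $G_\beta\to G_\alpha$" replaced by "at least one homomorphism $G_\beta\to G_\alpha$". A cardinal $\kappa$ is $\lambda$-strong, where $\lambda>\kappa$ is a cardinal, if there is an elementary embedding $j:V\to M$ with $M$ transitive, critical point $\kappa$, and $V_\lambda\subseteq M$; $\kappa$ is strong if it is $\lambda$-strong for every cardinal $\lambda>\kappa$. -}

module Defs where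

open import Level using (Level) renaming (suc to lsuc)
open import Data.Nat.Base using (ℕ; zero; suc)
open import Data.Fin.Base using (Fin; zero; suc)
open import Data.Vec.Base using (Vec; _∷_; lookup)
open import Data.Vec.Relation.Binary.Pointwise.Inductive using (Pointwise)
open import Data.Product using (_×_; ∃; ∃-syntax; ∃!; proj₁)
open import Data.Sum.Base using (_⊎_)
open import Data.Unit.Polymorphic.Base using (⊤)
open import Function.Bundles using (_⇔_)
open import Relation.Binary.PropositionalEquality using (_≡_; _≢_)
open import Relation.Nullary.Negation using (¬_)

infix  8 _∈̇_ _≐_
infixr 6 _∧̇_
infixr 5 _∨̇_
infixr 4 _⇒̇_

-- De Bruijn: a quantifier binds index zero of its body.
data Formula : ℕ → Set where
  _∈̇_ _≐_        : ∀ {n} → Fin n → Fin n → Formula n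
  ¬̇_             : ∀ {n} → Formula n → Formula n
  _∧̇_ _∨̇_ _⇒̇_    : ∀ {n} → Formula n → Formula n → Formula n
  ∀̇_ ∃̇_          : ∀ {n} → Formula (suc n) → Formula n

-- In the bounded quantifiers the bound is `suc i`, so it is never the
-- quantified variable itself.
data IsΔ₀ : ∀ {n} → Formula n → Set where
  mem  : ∀ {n} {i j : Fin n} → IsΔ₀ (i ∈̇ j)
  eq   : ∀ {n} {i j : Fin n} → IsΔ₀ (i ≐ j)
  neg  : ∀ {n} {φ : Formula n} → IsΔ₀ φ → IsΔ₀ (¬̇ φ)
  conj : ∀ {n} {φ ψ : Formula n} → IsΔ₀ φ → IsΔ₀ ψ → IsΔ₀ (φ ∧̇ ψ)
  disj : ∀ {n} {φ ψ : Formula n} → IsΔ₀ φ → IsΔ₀ ψ → IsΔ₀ (φ ∨̇ ψ)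
  impl : ∀ {n} {φ ψ : Formula n} → IsΔ₀ φ → IsΔ₀ ψ → IsΔ₀ (φ ⇒̇ ψ)
  all∈ : ∀ {n} {i : Fin n} {φ : Formula (suc n)} →
         IsΔ₀ φ → IsΔ₀ (∀̇ (zero ∈̇ suc i ⇒̇ φ))
  ex∈  : ∀ {n} {i : Fin n} {φ : Formula (suc n)} →
         IsΔ₀ φ → IsΔ₀ (∃̇ (zero ∈̇ suc i ∧̇ φ))

-- A Σₘ₊₁ formula is a finite block of ∃ in front of a Πₘ formula, and dually.
mutual
  data IsΣ : ℕ → ∀ {n} → Formula n → Set where
    Δ₀ : ∀ {n} {φ : Formula n} → IsΔ₀ φ → IsΣ 0 φ
    Π⇒ : ∀ {m n} {φ : Formula n} → IsΠ m φ → IsΣ (suc m) φ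
    ex : ∀ {m n} {φ : Formula (suc n)} → IsΣ (suc m) φ → IsΣ (suc m) (∃̇ φ)

  data IsΠ : ℕ → ∀ {n} → Formula n → Set where
    Δ₀  : ∀ {n} {φ : Formula n} → IsΔ₀ φ → IsΠ 0 φ
    Σ⇒  : ∀ {m n} {φ : Formula n} → IsΣ m φ → IsΠ (suc m) φ
    all : ∀ {m n} {φ : Formula (suc n)} → IsΠ (suc m) φ → IsΠ (suc m) (∀̇ φ)

-- Satisfaction with the quantifiers restricted to D.
module Satisfaction {ℓ : Level} {V : Set ℓ} (_∈_ : V → V → Set ℓ) where

  Sat : (V → Set ℓ) → ∀ {n} → Formula n → Vec V n → Set ℓ
  Sat D (i ∈̇ j) ρ = lookup ρ i ∈ lookup ρ j
  Sat D (i ≐ j) ρ = lookup ρ i ≡ lookup ρ j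
  Sat D (¬̇ φ)   ρ = ¬ Sat D φ ρ
  Sat D (φ ∧̇ ψ) ρ = Sat D φ ρ × Sat D ψ ρ
  Sat D (φ ∨̇ ψ) ρ = Sat D φ ρ ⊎ Sat D ψ ρ
  Sat D (φ ⇒̇ ψ) ρ = Sat D φ ρ → Sat D ψ ρ
  Sat D (∀̇ φ)   ρ = ∀ x → D x → Sat D φ (x ∷ ρ)
  Sat D (∃̇ φ)   ρ = ∃[ x ] (D x × Sat D φ (x ∷ ρ))

  All : V → Set ℓ
  All _ = ⊤

-- Separation and replacement are the first-order schemas: the model need not
-- be well-founded or contain every externally given subset of its elements.
record ZFCModel (ℓ : Level) : Set (lsuc ℓ) where
  infix 4 _∈_
  field
    V   : Set ℓ
    _∈_ : V → V → Set ℓ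

  open Satisfaction _∈_ public

  field
    extensionality : ∀ {x y} → (∀ z → z ∈ x ⇔ z ∈ y) → x ≡ y
    foundation     : ∀ x → (∃[ y ] y ∈ x) → ∃[ y ] (y ∈ x × ∀ z → z ∈ x → ¬ z ∈ y)
    pairing        : ∀ x y → ∃[ p ] ∀ z → z ∈ p ⇔ (z ≡ x ⊎ z ≡ y)
    union          : ∀ x → ∃[ u ] ∀ z → z ∈ u ⇔ (∃[ y ] (y ∈ x × z ∈ y))
    powerset       : ∀ x → ∃[ p ] ∀ z → z ∈ p ⇔ (∀ y → y ∈ z → y ∈ x)
    infinity       : ∃[ w ] ((∃[ e ] (e ∈ w × ∀ z → ¬ z ∈ e)) ×
                       (∀ x → x ∈ w → ∃[ s ] (s ∈ w × ∀ z → z ∈ s ⇔ (z ∈ x ⊎ z ≡ x))))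
    separation     : ∀ {n} (φ : Formula (suc n)) (ρ : Vec V n) x →
                     ∃[ y ] ∀ z → z ∈ y ⇔ (z ∈ x × Sat All φ (z ∷ ρ))
    replacement    : ∀ {n} (φ : Formula (suc (suc n))) (ρ : Vec V n) x →
                     (∀ u v w → u ∈ x → Sat All φ (u ∷ v ∷ ρ) →
                        Sat All φ (u ∷ w ∷ ρ) → v ≡ w) →
                     ∃[ y ] ∀ v → v ∈ y ⇔ (∃[ u ] (u ∈ x × Sat All φ (u ∷ v ∷ ρ)))
    choice         : ∀ x → (∀ y → y ∈ x → ∃[ z ] z ∈ y) →
                     (∀ y y′ z → y ∈ x → y′ ∈ x → z ∈ y → z ∈ y′ → y ≡ y′) →
                     ∃[ c ] ∀ y → y ∈ x → ∃! _≡_ λ z → z ∈ y × z ∈ c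

module SetTheory {ℓ : Level} (𝒱 : ZFCModel ℓ) where
  open ZFCModel 𝒱

  Predicate : Set (lsuc ℓ)
  Predicate = V → Set ℓ

  -- A class is definable from finitely many parameters.  Index zero of the
  -- formula is the element, the remaining indices are the parameters.
  record Class : Set ℓ where
    field
      {arity}    : ℕ
      formula    : Formula (suc arity)
      parameters : Vec V arity

  open Class public

  infix 4 _∈ᶜ_ _⊆_ _≤_

  _∈ᶜ_ : V → Class → Set ℓ
  x ∈ᶜ C = Sat All (formula C) (x ∷ parameters C)

  Proper : Predicate → Set ℓ
  Proper P = ¬ (∃[ s ] ∀ x → x ∈ s ⇔ P x)

  _⊆_ : V → V → Set ℓ
  x ⊆ y = ∀ z → z ∈ x → z ∈ y

  pair : V → V → V
  pair x y = proj₁ (pairing x y)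

  -- Kuratowski pairs
  ⟨_,_⟩ : V → V → V
  ⟨ x , y ⟩ = pair (pair x x) (pair x y)

  -- F is a (set or class) function with domain exactly D.
  IsFunction : Predicate → Predicate → Set ℓ
  IsFunction F D =
    (∀ z → F z → ∃[ x ] ∃[ y ] (D x × z ≡ ⟨ x , y ⟩)) ×
    (∀ x → D x → ∃! _≡_ λ y → F ⟨ x , y ⟩)

  -- A structure with one binary relation is coded as the pair of its universe
  -- and its relation.
  IsStructure : V → Set ℓ
  IsStructure A = ∃[ G ] ∃[ E ] (A ≡ ⟨ G , E ⟩ ×
    (∀ z → z ∈ E → ∃[ x ] ∃[ y ] (x ∈ G × y ∈ G × z ≡ ⟨ x , y ⟩)))

  Vertex : V → V → Set ℓ
  Vertex A x = ∃[ G ] ∃[ E ] (A ≡ ⟨ G , E ⟩ × x ∈ G)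

  Edge : V → V → V → Set ℓ
  Edge A x y = ∃[ G ] ∃[ E ] (A ≡ ⟨ G , E ⟩ × ⟨ x , y ⟩ ∈ E)

  IsGraph : V → Set ℓ
  IsGraph A = IsStructure A × ∃[ x ] Vertex A x

  IsHom : V → V → V → Set ℓ
  IsHom h A B =
    IsFunction (_∈ h) (Vertex A) ×
    (∀ x y → ⟨ x , y ⟩ ∈ h → Vertex B y) ×
    (∀ x x′ y y′ → ⟨ x , y ⟩ ∈ h → ⟨ x′ , y′ ⟩ ∈ h → Edge A x x′ → Edge B y y′)

  -- P = ∏ S; these clauses determine P by extensionality.
  IsProduct : V → V → Set ℓ
  IsProduct S P =
    IsStructure P ×
    (∀ f → Vertex P f ⇔
       (IsFunction (_∈ f) (_∈ S) ×
        (∀ A x → A ∈ S → ⟨ A , x ⟩ ∈ f → Vertex A x))) ×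
    (∀ f g → Edge P f g ⇔
       (Vertex P f × Vertex P g ×
        (∀ A x y → A ∈ S → ⟨ A , x ⟩ ∈ f → ⟨ A , y ⟩ ∈ g → Edge A x y)))

  _≤_ : V → V → Set ℓ
  α ≤ β = α ∈ β ⊎ α ≡ β

  IsTransitive : Predicate → Set ℓ
  IsTransitive M = ∀ x y → M x → y ∈ x → M y

  IsWellOrderedBy∈ : V → Set ℓ
  IsWellOrderedBy∈ α =
    (∀ x → x ∈ α → ¬ x ∈ x) ×
    (∀ x y z → x ∈ α → y ∈ α → z ∈ α → x ∈ y → y ∈ z → x ∈ z) ×
    (∀ x y → x ∈ α → y ∈ α → x ∈ y ⊎ x ≡ y ⊎ y ∈ x) ×
    (∀ s → s ⊆ α → (∃[ x ] x ∈ s) → ∃[ x ] (x ∈ s × ∀ y → y ∈ s → x ≤ y))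

  IsOrdinal : V → Set ℓ
  IsOrdinal α = IsTransitive (_∈ α) × IsWellOrderedBy∈ α

  IsBijection : V → V → V → Set ℓ
  IsBijection f a b =
    IsFunction (_∈ f) (_∈ a) ×
    (∀ x y → ⟨ x , y ⟩ ∈ f → y ∈ b) ×
    (∀ y → y ∈ b → ∃! _≡_ λ x → ⟨ x , y ⟩ ∈ f)

  IsCardinal : V → Set ℓ
  IsCardinal κ = IsOrdinal κ × (∀ α → α ∈ κ → ¬ (∃[ f ] IsBijection f α κ))

  -- w = V_α, by the recursion V_α = ⋃_{γ<α} 𝒫(V_γ), with f the sequence
  -- ⟨V_γ : γ < α⟩.  The sequence is an element of the model: an inductive type
  -- would only reach the externally well-founded ordinals.
  IsStage : V → V → Set ℓ
  IsStage α w = ∃[ f ] (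
    IsFunction (_∈ f) (_∈ α) ×
    (∀ β v → ⟨ β , v ⟩ ∈ f → ∀ x → x ∈ v ⇔
       (∃[ γ ] ∃[ u ] (γ ∈ β × ⟨ γ , u ⟩ ∈ f × x ⊆ u))) ×
    (∀ x → x ∈ w ⇔ (∃[ γ ] ∃[ u ] (γ ∈ α × ⟨ γ , u ⟩ ∈ f × x ⊆ u))))

  -- Elementarity is a schema over all formulas; note the second satisfaction is
  -- the one in the definable class M.
  IsElementaryEmbedding : Class → Class → Set ℓ
  IsElementaryEmbedding j M =
    IsFunction (_∈ᶜ j) All ×
    (∀ x y → ⟨ x , y ⟩ ∈ᶜ j → y ∈ᶜ M) ×
    (∀ {n} (φ : Formula n) (ρ σ : Vec V n) →
       Pointwise (λ x y → ⟨ x , y ⟩ ∈ᶜ j) ρ σ →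
       Sat All φ ρ ⇔ Sat (_∈ᶜ M) φ σ)

  -- κ is the least ordinal moved by j.
  IsCriticalPoint : V → Class → Set ℓ
  IsCriticalPoint κ j =
    IsOrdinal κ ×
    (∀ α → α ∈ κ → ⟨ α , α ⟩ ∈ᶜ j) ×
    ¬ (⟨ κ , κ ⟩ ∈ᶜ j)

  -- For cardinals κ < μ: κ is μ-strong.
  IsStrongUpTo : V → V → Set ℓ
  IsStrongUpTo μ κ = ∃[ j ] ∃[ M ] (
    IsElementaryEmbedding j M ×
    IsTransitive (_∈ᶜ M) ×
    IsCriticalPoint κ j ×
    (∀ w x → IsStage μ w → x ∈ w → x ∈ᶜ M))

  IsStrong : V → Set ℓ
  IsStrong κ = IsCardinal κ × (∀ μ → IsCardinal μ → κ ∈ μ → IsStrongUpTo μ κ)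

  -- A lightface formula class Γ; parameters come with `Class`, so the
  -- principles below are the boldface ones.
  FormulaClass : Set₁
  FormulaClass = ∀ {n} → Formula n → Set

  PRP : FormulaClass → Set ℓ
  PRP Γ = ∀ C → Γ (formula C) → (∀ x → x ∈ᶜ C → IsGraph x) → Proper (_∈ᶜ C) →
    ∃[ S ] ((∀ x → x ∈ S → x ∈ᶜ C) ×
      (∀ G → G ∈ᶜ C → ∃[ P ] (IsProduct S P × ∃[ h ] IsHom h P G)))

  -- C is a sequence ⟨G_α : α ∈ OR⟩ of graphs, as a class of pairs ⟨α , G_α⟩.
  IsGraphSequence : Class → Set ℓ
  IsGraphSequence C =
    IsFunction (_∈ᶜ C) IsOrdinal × (∀ α G → ⟨ α , G ⟩ ∈ᶜ C → IsGraph G)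

  NoForwardHom : Class → Set ℓ
  NoForwardHom C = ∀ α β A B → ⟨ α , A ⟩ ∈ᶜ C → ⟨ β , B ⟩ ∈ᶜ C →
    α ∈ β → ¬ (∃[ h ] IsHom h A B)

  WVP : FormulaClass → Set ℓ
  WVP Γ = ¬ (∃[ C ] (Γ (formula C) × IsGraphSequence C ×
    (∀ α β A B → ⟨ α , A ⟩ ∈ᶜ C → ⟨ β , B ⟩ ∈ᶜ C →
       α ≤ β → ∃! _≡_ λ h → IsHom h B A) ×
    NoForwardHom C))

  SWVP : FormulaClass → Set ℓ
  SWVP Γ = ¬ (∃[ C ] (Γ (formula C) × IsGraphSequence C ×
    (∀ α β A B → ⟨ α , A ⟩ ∈ᶜ C → ⟨ β , B ⟩ ∈ᶜ C →
       α ≤ β → ∃[ h ] IsHom h B A) ×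
    NoForwardHom C))

{-# OPTIONS --safe #-}

-- Let κ be the least strong cardinal above the ranks of the parameters of a Σ₂ class C of graphs,
-- let θ bound witnesses that the ordinals below κ are not strong, and let S = C ∩ V_θ. An
-- embedding j with critical point κ whose target contains V_ν sends θ above ν, so for G ∈ C and
-- large ν the graph G belongs to j(S), and f ↦ j(f)(G) is a homomorphism ∏ S → G. Applied to the
-- range of a sequence as in SWVP, product reflection yields a forward homomorphism.
--
-- Conversely let ρ bound the strong cardinals. G_α codes the power set of V_λ, λ = λ(α) > α, with
-- finitely many relations. A map e from the subsets of V_λ to those of V_λ′ preserving them is an
-- extender: its ultrapower is an elementary embedding j with j(X) ∩ V_λ′ = e(X) and V_λ′ in the
-- target. The levels λ are closed under failures of strongness, which excludes critical points
-- between ρ and λ′, and a choice of cofinal ω-sequences on ρ, named by the graph, excludes those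
-- below ρ. Hence e(X) = X ∩ V_λ′ is the only homomorphism, and a predicate for α ⊆ X blocks the
-- forward ones.
--
-- The model need not be well-founded, so embeddings and inner models are formulas with parameters,
-- and all recursions and collapses are carried out inside the model.

module Submission where

open import Defs
open import Axiom.ExcludedMiddle using (ExcludedMiddle)
open import Data.Bool.Base using (Bool; true; false; _∧_; _∨_; not)
open import Data.Bool.Properties using () renaming (_≟_ to _≟ᵇ_)
open import Data.Empty using (⊥; ⊥-elim)
open import Data.Fin using (#_)
open import Data.Fin.Base using (Fin; zero; suc; toℕ; _↑ˡ_; _↑ʳ_)
open import Data.Fin.Patterns using (0F; 1F; 2F; 3F; 4F; 5F; 6F; 7F; 8F; 9F)
open import Data.Fin.Properties using (toℕ-injective; suc-injective; all?) renaming (_≟_ to _≟ᶠ_)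
open import Data.List.Base using (List; []; _∷_) renaming (_++_ to _++ˡ_)
open import Data.Nat.Base using (ℕ; zero; suc; _+_)
open import Data.Product using (_×_; ∃; ∃-syntax; ∃!; proj₁; proj₂; _,_; Σ-syntax)
open import Data.Sum.Base using (_⊎_; inj₁; inj₂; [_,_]′)
open import Data.Unit.Base using () renaming (tt to tt₀; ⊤ to ⊤₀)
open import Data.Unit.Polymorphic.Base using (tt)
open import Data.Vec.Base using (Vec; []; _∷_; lookup; tail; map; tabulate; _++_; _∷ʳ_; last; head)
open import Data.Vec.Properties using (lookup-++ˡ; lookup-++ʳ; lookup-map; lookup∘tabulate; tabulate∘lookup; map-∘; map-cong; map-id; map-++)
open import Data.Vec.Relation.Binary.Pointwise.Inductive using (Pointwise; []; _∷_)
open import Function.Base using (_∘_; id; case_of_; _$_)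
open import Function.Bundles using (_⇔_; mk⇔; module Equivalence)
open import Level using (Level; Lift; lift; lower)
open import Relation.Binary.PropositionalEquality using (_≡_; _≢_; refl; sym; trans; cong; cong₂; subst; subst₂)
open import Relation.Nullary.Decidable using (_⊎-dec_; _×-dec_; Dec; yes; no; does; toWitness)
open import Relation.Nullary.Negation using (¬_)

-- Strongness quantifies over the classes `j` and `M`, so it is not a formula of the model and
-- cannot enter separation or replacement. It is replaced by `QAll`, which quantifies over sets
-- only: maps on the subsets of V_μ that preserve certain relations. These relations are what Łoś's
-- theorem and the collapse consume: Boolean operations and rearrangements of finite stacks for
-- connectives and variables, a bounded projection so that the identity function represents the
-- seeds, and well-foundedness. They are finitely many and Δ₀, which is what lets graphs code them.
--
-- Three copies of every subset and ten kinds of triples make 13 sorts of vertices. A rigid core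
-- with one vertex per sort marks them, and this is the origin of the number 13.
--
-- Complexity is the second constraint: the sequence must be Π₁, and for product reflection its
-- range as well. The graphs therefore record in their core vertices the index, the level λ, the
-- hierarchy below λ, V_λ and its power set. Correctness of this record is a single universal
-- quantifier in front of a Δ₀ matrix, and the index can be read off the graph.

module Syntax where
  open Equivalence public using (to; from)

  private variable
    a b c : Level
    A A′ B B′ : Set a

  ⇔-refl : A ⇔ A
  ⇔-refl = mk⇔ id id

  ⇔-sym : A ⇔ B → B ⇔ A
  ⇔-sym e = mk⇔ (from e) (to e)

  infixr 2 _⇔∘_
  _⇔∘_ : {C : Set c} → A ⇔ B → B ⇔ C → A ⇔ C
  e ⇔∘ f = mk⇔ (to f ∘ to e) (from e ∘ from f)

  ×-⇔ : A ⇔ A′ → B ⇔ B′ → (A × B) ⇔ (A′ × B′)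
  ×-⇔ e f = mk⇔ (λ (x , y) → to e x , to f y) (λ (x , y) → from e x , from f y)

  ⊎-⇔ : A ⇔ A′ → B ⇔ B′ → (A ⊎ B) ⇔ (A′ ⊎ B′)
  ⊎-⇔ e f = mk⇔ [ inj₁ ∘ to e , inj₂ ∘ to f ]′ [ inj₁ ∘ from e , inj₂ ∘ from f ]′

  →-⇔ : A ⇔ A′ → B ⇔ B′ → (A → B) ⇔ (A′ → B′)
  →-⇔ e f = mk⇔ (λ g → to f ∘ g ∘ from e) (λ g → from f ∘ g ∘ to e)

  ¬-⇔ : A ⇔ A′ → (¬ A) ⇔ (¬ A′)
  ¬-⇔ e = mk⇔ (λ n → n ∘ from e) (λ n → n ∘ to e)

  ∀-⇔ : {P : A → Set b} {Q : A → Set c} → (∀ x → P x ⇔ Q x) → (∀ x → P x) ⇔ (∀ x → Q x)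
  ∀-⇔ e = mk⇔ (λ f x → to (e x) (f x)) (λ f x → from (e x) (f x))

  ∃-⇔ : {P : A → Set b} {Q : A → Set c} → (∀ x → P x ⇔ Q x) → ∃ P ⇔ ∃ Q
  ∃-⇔ e = mk⇔ (λ (x , p) → x , to (e x) p) (λ (x , p) → x , from (e x) p)

  ≡-⇔ : ∀ {ℓ} {A B : Set ℓ} → A ≡ B → A ⇔ B
  ≡-⇔ refl = ⇔-refl

  pattern v0 = zero
  pattern v1 = suc zero
  pattern v2 = suc (suc zero)
  pattern v3 = suc (suc (suc zero))
  pattern v4 = suc (suc (suc (suc zero)))
  pattern v5 = suc (suc (suc (suc (suc zero))))
  pattern v6 = suc (suc (suc (suc (suc (suc zero)))))
  pattern v7 = suc (suc (suc (suc (suc (suc (suc zero))))))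
  pattern v8 = suc (suc (suc (suc (suc (suc (suc (suc zero)))))))
  pattern v9 = suc (suc (suc (suc (suc (suc (suc (suc (suc zero))))))))

  -- Renaming of variables in formulas and the index arithmetic of concatenated environments.

  ext : ∀ {n k} → (Fin n → Fin k) → Fin (suc n) → Fin (suc k)
  ext f zero    = zero
  ext f (suc i) = suc (f i)

  rename : ∀ {n k} → (Fin n → Fin k) → Formula n → Formula k
  rename f (i ∈̇ j) = f i ∈̇ f j
  rename f (i ≐ j) = f i ≐ f j
  rename f (¬̇ φ)   = ¬̇ rename f φ
  rename f (φ ∧̇ ψ) = rename f φ ∧̇ rename f ψ
  rename f (φ ∨̇ ψ) = rename f φ ∨̇ rename f ψ
  rename f (φ ⇒̇ ψ) = rename f φ ⇒̇ rename f ψ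
  rename f (∀̇ φ)   = ∀̇ rename (ext f) φ
  rename f (∃̇ φ)   = ∃̇ rename (ext f) φ

  rename-Δ₀ : ∀ {n k} (f : Fin n → Fin k) {φ : Formula n} → IsΔ₀ φ → IsΔ₀ (rename f φ)
  rename-Δ₀ f mem        = mem
  rename-Δ₀ f eq         = eq
  rename-Δ₀ f (neg p)    = neg (rename-Δ₀ f p)
  rename-Δ₀ f (conj p q) = conj (rename-Δ₀ f p) (rename-Δ₀ f q)
  rename-Δ₀ f (disj p q) = disj (rename-Δ₀ f p) (rename-Δ₀ f q)
  rename-Δ₀ f (impl p q) = impl (rename-Δ₀ f p) (rename-Δ₀ f q)
  rename-Δ₀ f (all∈ p)   = all∈ (rename-Δ₀ (ext f) p)
  rename-Δ₀ f (ex∈ p)    = ex∈ (rename-Δ₀ (ext f) p)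

  mutual
    rename-Σ : ∀ {m n k} (f : Fin n → Fin k) {φ : Formula n} → IsΣ m φ → IsΣ m (rename f φ)
    rename-Σ f (Δ₀ p) = Δ₀ (rename-Δ₀ f p)
    rename-Σ f (Π⇒ p) = Π⇒ (rename-Π f p)
    rename-Σ f (ex p) = ex (rename-Σ (ext f) p)

    rename-Π : ∀ {m n k} (f : Fin n → Fin k) {φ : Formula n} → IsΠ m φ → IsΠ m (rename f φ)
    rename-Π f (Δ₀ p)  = Δ₀ (rename-Δ₀ f p)
    rename-Π f (Σ⇒ p)  = Σ⇒ (rename-Σ f p)
    rename-Π f (all p) = all (rename-Π (ext f) p)

  Vec-tail : ∀ {X : Set a} {n} (ρ : Vec X (suc n)) (i : Fin n) → lookup ρ (suc i) ≡ lookup (tail ρ) i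
  Vec-tail (x ∷ ρ) i = refl

  -- Combining two definitions concatenates their parameter lists; `embedˡ` and `embedʳ` keep the
  -- first `n` variables and send the parameters into the left or the right list.
  embedˡ : ∀ n {m k} → Fin (n + m) → Fin (n + (m + k))
  embedˡ zero        i       = i ↑ˡ _
  embedˡ (suc n)     zero    = zero
  embedˡ (suc n)     (suc i) = suc (embedˡ n i)

  embedʳ : ∀ n {m k} → Fin (n + k) → Fin (n + (m + k))
  embedʳ zero        i       = _ ↑ʳ i
  embedʳ (suc n)     zero    = zero
  embedʳ (suc n)     (suc i) = suc (embedʳ n i)

  lookup-embedˡ : ∀ {X : Set a} {n m k} (ρ : Vec X n) (xs : Vec X m) (ys : Vec X k) i →
    lookup (ρ ++ (xs ++ ys)) (embedˡ n i) ≡ lookup (ρ ++ xs) i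
  lookup-embedˡ []      xs ys i       = lookup-++ˡ xs ys i
  lookup-embedˡ (x ∷ ρ) xs ys zero    = refl
  lookup-embedˡ (x ∷ ρ) xs ys (suc i) = lookup-embedˡ ρ xs ys i

  lookup-embedʳ : ∀ {X : Set a} {n m k} (ρ : Vec X n) (xs : Vec X m) (ys : Vec X k) i →
    lookup (ρ ++ (xs ++ ys)) (embedʳ n i) ≡ lookup (ρ ++ ys) i
  lookup-embedʳ []      xs ys i       = lookup-++ʳ xs ys i
  lookup-embedʳ (x ∷ ρ) xs ys zero    = refl
  lookup-embedʳ (x ∷ ρ) xs ys (suc i) = lookup-embedʳ ρ xs ys i

  liftRen : ∀ {n k} m → (Fin n → Fin k) → Fin (n + m) → Fin (k + m)
  liftRen {zero}  {k} m f i       = k ↑ʳ i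
  liftRen {suc n} {k} m f zero    = f zero ↑ˡ m
  liftRen {suc n} {k} m f (suc i) = liftRen m (f ∘ suc) i

  lookup-liftRen : ∀ {X : Set a} {n k m} (f : Fin n → Fin k) (ρ : Vec X k) (xs : Vec X m) i →
    lookup (ρ ++ xs) (liftRen m f i) ≡ lookup (tabulate (lookup ρ ∘ f) ++ xs) i
  lookup-liftRen {n = zero}  f ρ xs i       = lookup-++ʳ ρ xs i
  lookup-liftRen {n = suc n} f ρ xs zero    = lookup-++ˡ ρ xs (f zero)
  lookup-liftRen {n = suc n} f ρ xs (suc i) = lookup-liftRen (f ∘ suc) ρ xs i

open Syntax public

-- A rigid digraph on 13 vertices.

module Core where
  -- A directed 13-cycle with the additional edge 1 → 0.

  next : Fin 13 → Fin 13
  next i = lookup (tabulate {n = 12} suc ∷ʳ zero) i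

  CoreEdge : Fin 13 → Fin 13 → Set
  CoreEdge i j = j ≡ next i ⊎ (i ≡ 1F × j ≡ 0F)

  -- The enumeration branches only at the vertex 1, which has two successors, so that the test of
  -- all walks of length 12 is a feasible computation. The walk is accumulated in the continuation
  -- `P`.
  onWalks : ∀ n → Fin 13 → (Vec (Fin 13) n → Bool) → Bool
  onWalks zero    i P = P []
  onWalks (suc n) i P = onWalks n (next i) (λ w → P (next i ∷ w)) ∧ (not (does (i ≟ᶠ 1F)) ∨ onWalks n 0F (λ w → P (0F ∷ w)))

  Walk : ∀ {n} → Fin 13 → Vec (Fin 13) n → Set
  Walk i []      = ⊤₀
  Walk i (j ∷ w) = CoreEdge i j × Walk j w

  ∧-true : ∀ {a b} → a ∧ b ≡ true → a ≡ true × b ≡ true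
  ∧-true {true} {true} _ = refl , refl

  onWalks-sound : ∀ n i P → onWalks n i P ≡ true → ∀ w → Walk i w → P w ≡ true
  onWalks-sound zero    i P h []      _                = h
  onWalks-sound (suc n) i P h (j ∷ w) (inj₁ refl , k)  = onWalks-sound n (next i) _ (proj₁ (∧-true h)) w k
  onWalks-sound (suc n) i P h (j ∷ w) (inj₂ (refl , refl) , k) =
    onWalks-sound n 0F _ (proj₂ (∧-true {onWalks n (next 1F) (λ w → P (next 1F ∷ w))} h)) w k

  eqᵇ : ∀ {n} → Vec (Fin 13) n → Vec (Fin 13) n → Bool
  eqᵇ []      []      = true
  eqᵇ (i ∷ v) (j ∷ w) = does (i ≟ᶠ j) ∧ eqᵇ v w

  eqᵇ-sound : ∀ {n} (v w : Vec (Fin 13) n) → eqᵇ v w ≡ true → v ≡ w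
  eqᵇ-sound []      []      _ = refl
  eqᵇ-sound (i ∷ v) (j ∷ w) h with i ≟ᶠ j
  ... | yes refl = cong (i ∷_) (eqᵇ-sound v w h)

  edgeᵇ : Fin 13 → Fin 13 → Bool
  edgeᵇ i j = does (j ≟ᶠ next i) ∨ (does (i ≟ᶠ 1F) ∧ does (j ≟ᶠ 0F))

  edgeᵇ-complete : ∀ {i j} → CoreEdge i j → edgeᵇ i j ≡ true
  edgeᵇ-complete {i} (inj₁ refl) with next i ≟ᶠ next i
  ... | yes _ = refl
  ... | no n = ⊥-elim (n refl)
  edgeᵇ-complete (inj₂ (refl , refl)) = refl

  orbit : Vec (Fin 13) 12
  orbit = tabulate suc

  -- An endomorphism maps the cycle to a closed walk with a chord; of the walks of length 12, which
  -- are few, only the cycle itself closes up in this way.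
  closes : Fin 13 → Vec (Fin 13) 12 → Bool
  closes i w = not (edgeᵇ (last w) i ∧ edgeᵇ (head w) i) ∨ (does (i ≟ᶠ 0F) ∧ eqᵇ w orbit)

  closing-walks : ∀ i → onWalks 12 i (closes i) ≡ true
  closing-walks = toWitness {a? = all? λ i → onWalks 12 i (closes i) ≟ᵇ true} tt₀

  modus : ∀ {a b c d} → not (a ∧ b) ∨ (c ∧ d) ≡ true → a ≡ true → b ≡ true → c ≡ true × d ≡ true
  modus h refl refl = ∧-true h

  does-sound : ∀ {i j : Fin 13} → does (i ≟ᶠ j) ≡ true → i ≡ j
  does-sound {i} {j} h with i ≟ᶠ j
  ... | yes p = p

  -- Besides the cycle, the only short closed walk is 0 → 1 → 0; as 13 is odd, the cycle cannot be
  -- folded onto it. The edge 1 → 0 excludes the rotations. The image of the cycle is one of the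
  -- walks tested by `closing-walks`.
  core-rigid : (σ : Fin 13 → Fin 13) → (∀ i j → CoreEdge i j → CoreEdge (σ i) (σ j)) → ∀ i → σ i ≡ i
  core-rigid σ h = λ { zero → does-sound (proj₁ conclusion) ; (suc i) → trans (sym (lookup∘tabulate (λ i → σ (suc i)) i))
        (trans (cong (λ w → lookup w i) (eqᵇ-sound path orbit (proj₂ conclusion))) (lookup∘tabulate suc i)) }
    where
      path : Vec (Fin 13) 12
      path = tabulate (λ i → σ (suc i))
      step : ∀ i → CoreEdge (σ i) (σ (next i))
      step i = h i (next i) (inj₁ refl)
      walk : Walk (σ 0F) path
      walk = step 0F , step 1F , step 2F , step 3F , step 4F , step 5F , step 6F , step 7F , step 8F , step 9F ,
        step (suc 9F) , step (suc (suc 9F)) , tt₀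
      conclusion : does (σ 0F ≟ᶠ 0F) ≡ true × eqᵇ path orbit ≡ true
      conclusion = modus {edgeᵇ (last path) (σ 0F)} {edgeᵇ (head path) (σ 0F)}
        (onWalks-sound 12 (σ 0F) (closes (σ 0F)) (closing-walks (σ 0F)) path walk)
        (edgeᵇ-complete (step (suc (suc (suc 9F))))) (edgeᵇ-complete (h 1F 0F (inj₂ (refl , refl))))

open Core using (CoreEdge; next; core-rigid)

module Theory {ℓ : Level} (em : ExcludedMiddle ℓ) (𝒱 : ZFCModel ℓ) where
  open ZFCModel 𝒱 public
  open SetTheory 𝒱 public

  -- Definable relations, terms, and the schemas of separation and replacement for them.

  module Formulas where

    lem : (A : Set ℓ) → A ⊎ ¬ A
    lem A with em {A}
    ... | yes a = inj₁ a
    ... | no na = inj₂ na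

    byContra : {A : Set ℓ} → ¬ ¬ A → A
    byContra {A} nn with em {A}
    ... | yes a = a
    ... | no na = ⊥-elim (nn na)

    Sat-rename : ∀ (M : V → Set ℓ) {n k} (f : Fin n → Fin k) (φ : Formula n) (ρ : Vec V n) (σ : Vec V k) →
      (∀ i → lookup σ (f i) ≡ lookup ρ i) → Sat M φ ρ ⇔ Sat M (rename f φ) σ
    Sat-rename M f (i ∈̇ j) ρ σ e = ≡-⇔ (cong₂ _∈_ (sym (e i)) (sym (e j)))
    Sat-rename M f (i ≐ j) ρ σ e = ≡-⇔ (cong₂ _≡_ (sym (e i)) (sym (e j)))
    Sat-rename M f (¬̇ φ) ρ σ e = ¬-⇔ (Sat-rename M f φ ρ σ e)
    Sat-rename M f (φ ∧̇ ψ) ρ σ e = ×-⇔ (Sat-rename M f φ ρ σ e) (Sat-rename M f ψ ρ σ e)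
    Sat-rename M f (φ ∨̇ ψ) ρ σ e = ⊎-⇔ (Sat-rename M f φ ρ σ e) (Sat-rename M f ψ ρ σ e)
    Sat-rename M f (φ ⇒̇ ψ) ρ σ e = →-⇔ (Sat-rename M f φ ρ σ e) (Sat-rename M f ψ ρ σ e)
    Sat-rename M f (∀̇ φ) ρ σ e = ∀-⇔ λ x → →-⇔ ⇔-refl
      (Sat-rename M (ext f) φ (x ∷ ρ) (x ∷ σ) λ { zero → refl ; (suc i) → e i })
    Sat-rename M f (∃̇ φ) ρ σ e = ∃-⇔ λ x → ×-⇔ ⇔-refl
      (Sat-rename M (ext f) φ (x ∷ ρ) (x ∷ σ) λ { zero → refl ; (suc i) → e i })

    Sat-Δ₀ : ∀ (M : V → Set ℓ) → IsTransitive M → ∀ {n} {φ : Formula n} → IsΔ₀ φ → (ρ : Vec V n) →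
      (∀ i → M (lookup ρ i)) → Sat M φ ρ ⇔ Sat All φ ρ
    Sat-Δ₀ M t mem ρ m = ⇔-refl
    Sat-Δ₀ M t eq ρ m = ⇔-refl
    Sat-Δ₀ M t (neg p) ρ m = ¬-⇔ (Sat-Δ₀ M t p ρ m)
    Sat-Δ₀ M t (conj p q) ρ m = ×-⇔ (Sat-Δ₀ M t p ρ m) (Sat-Δ₀ M t q ρ m)
    Sat-Δ₀ M t (disj p q) ρ m = ⊎-⇔ (Sat-Δ₀ M t p ρ m) (Sat-Δ₀ M t q ρ m)
    Sat-Δ₀ M t (impl p q) ρ m = →-⇔ (Sat-Δ₀ M t p ρ m) (Sat-Δ₀ M t q ρ m)
    Sat-Δ₀ M t (all∈ {i = i} p) ρ m = mk⇔
      (λ f x _ x∈ → to (ih x x∈) (f x (t _ _ (m i) x∈) x∈))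
      (λ f x _ x∈ → from (ih x x∈) (f x tt x∈))
      where ih = λ x x∈ → Sat-Δ₀ M t p (x ∷ ρ) λ { zero → t _ _ (m i) x∈ ; (suc j) → m j }
    Sat-Δ₀ M t (ex∈ {i = i} p) ρ m = mk⇔
      (λ (x , _ , x∈ , s) → x , tt , x∈ , to (ih x x∈) s)
      (λ (x , _ , x∈ , s) → x , t _ _ (m i) x∈ , x∈ , from (ih x x∈) s)
      where ih = λ x x∈ → Sat-Δ₀ M t p (x ∷ ρ) λ { zero → t _ _ (m i) x∈ ; (suc j) → m j }

    -- A relation of the metatheory together with a formula for it. The absence of parameters lets
    -- elementarity move the relation from ρ to the images of ρ alone, and the class Γ is what
    -- absoluteness for transitive classes depends on.
    record Closed (Γ : FormulaClass) (n : ℕ) (P : Vec V n → Set ℓ) : Set ℓ where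
      constructor closed
      field
        form  : Formula n
        class : Γ form
        means : ∀ ρ → Sat All form ρ ⇔ P ρ

    -- The companion of `Closed` for the axiom schemas and internal inductions, where arbitrary
    -- parameters are allowed and complexity is not recorded.
    record Def (n : ℕ) (P : Vec V n → Set ℓ) : Set ℓ where
      constructor def
      field
        {arity′} : ℕ
        params   : Vec V arity′
        form     : Formula (n + arity′)
        means    : ∀ ρ → Sat All form (ρ ++ params) ⇔ P ρ

    D₀ : (n : ℕ) → (Vec V n → Set ℓ) → Set ℓ
    D₀ = Closed IsΔ₀

    infix  8 _∈₀_ _≡₀_
    infixr 6 _∧₀_ _∧ᵈ_
    infixr 5 _∨₀_ _∨ᵈ_
    infixr 4 _⇒₀_ _⇒ᵈ_ _⇔₀_ _⇔ᵈ_

    private variable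
      n : ℕ
      P Q : Vec V n → Set ℓ

    opaque
      _∈₀_ : (i j : Fin n) → D₀ n (λ ρ → lookup ρ i ∈ lookup ρ j)
      i ∈₀ j = closed (i ∈̇ j) mem λ _ → ⇔-refl

      _≡₀_ : (i j : Fin n) → D₀ n (λ ρ → lookup ρ i ≡ lookup ρ j)
      i ≡₀ j = closed (i ≐ j) eq λ _ → ⇔-refl

      ¬₀_ : D₀ n P → D₀ n (λ ρ → ¬ P ρ)
      ¬₀ closed φ p e = closed (¬̇ φ) (neg p) λ ρ → ¬-⇔ (e ρ)

      _∧₀_ : D₀ n P → D₀ n Q → D₀ n (λ ρ → P ρ × Q ρ)
      closed φ p e ∧₀ closed ψ q f = closed (φ ∧̇ ψ) (conj p q) λ ρ → ×-⇔ (e ρ) (f ρ)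

      _∨₀_ : D₀ n P → D₀ n Q → D₀ n (λ ρ → P ρ ⊎ Q ρ)
      closed φ p e ∨₀ closed ψ q f = closed (φ ∨̇ ψ) (disj p q) λ ρ → ⊎-⇔ (e ρ) (f ρ)

      _⇒₀_ : D₀ n P → D₀ n Q → D₀ n (λ ρ → P ρ → Q ρ)
      closed φ p e ⇒₀ closed ψ q f = closed (φ ⇒̇ ψ) (impl p q) λ ρ → →-⇔ (e ρ) (f ρ)

      cast₀ : (∀ ρ → P ρ ⇔ Q ρ) → D₀ n P → D₀ n Q
      cast₀ e (closed φ p f) = closed φ p λ ρ → f ρ ⇔∘ e ρ

      infixl 1 _redef₀_
      _redef₀_ : D₀ n P → (∀ ρ → P ρ ⇔ Q ρ) → D₀ n Q
      d redef₀ e = cast₀ e d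

      ∀∈₀ : (i : Fin n) → D₀ (suc n) P → D₀ n (λ ρ → ∀ x → x ∈ lookup ρ i → P (x ∷ ρ))
      ∀∈₀ i (closed φ p e) = closed (∀̇ (zero ∈̇ suc i ⇒̇ φ)) (all∈ p) λ ρ →
        mk⇔ (λ f x x∈ → to (e _) (f x tt x∈)) (λ f x _ x∈ → from (e _) (f x x∈))

      ∃∈₀ : (i : Fin n) → D₀ (suc n) P → D₀ n (λ ρ → ∃[ x ] (x ∈ lookup ρ i × P (x ∷ ρ)))
      ∃∈₀ i (closed φ p e) = closed (∃̇ (zero ∈̇ suc i ∧̇ φ)) (ex∈ p) λ ρ →
        mk⇔ (λ (x , _ , x∈ , s) → x , x∈ , to (e _) s) (λ (x , x∈ , s) → x , tt , x∈ , from (e _) s)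

      ren₀ : ∀ {k} (f : Fin k → Fin n) {P : Vec V k → Set ℓ} → D₀ k P → D₀ n (λ ρ → P (tabulate (lookup ρ ∘ f)))
      ren₀ f (closed φ p e) = closed (rename f φ) (rename-Δ₀ f p) λ ρ →
        ⇔-sym (Sat-rename All f φ (tabulate (lookup ρ ∘ f)) ρ (λ i → sym (lookup∘tabulate _ i))) ⇔∘ e _

    _⇔₀_ : D₀ n P → D₀ n Q → D₀ n (λ ρ → P ρ ⇔ Q ρ)
    p ⇔₀ q = cast₀ (λ ρ → mk⇔ (λ (f , g) → mk⇔ f g) (λ e → to e , from e)) ((p ⇒₀ q) ∧₀ (q ⇒₀ p))

    opaque
      D₀⇒D : D₀ n P → Def n P
      D₀⇒D {n} (closed φ _ e) = def [] (rename (embedˡ′ n) φ) λ ρ →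
        ⇔-sym (Sat-rename All (embedˡ′ n) φ ρ (ρ ++ []) (λ i → lookup-++ˡ ρ [] i)) ⇔∘ e ρ
        where
          embedˡ′ : ∀ n → Fin n → Fin (n + 0)
          embedˡ′ n i = i ↑ˡ 0

      castᵈ : (∀ ρ → P ρ ⇔ Q ρ) → Def n P → Def n Q
      castᵈ e (def ps φ f) = def ps φ λ ρ → f ρ ⇔∘ e ρ

      infixl 1 _redef_
      _redef_ : Def n P → (∀ ρ → P ρ ⇔ Q ρ) → Def n Q
      d redef e = castᵈ e d

      ¬ᵈ_ : Def n P → Def n (λ ρ → ¬ P ρ)
      ¬ᵈ def ps φ e = def ps (¬̇ φ) λ ρ → ¬-⇔ (e ρ)

      ∀ᵈ : Def (suc n) P → Def n (λ ρ → ∀ x → P (x ∷ ρ))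
      ∀ᵈ (def ps φ e) = def ps (∀̇ φ) λ ρ →
        mk⇔ (λ f x → to (e _) (f x tt)) (λ f x _ → from (e _) (f x))

      ∃ᵈ : Def (suc n) P → Def n (λ ρ → ∃[ x ] P (x ∷ ρ))
      ∃ᵈ (def ps φ e) = def ps (∃̇ φ) λ ρ →
        mk⇔ (λ (x , _ , s) → x , to (e _) s) (λ (x , s) → x , tt , from (e _) s)

      _∧ᵈ_ : Def n P → Def n Q → Def n (λ ρ → P ρ × Q ρ)
      _∧ᵈ_ {n} (def ps φ e) (def qs ψ f) = def (ps ++ qs) (rename (embedˡ n) φ ∧̇ rename (embedʳ n) ψ) λ ρ →
        ×-⇔ (⇔-sym (Sat-rename All (embedˡ n) φ _ _ (lookup-embedˡ ρ ps qs)) ⇔∘ e ρ)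
            (⇔-sym (Sat-rename All (embedʳ n) ψ _ _ (lookup-embedʳ ρ ps qs)) ⇔∘ f ρ)

      renᵈ : ∀ {k} (f : Fin k → Fin n) {P : Vec V k → Set ℓ} → Def k P → Def n (λ ρ → P (tabulate (lookup ρ ∘ f)))
      renᵈ f (def {m} ps φ e) = def ps (rename (liftRen m f) φ) λ ρ →
        ⇔-sym (Sat-rename All (liftRen m f) φ _ _ (lookup-liftRen f ρ ps)) ⇔∘ e _

      var∈ : (i j : Fin n) → Def n (λ ρ → lookup ρ i ∈ lookup ρ j)
      var∈ i j = D₀⇒D (i ∈₀ j)

      var≡ : (i j : Fin n) → Def n (λ ρ → lookup ρ i ≡ lookup ρ j)
      var≡ i j = D₀⇒D (i ≡₀ j)

      var≡con : (i : Fin n) (a : V) → Def n (λ ρ → lookup ρ i ≡ a)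
      var≡con {n} i a = def (a ∷ []) ((i ↑ˡ 1) ≐ (n ↑ʳ zero)) λ ρ →
        ≡-⇔ (cong₂ _≡_ (lookup-++ˡ ρ (a ∷ []) i) (lookup-++ʳ ρ (a ∷ []) zero))

    _⇒ᵈ_ : Def n P → Def n Q → Def n (λ ρ → P ρ → Q ρ)
    p ⇒ᵈ q = castᵈ (λ ρ → mk⇔ (λ f a → byContra λ nb → f (a , nb)) (λ f (a , nb) → nb (f a))) (¬ᵈ (p ∧ᵈ ¬ᵈ q))

    _∨ᵈ_ : Def n P → Def n Q → Def n (λ ρ → P ρ ⊎ Q ρ)
    p ∨ᵈ q = castᵈ (λ ρ → mk⇔ (λ f → byContra λ n → f (n ∘ inj₁ , n ∘ inj₂)) (λ { (inj₁ a) (na , _) → na a ; (inj₂ b) (_ , nb) → nb b }))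
      (¬ᵈ (¬ᵈ p ∧ᵈ ¬ᵈ q))

    _⇔ᵈ_ : Def n P → Def n Q → Def n (λ ρ → P ρ ⇔ Q ρ)
    p ⇔ᵈ q = castᵈ (λ ρ → mk⇔ (λ (f , g) → mk⇔ f g) (λ e → to e , from e)) ((p ⇒ᵈ q) ∧ᵈ (q ⇒ᵈ p))

    record Graph₁ (F : V → V) : Set ℓ where
      constructor gr₁
      field rel₁ : Def 2 (λ ρ → lookup ρ v0 ≡ F (lookup ρ v1))

    record Graph₂ (F : V → V → V) : Set ℓ where
      constructor gr₂
      field rel₂ : Def 3 (λ ρ → lookup ρ v0 ≡ F (lookup ρ v1) (lookup ρ v2))

    open Graph₁ public
    open Graph₂ public

    -- Terms of the definitional extension by operations whose graphs are definable. `let₁` names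
    -- the value of a term by an existential quantifier, and `satT` thereby translates formulas
    -- about terms back into the language of ∈.
    data Tm (n : ℕ) : Set ℓ where
      var : Fin n → Tm n
      con : V → Tm n
      fn₁ : {F : V → V} → Graph₁ F → Tm n → Tm n
      fn₂ : {F : V → V → V} → Graph₂ F → Tm n → Tm n → Tm n

    ⟦_⟧ : Tm n → Vec V n → V
    ⟦ var i ⟧ ρ           = lookup ρ i
    ⟦ con c ⟧ ρ           = c
    ⟦ fn₁ {F} _ t ⟧ ρ     = F (⟦ t ⟧ ρ)
    ⟦ fn₂ {F} _ t s ⟧ ρ   = F (⟦ t ⟧ ρ) (⟦ s ⟧ ρ)

    wk : Tm n → Tm (suc n)
    wk (var i)     = var (suc i)
    wk (con c)     = con c
    wk (fn₁ d t)   = fn₁ d (wk t)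
    wk (fn₂ d t s) = fn₂ d (wk t) (wk s)

    ⟦wk⟧ : (t : Tm n) (ρ : Vec V (suc n)) → ⟦ wk t ⟧ ρ ≡ ⟦ t ⟧ (tail ρ)
    ⟦wk⟧ (var i) ρ             = Vec-tail ρ i
    ⟦wk⟧ (con c) ρ             = refl
    ⟦wk⟧ (fn₁ {F} _ t) ρ       = cong F (⟦wk⟧ t ρ)
    ⟦wk⟧ (fn₂ {F} _ t s) ρ     = cong₂ F (⟦wk⟧ t ρ) (⟦wk⟧ s ρ)

    opaque
      var≡tm′ : ∀ {k} (f : Fin n → Fin k) (i : Fin k) (t : Tm n) →
        Def k (λ ρ → lookup ρ i ≡ ⟦ t ⟧ (tabulate (lookup ρ ∘ f)))
      var≡tm′ f i (var j) = castᵈ (λ ρ → ≡-⇔ (cong (lookup ρ i ≡_) (sym (lookup∘tabulate (lookup ρ ∘ f) j)))) (var≡ i (f j))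
      var≡tm′ f i (con c) = var≡con i c
      var≡tm′ f i (fn₁ {F} d t) = castᵈ
        (λ ρ → mk⇔ (λ (x , e , f) → trans f (cong F e)) (λ e → _ , refl , e))
        (∃ᵈ (var≡tm′ (suc ∘ f) v0 t ∧ᵈ renᵈ (λ { v0 → suc i ; v1 → v0 }) (rel₁ d)))
      var≡tm′ f i (fn₂ {F} d t s) = castᵈ
        (λ ρ → mk⇔ (λ (x , e , y , f , g) → trans g (cong₂ F e f)) (λ e → _ , refl , _ , refl , e))
        (∃ᵈ (var≡tm′ (suc ∘ f) v0 t ∧ᵈ
          ∃ᵈ (var≡tm′ (λ j → suc (suc (f j))) v0 s ∧ᵈ renᵈ (λ { v0 → suc (suc i) ; v1 → v1 ; v2 → v0 }) (rel₂ d))))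

      var≡tm : (i : Fin n) (t : Tm n) → Def n (λ ρ → lookup ρ i ≡ ⟦ t ⟧ ρ)
      var≡tm i t = castᵈ (λ ρ → ≡-⇔ (cong (λ σ → lookup ρ i ≡ ⟦ t ⟧ σ) (tabulate∘lookup ρ))) (var≡tm′ id i t)

      let₁ : (t : Tm n) → Def (suc n) P → Def n (λ ρ → P (⟦ t ⟧ ρ ∷ ρ))
      let₁ {P = P} t d = castᵈ
        (λ ρ → mk⇔ (λ (x , e , p) → subst (λ x → P (x ∷ ρ)) (trans e (⟦wk⟧ t (x ∷ ρ))) p)
                   (λ p → ⟦ t ⟧ ρ , sym (⟦wk⟧ t (⟦ t ⟧ ρ ∷ ρ)) , p))
        (∃ᵈ (var≡tm v0 (wk t) ∧ᵈ d))

      satT : ∀ {k} (φ : Formula k) (ts : Vec (Tm n) k) → Def n (λ ρ → Sat All φ (map (λ t → ⟦ t ⟧ ρ) ts))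
      satT (i ∈̇ j) ts = castᵈ
        (λ ρ → mk⇔ (λ p → subst₂ _∈_ (sym (trans (lookup-map i _ ts) (sym (⟦wk⟧ (lookup ts i) (⟦ lookup ts j ⟧ ρ ∷ ρ)))))
                                 (sym (lookup-map j _ ts)) p)
                   (λ p → subst₂ _∈_ (trans (lookup-map i _ ts) (sym (⟦wk⟧ (lookup ts i) (⟦ lookup ts j ⟧ ρ ∷ ρ))))
                                 (lookup-map j _ ts) p))
        (let₁ (lookup ts j) (let₁ (wk (lookup ts i)) (var∈ v0 v1)))
      satT (i ≐ j) ts = castᵈ
        (λ ρ → mk⇔ (λ p → subst₂ _≡_ (sym (trans (lookup-map i _ ts) (sym (⟦wk⟧ (lookup ts i) (⟦ lookup ts j ⟧ ρ ∷ ρ)))))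
                                 (sym (lookup-map j _ ts)) p)
                   (λ p → subst₂ _≡_ (trans (lookup-map i _ ts) (sym (⟦wk⟧ (lookup ts i) (⟦ lookup ts j ⟧ ρ ∷ ρ))))
                                 (lookup-map j _ ts) p))
        (let₁ (lookup ts j) (let₁ (wk (lookup ts i)) (var≡ v0 v1)))
      satT (¬̇ φ) ts = ¬ᵈ satT φ ts
      satT (φ ∧̇ ψ) ts = satT φ ts ∧ᵈ satT ψ ts
      satT (φ ∨̇ ψ) ts = satT φ ts ∨ᵈ satT ψ ts
      satT (φ ⇒̇ ψ) ts = satT φ ts ⇒ᵈ satT ψ ts
      satT (∀̇ φ) ts = castᵈ
        (λ ρ → ∀-⇔ λ x → mk⇔ (λ s _ → subst (λ σ → Sat All φ (x ∷ σ)) (map-wk x ρ ts) s)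
                              (λ s → subst (λ σ → Sat All φ (x ∷ σ)) (sym (map-wk x ρ ts)) (s tt)))
        (∀ᵈ (satT φ (var v0 ∷ map wk ts)))
        where
          map-wk : ∀ {n k} x (ρ : Vec V n) (ts : Vec (Tm n) k) → map (λ t → ⟦ t ⟧ (x ∷ ρ)) (map wk ts) ≡ map (λ t → ⟦ t ⟧ ρ) ts
          map-wk x ρ ts = trans (sym (map-∘ _ _ ts)) (map-cong (λ t → ⟦wk⟧ t (x ∷ ρ)) ts)
      satT (∃̇ φ) ts = castᵈ
        (λ ρ → ∃-⇔ λ x → mk⇔ (λ s → tt , subst (λ σ → Sat All φ (x ∷ σ)) (map-wk x ρ ts) s)
                              (λ (_ , s) → subst (λ σ → Sat All φ (x ∷ σ)) (sym (map-wk x ρ ts)) s))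
        (∃ᵈ (satT φ (var v0 ∷ map wk ts)))
        where
          map-wk : ∀ {n k} x (ρ : Vec V n) (ts : Vec (Tm n) k) → map (λ t → ⟦ t ⟧ (x ∷ ρ)) (map wk ts) ≡ map (λ t → ⟦ t ⟧ ρ) ts
          map-wk x ρ ts = trans (sym (map-∘ _ _ ts)) (map-cong (λ t → ⟦wk⟧ t (x ∷ ρ)) ts)

    infix 8 _∈ᵈ_ _≡ᵈ_ _∈ᵈᶜ_

    _∈ᵈ_ : (t s : Tm n) → Def n (λ ρ → ⟦ t ⟧ ρ ∈ ⟦ s ⟧ ρ)
    t ∈ᵈ s = satT (v0 ∈̇ v1) (t ∷ s ∷ [])

    _≡ᵈ_ : (t s : Tm n) → Def n (λ ρ → ⟦ t ⟧ ρ ≡ ⟦ s ⟧ ρ)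
    t ≡ᵈ s = satT (v0 ≐ v1) (t ∷ s ∷ [])

    opaque
      _∈ᵈᶜ_ : (t : Tm n) (C : Class) → Def n (λ ρ → ⟦ t ⟧ ρ ∈ᶜ C)
      t ∈ᵈᶜ C = castᵈ (λ ρ → ≡-⇔ (cong (λ σ → Sat All (formula C) (⟦ t ⟧ ρ ∷ σ))
                         (trans (sym (map-∘ _ con (parameters C))) (map-id (parameters C)))))
                      (satT (formula C) (t ∷ map con (parameters C)))

    Def⇒Class : Def 1 P → Class
    Def⇒Class d = record { formula = Def.form d ; parameters = Def.params d }

    ∈Def⇒Class : {P : Vec V 1 → Set ℓ} (d : Def 1 P) → ∀ x → x ∈ᶜ Def⇒Class d ⇔ P (x ∷ [])
    ∈Def⇒Class d x = Def.means d (x ∷ [])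

    opaque
      sep : {P : Vec V 1 → Set ℓ} → Def 1 P → V → V
      sep (def ps φ e) x = proj₁ (separation φ ps x)

      ∈sep : {P : Vec V 1 → Set ℓ} {d : Def 1 P} {x z : V} → z ∈ sep d x ⇔ (z ∈ x × P (z ∷ []))
      ∈sep {d = def ps φ e} {x} {z} = proj₂ (separation φ ps x) z ⇔∘ ×-⇔ ⇔-refl (e _)

      repl : {P : Vec V 2 → Set ℓ} → Def 2 P → ∀ x → (∀ u v w → u ∈ x → P (u ∷ v ∷ []) → P (u ∷ w ∷ []) → v ≡ w) →
        ∃[ y ] ∀ v → v ∈ y ⇔ (∃[ u ] (u ∈ x × P (u ∷ v ∷ [])))
      repl (def ps φ e) x f with replacement φ ps x (λ u v w u∈ p q → f u v w u∈ (to (e _) p) (to (e _) q))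
      ... | y , g = y , λ v → g v ⇔∘ ∃-⇔ λ u → ×-⇔ ⇔-refl (e _)

    infix 9 _₀[_] _ᵈ[_]

    _₀[_] : ∀ {k} {P : Vec V k → Set ℓ} → D₀ k P → (is : Vec (Fin n) k) → D₀ n (λ ρ → P (tabulate (λ i → lookup ρ (lookup is i))))
    d ₀[ is ] = ren₀ (lookup is) d

    opaque
      _ᵈ[_] : ∀ {k} {P : Vec V k → Set ℓ} → Def k P → (ts : Vec (Tm n) k) → Def n (λ ρ → P (map (λ t → ⟦ t ⟧ ρ) ts))
      def ps φ e ᵈ[ ts ] = castᵈ (λ ρ → ≡-⇔ (cong (Sat All φ) (trans (map-++ _ ts _)
          (cong (map _ ts ++_) (trans (sym (map-∘ _ con ps)) (map-id ps))))) ⇔∘ e _)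
        (satT φ (ts ++ map con ps))

    graph₁ : (t : Tm 1) → Graph₁ (λ x → ⟦ t ⟧ (x ∷ []))
    graph₁ t = gr₁ (castᵈ (λ { (y ∷ x ∷ []) → ≡-⇔ (cong (y ≡_) (⟦wk⟧ t (y ∷ x ∷ []))) }) (var≡tm v0 (wk t)))

  open Formulas public

  -- Elementary set theory: pairs, unions, images, functions, products.

  module Sets where
    private variable
      n : ℕ
      A B f g x y z u v w : V

    ⊆-antisym : x ⊆ y → y ⊆ x → x ≡ y
    ⊆-antisym p q = extensionality λ z → mk⇔ (p z) (q z)

    _≐ₛ_ : V → V → Set ℓ
    x ≐ₛ y = ∀ z → z ∈ x ⇔ z ∈ y

    byElements₁ : {F : V → V} {P : Vec V 2 → Set ℓ} → (∀ x z → z ∈ F x ⇔ P (z ∷ x ∷ [])) → Def 2 P → Graph₁ F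
    byElements₁ {F} e d = gr₁ $ castᵈ
      (λ { (y ∷ x ∷ []) → mk⇔ (λ h → extensionality λ z → h z ⇔∘ ⇔-sym (e x z))
                               (λ { refl z → e x z }) })
      (∀ᵈ (var v0 ∈ᵈ var v1 ⇔ᵈ d ᵈ[ var v0 ∷ var v2 ∷ [] ]))

    byElements₂ : {F : V → V → V} {P : Vec V 3 → Set ℓ} → (∀ x y z → z ∈ F x y ⇔ P (z ∷ x ∷ y ∷ [])) → Def 3 P → Graph₂ F
    byElements₂ {F} e d = gr₂ $ castᵈ
      (λ { (w ∷ x ∷ y ∷ []) → mk⇔ (λ h → extensionality λ z → h z ⇔∘ ⇔-sym (e x y z))
                                   (λ { refl z → e x y z }) })
      (∀ᵈ (var v0 ∈ᵈ var v1 ⇔ᵈ d ᵈ[ var v0 ∷ var v2 ∷ var v3 ∷ [] ]))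

    -- Pairs

    ∈pair : z ∈ pair x y ⇔ (z ≡ x ⊎ z ≡ y)
    ∈pair {z} {x} {y} = proj₂ (pairing x y) z

    pairG : Graph₂ pair
    pairG = byElements₂ (λ x y z → ∈pair) (var v0 ≡ᵈ var v1 ∨ᵈ var v0 ≡ᵈ var v2)

    sing : V → V
    sing x = pair x x

    ∈sing : z ∈ sing x ⇔ z ≡ x
    ∈sing = ∈pair ⇔∘ mk⇔ [ id , id ]′ inj₁

    self∈sing : x ∈ sing x
    self∈sing = from ∈sing refl

    pairᵗ : Tm n → Tm n → Tm n
    pairᵗ = fn₂ pairG

    singᵗ : Tm n → Tm n
    singᵗ t = pairᵗ t t

    infix 9 ⟨_,_⟩ᵗ
    ⟨_,_⟩ᵗ : Tm n → Tm n → Tm n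
    ⟨ t , s ⟩ᵗ = pairᵗ (singᵗ t) (pairᵗ t s)

    ∈pairˡ : x ∈ pair x y
    ∈pairˡ = from ∈pair (inj₁ refl)

    ∈pairʳ : y ∈ pair x y
    ∈pairʳ = from ∈pair (inj₂ refl)

    sing-inj : sing x ≡ sing y → x ≡ y
    sing-inj e = to ∈sing (subst (_ ∈_) e self∈sing)

    opaque
      pair-inj : ∀ {x y x′ y′} → ⟨ x , y ⟩ ≡ ⟨ x′ , y′ ⟩ → x ≡ x′ × y ≡ y′
      pair-inj {x} {y} {x′} {y′} e = x≡ , y≡
        where
          x≡ : x ≡ x′
          x≡ with to ∈pair (subst (sing x ∈_) e ∈pairˡ)
          ... | inj₁ p = sing-inj p
          ... | inj₂ p = sym (to ∈sing (subst (x′ ∈_) (sym p) ∈pairˡ))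
          second : ∀ {x y y′} → pair x y ≡ pair x y′ → y ≡ y′
          second {x} {y} {y′} p with to ∈pair (subst (y ∈_) p ∈pairʳ) | to ∈pair (subst (y′ ∈_) (sym p) ∈pairʳ)
          ... | inj₂ q | _ = q
          ... | inj₁ q | inj₂ r = sym r
          ... | inj₁ q | inj₁ r = trans q (sym r)
          y≡ : y ≡ y′
          y≡ = aux x≡ e
            where
              aux : x ≡ x′ → ⟨ x , y ⟩ ≡ ⟨ x′ , y′ ⟩ → y ≡ y′
              aux refl e with to ∈pair (subst (pair x y ∈_) e ∈pairʳ)
              ... | inj₂ p = second p
              ... | inj₁ p with to ∈pair (subst (pair x y′ ∈_) (sym e) ∈pairʳ)
              ...   | inj₂ q = sym (second q)
              ...   | inj₁ q = second (trans p (sym q))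

    pair-inj₁ : ∀ {x y x′ y′} → ⟨ x , y ⟩ ≡ ⟨ x′ , y′ ⟩ → x ≡ x′
    pair-inj₁ e = proj₁ (pair-inj e)

    pair-inj₂ : ∀ {x y x′ y′} → ⟨ x , y ⟩ ≡ ⟨ x′ , y′ ⟩ → y ≡ y′
    pair-inj₂ e = proj₂ (pair-inj e)

    -- Unions, power sets, the empty set

    opaque
      ⋃ : V → V
      ⋃ x = proj₁ (union x)

      ∈⋃ : z ∈ ⋃ x ⇔ (∃[ y ] (y ∈ x × z ∈ y))
      ∈⋃ {z} {x} = proj₂ (union x) z

      𝒫 : V → V
      𝒫 x = proj₁ (powerset x)

      ∈𝒫 : z ∈ 𝒫 x ⇔ z ⊆ x
      ∈𝒫 {z} {x} = proj₂ (powerset x) z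

      ∅ : V
      ∅ = proj₁ (proj₁ (proj₂ infinity))

      ∉∅ : ¬ z ∈ ∅
      ∉∅ {z} = proj₂ (proj₂ (proj₁ (proj₂ infinity))) z

    ⊆ᵈ : Def 2 (λ ρ → lookup ρ v0 ⊆ lookup ρ v1)
    ⊆ᵈ = ∀ᵈ (var v0 ∈ᵈ var v1 ⇒ᵈ var v0 ∈ᵈ var v2)

    ⋃G : Graph₁ ⋃
    ⋃G = byElements₁ (λ x z → ∈⋃) (∃ᵈ (var v0 ∈ᵈ var v2 ∧ᵈ var v1 ∈ᵈ var v0))

    𝒫G : Graph₁ 𝒫
    𝒫G = byElements₁ (λ x z → ∈𝒫) ⊆ᵈ

    ⋃ᵗ 𝒫ᵗ : Tm n → Tm n
    ⋃ᵗ = fn₁ ⋃G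
    𝒫ᵗ = fn₁ 𝒫G

    ⊆-refl : x ⊆ x
    ⊆-refl _ p = p

    empty : (∀ z → ¬ z ∈ x) → x ≡ ∅
    empty n = extensionality λ z → mk⇔ (⊥-elim ∘ n z) (⊥-elim ∘ ∉∅)

    infixr 6 _∪_
    _∪_ : V → V → V
    x ∪ y = ⋃ (pair x y)

    opaque
      ∈∪ : z ∈ x ∪ y ⇔ (z ∈ x ⊎ z ∈ y)
      ∈∪ = mk⇔
        (λ p → case to ∈⋃ p of λ (w , q , r) → case to ∈pair q of λ
          { (inj₁ refl) → inj₁ r ; (inj₂ refl) → inj₂ r })
        [ (λ p → from ∈⋃ (_ , ∈pairˡ , p)) , (λ p → from ∈⋃ (_ , ∈pairʳ , p)) ]′

    _∪ᵗ_ : Tm n → Tm n → Tm n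
    t ∪ᵗ s = ⋃ᵗ (pairᵗ t s)

    opaque
      foundation′ : (∃[ y ] y ∈ x) → ∃[ y ] (y ∈ x × ∀ z → z ∈ y → ¬ z ∈ x)
      foundation′ {x} ne with foundation x ne
      ... | y , p , q = y , p , λ z r s → q z s r

      ∈-irrefl : ¬ x ∈ x
      ∈-irrefl {x} p with foundation (sing x) (x , self∈sing)
      ... | y , q , r = r x self∈sing (subst (x ∈_) (sym (to ∈sing q)) p)

    opaque
      im : {F : V → V} → Graph₁ F → V → V
      im g x = proj₁ (repl (rel₁ g ᵈ[ var v1 ∷ var v0 ∷ [] ]) x λ u v w _ p q → trans p (sym q))

      ∈im : {F : V → V} {g : Graph₁ F} → z ∈ im g x ⇔ (∃[ u ] (u ∈ x × z ≡ F u))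
      ∈im {z} {x} {g = g} = proj₂ (repl (rel₁ g ᵈ[ var v1 ∷ var v0 ∷ [] ]) x λ u v w _ p q → trans p (sym q)) z

    im∋ : {F : V → V} {g : Graph₁ F} → u ∈ x → F u ∈ im g x
    im∋ p = from ∈im (_ , p , refl)

    imG : {F : V → V} (g : Graph₁ F) → Graph₁ (im g)
    imG g = byElements₁ (λ x z → ∈im) (∃ᵈ (var v0 ∈ᵈ var v2 ∧ᵈ rel₁ g ᵈ[ var v1 ∷ var v0 ∷ [] ]))

    -- Functions

    record Fun (f A : V) : Set ℓ where
      constructor fun
      field
        isFun : IsFunction (_∈ f) (_∈ A)
    open Fun public

    ∃!ᵈ : {P : Vec V (suc n) → Set ℓ} → Def (suc n) P → Def n (λ ρ → ∃! _≡_ λ y → P (y ∷ ρ))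
    ∃!ᵈ {n} {P} d = castᵈ (λ ρ → ∃-⇔ λ x → ×-⇔ ⇔-refl (mk⇔
        (λ f {y} p → f y (subst P (sym (tab y x ρ)) p)) (λ f y p → f (subst P (tab y x ρ) p))))
      (∃ᵈ (d ∧ᵈ ∀ᵈ (renᵈ skip d ⇒ᵈ var v1 ≡ᵈ var v0)))
      where
        skip : Fin (suc n) → Fin (suc (suc n))
        skip zero    = zero
        skip (suc i) = suc (suc i)
        tab : ∀ y x (ρ : Vec V n) → tabulate (lookup (y ∷ x ∷ ρ) ∘ skip) ≡ y ∷ ρ
        tab y x ρ = cong (y ∷_) (tabulate∘lookup ρ)

    funᵈ : Def 2 (λ ρ → Fun (lookup ρ v0) (lookup ρ v1))
    funᵈ = castᵈ (λ ρ → mk⇔ fun isFun) (∀ᵈ (var v0 ∈ᵈ var v1 ⇒ᵈ ∃ᵈ (∃ᵈ (var v1 ∈ᵈ var v4 ∧ᵈ var v2 ≡ᵈ ⟨ var v1 , var v0 ⟩ᵗ)))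
        ∧ᵈ ∀ᵈ (var v0 ∈ᵈ var v2 ⇒ᵈ ∃!ᵈ (⟨ var v1 , var v0 ⟩ᵗ ∈ᵈ var v2)))

    opaque
      ∈⋃⋃ʳ : ⟨ x , y ⟩ ∈ f → y ∈ ⋃ (⋃ f)
      ∈⋃⋃ʳ p = from ∈⋃ (_ , from ∈⋃ (_ , p , ∈pairʳ) , ∈pairʳ)

    opaque
      -- The union of all values at `x`: the value itself if there is exactly one, and ∅ outside the
      -- domain. This makes application a total operation with a definable graph.
      app : V → V → V
      app f x = ⋃ (sep (⟨ con x , var v0 ⟩ᵗ ∈ᵈ con f) (⋃ (⋃ f)))

      ∈app : z ∈ app f x ⇔ (∃[ y ] (⟨ x , y ⟩ ∈ f × z ∈ y))
      ∈app {z} {f} {x} = ∈⋃ ⇔∘ ∃-⇔ λ y → ×-⇔ (∈sep ⇔∘ mk⇔ proj₂ (λ p → ∈⋃⋃ʳ p , p)) ⇔-refl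

    appG : Graph₂ app
    appG = byElements₂ (λ x y z → ∈app) (∃ᵈ (⟨ var v3 , var v0 ⟩ᵗ ∈ᵈ var v2 ∧ᵈ var v1 ∈ᵈ var v0))

    appᵗ : Tm n → Tm n → Tm n
    appᵗ = fn₂ appG

    opaque
      app-unique : (∀ y′ → ⟨ x , y′ ⟩ ∈ f → y ≡ y′) → ⟨ x , y ⟩ ∈ f → app f x ≡ y
      app-unique {y = y} u p = extensionality λ z → ∈app ⇔∘ mk⇔ (λ (w , q , r) → subst (z ∈_) (sym (u w q)) r) (λ r → y , p , r)

      fun-dom : Fun f A → ⟨ x , y ⟩ ∈ f → x ∈ A
      fun-dom {A = A} F p = let (x′ , y′ , x′∈ , e) = proj₁ (isFun F) _ p in subst (_∈ A) (sym (pair-inj₁ e)) x′∈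

      app-≡ : Fun f A → ⟨ x , y ⟩ ∈ f → app f x ≡ y
      app-≡ F p = let (y″ , q , u) = proj₂ (isFun F) _ (fun-dom F p) in
        app-unique (λ w r → trans (sym (u p)) (u r)) p

      app∈ : Fun f A → x ∈ A → ⟨ x , app f x ⟩ ∈ f
      app∈ {f} {A} {x} F x∈ = let (y , p , u) = proj₂ (isFun F) x x∈ in
        subst (λ y → ⟨ x , y ⟩ ∈ f) (sym (app-≡ F p)) p

      fun-elem : Fun f A → z ∈ f → ∃[ x ] (x ∈ A × z ≡ ⟨ x , app f x ⟩)
      fun-elem {f} {A} {z} F p = let (x , y , x∈ , e) = proj₁ (isFun F) z p in
        x , x∈ , trans e (cong ⟨ x ,_⟩ (sym (app-≡ F (subst (_∈ f) e p))))

      fun-ext : Fun f A → Fun g A → (∀ x → x ∈ A → app f x ≡ app g x) → f ≡ g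
      fun-ext {f} {A} {g} F G e = ⊆-antisym (half F G e) (half G F (λ x p → sym (e x p)))
        where
          half : Fun u A → Fun v A → (∀ x → x ∈ A → app u x ≡ app v x) → u ⊆ v
          half {u} {v} F G e z p = let (x , x∈ , q) = fun-elem F p in
            subst (_∈ v) (trans (cong ⟨ x ,_⟩ (sym (e x x∈))) (sym q)) (app∈ G x∈)

    lam : {F : V → V} → Graph₁ F → V → V
    lam {F} g = im (graph₁ ⟨ var v0 , fn₁ g (var v0) ⟩ᵗ)

    opaque
      ∈lam : {F : V → V} {g : Graph₁ F} → ⟨ x , y ⟩ ∈ lam g A ⇔ (x ∈ A × y ≡ F x)
      ∈lam = ∈im ⇔∘ mk⇔
        (λ { (u , p , e) → case pair-inj e of λ { (refl , q) → p , q } })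
        (λ { (p , refl) → _ , p , refl })

      lam-fun : {F : V → V} {g : Graph₁ F} → Fun (lam g A) A
      lam-fun {A} {F} = fun ((λ z p → case to ∈im p of λ (u , q , e) → u , F u , q , e) ,
        (λ x p → F x , from ∈lam (p , refl) , λ q → sym (proj₂ (to ∈lam q))))

      app-lam : {F : V → V} {g : Graph₁ F} → x ∈ A → app (lam g A) x ≡ F x
      app-lam p = app-≡ lam-fun (from ∈lam (p , refl))

    infixr 7 _⊗_
    opaque
      row : V → V → V
      row x B = im (graph₁ ⟨ con x , var v0 ⟩ᵗ) B

      ∈row : z ∈ row x B ⇔ (∃[ y ] (y ∈ B × z ≡ ⟨ x , y ⟩))
      ∈row = ∈im

    rowG : Graph₂ row
    rowG = byElements₂ (λ x B z → ∈row) (∃ᵈ (var v0 ∈ᵈ var v3 ∧ᵈ var v1 ≡ᵈ ⟨ var v2 , var v0 ⟩ᵗ))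

    opaque
      _⊗_ : V → V → V
      A ⊗ B = ⋃ (im (graph₁ (fn₂ rowG (var v0) (con B))) A)

      ∈⊗ : z ∈ A ⊗ B ⇔ (∃[ x ] ∃[ y ] (x ∈ A × y ∈ B × z ≡ ⟨ x , y ⟩))
      ∈⊗ {z} {A} {B} = ∈⋃ ⇔∘ mk⇔
        (λ (w , p , q) → let (x , x∈ , e) = to ∈im p ; (y , y∈ , e′) = to ∈row (subst (z ∈_) e q) in x , y , x∈ , y∈ , e′)
        (λ (x , y , x∈ , y∈ , e) → row x B , im∋ x∈ , from ∈row (y , y∈ , e))

    ⊗G : Graph₂ _⊗_
    ⊗G = byElements₂ (λ x y z → ∈⊗) (∃ᵈ (∃ᵈ (var v1 ∈ᵈ var v3 ∧ᵈ var v0 ∈ᵈ var v4 ∧ᵈ var v2 ≡ᵈ ⟨ var v1 , var v0 ⟩ᵗ)))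

    opaque
      funset : V → V → V
      funset A B = sep (funᵈ ᵈ[ var v0 ∷ con A ∷ [] ]) (𝒫 (A ⊗ B))

      ∈funset : f ∈ funset A B ⇔ (Fun f A × ∀ x → x ∈ A → app f x ∈ B)
      ∈funset {f} {A} {B} = ∈sep ⇔∘ mk⇔
        (λ (p , F) → F , λ x x∈ → case to ∈⊗ (to ∈𝒫 p _ (app∈ F x∈)) of λ (_ , _ , _ , q , e) →
          subst (_∈ B) (sym (pair-inj₂ e)) q)
        (λ (F , q) → from ∈𝒫 (λ z p → case fun-elem F p of λ { (x , x∈ , refl) →
          from ∈⊗ (x , _ , x∈ , q x x∈ , refl) }) , F)

    describe : {P : Vec V 2 → Set ℓ} → Def 2 P → (∀ x → ∃! _≡_ λ y → P (y ∷ x ∷ [])) →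
      Σ[ F ∈ (V → V) ] (Graph₁ F × ∀ x → P (F x ∷ x ∷ []))
    describe {P} d h = (λ x → proj₁ (h x)) ,
      gr₁ (castᵈ (λ { (y ∷ x ∷ []) → mk⇔ (λ p → sym (proj₂ (proj₂ (h x)) p)) (λ { refl → proj₁ (proj₂ (h x)) }) }) d) ,
      λ x → proj₁ (proj₂ (h x))

  open Sets public

  -- Induction, recursion and closures inside the model.

  module Recursions where
    private variable
      n : ℕ
      x y z u v w : V

    -- A minimal counterexample exists only when the counterexamples form a set of the model, hence
    -- the definition of `P` among the arguments. Induction in Agda would reach only the externally
    -- well-founded part.
    wfInduction : ∀ {U} {R : V → V → Set ℓ} {P : V → Set ℓ} → Def 1 (λ ρ → P (lookup ρ v0)) →
      (∀ s → s ⊆ U → (∃[ x ] x ∈ s) → ∃[ m ] (m ∈ s × ∀ y → y ∈ s → ¬ R y m)) →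
      (∀ x → x ∈ U → (∀ y → y ∈ U → R y x → P y) → P x) → ∀ x → x ∈ U → P x
    wfInduction {U} {R} {P} d wf step x x∈ = byContra λ np →
      let bad = sep (¬ᵈ d) U
          (m , m∈ , min) = wf bad (λ z z∈ → proj₁ (to ∈sep z∈)) (x , from ∈sep (x∈ , np))
          (m∈U , nm) = to ∈sep m∈
      in nm (step m m∈U λ y y∈ r → byContra λ ny → min y (from ∈sep (y∈ , ny)) r)

    -- Recursion along a well-founded relation R on a set U: F x = H {F y : y ∈ U, R y x}.
    module Recursion (U : V) {R : V → V → Set ℓ} (dR : Def 2 (λ ρ → R (lookup ρ v0) (lookup ρ v1)))
      (wf : ∀ s → s ⊆ U → (∃[ x ] x ∈ s) → ∃[ m ] (m ∈ s × ∀ y → y ∈ s → ¬ R y m))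
      {H : V → V} (gH : Graph₁ H) where

      Preds : V → V → V → Set ℓ
      Preds p x s = ∀ v → v ∈ s ⇔ (∃[ z ] (z ∈ U × R z x × ⟨ z , v ⟩ ∈ p))

      predsᵈ : Def 3 (λ ρ → Preds (lookup ρ v0) (lookup ρ v1) (lookup ρ v2))
      predsᵈ = ∀ᵈ (var v0 ∈ᵈ var v3 ⇔ᵈ ∃ᵈ (var v0 ∈ᵈ con U ∧ᵈ dR ᵈ[ var v0 ∷ var v3 ∷ [] ] ∧ᵈ ⟨ var v0 , var v1 ⟩ᵗ ∈ᵈ var v2))

      record Step (p x y : V) : Set ℓ where
        constructor mkStep
        field
          inU    : x ∈ U
          down   : ∀ z → z ∈ U → R z x → ∃[ w ] ⟨ z , w ⟩ ∈ p
          {set}  : V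
          preds  : Preds p x set
          value  : y ≡ H set
      open Step

      Good : V → Set ℓ
      Good p = ∀ x y → ⟨ x , y ⟩ ∈ p → Step p x y

      goodᵈ : Def 1 (λ ρ → Good (lookup ρ v0))
      goodᵈ = ∀ᵈ (∀ᵈ (⟨ var v1 , var v0 ⟩ᵗ ∈ᵈ var v2 ⇒ᵈ castᵈ
        (λ ρ → mk⇔ (λ (a , b , s , c , e) → mkStep a b c e) (λ t → inU t , down t , set t , preds t , value t))
        (var v1 ∈ᵈ con U ∧ᵈ ∀ᵈ (var v0 ∈ᵈ con U ⇒ᵈ dR ᵈ[ var v0 ∷ var v2 ∷ [] ] ⇒ᵈ ∃ᵈ (⟨ var v1 , var v0 ⟩ᵗ ∈ᵈ var v4))
          ∧ᵈ ∃ᵈ (predsᵈ ᵈ[ var v3 ∷ var v2 ∷ var v0 ∷ [] ] ∧ᵈ var v1 ≡ᵈ fn₁ gH (var v0)))))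

      Agree : V → Set ℓ
      Agree x = ∀ p → Good p → ∀ q → Good q → ∀ y → ⟨ x , y ⟩ ∈ p → ∀ y′ → ⟨ x , y′ ⟩ ∈ q → y ≡ y′

      agreeᵈ : Def 1 (λ ρ → Agree (lookup ρ v0))
      agreeᵈ = ∀ᵈ (goodᵈ ᵈ[ var v0 ∷ [] ] ⇒ᵈ ∀ᵈ (goodᵈ ᵈ[ var v0 ∷ [] ] ⇒ᵈ ∀ᵈ (⟨ var v3 , var v0 ⟩ᵗ ∈ᵈ var v2 ⇒ᵈ
        ∀ᵈ (⟨ var v4 , var v0 ⟩ᵗ ∈ᵈ var v2 ⇒ᵈ var v1 ≡ᵈ var v0))))

      agree : ∀ x → x ∈ U → Agree x
      agree = wfInduction agreeᵈ wf step
        where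
          step : ∀ x → x ∈ U → (∀ y → y ∈ U → R y x → Agree y) → Agree x
          step x x∈ ih p gp q gq y yp y′ yq =
            trans (value a) (trans (cong H (⊆-antisym
              (λ v v∈ → let (z , z∈ , r , k) = to (preds a v) v∈ in from (preds b v) (z , z∈ , r , swap p gp q gq z z∈ r v k (down b z z∈ r)))
              (λ v v∈ → let (z , z∈ , r , k) = to (preds b v) v∈ in from (preds a v) (z , z∈ , r , swap q gq p gp z z∈ r v k (down a z z∈ r)))))
              (sym (value b)))
            where
              a = gp x y yp
              b = gq x y′ yq
              swap : ∀ p → Good p → ∀ q → Good q → ∀ z → z ∈ U → R z x → ∀ v → ⟨ z , v ⟩ ∈ p → (∃[ w ] ⟨ z , w ⟩ ∈ q) → ⟨ z , v ⟩ ∈ q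
              swap p gp q gq z z∈ r v k (w , l) = subst (λ v → ⟨ z , v ⟩ ∈ q) (sym (ih z z∈ r p gp q gq v k w l)) l

      Val : V → V → Set ℓ
      Val x y = ∃[ p ] (Good p × ⟨ x , y ⟩ ∈ p)

      valᵈ : Def 2 (λ ρ → Val (lookup ρ v0) (lookup ρ v1))
      valᵈ = ∃ᵈ (goodᵈ ᵈ[ var v0 ∷ [] ] ∧ᵈ ⟨ var v1 , var v2 ⟩ᵗ ∈ᵈ var v0)

      valUnique : Val x y → Val x z → y ≡ z
      valUnique {x} {y} {z} (p , gp , k) (q , gq , l) = agree x (inU (gp x y k)) p gp q gq y k z l

      opaque
        total : ∃[ r ] ∀ v → v ∈ r ⇔ (∃[ u ] (u ∈ U × ∃[ y ] (Val u y × v ≡ ⟨ u , y ⟩)))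
        total = repl (∃ᵈ (valᵈ ᵈ[ var v1 ∷ var v0 ∷ [] ] ∧ᵈ var v2 ≡ᵈ ⟨ var v1 , var v0 ⟩ᵗ)) U
          λ { u v w u∈ (y , k , e) (y′ , k′ , e′) → trans e (trans (cong ⟨ u ,_⟩ (valUnique k k′)) (sym e′)) }

      graph : V
      graph = proj₁ total

      opaque
        ∈graph : ⟨ x , y ⟩ ∈ graph ⇔ Val x y
        ∈graph {x} {y} = mk⇔
          (λ h → let (u , _ , y′ , k , e) = to (proj₂ total ⟨ x , y ⟩) h in
            subst₂ Val (sym (pair-inj₁ e)) (sym (pair-inj₂ e)) k)
          (λ k → let (p , gp , l) = k in from (proj₂ total ⟨ x , y ⟩) (x , inU (gp x y l) , y , k , refl))

        graph-pairs : z ∈ graph → ∃[ x ] ∃[ y ] (x ∈ U × z ≡ ⟨ x , y ⟩)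
        graph-pairs {z} h = let (u , u∈ , y , _ , e) = to (proj₂ total z) h in u , y , u∈ , e

        graphGood : Good graph
        graphGood x y h = let
          (p , gp , k) = to ∈graph h
          st = gp x y k
          in mkStep (inU st)
            (λ z z∈ r → let (w , l) = down st z z∈ r in w , from ∈graph (p , gp , l))
            (λ v → preds st v ⇔∘ mk⇔
              (λ (z , z∈ , r , l) → z , z∈ , r , from ∈graph (p , gp , l))
              (λ (z , z∈ , r , l) → z , z∈ , r , (let (w , m) = down st z z∈ r in
                subst (λ v → ⟨ z , v ⟩ ∈ p) (valUnique (p , gp , m) (to ∈graph l)) m)))
            (value st)

        -- If `x` had no value, the graph extended by the pair of `x` and `H s` would be a good
        -- approximation, so this pair would already belong to the graph, which collects all good
        -- approximations.
        defined : ∀ x → x ∈ U → ∃[ y ] ⟨ x , y ⟩ ∈ graph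
        defined = wfInduction (∃ᵈ (⟨ var v1 , var v0 ⟩ᵗ ∈ᵈ con graph)) wf step
          where
            step : ∀ x → x ∈ U → (∀ z → z ∈ U → R z x → ∃[ y ] ⟨ z , y ⟩ ∈ graph) → ∃[ y ] ⟨ x , y ⟩ ∈ graph
            step x x∈ ih = byContra λ none → none (_ , new none)
              where
                dp : Def 1 (λ ρ → ∃[ z ] (z ∈ U × R z x × ⟨ z , lookup ρ v0 ⟩ ∈ graph))
                dp = ∃ᵈ (var v0 ∈ᵈ con U ∧ᵈ dR ᵈ[ var v0 ∷ con x ∷ [] ] ∧ᵈ ⟨ var v0 , var v1 ⟩ᵗ ∈ᵈ con graph)
                s : V
                s = sep dp (⋃ (⋃ graph))
                sP : Preds graph x s
                sP v = ∈sep ⇔∘ mk⇔ proj₂ (λ h → let (_ , _ , _ , k) = h in ∈⋃⋃ʳ k , h)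
                p′ : V
                p′ = graph ∪ sing ⟨ x , H s ⟩
                module _ (none : ¬ (∃[ y ] ⟨ x , y ⟩ ∈ graph)) where
                  old : ∀ {z v} → (∃[ w ] ⟨ z , w ⟩ ∈ graph) → ⟨ z , v ⟩ ∈ p′ → ⟨ z , v ⟩ ∈ graph
                  old {z} {v} (w , l) h = [ id , (λ e → ⊥-elim (none (w , subst (λ z → ⟨ z , w ⟩ ∈ graph) (pair-inj₁ (to ∈sing e)) l))) ]′ (to ∈∪ h)
                  up : ∀ {x′ t} → (∀ z → z ∈ U → R z x′ → ∃[ w ] ⟨ z , w ⟩ ∈ graph) → Preds graph x′ t → Preds p′ x′ t
                  up dn P v = P v ⇔∘ mk⇔
                    (λ (z , z∈ , r , l) → z , z∈ , r , from ∈∪ (inj₁ l))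
                    (λ (z , z∈ , r , l) → z , z∈ , r , old (dn z z∈ r) l)
                  inc : (∃[ w ] ⟨ z , w ⟩ ∈ graph) → ∃[ w ] ⟨ z , w ⟩ ∈ p′
                  inc (w , l) = w , from ∈∪ (inj₁ l)
                  newStep : Step p′ x (H s)
                  newStep = mkStep x∈ (λ z z∈ r → inc (ih z z∈ r)) (up ih sP) refl
                  good′ : Good p′
                  good′ x′ y′ h = [ (λ l → let st = graphGood x′ y′ l in
                      mkStep (inU st) (λ z z∈ r → inc (down st z z∈ r)) (up (down st) (preds st)) (value st))
                    , (λ e → subst₂ (Step p′) (sym (pair-inj₁ (to ∈sing e))) (sym (pair-inj₂ (to ∈sing e))) newStep) ]′ (to ∈∪ h)
                  new : ⟨ x , H s ⟩ ∈ graph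
                  new = from ∈graph (p′ , good′ , from ∈∪ (inj₂ self∈sing))

        graphFun : Fun graph U
        graphFun = fun ((λ z h → graph-pairs h) , λ x x∈ → let (y , h) = defined x x∈ in
          y , h , λ h′ → valUnique (to ∈graph h) (to ∈graph h′))

        rec-eq : ∀ {x} → x ∈ U → ∃[ s ] ((∀ v → v ∈ s ⇔ (∃[ z ] (z ∈ U × R z x × v ≡ app graph z))) × app graph x ≡ H s)
        rec-eq {x} x∈ = let st = graphGood x (app graph x) (app∈ graphFun x∈) in
          set st , (λ v → preds st v ⇔∘ mk⇔
            (λ (z , z∈ , r , l) → z , z∈ , r , sym (app-≡ graphFun l))
            (λ (z , z∈ , r , e) → z , z∈ , r , subst (λ v → ⟨ z , v ⟩ ∈ graph) (sym e) (app∈ graphFun z∈)))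
          , value st

    ∈-wf : ∀ U s → s ⊆ U → (∃[ x ] x ∈ s) → ∃[ m ] (m ∈ s × ∀ y → y ∈ s → ¬ y ∈ m)
    ∈-wf U s _ ne = let (m , m∈ , h) = foundation′ ne in m , m∈ , λ y y∈ r → h y r y∈

    ∈R : Def 2 (λ ρ → lookup ρ v0 ∈ lookup ρ v1)
    ∈R = var v0 ∈ᵈ var v1

    -- The least set containing x and closed under the members of F y.
    module Closure (x : V) {F : V → V} (gF : Graph₁ F) where
      private
        -- Some inductive set. The stage at `n` collects the members of `F y` for all `y` in earlier
        -- stages, so what is generated from the stage at `n` appears at a successor of `n` in `W`.
        W = proj₁ infinity
        stepT : Tm 1
        stepT = con x ∪ᵗ ⋃ᵗ (fn₁ (imG gF) (⋃ᵗ (var v0)))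
      opaque
        H : V → V
        H s = ⟦ stepT ⟧ (s ∷ [])

        gH : Graph₁ H
        gH = graph₁ stepT

        ∈H : ∀ {s} → z ∈ H s ⇔ (z ∈ x ⊎ ∃[ c ] ∃[ y ] (c ∈ s × y ∈ c × z ∈ F y))
        ∈H {z} {s} = ∈∪ ⇔∘ ⊎-⇔ ⇔-refl (∈⋃ ⇔∘ mk⇔
          (λ (t , t∈ , z∈) → let (y , y∈ , e) = to ∈im t∈ ; (c , c∈ , y∈c) = to ∈⋃ y∈ in c , y , c∈ , y∈c , subst (z ∈_) e z∈)
          (λ (c , y , c∈ , y∈c , z∈) → F y , im∋ (from ∈⋃ (c , c∈ , y∈c)) , z∈))

      private
        module R = Recursion W ∈R (∈-wf W) gH
        P₀ = R.graph

      opaque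
        J : V
        J = ⋃ (im (graph₁ (appᵗ (con P₀) (var v0))) W)

        toJ : ∀ {n} → n ∈ W → z ∈ app P₀ n → z ∈ J
        toJ {n = n} n∈ h = from ∈⋃ (app P₀ n , im∋ n∈ , h)

        fromJ : z ∈ J → ∃[ n ] (n ∈ W × z ∈ app P₀ n)
        fromJ {z} h = let (t , t∈ , z∈) = to ∈⋃ h ; (n , n∈ , e) = to ∈im t∈ in n , n∈ , subst (z ∈_) e z∈

        val : ∀ {n} → n ∈ W → z ∈ app P₀ n ⇔ (z ∈ x ⊎ ∃[ m ] ∃[ y ] (m ∈ W × m ∈ n × y ∈ app P₀ m × z ∈ F y))
        val {z} {n} n∈ = let (s , sP , e) = R.rec-eq n∈ in ≡-⇔ (cong (z ∈_) e) ⇔∘ ∈H ⇔∘ ⊎-⇔ ⇔-refl (mk⇔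
          (λ (c , y , c∈ , y∈ , z∈) → let (m , m∈ , r , e₂) = to (sP c) c∈ in m , y , m∈ , r , subst (y ∈_) e₂ y∈ , z∈)
          (λ (m , y , m∈ , r , y∈ , z∈) → app P₀ m , y , from (sP (app P₀ m)) (m , m∈ , r , refl) , y∈ , z∈))

      opaque
        closure : V
        closure = J

        start : x ⊆ closure
        start z z∈ = let (e , e∈ , _) = proj₁ (proj₂ infinity) in toJ e∈ (from (val e∈) (inj₁ z∈))

        closed-under : y ∈ closure → F y ⊆ closure
        closed-under {y} y∈ z z∈ = let
          (n , n∈ , k) = fromJ y∈
          (s , s∈ , sc) = proj₂ (proj₂ infinity) n n∈
          in toJ s∈ (from (val s∈) (inj₂ (n , y , n∈ , from (sc n) (inj₂ refl) , k , z∈)))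

        generated : z ∈ closure → z ∈ x ⊎ ∃[ y ] (y ∈ closure × z ∈ F y)
        generated h = let (n , n∈ , k) = fromJ h in
          [ inj₁ , (λ (m , y , m∈ , _ , y∈ , z∈) → inj₂ (y , toJ m∈ y∈ , z∈)) ]′ (to (val n∈) k)

    Tr : V → Set ℓ
    Tr t = ∀ y → y ∈ t → y ⊆ t

    opaque
      transitiveHull : ∀ x → ∃[ t ] (Tr t × x ⊆ t)
      transitiveHull x = closure , (λ y y∈ → closed-under y∈) , start
        where open Closure x (graph₁ (var v0))

      ∈-induction : {P : V → Set ℓ} → Def 1 (λ ρ → P (lookup ρ v0)) → (∀ x → (∀ y → y ∈ x → P y) → P x) → ∀ x → P x
      ∈-induction {P} d step x = let (t , tr , sub) = transitiveHull (sing x) in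
        wfInduction d (∈-wf t) (λ y y∈ ih → step y λ z z∈ → ih z (tr y y∈ z z∈) z∈) x (sub x self∈sing)

  open Recursions public

  -- Ordinals, the cumulative hierarchy, collection and choice functions.

  module Ordinals where
    private variable
      n : ℕ
      x y z u v w f g A B α β γ δ : V

    -- Ordinals

    record Ord (α : V) : Set ℓ where
      constructor mkOrd
      field
        trans-ord : Tr α
        trans-mem : ∀ y → y ∈ α → Tr y
    open Ord public

    trᵈ : Def 1 (λ ρ → Tr (lookup ρ v0))
    trᵈ = ∀ᵈ (var v0 ∈ᵈ var v1 ⇒ᵈ ⊆ᵈ ᵈ[ var v0 ∷ var v1 ∷ [] ])

    ⊆₀ : D₀ 2 (λ ρ → lookup ρ v0 ⊆ lookup ρ v1)
    ⊆₀ = ∀∈₀ v0 (v0 ∈₀ v2)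

    tr₀ : D₀ 1 (λ ρ → Tr (lookup ρ v0))
    tr₀ = ∀∈₀ v0 (⊆₀ ₀[ v0 ∷ v1 ∷ [] ])

    ord₀ : D₀ 1 (λ ρ → Ord (lookup ρ v0))
    ord₀ = cast₀ (λ ρ → mk⇔ (λ (a , b) → mkOrd a b) (λ o → trans-ord o , trans-mem o)) (tr₀ ∧₀ ∀∈₀ v0 (tr₀ ₀[ v0 ∷ [] ]))

    ordᵈ : Def 1 (λ ρ → Ord (lookup ρ v0))
    ordᵈ = D₀⇒D ord₀

    ord-∈ : Ord α → β ∈ α → Ord β
    ord-∈ o b = mkOrd (trans-mem o _ b) (λ y y∈ → trans-mem o y (trans-ord o _ b y y∈))

    opaque
      trichotomy : Ord α → Ord β → α ∈ β ⊎ α ≡ β ⊎ β ∈ α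
      trichotomy {α} {β} oα = outer α oα β
        where
          T : V → V → Set ℓ
          T x y = x ∈ y ⊎ x ≡ y ⊎ y ∈ x
          Tᵈ : Def 2 (λ ρ → T (lookup ρ v0) (lookup ρ v1))
          Tᵈ = var v0 ∈ᵈ var v1 ∨ᵈ var v0 ≡ᵈ var v1 ∨ᵈ var v1 ∈ᵈ var v0
          outer : ∀ x → Ord x → ∀ y → Ord y → T x y
          outer = ∈-induction (ordᵈ ⇒ᵈ ∀ᵈ (ordᵈ ᵈ[ var v0 ∷ [] ] ⇒ᵈ Tᵈ ᵈ[ var v1 ∷ var v0 ∷ [] ]))
            λ x ihx ox → ∈-induction (ordᵈ ⇒ᵈ Tᵈ ᵈ[ con x ∷ var v0 ∷ [] ]) λ y ihy oy →
              byContra λ n → n (inj₂ (inj₁ (⊆-antisym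
                (λ a a∈ → [ id , [ (λ e → ⊥-elim (n (inj₂ (inj₂ (subst (_∈ x) e a∈))))) ,
                                   (λ y∈ → ⊥-elim (n (inj₂ (inj₂ (trans-ord ox a a∈ y y∈))))) ]′ ]′ (ihx a a∈ (ord-∈ ox a∈) y oy))
                (λ b b∈ → [ (λ x∈ → ⊥-elim (n (inj₁ (trans-ord oy b b∈ x x∈)))) ,
                            [ (λ e → ⊥-elim (n (inj₁ (subst (_∈ y) (sym e) b∈)))) , id ]′ ]′ (ihy b b∈ (ord-∈ oy b∈))))))

      -- Foundation provides the least elements and `trichotomy` the linearity, so a transitive set
      -- of transitive sets is well-ordered by ∈. The left side is Δ₀, which makes it the working
      -- definition.
      Ord⇔IsOrdinal : Ord α ⇔ IsOrdinal α
      Ord⇔IsOrdinal {α} = mk⇔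
        (λ o → (λ x y p q → trans-ord o x p y q) ,
          (λ _ _ → ∈-irrefl) ,
          (λ x y z _ _ z∈ p q → trans-mem o z z∈ y q x p) ,
          (λ x y x∈ y∈ → trichotomy (ord-∈ o x∈) (ord-∈ o y∈)) ,
          (λ s s⊆ ne → let (m , m∈ , min) = foundation′ ne in m , m∈ , λ y y∈ →
            [ inj₁ , [ inj₂ , (λ y∈m → ⊥-elim (min y y∈m y∈)) ]′ ]′
              (trichotomy (ord-∈ o (s⊆ m m∈)) (ord-∈ o (s⊆ y y∈)))))
        (λ (t , _ , tra , _) → mkOrd (λ y y∈ z z∈ → t y z y∈ z∈)
          (λ y y∈ z z∈ w w∈ → tra w z y (t z w (t y z y∈ z∈) w∈) (t y z y∈ z∈) y∈ w∈ z∈))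

    toOrd : IsOrdinal α → Ord α
    toOrd = from Ord⇔IsOrdinal

    fromOrd : Ord α → IsOrdinal α
    fromOrd = to Ord⇔IsOrdinal

    S : V → V
    S x = x ∪ sing x

    Sᵗ : Tm n → Tm n
    Sᵗ t = t ∪ᵗ singᵗ t

    opaque
      ∈S : x ∈ S y ⇔ (x ∈ y ⊎ x ≡ y)
      ∈S = ∈∪ ⇔∘ ⊎-⇔ ⇔-refl ∈sing

    self∈S : x ∈ S x
    self∈S = from ∈S (inj₂ refl)

    opaque
      ord-∅ : Ord ∅
      ord-∅ = mkOrd (λ y p → ⊥-elim (∉∅ p)) (λ y p → ⊥-elim (∉∅ p))

      ord-S : Ord α → Ord (S α)
      ord-S {α} o = mkOrd
        (λ y y∈ z z∈ → from ∈S (inj₁ ([ (λ p → trans-ord o y p z z∈) , (λ { refl → z∈ }) ]′ (to ∈S y∈))))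
        (λ y y∈ → [ trans-mem o y , (λ { refl → trans-ord o }) ]′ (to ∈S y∈))

      ord-⋃ : (∀ z → z ∈ x → Ord z) → Ord (⋃ x)
      ord-⋃ o = mkOrd
        (λ y y∈ z z∈ → let (a , a∈ , h) = to ∈⋃ y∈ in from ∈⋃ (a , a∈ , trans-ord (o a a∈) y h z z∈))
        (λ y y∈ → let (a , a∈ , h) = to ∈⋃ y∈ in trans-mem (o a a∈) y h)

      -- Burali-Forti: the ordinals in such an `x` would form a transitive set of ordinals, that is,
      -- an ordinal belonging to itself.
      ordinals-unbounded : ¬ (∀ z → Ord z → z ∈ x)
      ordinals-unbounded {x} h = ∈-irrefl (from ∈sep (h σ oσ , oσ))
        where
          σ : V
          σ = sep ordᵈ x
          oσ : Ord σ
          oσ = mkOrd (λ y y∈ z z∈ → let o = ord-∈ (proj₂ (to ∈sep y∈)) z∈ in from ∈sep (h z o , o))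
                     (λ y y∈ → trans-ord (proj₂ (to ∈sep y∈)))

      ord-sup : (∀ z → z ∈ x → Ord z) → ∃[ σ ] (Ord σ × ∀ z → z ∈ x → z ∈ σ)
      ord-sup {x} o = S (⋃ x) , oS , λ z z∈ →
        [ id , [ (λ e → subst (_∈ S (⋃ x)) (sym e) (⊥-elim′ z z∈ (subst (⋃ x ∈_) (sym e) self∈S))) ,
                 (λ h → ⊥-elim (∈-irrefl (from ∈⋃ (z , z∈ , trans-ord (o z z∈) _ h (⋃ x) self∈S)))) ]′ ]′ (trichotomy (o z z∈) oS)
        where
          oS : Ord (S (⋃ x))
          oS = ord-S (ord-⋃ o)
          ⊥-elim′ : ∀ z → z ∈ x → ⋃ x ∈ z → S (⋃ x) ∈ S (⋃ x)
          ⊥-elim′ z z∈ h = ⊥-elim (∈-irrefl (from ∈⋃ (z , z∈ , h)))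

      leastOrd : {P : V → Set ℓ} → Def 1 (λ ρ → P (lookup ρ v0)) → Ord α → P α →
        ∃[ β ] (Ord β × P β × ∀ γ → γ ∈ β → ¬ P γ)
      leastOrd {α} {P} d o p =
        let (m , m∈ , min) = foundation′ {sep d (S α)} (α , from ∈sep (self∈S , p))
            (m∈S , pm) = to ∈sep m∈
        in m , ord-∈ (ord-S o) m∈S , pm , λ γ γ∈ pγ → min γ γ∈ (from ∈sep (trans-ord (ord-S o) m m∈S γ γ∈ , pγ))

      ∈⇒⊆ : Ord α → β ∈ α → β ⊆ α
      ∈⇒⊆ o b = trans-ord o _ b

      ⊆⇒≤ : Ord α → Ord β → α ⊆ β → α ≤ β
      ⊆⇒≤ oα oβ h = [ inj₁ , [ inj₂ , (λ b → ⊥-elim (∈-irrefl (h _ b))) ]′ ]′ (trichotomy oα oβ)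

      ≤⇒⊆ : Ord β → α ≤ β → α ⊆ β
      ≤⇒⊆ o (inj₁ h) = ∈⇒⊆ o h
      ≤⇒⊆ o (inj₂ refl) = ⊆-refl

      ∉⇒⊆ : Ord α → Ord β → ¬ α ∈ β → β ⊆ α
      ∉⇒⊆ oα oβ n = [ (λ h → ⊥-elim (n h)) , [ (λ { refl → ⊆-refl }) , ∈⇒⊆ oα ]′ ]′ (trichotomy oα oβ)

      ord-max : Ord α → Ord β → ∃[ γ ] (Ord γ × α ∈ γ × β ∈ γ)
      ord-max {α} {β} oα oβ = let (σ , oσ , h) = ord-sup {pair α β} (λ z z∈ → [ (λ { refl → oα }) , (λ { refl → oβ }) ]′ (to ∈pair z∈))
        in σ , oσ , h α ∈pairˡ , h β ∈pairʳ

    -- The cumulative hierarchy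

    stageᵈ : Def 2 (λ ρ → IsStage (lookup ρ v0) (lookup ρ v1))
    stageᵈ = ∃ᵈ (castᵈ (λ ρ → mk⇔ isFun fun) (funᵈ ᵈ[ var v0 ∷ var v1 ∷ [] ])
      ∧ᵈ ∀ᵈ (∀ᵈ (⟨ var v1 , var v0 ⟩ᵗ ∈ᵈ var v2 ⇒ᵈ ∀ᵈ (var v0 ∈ᵈ var v1 ⇔ᵈ
           ∃ᵈ (∃ᵈ (var v1 ∈ᵈ var v4 ∧ᵈ ⟨ var v1 , var v0 ⟩ᵗ ∈ᵈ var v5 ∧ᵈ ⊆ᵈ ᵈ[ var v2 ∷ var v0 ∷ [] ])))))
      ∧ᵈ ∀ᵈ (var v0 ∈ᵈ var v3 ⇔ᵈ ∃ᵈ (∃ᵈ (var v1 ∈ᵈ var v4 ∧ᵈ ⟨ var v1 , var v0 ⟩ᵗ ∈ᵈ var v3 ∧ᵈ ⊆ᵈ ᵈ[ var v2 ∷ var v0 ∷ [] ]))))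

    opaque
      stage-unique : Ord α → IsStage α u → IsStage α v → u ≡ v
      stage-unique {α} {u} {v} o (f , F , fe , fw) (g , G , ge , gw) = whole
        where
          P : V → Set ℓ
          P β = ∀ a b → ⟨ β , a ⟩ ∈ f → ⟨ β , b ⟩ ∈ g → a ≡ b
          same : ∀ β → β ∈ α → P β
          same = wfInduction (∀ᵈ (∀ᵈ (⟨ var v2 , var v1 ⟩ᵗ ∈ᵈ con f ⇒ᵈ ⟨ var v2 , var v0 ⟩ᵗ ∈ᵈ con g ⇒ᵈ var v1 ≡ᵈ var v0))) (∈-wf α)
            λ β β∈ ih a b fa gb → extensionality λ x → fe β a fa x ⇔∘ mk⇔
              (λ (γ , c , γ∈ , h , s) → let (d , k , _) = proj₂ G γ (trans-ord o β β∈ γ γ∈) in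
                γ , d , γ∈ , k , subst (x ⊆_) (ih γ (trans-ord o β β∈ γ γ∈) γ∈ c d h k) s)
              (λ (γ , d , γ∈ , k , s) → let (c , h , _) = proj₂ F γ (trans-ord o β β∈ γ γ∈) in
                γ , c , γ∈ , h , subst (x ⊆_) (sym (ih γ (trans-ord o β β∈ γ γ∈) γ∈ c d h k)) s)
              ⇔∘ ⇔-sym (ge β b gb x)
          whole : u ≡ v
          whole = extensionality λ x → fw x ⇔∘ mk⇔
              (λ (γ , c , γ∈ , h , s) → let (d , k , _) = proj₂ G γ γ∈ in γ , d , γ∈ , k , subst (x ⊆_) (same γ γ∈ c d h k) s)
              (λ (γ , d , γ∈ , k , s) → let (c , h , _) = proj₂ F γ γ∈ in γ , c , γ∈ , h , subst (x ⊆_) (sym (same γ γ∈ c d h k)) s)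
              ⇔∘ ⇔-sym (gw x)

      powers : V → V
      powers s = ⋃ (im 𝒫G s)

      powersG : Graph₁ powers
      powersG = graph₁ (⋃ᵗ (fn₁ (imG 𝒫G) (var v0)))

      ∈powers : x ∈ powers y ⇔ (∃[ c ] (c ∈ y × x ⊆ c))
      ∈powers {x} = ∈⋃ ⇔∘ mk⇔
        (λ (p , p∈ , x∈) → let (c , c∈ , e) = to ∈im p∈ in c , c∈ , to ∈𝒫 (subst (x ∈_) e x∈))
        (λ (c , c∈ , xs) → 𝒫 c , im∋ c∈ , from ∈𝒫 xs)

    module StageRecursion (α : V) where
      open Recursion α ∈R (∈-wf α) powersG using (graph; rec-eq)

      valuesG : Graph₁ (app graph)
      valuesG = graph₁ (appᵗ (con graph) (var v0))

      sequence top : V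
      sequence = lam valuesG α
      top = powers (im valuesG α)

      opaque
        sequence-step : ⟨ β , v ⟩ ∈ sequence → x ∈ v ⇔ (∃[ γ ] ∃[ u ] (γ ∈ β × ⟨ γ , u ⟩ ∈ sequence × x ⊆ u))
        sequence-step {β} {v} {x} h = let (β∈ , e) = to ∈lam h ; (s , sP , e′) = rec-eq β∈ in
          ≡-⇔ (cong (x ∈_) (trans e e′)) ⇔∘ ∈powers ⇔∘ mk⇔
            (λ (c , c∈ , xs) → let (γ , γ∈ , γβ , e) = to (sP c) c∈ in
              γ , app graph γ , γβ , from ∈lam (γ∈ , refl) , subst (x ⊆_) e xs)
            (λ (γ , c , γβ , h , xs) → let (γ∈ , e) = to ∈lam h in
              app graph γ , from (sP (app graph γ)) (γ , γ∈ , γβ , refl) , subst (x ⊆_) e xs)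

        top-step : x ∈ top ⇔ (∃[ γ ] ∃[ u ] (γ ∈ α × ⟨ γ , u ⟩ ∈ sequence × x ⊆ u))
        top-step {x} = ∈powers ⇔∘ mk⇔
          (λ (c , c∈ , xs) → let (γ , γ∈ , e) = to ∈im c∈ in γ , app graph γ , γ∈ , from ∈lam (γ∈ , refl) , subst (x ⊆_) e xs)
          (λ (γ , c , γ∈ , h , xs) → app graph γ , im∋ γ∈ , subst (x ⊆_) (proj₂ (to ∈lam h)) xs)

      isStage : IsStage α top
      isStage = sequence , isFun lam-fun , (λ β v h x → sequence-step h) , λ x → top-step

    -- The default ∅ outside the ordinals makes 𝕍 a total operation with a definable graph, so that
    -- it may occur in terms.
    record StageValue (w α : V) : Set ℓ where
      constructor stageValue
      field stageOrEmpty : (Ord α × IsStage α w) ⊎ (¬ Ord α × w ≡ ∅)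

    stageValueᵈ : Def 2 (λ ρ → StageValue (lookup ρ v0) (lookup ρ v1))
    stageValueᵈ = castᵈ (λ ρ → mk⇔ stageValue StageValue.stageOrEmpty)
      ((ordᵈ ᵈ[ var v1 ∷ [] ] ∧ᵈ stageᵈ ᵈ[ var v1 ∷ var v0 ∷ [] ]) ∨ᵈ (¬ᵈ (ordᵈ ᵈ[ var v1 ∷ [] ]) ∧ᵈ var v0 ≡ᵈ con ∅))

    opaque
      private
        𝕍-graph : Σ[ F ∈ (V → V) ] (Graph₁ F × ∀ α → StageValue (F α) α)
        𝕍-graph = describe stageValueᵈ
          λ α → [ (λ o → StageRecursion.top α , stageValue (inj₁ (o , StageRecursion.isStage α)) , λ
                     { (stageValue (inj₁ (_ , k))) → stage-unique o (StageRecursion.isStage α) k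
                     ; (stageValue (inj₂ (n , _))) → ⊥-elim (n o) })
                , (λ n → ∅ , stageValue (inj₂ (n , refl)) , λ
                     { (stageValue (inj₁ (o , _))) → ⊥-elim (n o)
                     ; (stageValue (inj₂ (_ , e))) → sym e }) ]′ (lem (Ord α))

      𝕍 : V → V
      𝕍 = proj₁ 𝕍-graph

      𝕍G : Graph₁ 𝕍
      𝕍G = proj₁ (proj₂ 𝕍-graph)

      𝕍-stage : Ord α → IsStage α (𝕍 α)
      𝕍-stage {α} o = [ proj₂ , (λ (n , _) → ⊥-elim (n o)) ]′ (StageValue.stageOrEmpty (proj₂ (proj₂ 𝕍-graph) α))

      stage≡𝕍 : Ord α → IsStage α w → w ≡ 𝕍 α
      stage≡𝕍 o h = stage-unique o h (𝕍-stage o)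

      -- The restriction of `f` to β witnesses that its value at β is a stage, and stages are
      -- unique.
      stage-values : Ord α → IsStage α w → ∀ f → IsFunction (_∈ f) (_∈ α) →
        (∀ β v → ⟨ β , v ⟩ ∈ f → ∀ x → x ∈ v ⇔ (∃[ γ ] ∃[ u ] (γ ∈ β × ⟨ γ , u ⟩ ∈ f × x ⊆ u))) →
        ∀ β v → β ∈ α → ⟨ β , v ⟩ ∈ f → v ≡ 𝕍 β
      stage-values {α} o _ f F fe β v β∈ h = stage≡𝕍 (ord-∈ o β∈) $
        g₀ , ((λ z z∈ → let (z∈f , k) = to ∈sep z∈ ; (x , y , _ , e) = proj₁ F z z∈f ; (x′ , x′∈ , y′ , e′) = k in
                x′ , y′ , x′∈ , e′) ,
              (λ x x∈ → let (y , k , un) = proj₂ F x (trans-ord o β β∈ x x∈) in y , from ∈sep (k , x , x∈ , y , refl) , λ k′ → un (proj₁ (to ∈sep k′)))) ,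
        (λ δ d h′ x → fe δ d (proj₁ (to ∈sep h′)) x ⇔∘ mk⇔
          (λ (γ , u , γ∈ , k , xs) → γ , u , γ∈ , from ∈sep (k , γ , inβ δ d h′ γ γ∈ , u , refl) , xs)
          (λ (γ , u , γ∈ , k , xs) → γ , u , γ∈ , proj₁ (to ∈sep k) , xs)) ,
        λ x → fe β v h x ⇔∘ mk⇔
          (λ (γ , u , γ∈ , k , xs) → γ , u , γ∈ , from ∈sep (k , γ , γ∈ , u , refl) , xs)
          (λ (γ , u , γ∈ , k , xs) → γ , u , γ∈ , proj₁ (to ∈sep k) , xs)
        where
          g₀ : V
          g₀ = sep (∃ᵈ (var v0 ∈ᵈ con β ∧ᵈ ∃ᵈ (var v2 ≡ᵈ ⟨ var v1 , var v0 ⟩ᵗ))) f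
          inβ : ∀ δ d → ⟨ δ , d ⟩ ∈ g₀ → ∀ γ → γ ∈ δ → γ ∈ β
          inβ δ d h′ γ γ∈ = let (_ , x′ , x′∈ , y′ , e) = to ∈sep h′ in
            trans-mem o β β∈ x′ x′∈ γ (subst (γ ∈_) (pair-inj₁ e) γ∈)

      ∈𝕍 : Ord α → x ∈ 𝕍 α ⇔ (∃[ γ ] (γ ∈ α × x ⊆ 𝕍 γ))
      ∈𝕍 {α} {x} o = let (f , F , fe , fw) = 𝕍-stage o in fw x ⇔∘ mk⇔
        (λ (γ , u , γ∈ , h , xs) → γ , γ∈ , subst (x ⊆_) (stage-values o (𝕍-stage o) f F fe γ u γ∈ h) xs)
        (λ (γ , γ∈ , xs) → let (u , h , _) = proj₂ F γ γ∈ in γ , u , γ∈ , h ,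
          subst (x ⊆_) (sym (stage-values o (𝕍-stage o) f F fe γ u γ∈ h)) xs)

    𝕍ᵗ : Tm n → Tm n
    𝕍ᵗ = fn₁ 𝕍G

    opaque
      𝕍-mono : Ord β → α ⊆ β → Ord α → 𝕍 α ⊆ 𝕍 β
      𝕍-mono oβ s oα x h = let (γ , γ∈ , xs) = to (∈𝕍 oα) h in from (∈𝕍 oβ) (γ , s γ γ∈ , xs)

      𝕍-trans : Ord α → Tr (𝕍 α)
      𝕍-trans oα y h z z∈ = let (γ , γ∈ , ys) = to (∈𝕍 oα) h in
        𝕍-mono oα (∈⇒⊆ oα γ∈) (ord-∈ oα γ∈) z (ys z z∈)

      ⊆𝕍⇒∈ : Ord α → β ∈ α → x ⊆ 𝕍 β → x ∈ 𝕍 α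
      ⊆𝕍⇒∈ oα β∈ xs = from (∈𝕍 oα) (_ , β∈ , xs)

      𝕍-⊆ : Ord α → x ∈ 𝕍 α → y ⊆ x → y ∈ 𝕍 α
      𝕍-⊆ oα h s = let (γ , γ∈ , xs) = to (∈𝕍 oα) h in from (∈𝕍 oα) (γ , γ∈ , λ z z∈ → xs z (s z z∈))

      ord⊆𝕍 : ∀ α → Ord α → α ⊆ 𝕍 α
      ord⊆𝕍 = ∈-induction (ordᵈ ⇒ᵈ ⊆ᵈ ᵈ[ var v0 ∷ 𝕍ᵗ (var v0) ∷ [] ])
        λ α ih o β β∈ → ⊆𝕍⇒∈ o β∈ (ih β β∈ (ord-∈ o β∈))

      -- Scott's trick
      leastRel : {R : V → V → Set ℓ} → Def 2 (λ ρ → R (lookup ρ v0) (lookup ρ v1)) → ∀ A →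
        (∀ x → x ∈ A → ∃[ α ] (Ord α × R x α)) → ∃[ σ ] (Ord σ × ∀ x → x ∈ A → ∃[ α ] (α ∈ σ × Ord α × R x α))
      leastRel {R} d A h =
        let L : V → V → Set ℓ
            L x α = Ord α × R x α × ∀ γ → γ ∈ α → ¬ (Ord γ × R x γ)
            dL : Def 2 (λ ρ → L (lookup ρ v0) (lookup ρ v1))
            dL = ordᵈ ᵈ[ var v1 ∷ [] ] ∧ᵈ d ∧ᵈ ∀ᵈ (var v0 ∈ᵈ var v2 ⇒ᵈ ¬ᵈ (ordᵈ ᵈ[ var v0 ∷ [] ] ∧ᵈ d ᵈ[ var v1 ∷ var v0 ∷ [] ]))
            (B , hB) = repl dL A λ x α β _ (oα , rα , mα) (oβ , rβ , mβ) →
              [ (λ k → ⊥-elim (mβ α k (oα , rα))) , [ id , (λ k → ⊥-elim (mα β k (oβ , rβ))) ]′ ]′ (trichotomy oα oβ)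
            (σ , oσ , hσ) = ord-sup {B} (λ z z∈ → let (_ , _ , o , _) = to (hB z) z∈ in o)
        in σ , oσ , λ x x∈ →
          let (α , oα , rα) = h x x∈
              (β , oβ , rβ , mβ) = leastOrd {P = λ α → Ord α × R x α} (ordᵈ ∧ᵈ d ᵈ[ con x ∷ var v0 ∷ [] ]) oα (oα , rα)
          in β , hσ β (from (hB β) (x , x∈ , oβ , proj₂ rβ , mβ)) , oβ , proj₂ rβ

      everySetRanked : ∀ x → ∃[ α ] (Ord α × x ∈ 𝕍 α)
      everySetRanked = ∈-induction (∃ᵈ (ordᵈ ᵈ[ var v0 ∷ [] ] ∧ᵈ var v1 ∈ᵈ 𝕍ᵗ (var v0))) λ x ih →
        let (σ , oσ , h) = leastRel {R = λ y α → y ∈ 𝕍 α} (var v0 ∈ᵈ 𝕍ᵗ (var v1)) x ih in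
        S σ , ord-S oσ , ⊆𝕍⇒∈ (ord-S oσ) self∈S λ y y∈ →
          let (α , α∈ , oα , k) = h y y∈ in 𝕍-mono oσ (∈⇒⊆ oσ α∈) oα y k

      collection : {R : V → V → Set ℓ} → Def 2 (λ ρ → R (lookup ρ v0) (lookup ρ v1)) → ∀ A →
        (∀ x → x ∈ A → ∃[ y ] R x y) → ∃[ B ] (∀ x → x ∈ A → ∃[ y ] (y ∈ B × R x y))
      collection {R} d A h =
        let (σ , oσ , k) = leastRel {R = λ x α → ∃[ y ] (y ∈ 𝕍 α × R x y)}
              (∃ᵈ (var v0 ∈ᵈ 𝕍ᵗ (var v2) ∧ᵈ d ᵈ[ var v1 ∷ var v0 ∷ [] ])) A
              (λ x x∈ → let (y , r) = h x x∈ ; (α , o , y∈) = everySetRanked y in α , o , y , y∈ , r)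
        in 𝕍 σ , λ x x∈ → let (α , α∈ , oα , y , y∈ , r) = k x x∈ in y , 𝕍-mono oσ (∈⇒⊆ oσ α∈) oα y y∈ , r

      -- The axiom of choice selects from disjoint families. Tagging the values by `x` makes the
      -- fibres disjoint, collection makes them sets, and the selected pairs form the function.
      choiceFunction : {R : V → V → Set ℓ} → Def 2 (λ ρ → R (lookup ρ v0) (lookup ρ v1)) → ∀ A →
        (∀ x → x ∈ A → ∃[ y ] R x y) → ∃[ g ] (Fun g A × ∀ x → x ∈ A → R x (app g x))
      choiceFunction {R} d A h = g₀ , gFun , λ x x∈ → fibre (app∈ gFun x∈)
        where
          BB : ∃[ B ] (∀ x → x ∈ A → ∃[ y ] (y ∈ B × R x y))
          BB = collection d A h
          B₀ : V
          B₀ = proj₁ BB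
          fib : V → V → Set ℓ
          fib z x = z ∈ row x B₀ × ∃[ y ] (z ≡ ⟨ x , y ⟩ × R x y)
          fibᵈ : Def 2 (λ ρ → fib (lookup ρ v0) (lookup ρ v1))
          fibᵈ = var v0 ∈ᵈ fn₂ rowG (var v1) (con B₀) ∧ᵈ ∃ᵈ (var v1 ≡ᵈ ⟨ var v2 , var v0 ⟩ᵗ ∧ᵈ d ᵈ[ var v2 ∷ var v0 ∷ [] ])
          fibre-set : V → V
          fibre-set x = sep (fibᵈ ᵈ[ var v0 ∷ con x ∷ [] ]) (row x B₀)
          ∈fs : ∀ {z x} → z ∈ fibre-set x ⇔ fib z x
          ∈fs = ∈sep ⇔∘ mk⇔ proj₂ (λ p → proj₁ p , p)
          fsG : Graph₁ fibre-set
          fsG = byElements₁ (λ x z → ∈fs) fibᵈ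
          fam : V
          fam = im fsG A
          ch : ∃[ c ] ∀ y → y ∈ fam → ∃! _≡_ λ z → z ∈ y × z ∈ c
          ch = choice fam
            (λ y y∈ → let (x , x∈ , e) = to ∈im y∈ ; (b , b∈ , r) = proj₂ BB x x∈ in
              ⟨ x , b ⟩ , subst (⟨ x , b ⟩ ∈_) (sym e) (from ∈fs (from ∈row (b , b∈ , refl) , b , refl , r)))
            (λ y y′ z y∈ y′∈ z∈ z∈′ → let
                (x , _ , e) = to ∈im y∈ ; (x′ , _ , e′) = to ∈im y′∈
                (_ , _ , p , _) = to ∈fs (subst (z ∈_) e z∈)
                (_ , _ , p′ , _) = to ∈fs (subst (z ∈_) e′ z∈′)
              in trans e (trans (cong fibre-set (pair-inj₁ (trans (sym p) p′))) (sym e′)))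
          g₀ : V
          g₀ = sep (var v0 ∈ᵈ con (proj₁ ch)) (⋃ fam)
          ∈g₀ : ∀ {x y} → ⟨ x , y ⟩ ∈ g₀ ⇔ (x ∈ A × ⟨ x , y ⟩ ∈ fibre-set x × ⟨ x , y ⟩ ∈ proj₁ ch)
          ∈g₀ {x} {y} = ∈sep ⇔∘ mk⇔
            (λ (p , c) → let (t , t∈ , k) = to ∈⋃ p ; (x′ , x′∈ , e) = to ∈im t∈
                             k′ = subst (⟨ x , y ⟩ ∈_) e k
                             (_ , _ , q , _) = to ∈fs k′
                             e′ = sym (pair-inj₁ q)
                         in subst (_∈ A) e′ x′∈ , subst (λ x′ → ⟨ x , y ⟩ ∈ fibre-set x′) e′ k′ , c)
            (λ (x∈ , k , c) → from ∈⋃ (fibre-set x , im∋ x∈ , k) , c)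
          fibre : ∀ {x y} → ⟨ x , y ⟩ ∈ g₀ → R x y
          fibre {x} k = let (_ , l , _) = to ∈g₀ k ; (_ , y , e , r) = to ∈fs l in subst (R x) (sym (pair-inj₂ e)) r
          gFun : Fun g₀ A
          gFun = fun ((λ z z∈ → let
                    (p , _) = to ∈sep z∈ ; (t , t∈ , k) = to ∈⋃ p ; (x , x∈ , e) = to ∈im t∈
                    (_ , y , q , _) = to ∈fs (subst (z ∈_) e k) in x , y , x∈ , q)
            , λ x x∈ → let
                (z , (z∈ , z∈c) , un) = proj₂ ch (fibre-set x) (im∋ x∈)
                (_ , y , q , _) = to ∈fs z∈
              in y , from ∈g₀ (x∈ , subst (_∈ fibre-set x) q z∈ , subst (_∈ proj₁ ch) q z∈c) ,
                 λ {y′} k → let (_ , l , c) = to ∈g₀ k in pair-inj₂ (trans (sym q) (un (l , c))))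

  open Ordinals public

  -- Zermelo numerals, Δ₀ formulas about pairs, and the relations to be preserved.

  module Colours where
    private variable
      n : ℕ
      x y z u : V
      P : Vec V n → Set ℓ

    -- Zermelo numerals: unlike the von Neumann numerals they are characterised one step at a time.

    private module Zermelo = Closure (sing ∅) (graph₁ (singᵗ (singᵗ (var v0))))

    opaque
      Z : V
      Z = Zermelo.closure

      ∅∈Z : ∅ ∈ Z
      ∅∈Z = Zermelo.start ∅ self∈sing

      sing∈Z : x ∈ Z → sing x ∈ Z
      sing∈Z x∈ = Zermelo.closed-under x∈ _ self∈sing

      Z-cases : x ∈ Z → x ≡ ∅ ⊎ ∃[ y ] (y ∈ Z × x ≡ sing y)
      Z-cases x∈ = [ inj₁ ∘ to ∈sing , (λ (y , y∈ , h) → inj₂ (y , y∈ , to ∈sing h)) ]′ (Zermelo.generated x∈)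

      Z-induction : {P : V → Set ℓ} → Def 1 (λ ρ → P (lookup ρ v0)) → P ∅ →
        (∀ n → n ∈ Z → P n → P (sing n)) → ∀ n → n ∈ Z → P n
      Z-induction {P} d p∅ ps = wfInduction d (∈-wf Z) λ x x∈ ih →
        [ (λ e → subst P (sym e) p∅)
        , (λ (y , y∈ , e) → subst P (sym e) (ps y y∈ (ih y y∈ (subst (y ∈_) (sym e) self∈sing)))) ]′ (Z-cases x∈)

    sing≢∅ : sing x ≢ ∅
    sing≢∅ e = ∉∅ (subst (_ ∈_) e self∈sing)

    opaque
      successor-wf : ∀ s → s ⊆ Z → ∃[ x ] x ∈ s → ∃[ m ] (m ∈ s × ∀ y → y ∈ s → ¬ m ≡ sing y)
      successor-wf s s⊆ ne = let (m , m∈ , h) = foundation′ ne in m , m∈ , λ y y∈ e → h y (subst (y ∈_) (sym e) self∈sing) y∈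

    module Iterate (start : V) {G : V → V} (gG : Graph₁ G) where
      opaque
        -- Recursion hands over the set of values at the predecessors. It is empty at ∅ and a
        -- singleton at a successor, so a union of images applies `G` in the second case, and
        -- emptiness recognises the first.
        step : V → V
        step s = ⋃ (im gG s) ∪ sep (con s ≡ᵈ con ∅) start

        ∈step : ∀ {s} → z ∈ step s ⇔ ((∃[ c ] (c ∈ s × z ∈ G c)) ⊎ (z ∈ start × s ≡ ∅))
        ∈step {z} {s} = ∈∪ ⇔∘ ⊎-⇔ (∈⋃ ⇔∘ mk⇔
            (λ (t , t∈ , z∈) → let (c , c∈ , e) = to ∈im t∈ in c , c∈ , subst (z ∈_) e z∈)
            (λ (c , c∈ , z∈) → G c , im∋ c∈ , z∈))
          ∈sep

      stepG : Graph₁ step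
      stepG = byElements₁ (λ s z → ∈step)
        (∃ᵈ (var v0 ∈ᵈ var v2 ∧ᵈ var v1 ∈ᵈ fn₁ gG (var v0)) ∨ᵈ (var v0 ∈ᵈ con start ∧ᵈ var v1 ≡ᵈ con ∅))

      private module R = Recursion Z {R = λ y x → x ≡ sing y} (var v1 ≡ᵈ singᵗ (var v0)) successor-wf stepG

      opaque
        sequence : V
        sequence = R.graph

        sequenceFun : Fun sequence Z
        sequenceFun = R.graphFun

        at-∅ : app sequence ∅ ≡ start
        at-∅ = let (s , sP , e) = R.rec-eq ∅∈Z ; s∅ = empty (λ z z∈ → let (y , _ , e , _) = to (sP z) z∈ in sing≢∅ (sym e)) in
          trans e (extensionality λ z → ∈step ⇔∘ mk⇔
            [ (λ (c , c∈ , _) → ⊥-elim (∉∅ (subst (c ∈_) s∅ c∈))) , proj₁ ]′ (λ z∈ → inj₂ (z∈ , s∅)))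

        at-sing : x ∈ Z → app sequence (sing x) ≡ G (app sequence x)
        at-sing {x} x∈ = let
            (s , sP , e) = R.rec-eq (sing∈Z x∈)
            x∈s = from (sP (app R.graph x)) (x , x∈ , refl , refl)
          in trans e (extensionality λ z → ∈step ⇔∘ mk⇔
            [ (λ (c , c∈ , z∈) → let (y , _ , e₁ , e₂) = to (sP c) c∈ in
                 subst (λ c → z ∈ G c) (trans e₂ (cong (app R.graph) (sym (sing-inj e₁)))) z∈)
            , (λ (_ , s∅) → ⊥-elim (∉∅ (subst (app R.graph x ∈_) s∅ x∈s))) ]′
            (λ z∈ → inj₁ (app R.graph x , x∈s , z∈)))

    -- Projections; both are ∅ on sets that are not pairs.

    opaque
      firsts seconds : V → V
      firsts x  = sep (∃ᵈ (con x ≡ᵈ ⟨ var v1 , var v0 ⟩ᵗ)) (⋃ x)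
      seconds x = sep (∃ᵈ (con x ≡ᵈ ⟨ var v0 , var v1 ⟩ᵗ)) (⋃ x)

      ∈firsts : u ∈ firsts x ⇔ (∃[ b ] x ≡ ⟨ u , b ⟩)
      ∈firsts {u} {x} = ∈sep ⇔∘ mk⇔ proj₂
        (λ h → subst (λ x → u ∈ ⋃ x) (sym (proj₂ h)) (from ∈⋃ (pair u (proj₁ h) , ∈pairʳ , ∈pairˡ)) , h)

      ∈seconds : u ∈ seconds x ⇔ (∃[ a ] x ≡ ⟨ a , u ⟩)
      ∈seconds {u} {x} = ∈sep ⇔∘ mk⇔ proj₂
        (λ h → subst (λ x → u ∈ ⋃ x) (sym (proj₂ h)) (from ∈⋃ (pair (proj₁ h) u , ∈pairʳ , ∈pairʳ)) , h)

    opaque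
      π₁ π₂ : V → V
      π₁ x = ⋃ (firsts x)
      π₂ x = ⋃ (seconds x)

      ∈π₁ : z ∈ π₁ x ⇔ (∃[ a ] ∃[ b ] (x ≡ ⟨ a , b ⟩ × z ∈ a))
      ∈π₁ {z} {x} = ∈⋃ ⇔∘ mk⇔
        (λ (a , h , z∈) → let (b , e) = to ∈firsts h in a , b , e , z∈)
        (λ (a , b , e , z∈) → a , from ∈firsts (b , e) , z∈)

      ∈π₂ : z ∈ π₂ x ⇔ (∃[ b ] ∃[ a ] (x ≡ ⟨ a , b ⟩ × z ∈ b))
      ∈π₂ {z} {x} = ∈⋃ ⇔∘ mk⇔
        (λ (b , h , z∈) → let (a , e) = to ∈seconds h in b , a , e , z∈)
        (λ (b , a , e , z∈) → b , from ∈seconds (a , e) , z∈)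

      π₁-pair : π₁ ⟨ x , y ⟩ ≡ x
      π₁-pair {x} {y} = extensionality λ z → ∈π₁ ⇔∘ mk⇔ (λ (a , b , e , h) → subst (z ∈_) (sym (pair-inj₁ e)) h) (λ h → x , y , refl , h)

      π₂-pair : π₂ ⟨ x , y ⟩ ≡ y
      π₂-pair {x} {y} = extensionality λ z → ∈π₂ ⇔∘ mk⇔ (λ (b , a , e , h) → subst (z ∈_) (sym (pair-inj₂ e)) h) (λ h → y , x , refl , h)

      π₁-junk : ¬ (∃[ a ] ∃[ b ] x ≡ ⟨ a , b ⟩) → π₁ x ≡ ∅
      π₁-junk n = empty λ z h → let (a , b , e , _) = to ∈π₁ h in n (a , b , e)

      π₂-junk : ¬ (∃[ a ] ∃[ b ] x ≡ ⟨ a , b ⟩) → π₂ x ≡ ∅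
      π₂-junk n = empty λ z h → let (b , a , e , _) = to ∈π₂ h in n (a , b , e)

    π₁G : Graph₁ π₁
    π₁G = byElements₁ (λ x z → ∈π₁) (∃ᵈ (∃ᵈ (var v3 ≡ᵈ ⟨ var v1 , var v0 ⟩ᵗ ∧ᵈ var v2 ∈ᵈ var v1)))

    π₂G : Graph₁ π₂
    π₂G = byElements₁ (λ x z → ∈π₂) (∃ᵈ (∃ᵈ (var v3 ≡ᵈ ⟨ var v0 , var v1 ⟩ᵗ ∧ᵈ var v2 ∈ᵈ var v1)))

    π₁ᵗ π₂ᵗ : Tm n → Tm n
    π₁ᵗ = fn₁ π₁G
    π₂ᵗ = fn₁ π₂G

    opaque
      isPair₀ : (i j k : Fin n) → D₀ n (λ ρ → lookup ρ i ≡ pair (lookup ρ j) (lookup ρ k))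
      isPair₀ i j k = cast₀
        (λ ρ → mk⇔
          (λ (a , b , h) → extensionality λ z → mk⇔ (λ z∈ → from ∈pair (h z z∈))
            (λ z∈ → [ (λ e → subst (_∈ lookup ρ i) (sym e) a) , (λ e → subst (_∈ lookup ρ i) (sym e) b) ]′ (to ∈pair z∈)))
          (λ e → subst (_ ∈_) (sym e) ∈pairˡ , subst (_ ∈_) (sym e) ∈pairʳ , λ z z∈ → to ∈pair (subst (z ∈_) e z∈)))
        (j ∈₀ i ∧₀ k ∈₀ i ∧₀ ∀∈₀ i (v0 ≡₀ suc j ∨₀ v0 ≡₀ suc k))

      isOp₀ : (i j k : Fin n) → D₀ n (λ ρ → lookup ρ i ≡ ⟨ lookup ρ j , lookup ρ k ⟩)
      isOp₀ i j k = cast₀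
        (λ ρ → mk⇔
          (λ { (s , _ , refl , p , _ , refl , e) → e })
          (λ e → _ , subst (_ ∈_) (sym e) ∈pairˡ , refl , _ , subst (_ ∈_) (sym e) ∈pairʳ , refl , e))
        (∃∈₀ i (isPair₀ v0 (suc j) (suc j) ∧₀ ∃∈₀ (suc i) (isPair₀ v0 (suc (suc j)) (suc (suc k)) ∧₀ isPair₀ (suc (suc i)) v1 v0)))

      op∈₀ : (j k i : Fin n) → D₀ n (λ ρ → ⟨ lookup ρ j , lookup ρ k ⟩ ∈ lookup ρ i)
      op∈₀ j k i = cast₀ (λ ρ → mk⇔ (λ (z , z∈ , e) → subst (_∈ lookup ρ i) e z∈) (λ h → _ , h , refl))
        (∃∈₀ i (isOp₀ v0 (suc j) (suc k)))

      private
        skip₂ : Fin (suc (suc n)) → Fin (suc (suc (suc n)))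
        skip₂ zero          = zero
        skip₂ (suc zero)    = suc zero
        skip₂ (suc (suc i)) = suc (suc (suc i))

        skipped : D₀ (suc (suc n)) P → D₀ (suc (suc (suc n))) (λ ρ → P (lookup ρ v0 ∷ lookup ρ v1 ∷ tail (tail (tail ρ))))
        skipped {P = P} d = cast₀ (λ { (a ∷ b ∷ c ∷ ρ) → ≡-⇔ (cong (λ σ → P (a ∷ b ∷ σ)) (tabulate∘lookup ρ)) }) (ren₀ skip₂ d)

      -- Both components of a Kuratowski pair belong to its element `pair a b`, which bounds all
      -- quantifiers.
      unpair₀ : (i : Fin n) → D₀ (suc (suc n)) P → D₀ n (λ ρ → ∃[ a ] ∃[ b ] (lookup ρ i ≡ ⟨ a , b ⟩ × P (b ∷ a ∷ ρ)))
      unpair₀ i d = cast₀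
        (λ ρ → mk⇔
          (λ (p , _ , a , _ , b , _ , e , h) → a , b , e , h)
          (λ (a , b , e , h) → pair a b , subst (_ ∈_) (sym e) ∈pairʳ , a , ∈pairˡ , b , ∈pairʳ , e , h))
        (∃∈₀ i (∃∈₀ v0 (∃∈₀ v1 (isOp₀ (suc (suc (suc i))) v1 v0 ∧₀ skipped d))))

      ∃op∈₀ : (i : Fin n) → D₀ (suc (suc n)) P → D₀ n (λ ρ → ∃[ a ] ∃[ b ] (⟨ a , b ⟩ ∈ lookup ρ i × P (b ∷ a ∷ ρ)))
      ∃op∈₀ i d = cast₀
        (λ ρ → mk⇔
          (λ (z , z∈ , a , b , e , h) → a , b , subst (_∈ lookup ρ i) e z∈ , h)
          (λ (a , b , z∈ , h) → _ , z∈ , a , b , refl , h))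
        (∃∈₀ i (unpair₀ v0 (skipped d)))

      ∀op∈₀ : (i : Fin n) → D₀ (suc (suc n)) P → D₀ n (λ ρ → ∀ a b → ⟨ a , b ⟩ ∈ lookup ρ i → P (b ∷ a ∷ ρ))
      ∀op∈₀ i d = cast₀
        (λ ρ → mk⇔
          (λ h a b z∈ → byContra λ np → h (a , b , z∈ , np))
          (λ h (a , b , z∈ , np) → np (h a b z∈)))
        (¬₀ (∃op∈₀ i (¬₀ d)))

    -- Partial rearrangements of pairs; those used to compare finite stacks of elements.

    data Instr : Set where
      idᵢ dupᵢ swapᵢ fstᵢ sndᵢ popᵢ : Instr

    Run : Instr → V → V → Set ℓ
    Run idᵢ   x y = y ≡ x
    Run dupᵢ  x y = y ≡ ⟨ x , x ⟩
    Run swapᵢ x y = ∃[ a ] ∃[ b ] (x ≡ ⟨ a , b ⟩ × y ≡ ⟨ b , a ⟩)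
    Run fstᵢ  x y = ∃[ q ] ∃[ c ] (x ≡ ⟨ q , c ⟩ × ∃[ a ] ∃[ b ] (q ≡ ⟨ a , b ⟩ × y ≡ ⟨ a , c ⟩))
    Run sndᵢ  x y = ∃[ q ] ∃[ c ] (x ≡ ⟨ q , c ⟩ × ∃[ a ] ∃[ b ] (q ≡ ⟨ a , b ⟩ × y ≡ ⟨ b , c ⟩))
    Run popᵢ  x y = ∃[ a ] ∃[ b ] (x ≡ ⟨ a , b ⟩ × y ≡ b)

    run₀ : ∀ r → D₀ 2 (λ ρ → Run r (lookup ρ v0) (lookup ρ v1))
    run₀ idᵢ   = v1 ≡₀ v0
    run₀ dupᵢ  = isOp₀ v1 v0 v0
    run₀ swapᵢ = unpair₀ v0 (isOp₀ v3 v0 v1)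
    run₀ fstᵢ  = unpair₀ v0 (unpair₀ v1 (isOp₀ v5 v1 v2))
    run₀ sndᵢ  = unpair₀ v0 (unpair₀ v1 (isOp₀ v5 v0 v2))
    run₀ popᵢ  = unpair₀ v0 (v3 ≡₀ v0)

    record PairClosed (u : V) : Set ℓ where
      field
        pc-tr   : Tr u
        pc-∅    : ∅ ∈ u
        pc-pair : x ∈ u → y ∈ u → pair x y ∈ u

      op∈ : x ∈ u → y ∈ u → ⟨ x , y ⟩ ∈ u
      op∈ x∈ y∈ = pc-pair (pc-pair x∈ x∈) (pc-pair x∈ y∈)

      opˡ : ⟨ x , y ⟩ ∈ u → x ∈ u
      opˡ h = pc-tr _ (pc-tr _ h _ ∈pairʳ) _ ∈pairˡ

      opʳ : ⟨ x , y ⟩ ∈ u → y ∈ u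
      opʳ h = pc-tr _ (pc-tr _ h _ ∈pairʳ) _ ∈pairʳ

      opaque
        run∈ : ∀ r → Run r x y → x ∈ u → y ∈ u
        run∈ idᵢ e h = subst (_∈ u) (sym e) h
        run∈ dupᵢ e h = subst (_∈ u) (sym e) (op∈ h h)
        run∈ swapᵢ (a , b , e , e′) h = let k = subst (_∈ u) e h in subst (_∈ u) (sym e′) (op∈ (opʳ k) (opˡ k))
        run∈ fstᵢ (a , b , e , c , d , e′ , q) h = let k = subst (_∈ u) e h ; l = subst (_∈ u) e′ (opˡ k) in subst (_∈ u) (sym q) (op∈ (opˡ l) (opʳ k))
        run∈ sndᵢ (a , b , e , c , d , e′ , q) h = let k = subst (_∈ u) e h ; l = subst (_∈ u) e′ (opˡ k) in subst (_∈ u) (sym q) (op∈ (opʳ l) (opʳ k))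
        run∈ popᵢ (a , b , e , q) h = subst (_∈ u) (sym q) (opʳ (subst (_∈ u) e h))

        π₁∈ : x ∈ u → π₁ x ∈ u
        π₁∈ {x} h = [ (λ (a , b , e) → subst (_∈ u) (sym (trans (cong π₁ e) π₁-pair)) (opˡ (subst (_∈ u) e h)))
                    , (λ n → subst (_∈ u) (sym (π₁-junk n)) pc-∅) ]′ (lem (∃[ a ] ∃[ b ] x ≡ ⟨ a , b ⟩))

        π₂∈ : x ∈ u → π₂ x ∈ u
        π₂∈ {x} h = [ (λ (a , b , e) → subst (_∈ u) (sym (trans (cong π₂ e) π₂-pair)) (opʳ (subst (_∈ u) e h)))
                    , (λ n → subst (_∈ u) (sym (π₂-junk n)) pc-∅) ]′ (lem (∃[ a ] ∃[ b ] x ≡ ⟨ a , b ⟩))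

        Z⊆ : Z ⊆ u
        Z⊆ = Z-induction (var v0 ∈ᵈ con u) pc-∅ λ n _ h → pc-pair h h
    open PairClosed public

    -- The relations between subsets of u that the maps e : 𝒫 u → 𝒫 u′ have to preserve.

    data Colour : Set where
      nandᶜ  : Instr → Colour
      existᶜ : Colour
      wfᶜ    : Colour

    Pre : Instr → V → V → Set ℓ
    Pre r x X = ∃[ y ] (y ∈ X × Run r x y)

    WF : V → V → Set ℓ
    WF p X = ∀ s → s ∈ p → (∃[ y ] y ∈ s) → ∃[ m ] (m ∈ s × ∀ y → y ∈ s → ¬ ⟨ y , m ⟩ ∈ X)

    -- `nandᶜ r` yields all Boolean operations and inverse images under `r`; `existᶜ` is the bounded
    -- projection in the last coordinate, through which seeds keep their elements; `wfᶜ` serves the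
    -- collapse. Relations of smaller arity repeat `X`, so that all are ternary.
    Rel : Colour → V → V → V → V → V → Set ℓ
    Rel (nandᶜ r) u p X Y W = W ⊆ u × ∀ x → x ∈ u → x ∈ W ⇔ (¬ (Pre r x X × x ∈ Y))
    Rel existᶜ u p X Y W = W ≡ X × Y ⊆ u × ∀ x → x ∈ u → x ∈ Y ⇔
      (∃[ a ] ∃[ b ] (x ≡ ⟨ a , b ⟩ × ∃[ b′ ] (b′ ∈ b × ⟨ a , b′ ⟩ ∈ X)))
    Rel wfᶜ u p X Y W = W ≡ X × Y ≡ X × WF p X

    rel₀ : ∀ c → D₀ 5 (λ ρ → Rel c (lookup ρ v0) (lookup ρ v1) (lookup ρ v2) (lookup ρ v3) (lookup ρ v4))
    rel₀ (nandᶜ r) = ⊆₀ ₀[ v4 ∷ v0 ∷ [] ] ∧₀ ∀∈₀ v0 (v0 ∈₀ v5 ⇔₀ ¬₀ (∃∈₀ v3 (run₀ r ₀[ v1 ∷ v0 ∷ [] ]) ∧₀ v0 ∈₀ v4))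
    rel₀ existᶜ = v4 ≡₀ v2 ∧₀ ⊆₀ ₀[ v3 ∷ v0 ∷ [] ] ∧₀ ∀∈₀ v0 (v0 ∈₀ v4 ⇔₀ unpair₀ v0 (∃∈₀ v0 (op∈₀ v2 v0 v6)))
    rel₀ wfᶜ = v4 ≡₀ v2 ∧₀ v3 ≡₀ v2 ∧₀ ∀∈₀ v1 (nonempty₀ ⇒₀ ∃∈₀ v0 (∀∈₀ v1 (¬₀ op∈₀ v0 v1 v5)))
      where
        nonempty₀ : D₀ (suc n) (λ ρ → ∃[ y ] y ∈ lookup ρ v0)
        nonempty₀ = cast₀ (λ ρ → ∃-⇔ λ y → mk⇔ proj₁ (λ h → h , refl)) (∃∈₀ v0 (v0 ≡₀ v0))

    record Good (u u′ : V) (e : V → V) : Set ℓ where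
      field
        e-⊆   : ∀ {X} → X ⊆ u → e X ⊆ u′
        e-rel : ∀ c {X Y W} → X ⊆ u → Y ⊆ u → W ⊆ u → Rel c u (𝒫 u) X Y W → Rel c u′ (𝒫 u′) (e X) (e Y) (e W)

  open Colours public

  -- Programs on stacks and the ultrafilters given by a preserving map.

  module Boolean where
    private variable
      n : ℕ
      x y z u w A c d X Y W : V

    opaque
      sepIn : {P : Vec V 1 → Set ℓ} {d : Def 1 P} → z ∈ A → z ∈ sep d A ⇔ P (z ∷ [])
      sepIn z∈ = ∈sep ⇔∘ mk⇔ proj₂ (λ p → z∈ , p)

      sep⊆ : {P : Vec V 1 → Set ℓ} {d : Def 1 P} → sep d A ⊆ A
      sep⊆ z p = proj₁ (to ∈sep p)

    RunP : List Instr → V → V → Set ℓ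
    RunP []       x y = y ≡ x
    RunP (r ∷ rs) x y = ∃[ m ] (Run r x m × RunP rs m y)

    runᵈ : ∀ r → Def 2 (λ ρ → Run r (lookup ρ v0) (lookup ρ v1))
    runᵈ r = D₀⇒D (run₀ r)

    runPᵈ : ∀ rs → Def 2 (λ ρ → RunP rs (lookup ρ v0) (lookup ρ v1))
    runPᵈ []       = var v1 ≡ᵈ var v0
    runPᵈ (r ∷ rs) = ∃ᵈ (runᵈ r ᵈ[ var v1 ∷ var v0 ∷ [] ] ∧ᵈ runPᵈ rs ᵈ[ var v0 ∷ var v2 ∷ [] ])

    runP-++ : ∀ rs {ss} → RunP rs x y → RunP ss y z → RunP (rs ++ˡ ss) x z
    runP-++ []       refl q          = q
    runP-++ (r ∷ rs) (m , p , p′) q = m , p , runP-++ rs p′ q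

    runP-++⁻ : ∀ rs {ss} → RunP (rs ++ˡ ss) x z → ∃[ y ] (RunP rs x y × RunP ss y z)
    runP-++⁻ []       q            = _ , refl , q
    runP-++⁻ (r ∷ rs) (m , p , q) = let (y , p′ , q′) = runP-++⁻ rs q in y , (m , p , p′) , q′

    nth : Fin n → V → V
    nth zero    t = π₁ t
    nth (suc i) t = nth i (π₂ t)

    select : Fin n → List Instr
    select zero    = fstᵢ ∷ []
    select (suc i) = sndᵢ ∷ select i

    -- Duplicates the stack, reduces one copy to its entry `i` and the other to its entry `j`. An
    -- atomic formula about two entries of a stack thereby becomes a binary relation on a pair.
    pick : Fin n → Fin n → List Instr
    pick i j = dupᵢ ∷ (select i ++ˡ (swapᵢ ∷ (select j ++ˡ (swapᵢ ∷ []))))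

    opaque
      select-sem : ∀ (i : Fin n) → RunP (select i) x y → ∃[ t ] ∃[ w ] (x ≡ ⟨ t , w ⟩ × y ≡ ⟨ nth i t , w ⟩)
      select-sem zero (m , (q , c , e , a , b , e′ , p) , p′) =
        q , c , e , trans p′ (trans p (cong ⟨_, c ⟩ (trans (sym π₁-pair) (cong π₁ (sym e′)))))
      select-sem (suc i) (m , (q , c , e , a , b , e′ , p) , p′) =
        let (t , w , k , l) = select-sem i p′ ; h = trans (sym p) k in
        q , c , e , trans l (cong₂ ⟨_,_⟩ (cong (nth i) (trans (sym (pair-inj₁ h)) (trans (sym π₂-pair) (cong π₂ (sym e′))))) (sym (pair-inj₂ h)))

      pick-sem : ∀ (i j : Fin n) → RunP (pick i j) x y → π₁ y ≡ nth i x × π₂ y ≡ nth j x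
      pick-sem {x = x} i j (m , p , q) =
        let (m₂ , q₁ , (m₃ , (a , b , s₁ , s₂) , q₂)) = runP-++⁻ (select i) q
            (m₄ , q₃ , (m₅ , (a′ , b′ , s₃ , s₄) , q₄)) = runP-++⁻ (select j) q₂
            (t , w , k₁ , k₂) = select-sem i q₁
            (t′ , w′ , k₃ , k₄) = select-sem j q₃
            h₁ = pair-inj (trans (sym p) k₁)
            h₂ = pair-inj (trans (sym s₁) k₂)
            h₃ = pair-inj (trans (sym s₂) k₃)
            h₄ = pair-inj (trans (sym s₃) k₄)
            y≡ = trans q₄ s₄
        in trans (cong π₁ y≡) (trans π₁-pair (trans (proj₂ h₄) (trans (sym (proj₂ h₃)) (trans (proj₁ h₂) (cong (nth i) (sym (proj₁ h₁))))))) ,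
           trans (cong π₂ y≡) (trans π₂-pair (trans (proj₁ h₄) (cong (nth j) (trans (sym (proj₁ h₃)) (trans (proj₂ h₂) (sym (proj₂ h₁)))))))

    -- The Boolean calculus of a map preserving the relations Rel: membership c ∈ e X is the
    -- ultrafilter at c.
    module Forcing (u u′ : V) (pc : PairClosed u) (pc′ : PairClosed u′) (e : V → V) (gE : Graph₁ e) (good : Good u u′ e) where
      open Good good public

      opaque
        co : V → V
        co X = sep (¬ᵈ (var v0 ∈ᵈ con X)) u

        ∈co : z ∈ co X ⇔ (z ∈ u × ¬ z ∈ X)
        ∈co = ∈sep

        co⊆ : co X ⊆ u
        co⊆ z h = proj₁ (to ∈co h)

        e-nand : ∀ r → X ⊆ u → Y ⊆ u → W ⊆ u → (∀ x → x ∈ u → x ∈ W ⇔ (¬ (Pre r x X × x ∈ Y))) →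
          c ∈ u′ → c ∈ e W ⇔ (¬ (Pre r c (e X) × c ∈ e Y))
        e-nand r X⊆ Y⊆ W⊆ h c∈ = proj₂ (e-rel (nandᶜ r) X⊆ Y⊆ W⊆ (W⊆ , h)) _ c∈

        e-nand′ : X ⊆ u → Y ⊆ u → W ⊆ u → (∀ x → x ∈ u → x ∈ W ⇔ (¬ (x ∈ X × x ∈ Y))) →
          c ∈ u′ → c ∈ e W ⇔ (¬ (c ∈ e X × c ∈ e Y))
        e-nand′ X⊆ Y⊆ W⊆ h c∈ = e-nand idᵢ X⊆ Y⊆ W⊆ (λ x x∈ → h x x∈ ⇔∘ ¬-⇔ (×-⇔ pre-id ⇔-refl)) c∈
            ⇔∘ ¬-⇔ (×-⇔ (⇔-sym pre-id) ⇔-refl)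
          where
            pre-id : ∀ {x X} → x ∈ X ⇔ Pre idᵢ x X
            pre-id {x} {X} = mk⇔ (λ h → x , h , refl) (λ (y , h , e) → subst (_∈ X) e h)

        e-co : X ⊆ u → c ∈ u′ → c ∈ e (co X) ⇔ (¬ c ∈ e X)
        e-co X⊆ c∈ = e-nand′ X⊆ X⊆ co⊆ (λ x x∈ → ∈co ⇔∘ mk⇔ (λ (_ , n) (h , _) → n h) (λ n → x∈ , λ h → n (h , h))) c∈
          ⇔∘ mk⇔ (λ n h → n (h , h)) (λ n (h , _) → n h)

        e-u : c ∈ u′ → c ∈ e u
        e-u {c} c∈ = byContra λ n → n (from (e-nand′ {X = u} {Y = co u} ⊆-refl co⊆ ⊆-refl
            (λ x x∈ → mk⇔ (λ _ (_ , h) → proj₂ (to ∈co h) x∈) (λ _ → x∈)) c∈)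
          (λ (h , _) → n h))

        -- Otherwise `c` lies in the images of X ∩ Y and of the complement of `W`. As X ∩ Y ⊆ W, the
        -- nand of these two sets is all of `u`, whose image contains `c`.
        e-mono₂ : X ⊆ u → Y ⊆ u → W ⊆ u → (∀ z → z ∈ X → z ∈ Y → z ∈ W) → c ∈ u′ → c ∈ e X → c ∈ e Y → c ∈ e W
        e-mono₂ {X} {Y} {W} X⊆ Y⊆ W⊆ h c∈ cX cY = byContra λ n →
          to (e-nand′ {X = co N} {Y = co W} co⊆ co⊆ ⊆-refl
              (λ x x∈ → mk⇔ (λ _ (p , q) → proj₂ (to ∈co q) (byContra λ nw → proj₂ (to ∈co p) (from ∈sep (x∈ , λ (a , b) → nw (h x a b))))) (λ _ → x∈)) c∈)
            (e-u c∈)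
            (from (e-co N⊆ c∈) (λ cN → to (e-nand′ X⊆ Y⊆ N⊆ (λ x x∈ → sepIn x∈) c∈) cN (cX , cY)) ,
             from (e-co W⊆ c∈) n)
          where
            N : V
            N = sep (¬ᵈ (var v0 ∈ᵈ con X ∧ᵈ var v0 ∈ᵈ con Y)) u
            N⊆ : N ⊆ u
            N⊆ z p = proj₁ (to ∈sep p)

        e-mono : X ⊆ u → W ⊆ u → X ⊆ W → c ∈ u′ → c ∈ e X → c ∈ e W
        e-mono X⊆ W⊆ h c∈ p = e-mono₂ X⊆ X⊆ W⊆ (λ z q _ → h z q) c∈ p p

        e-full : W ⊆ u → (∀ z → z ∈ u → z ∈ W) → c ∈ u′ → c ∈ e W
        e-full W⊆ h c∈ = e-mono ⊆-refl W⊆ h c∈ (e-u c∈)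

        e-disjoint : X ⊆ u → Y ⊆ u → (∀ z → z ∈ X → ¬ z ∈ Y) → c ∈ u′ → c ∈ e X → ¬ c ∈ e Y
        e-disjoint X⊆ Y⊆ h c∈ p = to (e-co Y⊆ c∈) (e-mono X⊆ co⊆ (λ z q → from ∈co (X⊆ z q , h z q)) c∈ p)

        -- Relative to `u`, the nand with `r` applied is the complement of an inverse image. The
        -- value `d` of `r` at `c` lies in `e X`, so `c` is outside the image of that complement.
        run-up : ∀ r → Run r c d → c ∈ u′ → X ⊆ u → W ⊆ u → (∀ z y → z ∈ u → y ∈ X → Run r z y → z ∈ W) → d ∈ e X → c ∈ e W
        run-up {c} {d} {X} r run c∈ X⊆ W⊆ h dX =
          e-mono co⊆ W⊆ (λ z p → let (z∈ , n) = to ∈co p in byContra λ nw → n (from ∈sep (z∈ , λ ((y , y∈ , k) , _) → nw (h z y z∈ y∈ k)))) c∈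
            (from (e-co N⊆ c∈) (λ cN → to (e-nand r X⊆ ⊆-refl N⊆ (λ x x∈ → sepIn x∈) c∈) cN ((d , dX , run) , e-u c∈)))
          where
            N : V
            N = sep (¬ᵈ (∃ᵈ (var v0 ∈ᵈ con X ∧ᵈ runᵈ r ᵈ[ var v1 ∷ var v0 ∷ [] ]) ∧ᵈ var v0 ∈ᵈ con u)) u
            N⊆ : N ⊆ u
            N⊆ z p = proj₁ (to ∈sep p)

        runP-up : ∀ rs → RunP rs c d → c ∈ u′ → X ⊆ u → W ⊆ u → (∀ z y → z ∈ u → y ∈ X → RunP rs z y → z ∈ W) → d ∈ e X → c ∈ e W
        runP-up [] refl c∈ X⊆ W⊆ h p = e-mono X⊆ W⊆ (λ z q → h z z (X⊆ z q) q refl) c∈ p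
        runP-up {c} {d} {X} {W} (r ∷ rs) (m , p , q) c∈ X⊆ W⊆ h dX =
          run-up r p c∈ N⊆ W⊆ (λ z y z∈ y∈ k → let (_ , y′ , y′∈ , k′) = to ∈sep y∈ in h z y′ z∈ y′∈ (y , k , k′))
            (runP-up rs q (run∈ pc′ r p c∈) X⊆ N⊆ (λ z y z∈ y∈ k → from ∈sep (z∈ , y , y∈ , k)) dX)
          where
            N : V
            N = sep (∃ᵈ (var v0 ∈ᵈ con X ∧ᵈ runPᵈ rs ᵈ[ var v1 ∷ var v0 ∷ [] ])) u
            N⊆ : N ⊆ u
            N⊆ z p = proj₁ (to ∈sep p)

        runP∈ : ∀ rs → RunP rs c d → c ∈ u′ → d ∈ u′
        runP∈ [] refl h = h
        runP∈ (r ∷ rs) (m , p , q) h = runP∈ rs q (run∈ pc′ r p h)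

        -- Ultrafilter duality: `runP-up` for the complements of `X` and `W`.
        runP-down : ∀ rs → RunP rs c d → c ∈ u′ → X ⊆ u → W ⊆ u → (∀ z y → z ∈ W → y ∈ u → RunP rs z y → y ∈ X) → c ∈ e W → d ∈ e X
        runP-down {c} {d} {X} {W} rs run c∈ X⊆ W⊆ h cW = byContra λ n →
          to (e-co W⊆ c∈) (runP-up rs run c∈ co⊆ co⊆ (λ z y z∈ y∈ k → from ∈co (z∈ , λ z∈W → let (y∈u , ny) = to ∈co y∈ in ny (h z y z∈W y∈u k)))
            (from (e-co X⊆ (runP∈ rs run c∈)) n)) cW

        e-exist : ∀ {a b} → X ⊆ u → Y ⊆ u → (∀ x → x ∈ u → x ∈ Y ⇔ (∃[ a ] ∃[ b ] (x ≡ ⟨ a , b ⟩ × ∃[ b′ ] (b′ ∈ b × ⟨ a , b′ ⟩ ∈ X)))) →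
          ⟨ a , b ⟩ ∈ u′ → ⟨ a , b ⟩ ∈ e Y ⇔ (∃[ b′ ] (b′ ∈ b × ⟨ a , b′ ⟩ ∈ e X))
        e-exist {X} {Y} {a} {b} X⊆ Y⊆ h ab∈ = proj₂ (proj₂ (e-rel existᶜ X⊆ Y⊆ X⊆ (refl , Y⊆ , h))) _ ab∈ ⇔∘ mk⇔
          (λ (a′ , b′ , eq₁ , b″ , b∈ , k) → b″ , subst (b″ ∈_) (sym (pair-inj₂ eq₁)) b∈ , subst (λ a → ⟨ a , b″ ⟩ ∈ e X) (sym (pair-inj₁ eq₁)) k)
          (λ (b′ , b∈ , k) → a , b , refl , b′ , b∈ , k)

        private
          diag tail₂ : V → V
          tail₂ X = sep (∃ᵈ (∃ᵈ (var v2 ≡ᵈ ⟨ var v1 , var v0 ⟩ᵗ ∧ᵈ var v0 ∈ᵈ con X))) u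
          diag X = sep (∃ᵈ (∃ᵈ (var v2 ≡ᵈ ⟨ var v1 , var v0 ⟩ᵗ ∧ᵈ ∃ᵈ (var v0 ∈ᵈ var v1 ∧ᵈ ⟨ var v2 , var v0 ⟩ᵗ ∈ᵈ con (tail₂ X))))) u

          ∈tail₂ : ∀ {a b} → ⟨ a , b ⟩ ∈ u → ⟨ a , b ⟩ ∈ tail₂ X ⇔ b ∈ X
          ∈tail₂ {X} {a} {b} h = sepIn h ⇔∘ mk⇔
            (λ (a′ , b′ , p , q) → subst (_∈ X) (sym (pair-inj₂ p)) q) (λ q → a , b , refl , q)

          diag-spec : ∀ x → x ∈ u → x ∈ diag X ⇔ (∃[ a ] ∃[ b ] (x ≡ ⟨ a , b ⟩ × ∃[ b′ ] (b′ ∈ b × ⟨ a , b′ ⟩ ∈ tail₂ X)))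
          diag-spec x x∈ = sepIn x∈

          ∈diag : y ∈ u → X ⊆ u → ⟨ y , y ⟩ ∈ diag X ⇔ (∃[ b ] (b ∈ y × b ∈ X))
          ∈diag {y} {X} y∈ X⊆ = diag-spec ⟨ y , y ⟩ (op∈ pc y∈ y∈) ⇔∘ mk⇔
            (λ (a , b , p , b′ , q , k) → b′ , subst (b′ ∈_) (sym (pair-inj₂ p)) q , to (∈tail₂ (sep⊆ ⟨ a , b′ ⟩ k)) k)
            (λ (b , q , k) → y , y , refl , b , q , from (∈tail₂ (op∈ pc y∈ (X⊆ b k))) k)

          run-dup : RunP (dupᵢ ∷ []) c ⟨ c , c ⟩
          run-dup = _ , refl , refl

          run-pop : ∀ {a b} → RunP (popᵢ ∷ []) ⟨ a , b ⟩ b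
          run-pop {a} {b} = b , (a , b , refl , refl) , refl

          dup-inv : RunP (dupᵢ ∷ []) x y → y ≡ ⟨ x , x ⟩
          dup-inv (m , p , q) = trans q p

          pop-inv : RunP (popᵢ ∷ []) x y → ∃[ a ] x ≡ ⟨ a , y ⟩
          pop-inv (m , (a , b , p , q) , r) = a , trans p (cong ⟨ a ,_⟩ (sym (trans r q)))

          e-tail₂ : ∀ {a b} → X ⊆ u → ⟨ a , b ⟩ ∈ u′ → ⟨ a , b ⟩ ∈ e (tail₂ X) ⇔ b ∈ e X
          e-tail₂ {X} X⊆ h = mk⇔
            (runP-down (popᵢ ∷ []) run-pop h X⊆ sep⊆ λ z y z∈ y∈ k → let (a , p) = pop-inv k in
              to (∈tail₂ (subst (_∈ u) p (sep⊆ z z∈))) (subst (_∈ tail₂ X) p z∈))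
            (runP-up (popᵢ ∷ []) run-pop h X⊆ sep⊆ λ z y z∈ y∈ k → let (a , p) = pop-inv k in
              subst (_∈ tail₂ X) (sym p) (from (∈tail₂ (subst (_∈ u) p z∈)) y∈))

        -- The colour `existᶜ` concerns pairs. A set is pulled back along the second projection
        -- (`tail₂`), projected, and pulled back along the diagonal, and each of these steps is
        -- respected by `e`.
        e-∃∈ : X ⊆ u → Y ⊆ u → (∀ y → y ∈ u → y ∈ Y ⇔ (∃[ b ] (b ∈ y × b ∈ X))) → c ∈ u′ → c ∈ e Y ⇔ (∃[ b ] (b ∈ c × b ∈ e X))
        e-∃∈ {X} {Y} {c} X⊆ Y⊆ h c∈ = mk⇔
            (runP-down (dupᵢ ∷ []) run-dup c∈ sep⊆ Y⊆ λ z y z∈ y∈ k →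
              subst (_∈ diag X) (sym (dup-inv k)) (from (∈diag (Y⊆ z z∈) X⊆) (to (h z (Y⊆ z z∈)) z∈)))
            (runP-up (dupᵢ ∷ []) run-dup c∈ sep⊆ Y⊆ λ z y z∈ y∈ k →
              from (h z z∈) (to (∈diag z∈ X⊆) (subst (_∈ diag X) (dup-inv k) y∈)))
          ⇔∘ e-exist sep⊆ sep⊆ diag-spec (op∈ pc′ c∈ c∈)
          ⇔∘ ∃-⇔ λ b → mk⇔
            (λ (b∈ , k) → b∈ , to (e-tail₂ X⊆ (op∈ pc′ c∈ (pc-tr pc′ c c∈ b b∈))) k)
            (λ (b∈ , k) → b∈ , from (e-tail₂ X⊆ (op∈ pc′ c∈ (pc-tr pc′ c c∈ b b∈))) k)

        point : V → V
        point a = sep (var v0 ≡ᵈ con a) u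

        point⊆ : ∀ {a} → point a ⊆ u
        point⊆ z p = proj₁ (to ∈sep p)

        ∈point : ∀ {a} → z ∈ point a ⇔ (z ∈ u × z ≡ a)
        ∈point = ∈sep

        pointG : Graph₁ point
        pointG = byElements₁ (λ a z → ∈point) (var v0 ∈ᵈ con u ∧ᵈ var v0 ≡ᵈ var v1)

        -- ∅ is the element of `u` without elements in `u`, and `sing n` is the one that meets the
        -- point `n` and does not meet its complement. So every point set of a numeral is built by
        -- operations that `e` respects.
        e-point : ∀ n → n ∈ Z → n ∈ e (point n)
        e-point = Z-induction (var v0 ∈ᵈ fn₁ gE (fn₁ pointG (var v0))) zero-case suc-case
          where
            meets : V → V
            meets X = sep (∃ᵈ (var v0 ∈ᵈ var v1 ∧ᵈ var v0 ∈ᵈ con X)) u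
            e-meets : X ⊆ u → c ∈ u′ → c ∈ e (meets X) ⇔ (∃[ b ] (b ∈ c × b ∈ e X))
            e-meets X⊆ = e-∃∈ X⊆ sep⊆ (λ y y∈ → sepIn y∈)
            zero-case : ∅ ∈ e (point ∅)
            zero-case = e-mono co⊆ point⊆
              (λ z p → let (z∈ , n) = to ∈co p in from ∈point (z∈ , empty λ t t∈ → n (from (sepIn z∈) (t , t∈ , pc-tr pc z z∈ t t∈))))
              (pc-∅ pc′) (from (e-co sep⊆ (pc-∅ pc′)) λ h → let (b , b∈ , _) = to (e-meets ⊆-refl (pc-∅ pc′)) h in ∉∅ b∈)
            suc-case : ∀ n → n ∈ Z → n ∈ e (point n) → sing n ∈ e (point (sing n))
            suc-case n n∈ ih = e-mono₂ sep⊆ co⊆ point⊆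
              (λ z p q → let (z∈ , ne) = to ∈co q ; (b , b∈ , bp) = to (sepIn z∈) p ; (_ , b≡) = to ∈point bp in
                from ∈point (z∈ , ⊆-antisym
                  (λ t t∈ → byContra λ nt → ne (from (sepIn z∈) (t , t∈ , from ∈co (pc-tr pc z z∈ t t∈ , λ tp → nt (from ∈sing (proj₂ (to ∈point tp)))))))
                  (λ t t∈ → subst (_∈ z) (trans b≡ (sym (to ∈sing t∈))) b∈)))
              sn∈ (from (e-meets point⊆ sn∈) (n , self∈sing , ih))
              (from (e-co sep⊆ sn∈) λ h → let (b , b∈ , k) = to (e-meets co⊆ sn∈) h in
                to (e-co point⊆ n∈′) (subst (_∈ e (co (point n))) (to ∈sing b∈) k) ih)
              where
                n∈′ : n ∈ u′
                n∈′ = Z⊆ pc′ n n∈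
                sn∈ : sing n ∈ u′
                sn∈ = pc-pair pc′ n∈′ n∈′

  open Boolean public

  -- The ultrapower and Łoś's theorem.

  module Łoś where
    private variable
      n : ℕ
      a b x y z u w f g : V

    -- The ultrapower: its elements are pairs of a seed in u′ and a function on u.
    module Ultrapower (u u′ : V) (pc : PairClosed u) (pc′ : PairClosed u′) (e : V → V) (gE : Graph₁ e) (good : Good u u′ e) where
      open Forcing u u′ pc pc′ e gE good public

      record El : Set ℓ where
        constructor el
        field
          seed  : V
          seed∈ : seed ∈ u′
          fn    : V
          fnFun : Fun fn u
      open El public

      stack : Vec El n → V
      stack []       = ∅
      stack (x ∷ xs) = ⟨ seed x , stack xs ⟩

      opaque
        stack∈ : ∀ (xs : Vec El n) → stack xs ∈ u′
        stack∈ []       = pc-∅ pc′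
        stack∈ (x ∷ xs) = op∈ pc′ (seed∈ x) (stack∈ xs)

      ev : Vec El n → V → Vec V n
      ev []       t = []
      ev (x ∷ xs) t = app (fn x) (π₁ t) ∷ ev xs (π₂ t)

      evᵗ : ∀ {k} → Vec El n → Tm k → Vec (Tm k) n
      evᵗ []       t = []
      evᵗ (x ∷ xs) t = appᵗ (con (fn x)) (π₁ᵗ t) ∷ evᵗ xs (π₂ᵗ t)

      opaque
        evᵗ-≡ : ∀ {k} (xs : Vec El n) (t : Tm k) ρ → map (λ s → ⟦ s ⟧ ρ) (evᵗ xs t) ≡ ev xs (⟦ t ⟧ ρ)
        evᵗ-≡ []       t ρ = refl
        evᵗ-≡ (x ∷ xs) t ρ = cong (app (fn x) (π₁ (⟦ t ⟧ ρ)) ∷_) (evᵗ-≡ xs (π₂ᵗ t) ρ)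

        ev-lookup : ∀ (xs : Vec El n) i t → lookup (ev xs t) i ≡ app (fn (lookup xs i)) (nth i t)
        ev-lookup (x ∷ xs) zero    t = refl
        ev-lookup (x ∷ xs) (suc i) t = ev-lookup xs i (π₂ t)

        evᵈ : (φ : Formula n) (xs : Vec El n) → Def 1 (λ ρ → Sat All φ (ev xs (lookup ρ v0)))
        evᵈ φ xs = castᵈ (λ ρ → ≡-⇔ (cong (Sat All φ) (evᵗ-≡ xs (var v0) ρ))) (satT φ (evᵗ xs (var v0)))

        truth : (φ : Formula n) (xs : Vec El n) → V
        truth φ xs = sep (evᵈ φ xs) u

        truth⊆ : {φ : Formula n} {xs : Vec El n} → truth φ xs ⊆ u
        truth⊆ = sep⊆

        ∈truth : {φ : Formula n} {xs : Vec El n} → x ∈ u → x ∈ truth φ xs ⇔ Sat All φ (ev xs x)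
        ∈truth = sepIn

        select-run : ∀ (xs : Vec El n) i w → RunP (select i) ⟨ stack xs , w ⟩ ⟨ seed (lookup xs i) , w ⟩
        select-run (x ∷ xs) zero    w = _ , (_ , w , refl , seed x , stack xs , refl , refl) , refl
        select-run (x ∷ xs) (suc i) w = _ , (_ , w , refl , seed x , stack xs , refl , refl) , select-run xs i w

        pick-run : ∀ (xs : Vec El n) i j → RunP (pick i j) (stack xs) ⟨ seed (lookup xs i) , seed (lookup xs j) ⟩
        pick-run xs i j = ⟨ stack xs , stack xs ⟩ , refl ,
          runP-++ (select i) (select-run xs i (stack xs)) (⟨ stack xs , si ⟩ , (si , stack xs , refl , refl) ,
          runP-++ (select j) (select-run xs j si) (⟨ si , sj ⟩ , (sj , si , refl , refl) , refl))
          where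
            si sj : V
            si = seed (lookup xs i)
            sj = seed (lookup xs j)

      opaque
        T∈ T≡ : V → V → V
        T∈ f g = sep (appᵗ (con f) (π₁ᵗ (var v0)) ∈ᵈ appᵗ (con g) (π₂ᵗ (var v0))) u
        T≡ f g = sep (appᵗ (con f) (π₁ᵗ (var v0)) ≡ᵈ appᵗ (con g) (π₂ᵗ (var v0))) u

        ∈T∈ : x ∈ T∈ f g ⇔ (x ∈ u × app f (π₁ x) ∈ app g (π₂ x))
        ∈T∈ = ∈sep

        ∈T≡ : x ∈ T≡ f g ⇔ (x ∈ u × app f (π₁ x) ≡ app g (π₂ x))
        ∈T≡ = ∈sep

        T∈⊆ : T∈ f g ⊆ u
        T∈⊆ = sep⊆

        T≡⊆ : T≡ f g ⊆ u
        T≡⊆ = sep⊆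

      T∈G : Graph₂ T∈
      T∈G = byElements₂ (λ f g x → ∈T∈) (var v0 ∈ᵈ con u ∧ᵈ appᵗ (var v1) (π₁ᵗ (var v0)) ∈ᵈ appᵗ (var v2) (π₂ᵗ (var v0)))

      infix 8 _∈̂_ _≈̂_
      record _∈̂_ (x y : El) : Set ℓ where
        constructor mk∈̂
        field un∈̂ : ⟨ seed x , seed y ⟩ ∈ e (T∈ (fn x) (fn y))
      record _≈̂_ (x y : El) : Set ℓ where
        constructor mk≈̂
        field un≈̂ : ⟨ seed x , seed y ⟩ ∈ e (T≡ (fn x) (fn y))
      open _∈̂_ public
      open _≈̂_ public

      SatU : Formula n → Vec El n → Set ℓ
      SatU (i ∈̇ j) xs = lookup xs i ∈̂ lookup xs j
      SatU (i ≐ j) xs = lookup xs i ≈̂ lookup xs j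
      SatU (¬̇ φ)   xs = ¬ SatU φ xs
      SatU (φ ∧̇ ψ) xs = SatU φ xs × SatU ψ xs
      SatU (φ ∨̇ ψ) xs = SatU φ xs ⊎ SatU ψ xs
      SatU (φ ⇒̇ ψ) xs = SatU φ xs → SatU ψ xs
      SatU (∀̇ φ)   xs = ∀ x → SatU φ (x ∷ xs)
      SatU (∃̇ φ)   xs = ∃[ x ] SatU φ (x ∷ xs)

      record Forces {n} (φ : Formula n) (xs : Vec El n) : Set ℓ where
        constructor forces
        field forced : stack xs ∈ e (truth φ xs)
      open Forces

      private variable
        φ ψ χ : Formula n
        xs : Vec El n

      opaque
        forces-mono₂ : (∀ ρ → Sat All φ ρ → Sat All ψ ρ → Sat All χ ρ) → Forces φ xs → Forces ψ xs → Forces χ xs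
        forces-mono₂ {φ = φ} {xs = xs} h (forces p) (forces q) = forces (e-mono₂ truth⊆ truth⊆ truth⊆
          (λ z a b → from (∈truth (truth⊆ z a)) (h (ev xs z) (to (∈truth (truth⊆ z a)) a) (to (∈truth (truth⊆ z b)) b))) (stack∈ xs) p q)

        forces-mono : (∀ ρ → Sat All φ ρ → Sat All ψ ρ) → Forces φ xs → Forces ψ xs
        forces-mono {φ = φ} h p = forces-mono₂ {φ = φ} {ψ = φ} (λ ρ a _ → h ρ a) p p

        forces-valid : (∀ ρ → Sat All φ ρ) → Forces φ xs
        forces-valid {xs = xs} h = forces (e-full truth⊆ (λ z z∈ → from (∈truth z∈) (h (ev xs z))) (stack∈ xs))

        forces-¬ : Forces (¬̇ φ) xs ⇔ (¬ Forces φ xs)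
        forces-¬ {φ = φ} {xs = xs} = mk⇔
          (λ (forces p) (forces q) → e-disjoint truth⊆ truth⊆ (λ z a b → to (∈truth (truth⊆ z a)) a (to (∈truth (truth⊆ z b)) b)) (stack∈ xs) p q)
          (λ n → forces (e-mono co⊆ truth⊆ (λ z p → let (z∈ , np) = to ∈co p in from (∈truth z∈) (λ s → np (from (∈truth z∈) s)))
            (stack∈ xs) (from (e-co truth⊆ (stack∈ xs)) (λ p → n (forces p)))))

        forces-∈ : ∀ {i j : Fin n} → Forces (i ∈̇ j) xs ⇔ lookup xs i ∈̂ lookup xs j
        forces-∈ {xs = xs} {i} {j} = mk⇔
          (λ (forces p) → mk∈̂ (runP-down (pick i j) (pick-run xs i j) (stack∈ xs) T∈⊆ truth⊆
            (λ z y z∈ y∈ r → let (h , k) = pick-sem i j r in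
              from ∈T∈ (y∈ , subst₂ _∈_ (at i z h) (at j z k) (to (∈truth (truth⊆ z z∈)) z∈))) p))
          (λ (mk∈̂ p) → forces (runP-up (pick i j) (pick-run xs i j) (stack∈ xs) T∈⊆ truth⊆
            (λ z y z∈ y∈ r → let (h , k) = pick-sem i j r in
              from (∈truth z∈) (subst₂ _∈_ (sym (at i z h)) (sym (at j z k)) (proj₂ (to ∈T∈ y∈)))) p))
          where
            at : ∀ i z {t} → t ≡ nth i z → lookup (ev xs z) i ≡ app (fn (lookup xs i)) t
            at i z h = trans (ev-lookup xs i z) (cong (app (fn (lookup xs i))) (sym h))

        forces-≡ : ∀ {i j : Fin n} → Forces (i ≐ j) xs ⇔ lookup xs i ≈̂ lookup xs j
        forces-≡ {xs = xs} {i} {j} = mk⇔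
          (λ (forces p) → mk≈̂ (runP-down (pick i j) (pick-run xs i j) (stack∈ xs) T≡⊆ truth⊆
            (λ z y z∈ y∈ r → let (h , k) = pick-sem i j r in
              from ∈T≡ (y∈ , subst₂ _≡_ (at i z h) (at j z k) (to (∈truth (truth⊆ z z∈)) z∈))) p))
          (λ (mk≈̂ p) → forces (runP-up (pick i j) (pick-run xs i j) (stack∈ xs) T≡⊆ truth⊆
            (λ z y z∈ y∈ r → let (h , k) = pick-sem i j r in
              from (∈truth z∈) (subst₂ _≡_ (sym (at i z h)) (sym (at j z k)) (proj₂ (to ∈T≡ y∈)))) p))
          where
            at : ∀ i z {t} → t ≡ nth i z → lookup (ev xs z) i ≡ app (fn (lookup xs i)) t
            at i z h = trans (ev-lookup xs i z) (cong (app (fn (lookup xs i))) (sym h))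

        private
          run-pop′ : RunP (popᵢ ∷ []) ⟨ a , b ⟩ b
          run-pop′ {a} {b} = b , (a , b , refl , refl) , refl

          ev-pop : ∀ (y : El) → RunP (popᵢ ∷ []) x z → ev (y ∷ xs) x ≡ app (fn y) (π₁ x) ∷ ev xs z
          ev-pop {xs = xs} y (m , (p , q , h , k) , l) =
            cong (λ t → app (fn y) _ ∷ ev xs t) (trans (cong π₂ h) (trans π₂-pair (sym (trans l k))))

        forces-drop : ∀ y → Forces (∀̇ φ) xs → Forces φ (y ∷ xs)
        forces-drop {φ = φ} {xs = xs} y (forces p) = forces (runP-up (popᵢ ∷ []) run-pop′ (stack∈ (y ∷ xs)) truth⊆ truth⊆
          (λ z t z∈ t∈ r → from (∈truth z∈) (subst (Sat All φ) (sym (ev-pop y r)) (to (∈truth (truth⊆ t t∈)) t∈ _ tt))) p)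

        forces-∃⁺ : ∀ y → Forces φ (y ∷ xs) → Forces (∃̇ φ) xs
        forces-∃⁺ {φ = φ} {xs = xs} y (forces p) = forces (runP-down (popᵢ ∷ []) run-pop′ (stack∈ (y ∷ xs)) truth⊆ truth⊆
          (λ z t z∈ t∈ r → from (∈truth t∈) (_ , tt , subst (Sat All φ) (ev-pop y r) (to (∈truth (truth⊆ z z∈)) z∈))) p)

        -- A Skolem function on stacks is itself an element of the ultrapower, with the whole stack
        -- as its seed; duplicating the stack puts this witness on top.
        forces-∃⁻ : Forces (∃̇ φ) xs → ∃[ y ] Forces φ (y ∷ xs)
        forces-∃⁻ {φ = φ} {xs = xs} (forces p) = y₀ , forces (runP-down (dupᵢ ∷ []) (_ , refl , refl) (stack∈ xs) truth⊆ truth⊆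
            (λ z t z∈ t∈ (m , r , l) → from (∈truth t∈) (subst (λ t → Sat All φ (ev (y₀ ∷ xs) t)) (sym (trans l r))
              (subst₂ (λ p q → Sat All φ (app (proj₁ choose) p ∷ ev xs q)) (sym π₁-pair) (sym π₂-pair)
                (let (w , _ , s) = to (∈truth (truth⊆ z z∈)) z∈ in proj₂ (proj₂ choose) z (truth⊆ z z∈) (w , s))))) p)
          where
            R : V → V → Set ℓ
            R z w = (∃[ w ] Sat All φ (w ∷ ev xs z)) → Sat All φ (w ∷ ev xs z)
            bodyᵈ : ∀ {k} (i j : Fin k) → Def k (λ ρ → Sat All φ (lookup ρ i ∷ ev xs (lookup ρ j)))
            bodyᵈ i j = castᵈ (λ ρ → ≡-⇔ (cong (λ σ → Sat All φ (lookup ρ i ∷ σ)) (evᵗ-≡ xs (var j) ρ))) (satT φ (var i ∷ evᵗ xs (var j)))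
            choose : ∃[ g ] (Fun g u × ∀ z → z ∈ u → R z (app g z))
            choose = choiceFunction {R = R} (∃ᵈ (bodyᵈ v0 v1) ⇒ᵈ bodyᵈ v1 v0) u
              λ z z∈ → [ (λ (w , s) → w , λ _ → s) , (λ n → ∅ , λ h → ⊥-elim (n h)) ]′ (lem (∃[ w ] Sat All φ (w ∷ ev xs z)))
            y₀ : El
            y₀ = el (stack xs) (stack∈ xs) (proj₁ choose) (proj₁ (proj₂ choose))

      opaque
        łoś : (φ : Formula n) (xs : Vec El n) → Forces φ xs ⇔ SatU φ xs
        łoś (i ∈̇ j) xs = forces-∈
        łoś (i ≐ j) xs = forces-≡
        łoś (¬̇ φ) xs = forces-¬ ⇔∘ ¬-⇔ (łoś φ xs)
        łoś (φ ∧̇ ψ) xs = mk⇔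
          (λ p → to (łoś φ xs) (forces-mono {φ = φ ∧̇ ψ} (λ _ → proj₁) p) , to (łoś ψ xs) (forces-mono {φ = φ ∧̇ ψ} (λ _ → proj₂) p))
          (λ (p , q) → forces-mono₂ {φ = φ} {ψ = ψ} (λ _ → _,_) (from (łoś φ xs) p) (from (łoś ψ xs) q))
        łoś (φ ∨̇ ψ) xs = mk⇔
          (λ p → byContra λ n → to (forces-¬ {φ = φ ∨̇ ψ})
            (forces-mono₂ {φ = ¬̇ φ} {ψ = ¬̇ ψ} (λ _ a b → [ a , b ]′) (from forces-¬ (λ q → n (inj₁ (to (łoś φ xs) q)))) (from forces-¬ (λ q → n (inj₂ (to (łoś ψ xs) q))))) p)
          [ (λ p → forces-mono {φ = φ} (λ _ → inj₁) (from (łoś φ xs) p)) , (λ p → forces-mono {φ = ψ} (λ _ → inj₂) (from (łoś ψ xs) p)) ]′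
        łoś (φ ⇒̇ ψ) xs = mk⇔
          (λ p q → to (łoś ψ xs) (forces-mono₂ {φ = φ ⇒̇ ψ} {ψ = φ} (λ _ a b → a b) p (from (łoś φ xs) q)))
          (λ h → [ (λ q → forces-mono {φ = ψ} (λ _ a _ → a) (from (łoś ψ xs) (h (to (łoś φ xs) q))))
                 , (λ n → forces-mono {φ = ¬̇ φ} (λ _ a b → ⊥-elim (a b)) (from forces-¬ n)) ]′ (lem (Forces φ xs)))
        łoś (∀̇ φ) xs = mk⇔
          (λ p y → to (łoś φ (y ∷ xs)) (forces-drop y p))
          (λ h → byContra λ n → refute h (forces-∃⁻ {φ = ¬̇ φ}
            (forces-mono {φ = ¬̇ (∀̇ φ)} (λ ρ s → byContra λ n → s λ x _ → byContra λ nx → n (x , tt , nx)) (from forces-¬ n))))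
          where
            refute : (∀ y → SatU φ (y ∷ xs)) → ¬ (∃[ y ] Forces (¬̇ φ) (y ∷ xs))
            refute h (y , q) = to (forces-¬ {φ = φ}) q (from (łoś φ (y ∷ xs)) (h y))
        łoś (∃̇ φ) xs = mk⇔
          (λ p → let (y , q) = forces-∃⁻ p in y , to (łoś φ (y ∷ xs)) q)
          (λ (y , q) → forces-∃⁺ y (from (łoś φ (y ∷ xs)) q))

      opaque
        -- What is true in V of all assignments holds in the ultrapower. The laws of equality and
        -- extensionality of the ultrapower are obtained in this way.
        valid : (φ : Formula n) → (∀ ρ → Sat All φ ρ) → ∀ xs → SatU φ xs
        valid φ h xs = to (łoś φ xs) (forces-valid h)

      opaque
        ≈-refl : ∀ {x} → x ≈̂ x
        ≈-refl {x} = valid (v0 ≐ v0) (λ ρ → refl) (x ∷ [])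

        ≈-sym : ∀ {x y} → x ≈̂ y → y ≈̂ x
        ≈-sym {x} {y} = valid (v0 ≐ v1 ⇒̇ v1 ≐ v0) (λ ρ → sym) (x ∷ y ∷ [])

        ∈-congˡ : ∀ {x y z} → x ≈̂ y → y ∈̂ z → x ∈̂ z
        ∈-congˡ {x} {y} {z} p q = valid (v0 ≐ v1 ∧̇ v1 ∈̇ v2 ⇒̇ v0 ∈̇ v2) (λ ρ (p , q) → subst (_∈ lookup ρ v2) (sym p) q) (x ∷ y ∷ z ∷ []) (p , q)

        ∈-congʳ : ∀ {x y z} → x ∈̂ y → y ≈̂ z → x ∈̂ z
        ∈-congʳ {x} {y} {z} p q = valid (v0 ∈̇ v1 ∧̇ v1 ≐ v2 ⇒̇ v0 ∈̇ v2) (λ ρ (p , q) → subst (lookup ρ v0 ∈_) q p) (x ∷ y ∷ z ∷ []) (p , q)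

      extFormula : Formula 2
      extFormula = (∀̇ ((v0 ∈̇ v1 ⇒̇ v0 ∈̇ v2) ∧̇ (v0 ∈̇ v2 ⇒̇ v0 ∈̇ v1))) ⇒̇ v0 ≐ v1

      opaque
        extFormula-valid : ∀ ρ → Sat All extFormula ρ
        extFormula-valid (x ∷ y ∷ []) k = extensionality λ z → mk⇔ (proj₁ (k z tt)) (proj₂ (k z tt))

        ≈-ext : ∀ {x y} → (∀ z → z ∈̂ x ⇔ z ∈̂ y) → x ≈̂ y
        ≈-ext {x} {y} h = valid extFormula extFormula-valid (x ∷ y ∷ []) λ z → to (h z) , from (h z)

  open Łoś public

  -- Well-foundedness of the ultrapower.

  module Collapsing where
    private variable
      n : ℕ
      a b c d x y z u f g A B : V

    funsetG : Graph₂ funset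
    funsetG = byElements₂ (λ A B f → ∈funset) (funᵈ ᵈ[ var v0 ∷ var v1 ∷ [] ] ∧ᵈ ∀ᵈ (var v0 ∈ᵈ var v2 ⇒ᵈ appᵗ (var v1) (var v0) ∈ᵈ var v3))

    opaque
      fst-inv : Run fstᵢ x y → π₁ y ≡ π₁ (π₁ x) × π₂ y ≡ π₂ x × ∃[ q ] ∃[ c ] x ≡ ⟨ q , c ⟩
      fst-inv (q , c , h , a , b , k , l) =
        trans (cong π₁ l) (trans π₁-pair (sym (trans (cong (π₁ ∘ π₁) h) (trans (cong π₁ π₁-pair) (trans (cong π₁ k) π₁-pair))))) ,
        trans (cong π₂ l) (trans π₂-pair (sym (trans (cong π₂ h) π₂-pair))) , q , c , h

      snd-inv : Run sndᵢ x y → π₁ y ≡ π₂ (π₁ x) × π₂ y ≡ π₂ x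
      snd-inv (q , c , h , a , b , k , l) =
        trans (cong π₁ l) (trans π₁-pair (sym (trans (cong (π₂ ∘ π₁) h) (trans (cong π₂ π₁-pair) (trans (cong π₂ k) π₂-pair))))) ,
        trans (cong π₂ l) (trans π₂-pair (sym (trans (cong π₂ h) π₂-pair)))

      swap-inv : Run swapᵢ x y → π₁ y ≡ π₂ x × π₂ y ≡ π₁ x
      swap-inv (a , b , h , k) = trans (cong π₁ k) (trans π₁-pair (sym (trans (cong π₂ h) π₂-pair))) ,
        trans (cong π₂ k) (trans π₂-pair (sym (trans (cong π₁ h) π₁-pair)))

      pop-inv : Run popᵢ x y → y ≡ π₂ x
      pop-inv (a , b , h , k) = trans k (sym (trans (cong π₂ h) π₂-pair))

      -- The nodes of `Descent` are pairs of a numeral and a seed. From a pair of nodes, the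
      -- programs here extract the two seeds, the first numeral and the second numeral.
      seconds-run : RunP (sndᵢ ∷ swapᵢ ∷ sndᵢ ∷ swapᵢ ∷ []) ⟨ ⟨ a , b ⟩ , ⟨ c , d ⟩ ⟩ ⟨ b , d ⟩
      seconds-run {a} {b} {c} {d} = ⟨ b , ⟨ c , d ⟩ ⟩ , (_ , _ , refl , a , b , refl , refl) , ⟨ ⟨ c , d ⟩ , b ⟩ , (_ , _ , refl , refl) ,
        ⟨ d , b ⟩ , (_ , _ , refl , c , d , refl , refl) , _ , (_ , _ , refl , refl) , refl

      seconds-sem : RunP (sndᵢ ∷ swapᵢ ∷ sndᵢ ∷ swapᵢ ∷ []) x y → π₁ y ≡ π₂ (π₁ x) × π₂ y ≡ π₂ (π₂ x)
      seconds-sem (m₁ , r₁ , m₂ , r₂ , m₃ , r₃ , m₄ , r₄ , h) =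
        let (p₁ , q₁) = snd-inv r₁ ; (p₂ , q₂) = swap-inv r₂ ; (p₃ , q₃) = snd-inv r₃ ; (p₄ , q₄) = swap-inv r₄ in
        trans (cong π₁ h) (trans p₄ (trans q₃ (trans q₂ p₁))) ,
        trans (cong π₂ h) (trans q₄ (trans p₃ (cong π₂ (trans p₂ q₁))))

      first₁-run : RunP (fstᵢ ∷ swapᵢ ∷ popᵢ ∷ []) ⟨ ⟨ a , b ⟩ , c ⟩ a
      first₁-run {a} {b} {c} = ⟨ a , c ⟩ , (_ , _ , refl , a , b , refl , refl) , ⟨ c , a ⟩ , (_ , _ , refl , refl) , a , (_ , _ , refl , refl) , refl

      first₁-sem : RunP (fstᵢ ∷ swapᵢ ∷ popᵢ ∷ []) x y → y ≡ π₁ (π₁ x)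
      first₁-sem (m₁ , r₁ , m₂ , r₂ , m₃ , r₃ , h) = trans h (trans (pop-inv r₃) (trans (proj₂ (swap-inv r₂)) (proj₁ (fst-inv r₁))))

      first₂-run : RunP (swapᵢ ∷ fstᵢ ∷ swapᵢ ∷ popᵢ ∷ []) ⟨ c , ⟨ a , b ⟩ ⟩ a
      first₂-run {c} {a} {b} = ⟨ ⟨ a , b ⟩ , c ⟩ , (_ , _ , refl , refl) , first₁-run

      first₂-sem : RunP (swapᵢ ∷ fstᵢ ∷ swapᵢ ∷ popᵢ ∷ []) x y → y ≡ π₁ (π₂ x)
      first₂-sem (m₁ , r₁ , q) = trans (first₁-sem q) (cong π₁ (proj₁ (swap-inv r₁)))

    module Collapse (u u′ : V) (pc : PairClosed u) (pc′ : PairClosed u′) (e : V → V) (gE : Graph₁ e) (good : Good u u′ e) where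
      open Ultrapower u u′ pc pc′ e gE good public

      code : El → V
      code x = ⟨ seed x , fn x ⟩

      T≡G : Graph₂ T≡
      T≡G = byElements₂ (λ f g x → ∈T≡) (var v0 ∈ᵈ con u ∧ᵈ appᵗ (var v1) (π₁ᵗ (var v0)) ≡ᵈ appᵗ (var v2) (π₂ᵗ (var v0)))

      infix 8 _∈ᶜᵒ_ _≈ᶜᵒ_
      record _∈ᶜᵒ_ (p q : V) : Set ℓ where
        constructor mk
        field un : ⟨ π₁ p , π₁ q ⟩ ∈ e (T∈ (π₂ p) (π₂ q))
      record _≈ᶜᵒ_ (p q : V) : Set ℓ where
        constructor mk
        field un : ⟨ π₁ p , π₁ q ⟩ ∈ e (T≡ (π₂ p) (π₂ q))

      ∈ᶜᵒᵈ : Def 2 (λ ρ → lookup ρ v0 ∈ᶜᵒ lookup ρ v1)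
      ∈ᶜᵒᵈ = castᵈ (λ ρ → mk⇔ mk _∈ᶜᵒ_.un)
        (⟨ π₁ᵗ (var v0) , π₁ᵗ (var v1) ⟩ᵗ ∈ᵈ fn₁ gE (fn₂ T∈G (π₂ᵗ (var v0)) (π₂ᵗ (var v1))))

      ≈ᶜᵒᵈ : Def 2 (λ ρ → lookup ρ v0 ≈ᶜᵒ lookup ρ v1)
      ≈ᶜᵒᵈ = castᵈ (λ ρ → mk⇔ mk _≈ᶜᵒ_.un)
        (⟨ π₁ᵗ (var v0) , π₁ᵗ (var v1) ⟩ᵗ ∈ᵈ fn₁ gE (fn₂ T≡G (π₂ᵗ (var v0)) (π₂ᵗ (var v1))))

      opaque
        code-∈ : ∀ {x y} → code x ∈ᶜᵒ code y ⇔ x ∈̂ y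
        code-∈ {x} {y} = mk⇔ (λ (mk h) → mk∈̂ (subst id eq₁ h)) (λ (mk∈̂ h) → mk (subst id (sym eq₁) h))
          where
            eq₁ : (⟨ π₁ (code x) , π₁ (code y) ⟩ ∈ e (T∈ (π₂ (code x)) (π₂ (code y)))) ≡ (⟨ seed x , seed y ⟩ ∈ e (T∈ (fn x) (fn y)))
            eq₁ = cong₂ (λ p q → p ∈ e q) (cong₂ ⟨_,_⟩ π₁-pair π₁-pair) (cong₂ T∈ π₂-pair π₂-pair)

        code-≈ : ∀ {x y} → code x ≈ᶜᵒ code y ⇔ x ≈̂ y
        code-≈ {x} {y} = mk⇔ (λ (mk h) → mk≈̂ (subst id eq₁ h)) (λ (mk≈̂ h) → mk (subst id (sym eq₁) h))
          where
            eq₁ : (⟨ π₁ (code x) , π₁ (code y) ⟩ ∈ e (T≡ (π₂ (code x)) (π₂ (code y)))) ≡ (⟨ seed x , seed y ⟩ ∈ e (T≡ (fn x) (fn y)))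
            eq₁ = cong₂ (λ p q → p ∈ e q) (cong₂ ⟨_,_⟩ π₁-pair π₁-pair) (cong₂ T≡ π₂-pair π₂-pair)

      opaque
        -- The ultrapower is a proper class, but its elements whose functions have values in a fixed
        -- set `D` form a set, on which recursion is available.
        codes : V → V
        codes D = u′ ⊗ funset u D

        codes-graph : Graph₁ codes
        codes-graph = graph₁ (fn₂ ⊗G (con u′) (fn₂ funsetG (con u) (var v0)))

      Into : V → El → Set ℓ
      Into D x = ∀ z → z ∈ u → app (fn x) z ∈ D

      opaque
        unfolding codes
        encode : ∀ {D} x → Into D x → code x ∈ codes D
        encode x h = from ∈⊗ (seed x , fn x , seed∈ x , from ∈funset (fnFun x , h) , refl)

        decode : ∀ {D p} → p ∈ codes D → ∃[ x ] (Into D x × p ≡ code x)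
        decode p∈ = let (a , f , a∈ , f∈ , h) = to ∈⊗ p∈ ; (F , k) = to ∈funset f∈ in el a a∈ f F , k , h

      record Carrier (D : V) : Set ℓ where
        field
          D-tr : Tr D
          D-∅  : ∅ ∈ D
      open Carrier

      opaque
        -- The value of `h` at `t` if it lies in `D`, and ∅ otherwise: a case distinction expressed
        -- as separation by a condition that ignores the separated element.
        trim : V → V → V → V
        trim D h t = sep (con (app h t) ∈ᵈ con D) (app h t)

        ∈trim : ∀ {D h t} → z ∈ trim D h t ⇔ (z ∈ app h t × app h t ∈ D)
        ∈trim = ∈sep

        trim-in : ∀ {D h t} → app h t ∈ D → trim D h t ≡ app h t
        trim-in p = extensionality λ z → ∈trim ⇔∘ mk⇔ proj₁ (λ q → q , p)

        trim∈ : ∀ {D h t} → Carrier D → trim D h t ∈ D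
        trim∈ {D} {h} {t} C = [ (λ p → subst (_∈ D) (sym (trim-in p)) p)
          , (λ n → subst (_∈ D) (sym (empty λ z k → n (proj₂ (to ∈trim k)))) (D-∅ C)) ]′ (lem (app h t ∈ D))

        trimG : ∀ {D h} → Graph₁ (trim D h)
        trimG {D} {h} = byElements₁ (λ t z → ∈trim) (var v0 ∈ᵈ appᵗ (con h) (var v1) ∧ᵈ appᵗ (con h) (var v1) ∈ᵈ con D)

        -- For almost all arguments the value of `y` belongs to a value of `x`, hence to the
        -- transitive set `D`. Trimming changes `y` only on a null set.
        restrict : ∀ {D x y} → Carrier D → Into D x → y ∈̂ x → ∃[ y′ ] (Into D y′ × y ≈̂ y′)
        restrict {D} {x} {y} C into (mk∈̂ p) = y₀ , into₀ , mk≈̂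
          (runP-down (dupᵢ ∷ []) (_ , refl , refl) (seed∈ y) T≡⊆ (sep⊆ {d = intoD})
            (λ z t z∈ t∈ (m , r , l) → let q = trans l r ; (z∈u , h) = to ∈sep z∈ in
              from ∈T≡ (t∈ , trans (cong (app (fn y)) (trans (cong π₁ q) π₁-pair)) (sym (trans (cong (app (fn y₀)) (trans (cong π₂ q) π₂-pair))
                (trans (app-lam z∈u) (trim-in h))))))
            (runP-down (swapᵢ ∷ popᵢ ∷ []) (_ , (_ , _ , refl , refl) , _ , (_ , _ , refl , refl) , refl) (op∈ pc′ (seed∈ y) (seed∈ x)) (sep⊆ {d = intoD}) T∈⊆
              (λ z t z∈ t∈ (m₁ , r₁ , m₂ , r₂ , l) → let (z∈u , h) = to ∈T∈ z∈ in
                from (sepIn t∈) (D-tr C _ (into (π₂ z) (π₂∈ pc z∈u)) _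
                  (subst (λ s → app (fn y) s ∈ app (fn x) (π₂ z)) (sym (trans l (trans (pop-inv r₂) (proj₂ (swap-inv r₁))))) h)))
              p))
          where
            intoD : Def 1 (λ ρ → app (fn y) (lookup ρ v0) ∈ D)
            intoD = appᵗ (con (fn y)) (var v0) ∈ᵈ con D
            y₀ : El
            y₀ = el (seed y) (seed∈ y) (lam (trimG {D} {fn y}) u) lam-fun
            into₀ : Into D y₀
            into₀ z z∈ = subst (_∈ D) (sym (app-lam z∈)) (trim∈ C)

      -- A descending sequence ⟨(aₙ , fₙ)⟩ would make ⟨n , aₙ⟩ descend along the image under e of
      -- the well-founded relation F x ∈ F y, where F ⟨n , x⟩ = fₙ x.
      module Descent (C : V) (start : V) (start∈ : start ∈ C) (next : V)
        (next∈ : ∀ x → x ∈ C → app next x ∈ C) (descends : ∀ x → x ∈ C → app next x ∈ᶜᵒ x)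
        (seeds : ∀ x → x ∈ C → π₁ x ∈ u′) where
        open Iterate start {app next} (graph₁ (appᵗ (con next) (var v0)))

        term : V → V
        term n = app sequence n

        opaque
          term∈ : ∀ n → n ∈ Z → term n ∈ C
          term∈ = Z-induction (appᵗ (con sequence) (var v0) ∈ᵈ con C) (subst (_∈ C) (sym at-∅) start∈)
            λ n n∈ h → subst (_∈ C) (sym (at-sing n∈)) (next∈ (term n) h)

          term-descends : ∀ n → n ∈ Z → term (sing n) ∈ᶜᵒ term n
          term-descends n n∈ = subst (_∈ᶜᵒ term n) (sym (at-sing n∈)) (descends (term n) (term∈ n n∈))

        joint : V → V
        joint t = app (π₂ (term (π₁ t))) (π₂ t)

        jointG : Graph₁ joint
        jointG = graph₁ (appᵗ (π₂ᵗ (appᵗ (con sequence) (π₁ᵗ (var v0)))) (π₂ᵗ (var v0)))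

        opaque
          F : V
          F = lam jointG u

          FG : Graph₁ (app F)
          FG = graph₁ (appᵗ (con F) (var v0))

          app-F : x ∈ u → app F x ≡ joint x
          app-F = app-lam

          F-wf : WF (𝒫 u) (T∈ F F)
          F-wf s s∈ (y , y∈) =
            let (m , m∈ , min) = foundation′ {im FG s} (app F y , im∋ y∈)
                (y₀ , y₀∈ , m≡) = to ∈im m∈
            in y₀ , y₀∈ , λ y y∈ h → min (app F y)
                 (subst (app F y ∈_) (sym m≡) (subst₂ (λ a b → app F a ∈ app F b) π₁-pair π₂-pair (proj₂ (to ∈T∈ h)))) (im∋ y∈)

          image-wf : WF (𝒫 u′) (e (T∈ F F))
          image-wf = proj₂ (proj₂ (e-rel wfᶜ T∈⊆ T∈⊆ T∈⊆ (refl , refl , F-wf)))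

          node : V → V
          node n = ⟨ n , π₁ (term n) ⟩

          nodeG : Graph₁ node
          nodeG = graph₁ ⟨ var v0 , π₁ᵗ (appᵗ (con sequence) (var v0)) ⟩ᵗ

          node∈ : ∀ n → n ∈ Z → node n ∈ u′
          node∈ n n∈ = op∈ pc′ (Z⊆ pc′ n n∈) (seeds (term n) (term∈ n n∈))

          -- On pairs with the indices `sing n` and `n`, the relation F x ∈ F y is the membership
          -- between the functions of the two successive terms. `e-point` places the pair of nodes
          -- over exactly these indices.
          node-descends : ∀ n → n ∈ Z → ⟨ node (sing n) , node n ⟩ ∈ e (T∈ F F)
          node-descends n n∈ =
            e-mono₂ (sep⊆ {d = relD}) (sep⊆ {d = bothD}) T∈⊆
              (λ z p q → let (z∈ , h) = to ∈sep p ; (_ , k₁ , k₂) = to ∈sep q in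
                from ∈T∈ (z∈ , subst₂ _∈_
                  (sym (trans (app-F (π₁∈ pc z∈)) (cong (λ m → app (π₂ (term m)) (π₂ (π₁ z))) k₁)))
                  (sym (trans (app-F (π₂∈ pc z∈)) (cong (λ m → app (π₂ (term m)) (π₂ (π₂ z))) k₂))) h))
              c∈
              (runP-up (sndᵢ ∷ swapᵢ ∷ sndᵢ ∷ swapᵢ ∷ []) seconds-run c∈ T∈⊆ sep⊆
                (λ z y z∈ y∈ r → let (h , k) = seconds-sem r ; (_ , l) = to ∈T∈ y∈ in
                  from (sepIn z∈) (subst₂ (λ a b → app (π₂ (term (sing n))) a ∈ app (π₂ (term n)) b) h k l))
                (_∈ᶜᵒ_.un (term-descends n n∈)))
              (e-mono₂ (sep⊆ {d = first₁D}) (sep⊆ {d = first₂D}) sep⊆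
                (λ z p q → let (z∈ , h) = to ∈sep p ; (_ , k) = to ∈sep q in from ∈sep (z∈ , h , k)) c∈
                (runP-up (fstᵢ ∷ swapᵢ ∷ popᵢ ∷ []) first₁-run c∈ point⊆ sep⊆
                  (λ z y z∈ y∈ r → from (sepIn z∈) (trans (sym (first₁-sem r)) (proj₂ (to ∈point y∈)))) (e-point (sing n) (sing∈Z n∈)))
                (runP-up (swapᵢ ∷ fstᵢ ∷ swapᵢ ∷ popᵢ ∷ []) first₂-run c∈ point⊆ sep⊆
                  (λ z y z∈ y∈ r → from (sepIn z∈) (trans (sym (first₂-sem r)) (proj₂ (to ∈point y∈)))) (e-point n n∈)))
            where
              relD : Def 1 (λ ρ → app (π₂ (term (sing n))) (π₂ (π₁ (lookup ρ v0))) ∈ app (π₂ (term n)) (π₂ (π₂ (lookup ρ v0))))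
              relD = appᵗ (con (π₂ (term (sing n)))) (π₂ᵗ (π₁ᵗ (var v0))) ∈ᵈ appᵗ (con (π₂ (term n))) (π₂ᵗ (π₂ᵗ (var v0)))
              bothD : Def 1 (λ ρ → π₁ (π₁ (lookup ρ v0)) ≡ sing n × π₁ (π₂ (lookup ρ v0)) ≡ n)
              bothD = π₁ᵗ (π₁ᵗ (var v0)) ≡ᵈ con (sing n) ∧ᵈ π₁ᵗ (π₂ᵗ (var v0)) ≡ᵈ con n
              first₁D : Def 1 (λ ρ → π₁ (π₁ (lookup ρ v0)) ≡ sing n)
              first₁D = π₁ᵗ (π₁ᵗ (var v0)) ≡ᵈ con (sing n)
              first₂D : Def 1 (λ ρ → π₁ (π₂ (lookup ρ v0)) ≡ n)
              first₂D = π₁ᵗ (π₂ᵗ (var v0)) ≡ᵈ con n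
              c∈ : ⟨ node (sing n) , node n ⟩ ∈ u′
              c∈ = op∈ pc′ (node∈ (sing n) (sing∈Z n∈)) (node∈ n n∈)

          impossible : ⊥
          impossible =
            let (m , m∈ , min) = image-wf (im nodeG Z)
                  (from ∈𝒫 λ z z∈ → let (n , n∈ , h) = to ∈im z∈ in subst (_∈ u′) (sym h) (node∈ n n∈)) (node ∅ , im∋ ∅∈Z)
                (n , n∈ , h) = to ∈im m∈
            in min (node (sing n)) (im∋ (sing∈Z n∈)) (subst (λ m → ⟨ node (sing n) , m ⟩ ∈ e (T∈ F F)) (sym h) (node-descends n n∈))

      opaque
        -- In a set without minimal elements a choice function picks smaller elements, and its
        -- iteration along the numerals contradicts `Descent`.
        codes-wf : ∀ D s → s ⊆ codes D → (∃[ x ] x ∈ s) → ∃[ m ] (m ∈ s × ∀ y → y ∈ s → ¬ y ∈ᶜᵒ m)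
        codes-wf D s s⊆ (x₀ , x₀∈) = byContra λ none →
          let (h , _ , k) = choiceFunction {R = λ x y → y ∈ s × y ∈ᶜᵒ x} (var v1 ∈ᵈ con s ∧ᵈ ∈ᶜᵒᵈ ᵈ[ var v1 ∷ var v0 ∷ [] ]) s
                λ x x∈ → byContra λ n → none (x , x∈ , λ y y∈ r → n (y , y∈ , r))
          in Descent.impossible s x₀ x₀∈ h (λ x x∈ → proj₁ (k x x∈)) (λ x x∈ → proj₂ (k x x∈))
               (λ x x∈ → let (y , _ , p) = decode (s⊆ x x∈) in subst (_∈ u′) (sym (trans (cong π₁ p) π₁-pair)) (seed∈ y))

  open Collapsing public

  -- The transitive collapse, its target class and its embedding.

  module Ultrapowers where
    private variable
      n : ℕ
      a b x y z u v f g X : V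

    module Transitive (u u′ : V) (pc : PairClosed u) (pc′ : PairClosed u′) (e : V → V) (gE : Graph₁ e) (good : Good u u′ e) where
      open Collapse u u′ pc pc′ e gE good public
      open Carrier

      record IsCollapse (D q : V) : Set ℓ where
        constructor isCollapse
        field
          carrier : Carrier D
          colFun  : Fun q (codes D)
          col-eq  : ∀ x → x ∈ codes D → ∀ v → v ∈ app q x ⇔ (∃[ y ] (y ∈ codes D × y ∈ᶜᵒ x × v ≡ app q y))
      open IsCollapse

      isCollapseᵈ : Def 2 (λ ρ → IsCollapse (lookup ρ v0) (lookup ρ v1))
      isCollapseᵈ = castᵈ (λ ρ → mk⇔ (λ ((t , n) , F , h) → isCollapse (record { D-tr = t ; D-∅ = n }) F h)
                                      (λ C → (D-tr (carrier C) , D-∅ (carrier C)) , colFun C , col-eq C))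
        ((trᵈ ᵈ[ var v0 ∷ [] ] ∧ᵈ con ∅ ∈ᵈ var v0) ∧ᵈ funᵈ ᵈ[ var v1 ∷ fn₁ codes-graph (var v0) ∷ [] ] ∧ᵈ
         ∀ᵈ (var v0 ∈ᵈ fn₁ codes-graph (var v1) ⇒ᵈ ∀ᵈ (var v0 ∈ᵈ appᵗ (var v3) (var v1) ⇔ᵈ
           ∃ᵈ (var v0 ∈ᵈ fn₁ codes-graph (var v3) ∧ᵈ ∈ᶜᵒᵈ ᵈ[ var v0 ∷ var v2 ∷ [] ] ∧ᵈ var v1 ≡ᵈ appᵗ (var v4) (var v0)))))

      opaque
        col : V → V
        col D = Recursion.graph (codes D) ∈ᶜᵒᵈ (codes-wf D) (graph₁ (var v0))

        col-isCollapse : ∀ {D} → Carrier D → IsCollapse D (col D)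
        col-isCollapse {D} C = isCollapse C R.graphFun λ x x∈ v →
          let (s , sP , h) = R.rec-eq x∈ in ≡-⇔ (cong (v ∈_) h) ⇔∘ sP v
          where module R = Recursion (codes D) ∈ᶜᵒᵈ (codes-wf D) (graph₁ (var v0))

        -- By `restrict`, each element of a coded object has an equivalent code with values in the
        -- other carrier, so induction compares the two collapses. Hence `π` does not depend on the
        -- carrier chosen by `hull`.
        coherent : ∀ {D D′ q q′} → IsCollapse D q → IsCollapse D′ q′ →
          ∀ p → p ∈ codes D → ∀ p′ → p′ ∈ codes D′ → p ≈ᶜᵒ p′ → app q p ≡ app q′ p′
        coherent {D} {D′} {q} {q′} C C′ = wfInduction
          (∀ᵈ (var v0 ∈ᵈ con (codes D′) ⇒ᵈ ≈ᶜᵒᵈ ᵈ[ var v1 ∷ var v0 ∷ [] ] ⇒ᵈ appᵗ (con q) (var v1) ≡ᵈ appᵗ (con q′) (var v0)))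
          (codes-wf D) step
          where
            step : ∀ p → p ∈ codes D → (∀ y → y ∈ codes D → y ∈ᶜᵒ p → ∀ p′ → p′ ∈ codes D′ → y ≈ᶜᵒ p′ → app q y ≡ app q′ p′) →
              ∀ p′ → p′ ∈ codes D′ → p ≈ᶜᵒ p′ → app q p ≡ app q′ p′
            step p p∈ ih p′ p′∈ p≈ = from-codes (decode p∈) (decode p′∈)
              where
                from-codes : ∃[ x ] (Into D x × p ≡ code x) → ∃[ x ] (Into D′ x × p′ ≡ code x) → app q p ≡ app q′ p′
                from-codes (x , intoX , refl) (x′ , intoX′ , refl) = ⊆-antisym
                  (λ v v∈ → let (y , y∈ , r , h) = to (col-eq C p p∈ v) v∈ in forth (decode y∈) y∈ r h)
                  (λ v v∈ → let (y , y∈ , r , h) = to (col-eq C′ p′ p′∈ v) v∈ in back (decode y∈) y∈ r h)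
                  where
                    x≈ : x ≈̂ x′
                    x≈ = to code-≈ p≈
                    forth : ∀ {y v} → ∃[ t ] (Into D t × y ≡ code t) → y ∈ codes D → y ∈ᶜᵒ p → v ≡ app q y → v ∈ app q′ p′
                    forth (t , _ , refl) y∈ r h =
                      let r′ = ∈-congʳ (to (code-∈ {t} {x}) r) x≈ ; (s , into , t≈s) = restrict (carrier C′) intoX′ r′ in
                      from (col-eq C′ p′ p′∈ _) (code s , encode s into , from code-∈ (∈-congˡ (≈-sym t≈s) r′) ,
                        trans h (ih (code t) y∈ r (code s) (encode s into) (from code-≈ t≈s)))
                    back : ∀ {y v} → ∃[ t ] (Into D′ t × y ≡ code t) → y ∈ codes D′ → y ∈ᶜᵒ p′ → v ≡ app q′ y → v ∈ app q p
                    back (t , _ , refl) y∈ r h =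
                      let r′ = ∈-congʳ (to (code-∈ {t} {x′}) r) (≈-sym x≈) ; (s , into , t≈s) = restrict (carrier C) intoX r′
                          r″ = ∈-congˡ (≈-sym t≈s) r′ in
                      from (col-eq C p p∈ _) (code s , encode s into , from code-∈ r″ ,
                        trans h (sym (ih (code s) (encode s into) (from code-∈ r″) (code t) y∈ (from code-≈ (≈-sym t≈s)))))

        -- Equal collapses have the same elements. By induction these come from equivalent codes,
        -- and the ultrapower is extensional.
        injective : ∀ {D q} → IsCollapse D q → ∀ p → p ∈ codes D → ∀ p′ → p′ ∈ codes D → app q p ≡ app q p′ → p ≈ᶜᵒ p′
        injective {D} {q} C = wfInduction
          (∀ᵈ (var v0 ∈ᵈ con (codes D) ⇒ᵈ appᵗ (con q) (var v1) ≡ᵈ appᵗ (con q) (var v0) ⇒ᵈ ≈ᶜᵒᵈ ᵈ[ var v1 ∷ var v0 ∷ [] ]))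
          (codes-wf D) step
          where
            step : ∀ p → p ∈ codes D → (∀ y → y ∈ codes D → y ∈ᶜᵒ p → ∀ p′ → p′ ∈ codes D → app q y ≡ app q p′ → y ≈ᶜᵒ p′) →
              ∀ p′ → p′ ∈ codes D → app q p ≡ app q p′ → p ≈ᶜᵒ p′
            step p p∈ ih p′ p′∈ same = from-codes (decode p∈) (decode p′∈)
              where
                from-codes : ∃[ x ] (Into D x × p ≡ code x) → ∃[ x ] (Into D x × p′ ≡ code x) → p ≈ᶜᵒ p′
                from-codes (x , intoX , refl) (x′ , intoX′ , refl) = from code-≈ (≈-ext λ z → mk⇔ forth back)
                  where
                    forth : ∀ {z} → z ∈̂ x → z ∈̂ x′
                    forth h =
                      let (s , into , z≈s) = restrict (carrier C) intoX h
                          s∈ = from code-∈ (∈-congˡ (≈-sym z≈s) h)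
                          (y , y∈ , r , k) = to (col-eq C p′ p′∈ (app q (code s))) (subst (app q (code s) ∈_) same
                                                (from (col-eq C p p∈ _) (code s , encode s into , s∈ , refl)))
                          (t , _ , y≡) = decode y∈
                      in ∈-congˡ z≈s (∈-congˡ (to (code-≈ {s} {t}) (subst (code s ≈ᶜᵒ_) y≡ (ih (code s) (encode s into) s∈ y y∈ k))) (to (code-∈ {t} {x′}) (subst (_∈ᶜᵒ p′) y≡ r)))
                    back : ∀ {z} → z ∈̂ x′ → z ∈̂ x
                    back h =
                      let (s , into , z≈s) = restrict (carrier C) intoX′ h
                          s∈ = from code-∈ (∈-congˡ (≈-sym z≈s) h)
                          (y , y∈ , r , k) = to (col-eq C p p∈ (app q (code s))) (subst (app q (code s) ∈_) (sym same)
                                                (from (col-eq C p′ p′∈ _) (code s , encode s into , s∈ , refl)))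
                          (t , _ , y≡) = decode y∈
                          y≈s = ih y y∈ r (code s) (encode s into) (sym k)
                      in ∈-congˡ z≈s (∈-congˡ (≈-sym (to (code-≈ {t} {s}) (subst (_≈ᶜᵒ code s) y≡ y≈s))) (to (code-∈ {t} {x}) (subst (_∈ᶜᵒ p) y≡ r)))

      opaque
        hull : (x y : El) → ∃[ D ] (Carrier D × Into D x × Into D y)
        hull x y = let (D , t , s) = transitiveHull (sing ∅ ∪ (im gx u ∪ im gy u)) in
          D , record { D-tr = t ; D-∅ = s ∅ (from ∈∪ (inj₁ self∈sing)) } ,
          (λ z z∈ → s _ (from ∈∪ (inj₂ (from ∈∪ (inj₁ (im∋ z∈)))))) , (λ z z∈ → s _ (from ∈∪ (inj₂ (from ∈∪ (inj₂ (im∋ z∈))))))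
          where
            gx : Graph₁ (app (fn x))
            gx = graph₁ (appᵗ (con (fn x)) (var v0))
            gy : Graph₁ (app (fn y))
            gy = graph₁ (appᵗ (con (fn y)) (var v0))

        π : El → V
        π x = app (col (proj₁ (hull x x))) (code x)

        π-at : ∀ {D q} → IsCollapse D q → ∀ x → Into D x → app q (code x) ≡ π x
        π-at C x into = let (D′ , C′ , into′ , _) = hull x x in
          coherent C (col-isCollapse C′) (code x) (encode x into) (code x) (encode x into′) (from (code-≈ {x} {x}) ≈-refl)

        π-cong : ∀ {x y} → x ≈̂ y → π x ≡ π y
        π-cong {x} {y} h = let (D , C , i , _) = hull x x ; (D′ , C′ , i′ , _) = hull y y in
          coherent (col-isCollapse C) (col-isCollapse C′) (code x) (encode x i) (code y) (encode y i′) (from code-≈ h)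

        π-inj : ∀ {x y} → π x ≡ π y → x ≈̂ y
        π-inj {x} {y} h = let (D , C , i , i′) = hull x y ; K = col-isCollapse C in
          to code-≈ (injective K (code x) (encode x i) (code y) (encode y i′) (trans (π-at K x i) (trans h (sym (π-at K y i′)))))

        ∈π : ∀ {v x} → v ∈ π x ⇔ (∃[ y ] (y ∈̂ x × v ≡ π y))
        ∈π {v} {x} = let (D , C , i , _) = hull x x ; K = col-isCollapse C in
          col-eq K (code x) (encode x i) v ⇔∘ mk⇔
            (λ (y , y∈ , r , h) → let (t , into , y≡) = decode y∈ in
              t , to code-∈ (subst (_∈ᶜᵒ code x) y≡ r) , trans h (trans (cong (app (col D)) y≡) (π-at K t into)))
            (λ (y , r , h) → let (s , into , y≈s) = restrict C i r in
              code s , encode s into , from code-∈ (∈-congˡ (≈-sym y≈s) r) , trans h (trans (π-cong y≈s) (sym (π-at K s into))))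

        π-∈ : ∀ {x y} → π x ∈ π y ⇔ x ∈̂ y
        π-∈ {x} {y} = mk⇔ (λ h → let (t , r , k) = to ∈π h in ∈-congˡ (π-inj k) r) (λ r → from ∈π (x , r , refl))

      InM : V → Set ℓ
      InM v = ∃[ x ] v ≡ π x

      opaque
        -- Definability requires quantification over all carriers and all their collapses; by `π-at`
        -- this gives the same values as the collapse chosen in `π`.
        Mᵈ : Def 1 (λ ρ → InM (lookup ρ v0))
        Mᵈ = ∃ᵈ (∃ᵈ (∃ᵈ (isCollapseᵈ ᵈ[ var v2 ∷ var v1 ∷ [] ] ∧ᵈ var v0 ∈ᵈ fn₁ codes-graph (var v2) ∧ᵈ var v3 ≡ᵈ appᵗ (var v1) (var v0))))
          redef λ ρ → mk⇔
            (λ (D , q , p , C , p∈ , h) → let (x , into , k) = decode p∈ in x , trans h (trans (cong (app q) k) (π-at C x into)))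
            (λ (x , h) → let (D , C , i , _) = hull x x in D , col D , code x , col-isCollapse C , encode x i , trans h (sym (π-at (col-isCollapse C) x i)))

      M : Class
      M = Def⇒Class Mᵈ

      ∈M : ∀ {v} → v ∈ᶜ M ⇔ InM v
      ∈M {v} = ∈Def⇒Class Mᵈ v

      M-transitive : IsTransitive (_∈ᶜ M)
      M-transitive x y x∈ y∈ = let (t , h) = to ∈M x∈ ; (s , _ , k) = to ∈π (subst (y ∈_) h y∈) in from ∈M (s , k)

      Sat-collapse : (φ : Formula n) (xs : Vec El n) → Sat (_∈ᶜ M) φ (map π xs) ⇔ SatU φ xs
      Sat-collapse (i ∈̇ j) xs = ≡-⇔ (cong₂ _∈_ (lookup-map i π xs) (lookup-map j π xs)) ⇔∘ π-∈
      Sat-collapse (i ≐ j) xs = ≡-⇔ (cong₂ _≡_ (lookup-map i π xs) (lookup-map j π xs)) ⇔∘ mk⇔ π-inj π-cong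
      Sat-collapse (¬̇ φ) xs = ¬-⇔ (Sat-collapse φ xs)
      Sat-collapse (φ ∧̇ ψ) xs = ×-⇔ (Sat-collapse φ xs) (Sat-collapse ψ xs)
      Sat-collapse (φ ∨̇ ψ) xs = ⊎-⇔ (Sat-collapse φ xs) (Sat-collapse ψ xs)
      Sat-collapse (φ ⇒̇ ψ) xs = →-⇔ (Sat-collapse φ xs) (Sat-collapse ψ xs)
      Sat-collapse (∀̇ φ) xs = mk⇔
        (λ h x → to (Sat-collapse φ (x ∷ xs)) (h (π x) (from ∈M (x , refl))))
        (λ h v v∈ → let (x , k) = to ∈M v∈ in subst (λ v → Sat (_∈ᶜ M) φ (v ∷ map π xs)) (sym k) (from (Sat-collapse φ (x ∷ xs)) (h x)))
      Sat-collapse (∃̇ φ) xs = mk⇔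
        (λ (v , v∈ , s) → let (x , k) = to ∈M v∈ in x , to (Sat-collapse φ (x ∷ xs)) (subst (λ v → Sat (_∈ᶜ M) φ (v ∷ map π xs)) k s))
        (λ (x , s) → π x , from ∈M (x , refl) , from (Sat-collapse φ (x ∷ xs)) s)

      opaque
        cst : V → V
        cst x = lam (graph₁ (con x)) u

        cst-fun : Fun (cst x) u
        cst-fun = lam-fun

        app-cst : z ∈ u → app (cst x) z ≡ x
        app-cst = app-lam

        cstG : Graph₁ cst
        cstG = byElements₁ (λ x z → mk⇔
            (λ h → let (t , t∈ , k) = fun-elem (lam-fun {g = graph₁ (con x)}) h in t , t∈ , trans k (cong ⟨ t ,_⟩ (app-lam t∈)))
            (λ (t , t∈ , k) → subst (_∈ lam (graph₁ (con x)) u) (sym k) (from ∈lam (t∈ , refl))))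
          (∃ᵈ (var v0 ∈ᵈ con u ∧ᵈ var v1 ≡ᵈ ⟨ var v0 , var v2 ⟩ᵗ))

      constant : V → El
      constant x = el ∅ (pc-∅ pc′) (cst x) cst-fun

      J : V → V
      J x = π (constant x)

      opaque
        jᵈ : Def 1 (λ ρ → ∃[ x ] lookup ρ v0 ≡ ⟨ x , J x ⟩)
        jᵈ = ∃ᵈ (∃ᵈ (∃ᵈ (isCollapseᵈ ᵈ[ var v1 ∷ var v0 ∷ [] ] ∧ᵈ ⟨ con ∅ , fn₁ cstG (var v2) ⟩ᵗ ∈ᵈ fn₁ codes-graph (var v1)
            ∧ᵈ var v3 ≡ᵈ ⟨ var v2 , appᵗ (var v0) ⟨ con ∅ , fn₁ cstG (var v2) ⟩ᵗ ⟩ᵗ)))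
          redef λ ρ → ∃-⇔ λ x → mk⇔
            (λ (D , q , C , p∈ , h) → let (y , into , k) = decode p∈ in trans h (cong ⟨ x ,_⟩
              (π-at C (constant x) (λ z z∈ → subst (λ f → app f z ∈ D) (sym (pair-inj₂ k)) (into z z∈)))))
            (λ h → let (D , C , i , _) = hull (constant x) (constant x) in D , col D , col-isCollapse C , encode (constant x) i ,
              trans h (cong ⟨ x ,_⟩ (sym (π-at (col-isCollapse C) (constant x) i))))

      j : Class
      j = Def⇒Class jᵈ

      opaque
        ∈j : ⟨ x , y ⟩ ∈ᶜ j ⇔ y ≡ J x
        ∈j {x} {y} = ∈Def⇒Class jᵈ ⟨ x , y ⟩ ⇔∘ mk⇔
          (λ (x′ , h) → trans (pair-inj₂ h) (cong J (sym (pair-inj₁ h)))) (λ h → x , cong ⟨ x ,_⟩ h)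

        ev-constant : ∀ (ρ : Vec V n) → z ∈ u → ev (map constant ρ) z ≡ ρ
        ev-constant []      z∈ = refl
        ev-constant (x ∷ ρ) z∈ = cong₂ _∷_ (app-cst (π₁∈ pc z∈)) (ev-constant ρ (π₂∈ pc z∈))

        forces-constant : (φ : Formula n) (ρ : Vec V n) → Sat All φ ρ ⇔ Forces φ (map constant ρ)
        forces-constant φ ρ = mk⇔
          (λ s → forces (e-full truth⊆ (λ z z∈ → from (∈truth z∈) (subst (Sat All φ) (sym (ev-constant ρ z∈)) s)) (stack∈ (map constant ρ))))
          (λ (forces h) → byContra λ n → e-disjoint truth⊆ truth⊆
            (λ z p _ → n (subst (Sat All φ) (ev-constant ρ (truth⊆ z p)) (to (∈truth (truth⊆ z p)) p))) (stack∈ (map constant ρ)) h h)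

        j-elementary : IsElementaryEmbedding j M
        j-elementary = ((λ z z∈ → let (x , h) = to (∈Def⇒Class jᵈ z) z∈ in x , J x , tt , h) ,
            (λ x _ → J x , from ∈j refl , λ h → sym (to ∈j h))) ,
          (λ x y h → from ∈M (constant x , to ∈j h)) ,
          λ φ ρ σ h → forces-constant φ ρ ⇔∘ łoś φ (map constant ρ) ⇔∘ ⇔-sym (Sat-collapse φ (map constant ρ)) ⇔∘
            ≡-⇔ (cong (Sat (_∈ᶜ M) φ) (images h))
          where
            images : ∀ {n} {ρ σ : Vec V n} → Pointwise (λ x y → ⟨ x , y ⟩ ∈ᶜ j) ρ σ → map π (map constant ρ) ≡ σ
            images []      = refl
            images (h ∷ hs) = cong₂ _∷_ (sym (to ∈j h)) (images hs)

      opaque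
        idf : V
        idf = lam (graph₁ (var v0)) u

        idf-fun : Fun idf u
        idf-fun = lam-fun

        app-idf : z ∈ u → app idf z ≡ z
        app-idf = app-lam

      -- The element [a , id] of an extender ultrapower. It collapses to its seed (`π-self`), which
      -- puts `u′` into the target.
      self : a ∈ u′ → El
      self {a} a∈ = el a a∈ idf idf-fun

      opaque
        uCarrier : Carrier u
        uCarrier = record { D-tr = pc-tr pc ; D-∅ = pc-∅ pc }

        self-into : (a∈ : a ∈ u′) → Into u (self a∈)
        self-into a∈ z z∈ = subst (_∈ u) (sym (app-idf z∈)) z∈

        -- x ∈ y unfolds to ∃ y′ ∈ y, x = y′, which the relation existᶜ makes e respect.
        ∈self : ∀ (x : El) (a∈ : a ∈ u′) → x ∈̂ self a∈ ⇔ (∃[ b ] Σ[ b∈ ∈ b ∈ u′ ] (b ∈ a × x ≈̂ self b∈))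
        ∈self {a} x a∈ = mk⇔ un∈̂ mk∈̂ ⇔∘ e-exist T≡⊆ T∈⊆ spec (op∈ pc′ (seed∈ x) a∈) ⇔∘ ∃-⇔ λ b → mk⇔
            (λ (b∈ , h) → pc-tr pc′ a a∈ b b∈ , b∈ , mk≈̂ h) (λ (b∈ , h , mk≈̂ k) → h , k)
          where
            spec : ∀ t → t ∈ u → t ∈ T∈ (fn x) idf ⇔ (∃[ a ] ∃[ b ] (t ≡ ⟨ a , b ⟩ × ∃[ b′ ] (b′ ∈ b × ⟨ a , b′ ⟩ ∈ T≡ (fn x) idf)))
            spec t t∈ = ∈T∈ ⇔∘ mk⇔
              (λ (_ , h) → let h′ = subst (app (fn x) (π₁ t) ∈_) (app-idf (π₂∈ pc t∈)) h in
                [ (λ (a , b , k) → let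
                      k₁ = trans (cong π₁ k) π₁-pair ; k₂ = trans (cong π₂ k) π₂-pair
                      t∈′ = subst (_∈ u) k t∈
                      fa∈ = subst₂ (λ p q → app (fn x) p ∈ q) k₁ k₂ h′
                      fa∈u = pc-tr pc b (opʳ pc t∈′) (app (fn x) a) fa∈
                    in a , b , k , app (fn x) a , fa∈ , from ∈T≡ (op∈ pc (opˡ pc t∈′) fa∈u ,
                         trans (cong (app (fn x)) π₁-pair) (sym (trans (cong (app idf) π₂-pair) (app-idf fa∈u)))))
                , (λ n → ⊥-elim (∉∅ (subst (app (fn x) (π₁ t) ∈_) (π₂-junk n) h′))) ]′ (lem (∃[ a ] ∃[ b ] t ≡ ⟨ a , b ⟩)))
              (λ (a , b , k , b′ , b′∈ , m) → let
                    (m∈ , h) = to ∈T≡ m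
                    b′≡ = trans (cong (app (fn x)) (sym π₁-pair)) (trans h (trans (cong (app idf) π₂-pair) (app-idf (opʳ pc m∈))))
                    k₁ = trans (cong π₁ k) π₁-pair ; k₂ = trans (cong π₂ k) π₂-pair
                  in t∈ , subst₂ _∈_ (trans (sym b′≡) (cong (app (fn x)) (sym k₁))) (sym (trans (app-idf (π₂∈ pc t∈)) k₂)) b′∈)

        collapse-self : ∀ a → a ∈ u′ → app (col u) ⟨ a , idf ⟩ ≡ a
        collapse-self = wfInduction (appᵗ (con (col u)) ⟨ var v0 , con idf ⟩ᵗ ≡ᵈ var v0) (∈-wf u′) λ a a∈ ih → extensionality λ v →
          col-eq K (code (self a∈)) (encode (self a∈) (self-into a∈)) v ⇔∘ mk⇔
            (λ (y , y∈ , r , h) → let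
                (t , into , y≡) = decode y∈
                (b , b∈u , b∈ , k) = to (∈self t a∈) (to code-∈ (subst (_∈ᶜᵒ code (self a∈)) y≡ r))
                v≡ = trans h (trans (coherent K K y y∈ (code (self b∈u)) (encode (self b∈u) (self-into b∈u))
                       (subst (_≈ᶜᵒ code (self b∈u)) (sym y≡) (from code-≈ k))) (ih b b∈u b∈))
              in subst (_∈ a) (sym v≡) b∈)
            (λ v∈ → let v∈u = pc-tr pc′ a a∈ v v∈ in code (self v∈u) , encode (self v∈u) (self-into v∈u) ,
              from code-∈ (from (∈self (self v∈u) a∈) (v , v∈u , v∈ , ≈-refl)) , sym (ih v v∈u v∈))
          where
            K : IsCollapse u (col u)
            K = col-isCollapse uCarrier

        π-self : (a∈ : a ∈ u′) → π (self a∈) ≡ a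
        π-self {a} a∈ = trans (sym (π-at (col-isCollapse uCarrier) (self a∈) (self-into a∈))) (collapse-self a a∈)

        u′⊆M : ∀ a → a ∈ u′ → a ∈ᶜ M
        u′⊆M a a∈ = from ∈M (self a∈ , sym (π-self a∈))

        -- As `a` is represented by [a , id] and `J X` by a constant function, membership is tested
        -- at the pair of `a` and the dummy seed ∅, which a program removes.
        J-restricts : X ⊆ u → a ∈ u′ → a ∈ J X ⇔ a ∈ e X
        J-restricts {X} {a} X⊆ a∈ = ≡-⇔ (cong (_∈ J X) (sym (π-self a∈))) ⇔∘ π-∈ ⇔∘ mk⇔ un∈̂ mk∈̂ ⇔∘ mk⇔
            (runP-down (swapᵢ ∷ popᵢ ∷ []) run c∈ X⊆ T∈⊆ λ z y z∈ y∈ r → let (z∈u , h) = to ∈T∈ z∈ in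
              subst₂ _∈_ (trans (app-idf (π₁∈ pc z∈u)) (sym (sem r))) (app-cst (π₂∈ pc z∈u)) h)
            (runP-up (swapᵢ ∷ popᵢ ∷ []) run c∈ X⊆ T∈⊆ λ z y z∈ y∈ r →
              from ∈T∈ (z∈ , subst₂ _∈_ (trans (sem r) (sym (app-idf (π₁∈ pc z∈)))) (sym (app-cst (π₂∈ pc z∈))) y∈))
          where
            c∈ : ⟨ a , ∅ ⟩ ∈ u′
            c∈ = op∈ pc′ a∈ (pc-∅ pc′)
            run : RunP (swapᵢ ∷ popᵢ ∷ []) ⟨ a , ∅ ⟩ a
            run = ⟨ ∅ , a ⟩ , (a , ∅ , refl , refl) , a , (∅ , a , refl , refl) , refl
            sem : ∀ {z y} → RunP (swapᵢ ∷ popᵢ ∷ []) z y → y ≡ π₁ z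
            sem (m₁ , r₁ , m₂ , r₂ , h) = trans h (trans (pop-inv r₂) (proj₂ (swap-inv r₁)))

  open Ultrapowers public

  -- Limit ordinals and stages witnessed by a Δ₀ formula.

  module Limits where
    private variable
      n : ℕ
      a c x y z u v f α β γ δ ξ : V

    record Lim (α : V) : Set ℓ where
      constructor mkLim
      field
        lim-ord : Ord α
        lim-∅   : ∅ ∈ α
        lim-S   : ∀ γ → γ ∈ α → S γ ∈ α
    open Lim public

    isS₀ : D₀ 2 (λ ρ → lookup ρ v0 ≡ S (lookup ρ v1))
    isS₀ = cast₀
      (λ { (s ∷ x ∷ []) → mk⇔
        (λ (h , k , l) → extensionality λ z → mk⇔ (λ z∈ → from ∈S (h z z∈)) (λ z∈ → [ k z , (λ { refl → l }) ]′ (to ∈S z∈)))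
        (λ { refl → (λ z z∈ → to ∈S z∈) , (λ z z∈ → from ∈S (inj₁ z∈)) , self∈S }) })
      (∀∈₀ v0 (v0 ∈₀ v2 ∨₀ v0 ≡₀ v2) ∧₀ ∀∈₀ v1 (v0 ∈₀ v1) ∧₀ v1 ∈₀ v0)

    isEmpty₀ : D₀ 1 (λ ρ → lookup ρ v0 ≡ ∅)
    isEmpty₀ = cast₀ (λ ρ → mk⇔ (λ h → empty λ z z∈ → h z z∈ refl) (λ h z z∈ → ⊥-elim (∉∅ (subst (z ∈_) h z∈)))) (∀∈₀ v0 (¬₀ (v0 ≡₀ v0)))

    lim₀ : D₀ 1 (λ ρ → Lim (lookup ρ v0))
    lim₀ = cast₀
      (λ ρ → mk⇔
        (λ (o , (e , e∈ , h) , k) → mkLim o (subst (_∈ lookup ρ v0) h e∈) λ γ γ∈ → let (s , s∈ , l) = k γ γ∈ in subst (_∈ lookup ρ v0) l s∈)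
        (λ L → lim-ord L , (∅ , lim-∅ L , refl) , λ γ γ∈ → S γ , lim-S L γ γ∈ , refl))
      (ord₀ ∧₀ ∃∈₀ v0 (isEmpty₀ ₀[ v0 ∷ [] ]) ∧₀ ∀∈₀ v0 (∃∈₀ v1 (isS₀ ₀[ v0 ∷ v1 ∷ [] ])))

    opaque
      ord-∅∈ : Ord α → x ∈ α → ∅ ∈ α
      ord-∅∈ {α} {x} o x∈ = [ id , [ (λ h → ⊥-elim (∉∅ (subst (x ∈_) (sym h) x∈))) , (λ h → ⊥-elim (∉∅ h)) ]′ ]′ (trichotomy ord-∅ o)

      ⊆⇒∈S : Ord α → Ord β → α ⊆ β → α ∈ S β
      ⊆⇒∈S oα oβ h = from ∈S (⊆⇒≤ oα oβ h)

      -- `bound x` lies above `x` and above all F ξ with ξ ≤ x; the supremum of its iterates from α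
      -- is the ordinal sought.
      closedLimit : {F : V → V} → Graph₁ F → (∀ x → Ord x → Ord (F x)) → Ord α →
        ∃[ σ ] (Lim σ × α ∈ σ × ∀ ξ → ξ ∈ σ → F ξ ∈ σ)
      closedLimit {α} {F} gF oF oα =
          σ , mkLim oσ (ord-∅∈ oσ α∈) succ , α∈ , images
        where
          boundT : Tm 1
          boundT = Sᵗ (var v0 ∪ᵗ ⋃ᵗ (fn₁ (imG gF) (Sᵗ (var v0))))
          bound : V → V
          bound x = S (x ∪ ⋃ (im gF (S x)))
          boundG : Graph₁ bound
          boundG = graph₁ boundT
          open Closure (sing α) (graph₁ (singᵗ (fn₁ boundG (var v0)))) renaming (closure to hull; start to base)
          C : V
          C = sep ordᵈ hull
          oU : ∀ x → Ord x → Ord (x ∪ ⋃ (im gF (S x)))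
          oU x ox = ord-⋃ λ z z∈ → [ (λ { refl → ox })
            , (λ { refl → ord-⋃ λ y y∈ → let (t , t∈ , h) = to ∈im y∈ in subst Ord (sym h) (oF t (ord-∈ (ord-S ox) t∈)) }) ]′ (to ∈pair z∈)
          oB : ∀ x → Ord x → Ord (bound x)
          oB x ox = ord-S (oU x ox)
          x∈B : ∀ x → Ord x → x ∈ bound x
          x∈B x ox = ⊆⇒∈S ox (oU x ox) (λ t t∈ → from ∈∪ (inj₁ t∈))
          F∈B : ∀ x ξ → Ord x → ξ ∈ S x → F ξ ∈ bound x
          F∈B x ξ ox ξ∈ = ⊆⇒∈S (oF ξ (ord-∈ (ord-S ox) ξ∈)) (oU x ox) (λ t t∈ → from ∈∪ (inj₂ (from ∈⋃ (F ξ , im∋ ξ∈ , t∈))))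
          oC : ∀ z → z ∈ C → Ord z
          oC z z∈ = proj₂ (to ∈sep z∈)
          up : ∀ x → x ∈ C → bound x ∈ C
          up x x∈ = let (h , o) = to ∈sep x∈ in from ∈sep (closed-under h (bound x) self∈sing , oB x o)
          σ : V
          σ = ⋃ C
          oσ : Ord σ
          oσ = ord-⋃ oC
          α∈ : α ∈ σ
          α∈ = from ∈⋃ (bound α , up α (from ∈sep (base α self∈sing , oα)) , x∈B α oα)
          succ : ∀ γ → γ ∈ σ → S γ ∈ σ
          succ γ γ∈ = let (c , c∈ , h) = to ∈⋃ γ∈ ; oc = oC c c∈ ; oγ = ord-∈ oc h in
            from ∈⋃ (bound c , up c c∈ ,
              ([ (λ k → trans-ord (oB c oc) c (x∈B c oc) (S γ) k) , (λ k → subst (_∈ bound c) (sym k) (x∈B c oc)) ]′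
                (⊆⇒≤ (ord-S oγ) oc (λ t t∈ → [ (λ k → trans-ord oc γ h t k) , (λ { refl → h }) ]′ (to ∈S t∈)))))
          images : ∀ ξ → ξ ∈ σ → F ξ ∈ σ
          images ξ ξ∈ = let (c , c∈ , h) = to ∈⋃ ξ∈ in from ∈⋃ (bound c , up c c∈ , F∈B c ξ (oC c c∈) (from ∈S (inj₁ h)))

      limitAbove : Ord α → ∃[ σ ] (Lim σ × α ∈ σ)
      limitAbove oα = let (σ , L , α∈ , _) = closedLimit (graph₁ (var v0)) (λ x o → o) oα in σ , L , α∈

      ∈𝕍lim : Lim α → x ∈ 𝕍 α → ∃[ γ ] (γ ∈ α × x ∈ 𝕍 γ)
      ∈𝕍lim L h = let (γ , γ∈ , s) = to (∈𝕍 (lim-ord L)) h in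
        S γ , lim-S L γ γ∈ , ⊆𝕍⇒∈ (ord-S (ord-∈ (lim-ord L) γ∈)) self∈S s

      ∈𝕍lim₂ : Lim α → x ∈ 𝕍 α → y ∈ 𝕍 α → ∃[ γ ] (γ ∈ α × x ∈ 𝕍 γ × y ∈ 𝕍 γ)
      ∈𝕍lim₂ {α} {x} {y} L hx hy = let
          (γ , γ∈ , p) = ∈𝕍lim L hx ; (δ , δ∈ , q) = ∈𝕍lim L hy
          oγ = ord-∈ (lim-ord L) γ∈ ; oδ = ord-∈ (lim-ord L) δ∈
        in [ (λ h → δ , δ∈ , 𝕍-mono oδ (∈⇒⊆ oδ h) oγ x p , q)
           , [ (λ h → γ , γ∈ , p , subst (λ δ → y ∈ 𝕍 δ) (sym h) q)
             , (λ h → γ , γ∈ , p , 𝕍-mono oγ (∈⇒⊆ oγ h) oδ y q) ]′ ]′ (trichotomy oγ oδ)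

      pair-stage : Ord γ → x ∈ 𝕍 γ → y ∈ 𝕍 γ → pair x y ∈ 𝕍 (S γ)
      pair-stage {γ} o p q = ⊆𝕍⇒∈ (ord-S o) self∈S λ z z∈ → [ (λ { refl → p }) , (λ { refl → q }) ]′ (to ∈pair z∈)

      op-stage : Ord γ → x ∈ 𝕍 γ → y ∈ 𝕍 γ → ⟨ x , y ⟩ ∈ 𝕍 (S (S γ))
      op-stage o p q = pair-stage (ord-S o) (pair-stage o p p) (pair-stage o p q)

      𝕍-pairClosed : Lim α → PairClosed (𝕍 α)
      𝕍-pairClosed {α} L = record
        { pc-tr = 𝕍-trans (lim-ord L)
        ; pc-∅ = ord⊆𝕍 α (lim-ord L) ∅ (lim-∅ L)
        ; pc-pair = λ p q → let (γ , γ∈ , p′ , q′) = ∈𝕍lim₂ L p q ; o = ord-∈ (lim-ord L) γ∈ in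
            𝕍-mono (lim-ord L) (∈⇒⊆ (lim-ord L) (lim-S L γ γ∈)) (ord-S o) _ (pair-stage o p′ q′) }

      𝒫-stage : Ord γ → x ∈ 𝕍 γ → 𝒫 x ∈ 𝕍 (S γ)
      𝒫-stage o p = ⊆𝕍⇒∈ (ord-S o) self∈S λ z z∈ → 𝕍-⊆ o p (to ∈𝒫 z∈)

      𝒫∈lim : Lim α → x ∈ 𝕍 α → 𝒫 x ∈ 𝕍 α
      𝒫∈lim L h = let (γ , γ∈ , p) = ∈𝕍lim L h ; o = ord-∈ (lim-ord L) γ∈ in
        𝕍-mono (lim-ord L) (∈⇒⊆ (lim-ord L) (lim-S L γ γ∈)) (ord-S o) _ (𝒫-stage o p)

      𝕍∈𝕍 : Ord α → γ ∈ α → 𝕍 γ ∈ 𝕍 α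
      𝕍∈𝕍 o γ∈ = ⊆𝕍⇒∈ o γ∈ ⊆-refl

      hierarchy : V → V
      hierarchy γ = lam 𝕍G γ

      hierarchy∈ : Lim α → γ ∈ α → hierarchy γ ∈ 𝕍 α
      hierarchy∈ {α} {γ} L γ∈ = let oα = lim-ord L ; o = ord-∈ oα γ∈ ; k = lim-S L _ (lim-S L γ γ∈) in
        ⊆𝕍⇒∈ oα k λ z z∈ → let (β , β∈ , h) = fun-elem lam-fun z∈ in
          subst (_∈ 𝕍 (S (S γ))) (sym (trans h (cong ⟨ β ,_⟩ (app-lam β∈))))
            (op-stage o (ord⊆𝕍 γ o β β∈) (𝕍∈𝕍 o β∈))

    -- Membership in a stage, witnessed by a function dominated by the hierarchy; a Δ₀ notion.

    record InStage (x γ f : V) : Set ℓ where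
      constructor inStage
      field
        coherent-values : ∀ β v → ⟨ β , v ⟩ ∈ f → ∀ y → y ∈ v → ∃[ δ ] ∃[ u ] (⟨ δ , u ⟩ ∈ f × δ ∈ β × y ⊆ u)
        appears         : ∃[ δ ] ∃[ u ] (⟨ δ , u ⟩ ∈ f × δ ∈ γ × x ⊆ u)
    open InStage public

    inStage₀ : D₀ 3 (λ ρ → InStage (lookup ρ v0) (lookup ρ v1) (lookup ρ v2))
    inStage₀ = cast₀ (λ ρ → mk⇔ (λ (h , k) → inStage h k) (λ I → coherent-values I , appears I))
      (∀op∈₀ v2 (∀∈₀ v0 (∃op∈₀ v5 (v1 ∈₀ v4 ∧₀ ⊆₀ ₀[ v2 ∷ v0 ∷ [] ])))
       ∧₀ ∃op∈₀ v2 (v1 ∈₀ v3 ∧₀ ⊆₀ ₀[ v2 ∷ v0 ∷ [] ]))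

    opaque
      unfolding hierarchy
      -- By ∈-induction every value of `f` at an ordinal β is included in 𝕍 β. As `f` may be any
      -- set, a witness found inside an inner model is also sound in V.
      inStage-sound : Ord γ → InStage x γ f → x ∈ 𝕍 γ
      inStage-sound {γ} {x} {f} o I = let (δ , u , h , δ∈ , s) = appears I in
          ⊆𝕍⇒∈ o δ∈ λ z z∈ → below δ (ord-∈ o δ∈) u h z (s z z∈)
        where
          below : ∀ β → Ord β → ∀ v → ⟨ β , v ⟩ ∈ f → v ⊆ 𝕍 β
          below = ∈-induction (ordᵈ ⇒ᵈ ∀ᵈ (⟨ var v1 , var v0 ⟩ᵗ ∈ᵈ con f ⇒ᵈ ⊆ᵈ ᵈ[ var v0 ∷ 𝕍ᵗ (var v1) ∷ [] ]))
            λ β ih oβ v h y y∈ → let (δ , u , k , δ∈ , s) = coherent-values I β v h y y∈ in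
              ⊆𝕍⇒∈ oβ δ∈ λ z z∈ → ih δ δ∈ (ord-∈ oβ δ∈) u k z (s z z∈)

      inStage-complete : Ord γ → x ∈ 𝕍 γ → InStage x γ (hierarchy γ)
      inStage-complete {γ} o h = inStage
        (λ β v k y y∈ → let (β∈ , v≡) = to ∈lam k ; (δ , δ∈ , s) = to (∈𝕍 (ord-∈ o β∈)) (subst (y ∈_) v≡ y∈) in
          δ , 𝕍 δ , from ∈lam (trans-ord o β β∈ δ δ∈ , refl) , δ∈ , s)
        (let (δ , δ∈ , s) = to (∈𝕍 o) h in δ , 𝕍 δ , from ∈lam (δ∈ , refl) , δ∈ , s)

  open Limits public

  -- Elementary embeddings and their restrictions to subsets of a stage.

  module Embeddings where
    private variable
      n : ℕ
      a b c d x y z u w g X Y W α γ δ ξ μ : V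
      P : Vec V n → Set ℓ

    ∈stage : Ord α → IsStage α w → x ∈ w ⇔ x ∈ 𝕍 α
    ∈stage o h = ≡-⇔ (cong (_ ∈_) (stage≡𝕍 o h))

    module Elementary (j M : Class) (elem : IsElementaryEmbedding j M) (tr : IsTransitive (_∈ᶜ M)) where

      opaque
        J : V → V
        J x = proj₁ (proj₂ (proj₁ elem) x tt)

        ∈j : ⟨ x , y ⟩ ∈ᶜ j ⇔ y ≡ J x
        ∈j {x} {y} = mk⇔ (λ h → sym (proj₂ (proj₂ (proj₂ (proj₁ elem) x tt)) h))
          (λ h → subst (λ y → ⟨ x , y ⟩ ∈ᶜ j) (sym h) (proj₁ (proj₂ (proj₂ (proj₁ elem) x tt))))

      JG : Graph₁ J
      JG = gr₁ ((⟨ var v1 , var v0 ⟩ᵗ ∈ᵈᶜ j) redef λ ρ → ∈j)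

      Jᵗ : Tm n → Tm n
      Jᵗ = fn₁ JG

      opaque
        J∈M : J x ∈ᶜ M
        J∈M {x} = proj₁ (proj₂ elem) x (J x) (from ∈j refl)

        J-pointwise : (ρ : Vec V n) → Pointwise (λ x y → ⟨ x , y ⟩ ∈ᶜ j) ρ (map J ρ)
        J-pointwise []      = []
        J-pointwise (x ∷ ρ) = from ∈j refl ∷ J-pointwise ρ

        J-sat : (φ : Formula n) (ρ : Vec V n) → Sat All φ ρ ⇔ Sat (_∈ᶜ M) φ (map J ρ)
        J-sat φ ρ = proj₂ (proj₂ elem) φ ρ (map J ρ) (J-pointwise ρ)

      InModel : Vec V n → Set ℓ
      InModel ρ = ∀ i → lookup ρ i ∈ᶜ M

      inModel-∷ : {ρ : Vec V n} → x ∈ᶜ M → InModel ρ → InModel (x ∷ ρ)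
      inModel-∷ h hs zero    = h
      inModel-∷ h hs (suc i) = hs i

      opaque
        inModel-J : (ρ : Vec V n) → InModel (map J ρ)
        inModel-J ρ i = subst (_∈ᶜ M) (sym (lookup-map i J ρ)) J∈M

        absolute : (d : D₀ n P) (ρ : Vec V n) → InModel ρ → Sat (_∈ᶜ M) (Closed.form d) ρ ⇔ P ρ
        absolute d ρ h = Sat-Δ₀ (_∈ᶜ M) tr (Closed.class d) ρ h ⇔∘ Closed.means d ρ

        J-Δ₀ : D₀ n P → ∀ ρ → P ρ ⇔ P (map J ρ)
        J-Δ₀ d ρ = ⇔-sym (Closed.means d ρ) ⇔∘ J-sat (Closed.form d) ρ ⇔∘ absolute d (map J ρ) (inModel-J ρ)

        -- The Δ₀ matrix is absolute for the transitive class `M`, so elementarity leaves only the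
        -- two quantifiers to be relativised.
        J-∀∀ : {P : Vec V (suc (suc n)) → Set ℓ} → D₀ (suc (suc n)) P → ∀ ρ → (∀ x y → P (y ∷ x ∷ ρ)) ⇔
          (∀ x y → x ∈ᶜ M → y ∈ᶜ M → P (y ∷ x ∷ map J ρ))
        J-∀∀ d ρ = mk⇔ (λ h x _ y _ → from (Closed.means d _) (h x y)) (λ h x y → to (Closed.means d _) (h x tt y tt)) ⇔∘
          J-sat (∀̇ (∀̇ (Closed.form d))) ρ ⇔∘
          mk⇔ (λ h x y x∈ y∈ → to (absolute d _ (inModel-∷ y∈ (inModel-∷ x∈ (inModel-J ρ)))) (h x x∈ y y∈))
              (λ h x x∈ y y∈ → from (absolute d _ (inModel-∷ y∈ (inModel-∷ x∈ (inModel-J ρ)))) (h x y x∈ y∈))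

        J-∀∃ : {P : Vec V (suc (suc n)) → Set ℓ} → D₀ (suc (suc n)) P → ∀ ρ → (∀ x → ∃[ y ] P (y ∷ x ∷ ρ)) ⇔
          (∀ x → x ∈ᶜ M → ∃[ y ] (y ∈ᶜ M × P (y ∷ x ∷ map J ρ)))
        J-∀∃ {P = P} d ρ = mk⇔ forth back
          where
            forth : (∀ x → ∃[ y ] P (y ∷ x ∷ ρ)) → ∀ x → x ∈ᶜ M → ∃[ y ] (y ∈ᶜ M × P (y ∷ x ∷ map J ρ))
            forth h x x∈ = let (y , y∈ , p) = to (J-sat (∀̇ (∃̇ (Closed.form d))) ρ)
                                  (λ x _ → proj₁ (h x) , tt , from (Closed.means d _) (proj₂ (h x))) x x∈
                           in y , y∈ , to (absolute d _ (inModel-∷ y∈ (inModel-∷ x∈ (inModel-J ρ)))) p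
            back : (∀ x → x ∈ᶜ M → ∃[ y ] (y ∈ᶜ M × P (y ∷ x ∷ map J ρ))) → ∀ x → ∃[ y ] P (y ∷ x ∷ ρ)
            back h x = let (y , _ , p) = from (J-sat (∀̇ (∃̇ (Closed.form d))) ρ) (λ x x∈ → proj₁ (h x x∈) , proj₁ (proj₂ (h x x∈)) ,
                             from (absolute d _ (inModel-∷ (proj₁ (proj₂ (h x x∈))) (inModel-∷ x∈ (inModel-J ρ)))) (proj₂ (proj₂ (h x x∈)))) x tt
                       in y , to (Closed.means d _) p

        J-∈ : x ∈ y ⇔ J x ∈ J y
        J-∈ {x} {y} = J-Δ₀ (v0 ∈₀ v1) (x ∷ y ∷ [])

        J-op : J ⟨ x , y ⟩ ≡ ⟨ J x , J y ⟩
        J-op {x} {y} = to (J-Δ₀ (isOp₀ v0 v1 v2) (⟨ x , y ⟩ ∷ x ∷ y ∷ [])) refl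

        J-⊆ : x ⊆ y → J x ⊆ J y
        J-⊆ {x} {y} = to (J-Δ₀ ⊆₀ (x ∷ y ∷ []))

        J-ord : Ord α → Ord (J α)
        J-ord {α} = to (J-Δ₀ ord₀ (α ∷ []))

        J-∅ : J ∅ ≡ ∅
        J-∅ = to (J-Δ₀ isEmpty₀ (∅ ∷ [])) refl

        J-increases : ∀ α → Ord α → α ⊆ J α
        J-increases α o = ∉⇒⊆ (J-ord o) o (notBelow α o)
          where
            notBelow : ∀ α → Ord α → ¬ J α ∈ α
            notBelow = ∈-induction (ordᵈ ⇒ᵈ ¬ᵈ (Jᵗ (var v0) ∈ᵈ var v0)) λ α ih o h → ih (J α) h (ord-∈ o h) (to J-∈ h)

        -- All elements of 𝕍 ξ have `InStage` witnesses. By elementarity `M` has witnesses for all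
        -- elements of `J (𝕍 ξ)`, and witnesses are sound in V.
        J-𝕍⊆ : Ord ξ → J (𝕍 ξ) ⊆ 𝕍 (J ξ)
        J-𝕍⊆ {ξ} o y y∈ = let
            (F , _ , h) = to (J-∀∃ {P = λ ρ → lookup ρ v1 ∈ lookup ρ v3 → InStage (lookup ρ v1) (lookup ρ v2) (lookup ρ v0)}
                (v1 ∈₀ v3 ⇒₀ inStage₀ ₀[ v1 ∷ v2 ∷ v0 ∷ [] ]) (ξ ∷ 𝕍 ξ ∷ []))
              (λ x → hierarchy ξ , λ h → inStage-complete o h) y (tr (J (𝕍 ξ)) y J∈M y∈)
          in inStage-sound (J-ord o) (h y∈)

        -- Elementarity puts every `InStage`-witnessed set of `M` into `J (𝕍 ξ)`. For y in 𝕍 γ with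
        -- γ below μ, the witness `hierarchy γ` belongs to 𝕍 μ and thus to `M`.
        ⊆J-𝕍 : Ord ξ → Lim μ → (∀ x → x ∈ 𝕍 μ → x ∈ᶜ M) → μ ⊆ J ξ → 𝕍 μ ⊆ J (𝕍 ξ)
        ⊆J-𝕍 {ξ} {μ} o L sub μ⊆ y y∈ = let (γ , γ∈ , y∈γ) = ∈𝕍lim L y∈
                                           I = inStage-complete (ord-∈ (lim-ord L) γ∈) y∈γ
                                           (δ , t , h , δ∈ , s) = appears I in
          to (J-∀∀ {P = λ ρ → InStage (lookup ρ v1) (lookup ρ v2) (lookup ρ v0) → lookup ρ v1 ∈ lookup ρ v3}
              (inStage₀ ₀[ v1 ∷ v2 ∷ v0 ∷ [] ] ⇒₀ v1 ∈₀ v3) (ξ ∷ 𝕍 ξ ∷ []))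
            (λ x F I → inStage-sound o I) y (hierarchy γ) (sub y y∈) (sub (hierarchy γ) (hierarchy∈ L γ∈))
            (inStage (coherent-values I) (δ , t , h , trans-ord (J-ord o) γ (μ⊆ γ γ∈) δ δ∈ , s))

    -- Well-foundedness is witnessed by a ranking, which makes it absolute.

    record Ranks (g u X : V) : Set ℓ where
      constructor mkRanks
      field
        ranked     : ∀ y → y ∈ u → ∃[ t ] (t ∈ g × ∃[ a ] ∃[ b ] (t ≡ ⟨ a , b ⟩ × a ≡ y))
        decreasing : ∀ y x → ⟨ y , x ⟩ ∈ X → ∀ a b → ⟨ a , b ⟩ ∈ g → ∀ a′ b′ → ⟨ a′ , b′ ⟩ ∈ g → y ≡ a → x ≡ a′ → b ∈ b′
    open Ranks

    ranks₀ : D₀ 3 (λ ρ → Ranks (lookup ρ v0) (lookup ρ v1) (lookup ρ v2))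
    ranks₀ = cast₀ (λ ρ → mk⇔ (λ (h , k) → mkRanks h k) (λ R → ranked R , decreasing R))
      (∀∈₀ v1 (∃∈₀ v1 (unpair₀ v0 (v1 ≡₀ v3)))
       ∧₀ ∀op∈₀ v2 (∀op∈₀ v2 (∀op∈₀ v4 (v5 ≡₀ v3 ⇒₀ v4 ≡₀ v1 ⇒₀ v2 ∈₀ v0))))

    opaque
      -- The ranking is the Mostowski collapse of `X`: a predecessor is sent to an element of the
      -- image.
      ranking : ∀ {u X} → WF (𝒫 u) X → X ⊆ u → PairClosed u → ∃[ g ] Ranks g u X
      ranking {u} {X} wf X⊆ pc = R.graph , mkRanks
        (λ y y∈ → ⟨ y , app R.graph y ⟩ , app∈ R.graphFun y∈ , y , app R.graph y , refl , refl)
        (λ { y x h a b k a′ b′ k′ refl refl → let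
               xy∈ = X⊆ ⟨ y , x ⟩ h
               (s , sP , h′) = R.rec-eq (opʳ pc xy∈)
             in subst₂ _∈_ (app-≡ R.graphFun k) (trans (sym h′) (app-≡ R.graphFun k′)) (from (sP (app R.graph y)) (y , opˡ pc xy∈ , h , refl)) })
        where
          module R = Recursion u {R = λ y x → ⟨ y , x ⟩ ∈ X} (⟨ var v0 , var v1 ⟩ᵗ ∈ᵈ con X)
            (λ s s⊆ ne → wf s (from ∈𝒫 s⊆) ne) (graph₁ (var v0))

      ranks⇒wf : ∀ {g u X p} → Ranks g u X → (∀ s → s ∈ p → s ⊆ u) → WF p X
      ranks⇒wf {g} {u} {X} R sub s s∈ (y , y∈) =
        let vals = sep (∃ᵈ (var v0 ∈ᵈ con s ∧ᵈ ⟨ var v0 , var v1 ⟩ᵗ ∈ᵈ con g)) (⋃ (⋃ g))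
            val : ∀ y → y ∈ s → ∃[ b ] (⟨ y , b ⟩ ∈ g)
            val y y∈ = let (t , t∈ , a , b , h , k) = ranked R y (sub s s∈ y y∈) in b , subst (_∈ g) (trans h (cong ⟨_, b ⟩ k)) t∈
            inVals : ∀ y b → y ∈ s → ⟨ y , b ⟩ ∈ g → b ∈ vals
            inVals y b y∈ h = from ∈sep (∈⋃⋃ʳ h , y , y∈ , h)
            (b , h) = val y y∈
            (m , m∈ , min) = foundation′ {vals} (b , inVals y b y∈ h)
            (_ , t , t∈ , k) = to ∈sep m∈
        in t , t∈ , λ y y∈ yt → let (b , h) = val y y∈ in min b (decreasing R y t yt y b h t m k refl refl) (inVals y b y∈ h)

    module Restriction (j M : Class) (elem : IsElementaryEmbedding j M) (tr : IsTransitive (_∈ᶜ M))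
      {ν μ : V} (Lν : Lim ν) (Lμ : Lim μ) (sub : ∀ x → x ∈ 𝕍 μ → x ∈ᶜ M)
      (cover : 𝕍 μ ⊆ Elementary.J j M elem tr (𝕍 ν)) where
      open Elementary j M elem tr

      opaque
        restriction : V → V
        restriction X = sep (var v0 ∈ᵈ con (J X)) (𝕍 μ)

        ∈restriction : x ∈ restriction X ⇔ (x ∈ 𝕍 μ × x ∈ J X)
        ∈restriction = ∈sep

      restrictionG : Graph₁ restriction
      restrictionG = byElements₁ (λ X x → ∈restriction) (var v0 ∈ᵈ con (𝕍 μ) ∧ᵈ var v0 ∈ᵈ Jᵗ (var v1))

      private
        U U′ : V
        U = 𝕍 ν
        U′ = 𝕍 μ
        pc : PairClosed U
        pc = 𝕍-pairClosed Lν
        pc′ : PairClosed U′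
        pc′ = 𝕍-pairClosed Lμ

      opaque
        -- Elementarity for the Δ₀ relation on 𝕍 ν, cut down to 𝕍 μ ⊆ J (𝕍 ν). Well-foundedness is
        -- different: it speaks of all subsets of 𝕍 μ, some of which `M` may lack, so the image of a
        -- ranking is used instead.
        restriction-rel : ∀ c {X Y W} → X ⊆ U → Y ⊆ U → W ⊆ U → Rel c U (𝒫 U) X Y W →
          Rel c U′ (𝒫 U′) (restriction X) (restriction Y) (restriction W)
        restriction-rel (nandᶜ r) {X} {Y} {W} X⊆ Y⊆ W⊆ h =
          let (_ , k) = to (J-Δ₀ (rel₀ (nandᶜ r)) (U ∷ 𝒫 U ∷ X ∷ Y ∷ W ∷ [])) h in
          (λ z z∈ → proj₁ (to ∈restriction z∈)) ,
          λ x x∈ → ∈restriction ⇔∘ mk⇔ proj₂ (x∈ ,_) ⇔∘ k x (cover x x∈) ⇔∘ ¬-⇔ (×-⇔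
            (mk⇔ (λ (y , y∈ , q) → y , from ∈restriction (run∈ pc′ r q x∈ , y∈) , q) (λ (y , y∈ , q) → y , proj₂ (to ∈restriction y∈) , q))
            (mk⇔ (λ p → from ∈restriction (x∈ , p)) (λ p → proj₂ (to ∈restriction p))))
        restriction-rel existᶜ {X} {Y} {W} X⊆ Y⊆ W⊆ h =
          let (_ , _ , k) = to (J-Δ₀ (rel₀ existᶜ) (U ∷ 𝒫 U ∷ X ∷ Y ∷ W ∷ [])) h in
          cong restriction (proj₁ h) , (λ z z∈ → proj₁ (to ∈restriction z∈)) ,
          λ x x∈ → ∈restriction ⇔∘ mk⇔ proj₂ (x∈ ,_) ⇔∘ k x (cover x x∈) ⇔∘ ∃-⇔ λ a → ∃-⇔ λ b → mk⇔
            (λ (x≡ , b′ , b′∈ , q) → x≡ , b′ , b′∈ , (let xx = subst (_∈ U′) x≡ x∈ in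
              from ∈restriction (op∈ pc′ (opˡ pc′ xx) (pc-tr pc′ b (opʳ pc′ xx) b′ b′∈) , q)))
            (λ (x≡ , b′ , b′∈ , q) → x≡ , b′ , b′∈ , proj₂ (to ∈restriction q))
        restriction-rel wfᶜ {X} {Y} {W} X⊆ Y⊆ W⊆ (e₁ , e₂ , wf) =
          cong restriction e₁ , cong restriction e₂ ,
          (let (g , R) = ranking wf X⊆ pc
               JR = to (J-Δ₀ ranks₀ (g ∷ U ∷ X ∷ [])) R
           in ranks⇒wf {g = J g} {u = U′} (mkRanks (λ y y∈ → ranked JR y (cover y y∈))
                (λ y x h → decreasing JR y x (proj₂ (to ∈restriction h)))) (λ s s∈ → to ∈𝒫 s∈))

      restriction-good : Good U U′ restriction
      restriction-good = record { e-⊆ = λ _ z z∈ → proj₁ (to ∈restriction z∈) ; e-rel = restriction-rel }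

  open Embeddings public

  -- Strongness expressed by sets.

  module Strongness where
    private variable
      n : ℕ
      a b c d x y z u w f X Y W α ξ κ μ ν : V

    allColours : {P : Colour → Vec V n → Set ℓ} → (∀ c → D₀ n (P c)) → D₀ n (λ ρ → ∀ c → P c ρ)
    allColours d = cast₀
      (λ ρ → mk⇔
        (λ { (h₁ , h₂ , h₃ , h₄ , h₅ , h₆ , h₇ , h₈) → λ
          { (nandᶜ idᵢ) → h₁ ; (nandᶜ dupᵢ) → h₂ ; (nandᶜ swapᵢ) → h₃ ; (nandᶜ fstᵢ) → h₄ ; (nandᶜ sndᵢ) → h₅ ; (nandᶜ popᵢ) → h₆
          ; existᶜ → h₇ ; wfᶜ → h₈ } })
        (λ h → h (nandᶜ idᵢ) , h (nandᶜ dupᵢ) , h (nandᶜ swapᵢ) , h (nandᶜ fstᵢ) , h (nandᶜ sndᵢ) , h (nandᶜ popᵢ) , h existᶜ , h wfᶜ))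
      (d (nandᶜ idᵢ) ∧₀ d (nandᶜ dupᵢ) ∧₀ d (nandᶜ swapᵢ) ∧₀ d (nandᶜ fstᵢ) ∧₀ d (nandᶜ sndᵢ) ∧₀ d (nandᶜ popᵢ) ∧₀ d existᶜ ∧₀ d wfᶜ)

    -- A set coding an embedding with critical point κ whose target contains u.
    record Witness (κ u p e : V) : Set ℓ where
      constructor mkWitness
      field
        w-pairs : ∀ z → z ∈ e → ∃[ a ] ∃[ b ] (z ≡ ⟨ a , b ⟩ × a ∈ p × b ∈ p)
        w-total : ∀ a → a ∈ p → ∃[ b ] (b ∈ p × ⟨ a , b ⟩ ∈ e)
        w-fun   : ∀ a b → ⟨ a , b ⟩ ∈ e → ∀ a′ b′ → ⟨ a′ , b′ ⟩ ∈ e → a ≡ a′ → b ≡ b′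
        w-rel   : ∀ c → ∀ X X′ → ⟨ X , X′ ⟩ ∈ e → ∀ Y Y′ → ⟨ Y , Y′ ⟩ ∈ e → ∀ W W′ → ⟨ W , W′ ⟩ ∈ e →
                  Rel c u p X Y W → Rel c u p X′ Y′ W′
        w-below : ∀ ξ → ξ ∈ κ → ⟨ ξ , ξ ⟩ ∈ e
        w-moved : ¬ ⟨ κ , κ ⟩ ∈ e
    open Witness public

    witness₀ : D₀ 4 (λ ρ → Witness (lookup ρ v0) (lookup ρ v1) (lookup ρ v2) (lookup ρ v3))
    witness₀ = cast₀
      (λ ρ → mk⇔ (λ (h₁ , h₂ , h₃ , h₄ , h₅ , h₆) → mkWitness h₁ h₂ h₃ h₄ h₅ h₆)
                  (λ w → w-pairs w , w-total w , w-fun w , w-rel w , w-below w , w-moved w))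
      (∀∈₀ v3 (unpair₀ v0 (v1 ∈₀ v5 ∧₀ v0 ∈₀ v5))
       ∧₀ ∀∈₀ v2 (∃∈₀ v3 (op∈₀ v1 v0 v5))
       ∧₀ ∀op∈₀ v3 (∀op∈₀ v5 (v3 ≡₀ v1 ⇒₀ v2 ≡₀ v0))
       ∧₀ allColours (λ c → ∀op∈₀ v3 (∀op∈₀ v5 (∀op∈₀ v7 (rel₀ c ₀[ v7 ∷ v8 ∷ v5 ∷ v3 ∷ v1 ∷ [] ] ⇒₀ rel₀ c ₀[ v7 ∷ v8 ∷ v4 ∷ v2 ∷ v0 ∷ [] ]))))
       ∧₀ ∀∈₀ v0 (op∈₀ v0 v0 v4)
       ∧₀ ¬₀ op∈₀ v0 v0 v3)

    Q : V → V → Set ℓ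
    Q κ μ = ∃[ e ] Witness κ (𝕍 μ) (𝒫 (𝕍 μ)) e

    Qᵈ : Def 2 (λ ρ → Q (lookup ρ v0) (lookup ρ v1))
    Qᵈ = ∃ᵈ (D₀⇒D witness₀ ᵈ[ var v1 ∷ 𝕍ᵗ (var v2) ∷ 𝒫ᵗ (𝕍ᵗ (var v2)) ∷ var v0 ∷ [] ])

    -- The definable form of strongness, equivalent to it for ordinals by `QAll⇒strong` and
    -- `strong⇒QAll`. It makes least strong cardinals and functions choosing failures available.
    QAll : V → Set ℓ
    QAll κ = ∀ μ → Lim μ → κ ∈ μ → Q κ μ

    QAllᵈ : Def 1 (λ ρ → QAll (lookup ρ v0))
    QAllᵈ = ∀ᵈ (D₀⇒D lim₀ ᵈ[ var v0 ∷ [] ] ⇒ᵈ var v1 ∈ᵈ var v0 ⇒ᵈ Qᵈ ᵈ[ var v1 ∷ var v0 ∷ [] ])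

    opaque
      witness-app : ∀ {p e} → Witness κ u p e → x ∈ p → ⟨ x , y ⟩ ∈ e → app e x ≡ y
      witness-app w x∈ h = app-unique (λ y′ h′ → w-fun w _ _ h _ _ h′ refl) h

      witness-val : ∀ {p e} → Witness κ u p e → x ∈ p → ⟨ x , app e x ⟩ ∈ e × app e x ∈ p
      witness-val {x = x} {p = p} {e = e} w x∈ = let (y , y∈ , h) = w-total w x x∈ ; k = sym (witness-app w x∈ h) in
        subst (λ y → ⟨ x , y ⟩ ∈ e) k h , subst (_∈ p) k y∈

      witness-good : ∀ {e} → Witness κ u (𝒫 u) e → Good u u (app e)
      witness-good w = record
        { e-⊆ = λ X⊆ → to ∈𝒫 (proj₂ (witness-val w (from ∈𝒫 X⊆)))
        ; e-rel = λ c X⊆ Y⊆ W⊆ → w-rel w c _ _ (proj₁ (witness-val w (from ∈𝒫 X⊆))) _ _ (proj₁ (witness-val w (from ∈𝒫 Y⊆)))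
                    _ _ (proj₁ (witness-val w (from ∈𝒫 W⊆))) }

      good-witness : {e : V → V} (gE : Graph₁ e) → Good u u e → κ ⊆ u → (∀ ξ → ξ ∈ κ → ξ ⊆ u × e ξ ≡ ξ) → e κ ≢ κ →
        Witness κ u (𝒫 u) (lam gE (𝒫 u))
      good-witness {u} {κ} {e} gE good κ⊆ fixed moved = mkWitness
        (λ z z∈ → let (a , a∈ , h) = fun-elem lam-fun z∈ in a , _ , h , a∈ , subst (_∈ 𝒫 u) (sym (app-lam a∈)) (val a a∈))
        (λ a a∈ → e a , val a a∈ , from ∈lam (a∈ , refl))
        (λ a b h a′ b′ h′ q → trans (proj₂ (to ∈lam h)) (trans (cong e q) (sym (proj₂ (to ∈lam h′)))))
        (λ c X X′ hX Y Y′ hY W W′ hW r → let (X∈ , X≡) = to ∈lam hX ; (Y∈ , Y≡) = to ∈lam hY ; (W∈ , W≡) = to ∈lam hW in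
          rel-subst c (sym X≡) (sym Y≡) (sym W≡) (Good.e-rel good c (to ∈𝒫 X∈) (to ∈𝒫 Y∈) (to ∈𝒫 W∈) r))
        (λ ξ ξ∈ → from ∈lam (from ∈𝒫 (proj₁ (fixed ξ ξ∈)) , sym (proj₂ (fixed ξ ξ∈))))
        (λ h → moved (sym (proj₂ (to ∈lam h))))
        where
          val : ∀ a → a ∈ 𝒫 u → e a ∈ 𝒫 u
          val a a∈ = from ∈𝒫 (Good.e-⊆ good (to ∈𝒫 a∈))
          rel-subst : ∀ c {X X′ Y Y′ W W′} → X ≡ X′ → Y ≡ Y′ → W ≡ W′ → Rel c u (𝒫 u) X Y W → Rel c u (𝒫 u) X′ Y′ W′
          rel-subst c refl refl refl r = r

      -- The witness is the map sending X to J X ∩ 𝕍 μ. Source and target stage coincide here, since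
      -- μ ⊆ J μ yields 𝕍 μ ⊆ J (𝕍 μ).
      embedding⇒Q : ∀ j M (elem : IsElementaryEmbedding j M) (tr : IsTransitive (_∈ᶜ M)) → Lim μ → (∀ x → x ∈ 𝕍 μ → x ∈ᶜ M) →
        κ ∈ μ → (∀ α → α ∈ κ → ⟨ α , α ⟩ ∈ᶜ j) → ¬ ⟨ κ , κ ⟩ ∈ᶜ j → Q κ μ
      embedding⇒Q {μ} {κ} j M elem tr L sub κ∈ fixed moved =
          _ , good-witness restrictionG restriction-good κ⊆ fix moves
        where
          open Elementary j M elem tr
          oμ : Ord μ
          oμ = lim-ord L
          oκ : Ord κ
          oκ = ord-∈ oμ κ∈
          open Restriction j M elem tr L L sub (⊆J-𝕍 oμ L sub (J-increases μ oμ))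
          κ⊆ : κ ⊆ 𝕍 μ
          κ⊆ ξ ξ∈ = ord⊆𝕍 μ oμ ξ (∈⇒⊆ oμ κ∈ ξ ξ∈)
          fix : ∀ ξ → ξ ∈ κ → ξ ⊆ 𝕍 μ × restriction ξ ≡ ξ
          fix ξ ξ∈ = ξ⊆ , ⊆-antisym (λ z z∈ → subst (z ∈_) (sym (to ∈j (fixed ξ ξ∈))) (proj₂ (to ∈restriction z∈)))
                                      (λ z z∈ → from ∈restriction (ξ⊆ z z∈ , subst (z ∈_) (to ∈j (fixed ξ ξ∈)) z∈))
            where
              ξ⊆ : ξ ⊆ 𝕍 μ
              ξ⊆ z z∈ = κ⊆ z (∈⇒⊆ oκ ξ∈ z z∈)
          moves : restriction κ ≢ κ
          moves h = moved (from ∈j ([ (λ k → ⊥-elim (∈-irrefl (subst (κ ∈_) h (from ∈restriction (ord⊆𝕍 μ oμ κ κ∈ , k))))) , id ]′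
            (⊆⇒≤ oκ (J-ord oκ) (J-increases κ oκ))))

      -- On elements of 𝕍 μ, the ultrapower image of a set agrees with its image under `e`. Hence α
      -- ∈ J α would give α ∈ α for α below κ, and J κ = κ would give a fixed κ for the witness.
      Q⇒embedding : Lim μ → κ ∈ μ → Q κ μ → ∃[ j ] ∃[ M ] (IsElementaryEmbedding j M × IsTransitive (_∈ᶜ M) ×
        (∀ α → α ∈ κ → ⟨ α , α ⟩ ∈ᶜ j) × ¬ ⟨ κ , κ ⟩ ∈ᶜ j × ∀ x → x ∈ 𝕍 μ → x ∈ᶜ M)
      Q⇒embedding {μ} {κ} L κ∈ (e , w) = T.j , T.M , T.j-elementary , T.M-transitive , fixed , moved , T.u′⊆M
        where
          pc : PairClosed (𝕍 μ)
          pc = 𝕍-pairClosed L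
          oμ : Ord μ
          oμ = lim-ord L
          oκ : Ord κ
          oκ = ord-∈ oμ κ∈
          module T = Transitive (𝕍 μ) (𝕍 μ) pc pc (app e) (graph₁ (appᵗ (con e) (var v0))) (witness-good w)
          module E = Elementary T.j T.M T.j-elementary T.M-transitive
          J≡ : ∀ x → E.J x ≡ T.J x
          J≡ x = to T.∈j (from E.∈j refl)
          ⊆u : ∀ α → Ord α → α ⊆ μ → α ⊆ 𝕍 μ
          ⊆u α o h ξ ξ∈ = ord⊆𝕍 μ oμ ξ (h ξ ξ∈)
          κ⊆μ : κ ⊆ μ
          κ⊆μ = ∈⇒⊆ oμ κ∈
          fixed : ∀ α → α ∈ κ → ⟨ α , α ⟩ ∈ᶜ T.j
          fixed α α∈ = from E.∈j (sym ([ (λ h → ⊥-elim (∈-irrefl (subst (α ∈_) eα (to (T.J-restricts α⊆ (ord⊆𝕍 μ oμ α (κ⊆μ α α∈))) (subst (α ∈_) (J≡ α) h))))) , sym ]′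
              (⊆⇒≤ oα (E.J-ord oα) (E.J-increases α oα))))
            where
              oα : Ord α
              oα = ord-∈ oκ α∈
              α⊆ : α ⊆ 𝕍 μ
              α⊆ = ⊆u α oα (∈⇒⊆ oμ (κ⊆μ α α∈))
              eα : app e α ≡ α
              eα = witness-app w (from ∈𝒫 α⊆) (w-below w α α∈)
          moved : ¬ ⟨ κ , κ ⟩ ∈ᶜ T.j
          moved h = w-moved w (subst (λ y → ⟨ κ , y ⟩ ∈ e) (extensionality λ z → mk⇔
              (λ z∈ → let z∈u = to ∈𝒫 (proj₂ (witness-val w κ∈p)) z z∈ in subst (z ∈_) Jκ (from (T.J-restricts κ⊆ z∈u) z∈))
              (λ z∈ → to (T.J-restricts κ⊆ (κ⊆ z z∈)) (subst (z ∈_) (sym Jκ) z∈)))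
            (proj₁ (witness-val w κ∈p)))
            where
              κ⊆ : κ ⊆ 𝕍 μ
              κ⊆ = ⊆u κ oκ κ⊆μ
              κ∈p : κ ∈ 𝒫 (𝕍 μ)
              κ∈p = from ∈𝒫 κ⊆
              Jκ : T.J κ ≡ κ
              Jκ = sym (to T.∈j h)

      -- A bijection from α ∈ κ onto κ has arguments and values below κ, which are fixed, so its
      -- image has the same values. The image is onto J κ, whence J κ ⊆ κ.
      critical-cardinal : ∀ j M → IsElementaryEmbedding j M → IsTransitive (_∈ᶜ M) → Ord κ →
        (∀ α → α ∈ κ → ⟨ α , α ⟩ ∈ᶜ j) → ¬ ⟨ κ , κ ⟩ ∈ᶜ j → IsCardinal κ
      critical-cardinal {κ} j M elem tr oκ fixed moved = fromOrd oκ , λ α α∈ (f , F , val , sur) →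
        let Jα = to ∈j (fixed α α∈)
            funct = to (J-Δ₀ {P = λ ρ → ∀ a b → ⟨ a , b ⟩ ∈ lookup ρ v0 → ∀ a′ b′ → ⟨ a′ , b′ ⟩ ∈ lookup ρ v0 → a ≡ a′ → b ≡ b′}
                    (∀op∈₀ v0 (∀op∈₀ v2 (v3 ≡₀ v1 ⇒₀ v2 ≡₀ v0))) (f ∷ []))
                    (λ { a b h a′ b′ h′ refl → trans (sym (app-≡ (fun F) h)) (app-≡ (fun F) h′) })
            onto = to (J-Δ₀ {P = λ ρ → ∀ y → y ∈ lookup ρ v2 → ∃[ x ] (x ∈ lookup ρ v1 × ⟨ x , y ⟩ ∈ lookup ρ v0)}
                    (∀∈₀ v2 (∃∈₀ v2 (op∈₀ v0 v1 v2))) (f ∷ α ∷ κ ∷ []))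
                    (λ y y∈ → let (x , h , _) = sur y y∈ in x , fun-dom (fun F) h , h)
        in moved (from ∈j (⊆-antisym (J-increases κ oκ) λ y y∈ →
             let (x , x∈ , h) = onto y y∈
                 x∈α = subst (x ∈_) (sym Jα) x∈
                 h₀ = app∈ (fun F) x∈α
                 y₀∈ = val x (app f x) h₀
                 Jh₀ = subst (_∈ J f) (trans J-op (cong₂ ⟨_,_⟩ (sym (to ∈j (fixed x (∈⇒⊆ oκ α∈ x x∈α)))) (sym (to ∈j (fixed (app f x) y₀∈))))) (to J-∈ h₀)
             in subst (_∈ κ) (funct x (app f x) Jh₀ x y h refl) y₀∈))
        where open Elementary j M elem tr

      QAll⇒strong : Ord κ → QAll κ → IsStrong κ
      QAll⇒strong {κ} oκ q = cardinal , λ μ (oμ , _) κ∈ →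
          let (λ′ , L , μ∈) = limitAbove (toOrd oμ)
              (j , M , elem , tr , fixed , moved , sub) = Q⇒embedding L (trans-ord (lim-ord L) μ μ∈ κ κ∈) (q λ′ L (trans-ord (lim-ord L) μ μ∈ κ κ∈))
          in j , M , elem , tr , (fromOrd oκ , fixed , moved) , λ w x st x∈ →
               sub x (𝕍-mono (lim-ord L) (∈⇒⊆ (lim-ord L) μ∈) (toOrd oμ) x (to (∈stage (toOrd oμ) st) x∈))
        where
          cardinal : IsCardinal κ
          cardinal = let (λ′ , L , κ∈) = limitAbove oκ ; (j , M , elem , tr , fixed , moved , _) = Q⇒embedding L κ∈ (q λ′ L κ∈) in
            critical-cardinal j M elem tr oκ fixed moved

      strongUpTo⇒Q : Ord ν → IsStrongUpTo ν κ → Lim μ → μ ⊆ ν → κ ∈ μ → Q κ μ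
      strongUpTo⇒Q oν (j , M , elem , tr , (_ , fixed , moved) , sub) L μ⊆ κ∈ =
        embedding⇒Q j M elem tr L (λ x x∈ → sub _ x (𝕍-stage oν) (𝕍-mono oν μ⊆ (lim-ord L) x x∈)) κ∈ fixed moved

  open Strongness public

  -- Unboundedness of the cardinals and of a proper class of strong cardinals.

  module Cardinals where
    private variable
      n : ℕ
      a b d x y z f g α β β′ γ δ κ μ ν : V

    -- Hartogs: if no cardinal exceeds α, every ordinal is the range of a function on some γ ≤ α,
    -- and is then determined by γ and the relation f x ∈ f y on γ.

    record Onto (f γ β : V) : Set ℓ where
      constructor mkOnto
      field
        onto-fun : Fun f γ
        onto-in  : ∀ x → x ∈ γ → app f x ∈ β
        onto-all : ∀ y → y ∈ β → ∃[ x ] (x ∈ γ × app f x ≡ y)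
    open Onto

    ontoᵈ : Def 3 (λ ρ → Onto (lookup ρ v0) (lookup ρ v1) (lookup ρ v2))
    ontoᵈ = castᵈ (λ ρ → mk⇔ (λ (h , k , l) → mkOnto h k l) (λ o → onto-fun o , onto-in o , onto-all o))
      (funᵈ ᵈ[ var v0 ∷ var v1 ∷ [] ] ∧ᵈ ∀ᵈ (var v0 ∈ᵈ var v2 ⇒ᵈ appᵗ (var v1) (var v0) ∈ᵈ var v3)
       ∧ᵈ ∀ᵈ (var v0 ∈ᵈ var v3 ⇒ᵈ ∃ᵈ (var v0 ∈ᵈ var v3 ∧ᵈ appᵗ (var v2) (var v0) ≡ᵈ var v1)))

    opaque
      order-of : V → V → V
      order-of f γ = sep (∃ᵈ (∃ᵈ (var v2 ≡ᵈ ⟨ var v1 , var v0 ⟩ᵗ ∧ᵈ appᵗ (con f) (var v1) ∈ᵈ appᵗ (con f) (var v0)))) (γ ⊗ γ)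

      ∈order : x ∈ γ → y ∈ γ → ⟨ x , y ⟩ ∈ order-of f γ ⇔ app f x ∈ app f y
      ∈order {x} {γ} {y} {f} x∈ y∈ = sepIn (from ∈⊗ (x , y , x∈ , y∈ , refl)) ⇔∘ mk⇔
        (λ (a , b , h , k) → subst₂ (λ p q → app f p ∈ app f q) (sym (pair-inj₁ h)) (sym (pair-inj₂ h)) k) (λ h → x , y , refl , h)

      order∈ : order-of f γ ∈ 𝒫 (γ ⊗ γ)
      order∈ = from ∈𝒫 sep⊆

      order-determines : Ord β → Ord β′ → Onto f γ β → Onto g γ β′ → order-of f γ ≡ order-of g γ → β ≡ β′
      order-determines {β} {β′} {f} {γ} {g} oβ oβ′ F G same = extensionality λ z → mk⇔
          (λ z∈ → let (x , x∈ , h) = onto-all F z z∈ in subst (_∈ β′) (trans (sym (agree x x∈)) h) (onto-in G x x∈))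
          (λ z∈ → let (x , x∈ , h) = onto-all G z z∈ in subst (_∈ β) (trans (agree x x∈) h) (onto-in F x x∈))
        where
          transfer : ∀ x y → x ∈ γ → y ∈ γ → app f x ∈ app f y ⇔ app g x ∈ app g y
          transfer x y x∈ y∈ = ⇔-sym (∈order x∈ y∈) ⇔∘ ≡-⇔ (cong (⟨ x , y ⟩ ∈_) same) ⇔∘ ∈order x∈ y∈
          agree : ∀ x → x ∈ γ → app f x ≡ app g x
          agree = wfInduction {R = λ y x → app f y ∈ app f x} (appᵗ (con f) (var v0) ≡ᵈ appᵗ (con g) (var v0))
            (λ s s⊆ (x , x∈) → let
                imf = im {F = app f} (graph₁ (appᵗ (con f) (var v0))) s
                (m , m∈ , min) = foundation′ {imf} (app f x , im∋ x∈)
                (t , t∈ , h) = to ∈im m∈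
              in t , t∈ , λ y y∈ k → min (app f y) (subst (app f y ∈_) (sym h) k) (im∋ y∈))
            λ x x∈ ih → extensionality λ z → mk⇔
              (λ z∈ → let (y , y∈ , h) = onto-all F z (trans-ord oβ _ (onto-in F x x∈) z z∈)
                          yx = subst (_∈ app f x) (sym h) z∈
                      in subst (_∈ app g x) (trans (sym (ih y y∈ yx)) h) (to (transfer y x y∈ x∈) yx))
              (λ z∈ → let (y , y∈ , h) = onto-all G z (trans-ord oβ′ _ (onto-in G x x∈) z z∈)
                          yx = from (transfer y x y∈ x∈) (subst (_∈ app g x) (sym h) z∈)
                      in subst (_∈ app f x) (trans (ih y y∈ yx) h) yx)

      cardinalsUnbounded : Ord α → ∃[ κ ] (IsCardinal κ × α ∈ κ)
      cardinalsUnbounded {α} oα = byContra λ none → ordinals-unbounded λ β oβ →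
          let (γ , γ∈ , f , F) = small none β oβ in
          from (proj₂ types β) (⟨ γ , order-of f γ ⟩ , from ∈⊗ (γ , order-of f γ , γ∈ , order∈′ γ∈ , refl) , oβ , γ , f , F , refl)
        where
          pairs : V
          pairs = 𝒫 (S α ⊗ S α)
          order∈′ : ∀ {γ f} → γ ∈ S α → order-of f γ ∈ pairs
          order∈′ {γ} γ∈ = from ∈𝒫 λ z z∈ → let (x , y , x∈ , y∈ , h) = to ∈⊗ (to ∈𝒫 order∈ z z∈) ; γ⊆ = ∈⇒⊆ (ord-S oα) γ∈ in
            from ∈⊗ (x , y , γ⊆ x x∈ , γ⊆ y y∈ , h)
          orderG : Graph₂ order-of
          orderG = byElements₂ (λ f γ z → ∈sep) (var v0 ∈ᵈ fn₂ ⊗G (var v2) (var v2) ∧ᵈ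
            ∃ᵈ (∃ᵈ (var v2 ≡ᵈ ⟨ var v1 , var v0 ⟩ᵗ ∧ᵈ appᵗ (var v3) (var v1) ∈ᵈ appᵗ (var v3) (var v0))))
          types : ∃[ T ] ∀ β → β ∈ T ⇔ (∃[ t ] (t ∈ S α ⊗ pairs × Ord β × ∃[ γ ] ∃[ f ] (Onto f γ β × t ≡ ⟨ γ , order-of f γ ⟩)))
          types = repl (ordᵈ ᵈ[ var v1 ∷ [] ] ∧ᵈ ∃ᵈ (∃ᵈ (ontoᵈ ᵈ[ var v0 ∷ var v1 ∷ var v3 ∷ [] ] ∧ᵈ var v2 ≡ᵈ ⟨ var v1 , fn₂ orderG (var v0) (var v1) ⟩ᵗ)))
            (S α ⊗ pairs) λ { t β β′ _ (oβ , γ , f , F , h) (oβ′ , γ′ , f′ , F′ , h′) →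
              determined oβ oβ′ F F′ (pair-inj (trans (sym h) h′)) }
            where
              determined : ∀ {β β′ f f′ γ γ′} → Ord β → Ord β′ → Onto f γ β → Onto f′ γ′ β′ →
                (γ ≡ γ′ × order-of f γ ≡ order-of f′ γ′) → β ≡ β′
              determined oβ oβ′ F F′ (refl , h) = order-determines oβ oβ′ F F′ h
          -- Induction on β: an ordinal above α fails to be a cardinal, so it is a bijective image
          -- of a smaller ordinal, whose enumeration is composed with the bijection.
          small : ¬ (∃[ κ ] (IsCardinal κ × α ∈ κ)) → ∀ β → Ord β → ∃[ γ ] (γ ∈ S α × ∃[ f ] Onto f γ β)
          small none = ∈-induction (ordᵈ ⇒ᵈ ∃ᵈ (var v0 ∈ᵈ con (S α) ∧ᵈ ∃ᵈ (ontoᵈ ᵈ[ var v0 ∷ var v1 ∷ var v2 ∷ [] ]))) step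
            where
              step : ∀ β → (∀ δ → δ ∈ β → Ord δ → ∃[ γ ] (γ ∈ S α × ∃[ f ] Onto f γ δ)) → Ord β → ∃[ γ ] (γ ∈ S α × ∃[ f ] Onto f γ β)
              step β ih oβ = [ (λ h → β , h , lam (graph₁ (var v0)) β , mkOnto lam-fun (λ x x∈ → subst (_∈ β) (sym (app-lam x∈)) x∈) (λ y y∈ → y , y∈ , app-lam y∈))
                  , (λ n → compose (byContra λ nc → none (β , (fromOrd oβ , λ δ δ∈ h → nc (δ , δ∈ , h)) ,
                       [ id , (λ h → ⊥-elim (n h)) ]′ (α∈β n)))) ]′ (lem (β ∈ S α))
                where
                  α∈β : ¬ β ∈ S α → α ∈ β ⊎ β ∈ S α
                  α∈β n = [ (λ h → inj₂ (from ∈S (inj₁ h))) , [ (λ h → inj₂ (from ∈S (inj₂ h))) , inj₁ ]′ ]′ (trichotomy oβ oα)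
                  compose : ∃[ δ ] (δ ∈ β × ∃[ h ] IsBijection h δ β) → ∃[ γ ] (γ ∈ S α × ∃[ f ] Onto f γ β)
                  compose (δ , δ∈ , h , hF , hval , hsur) =
                    let (γ , γ∈ , f , F) = ih δ δ∈ (ord-∈ oβ δ∈) in γ , γ∈ , lam (graph₁ (appᵗ (con h) (appᵗ (con f) (var v0)))) γ , mkOnto lam-fun
                      (λ x x∈ → subst (_∈ β) (sym (app-lam x∈)) (hval _ _ (app∈ (fun hF) (onto-in F x x∈))))
                      (λ y y∈ → let (d , dy , _) = hsur y y∈ ; (x , x∈ , k) = onto-all F d (fun-dom (fun hF) dy) in
                        x , x∈ , trans (app-lam x∈) (trans (cong (app h) k) (app-≡ (fun hF) dy)))

      strong⇒QAll : IsStrong κ → QAll κ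
      strong⇒QAll (_ , s) μ L κ∈ = let (ν , cν , μ∈) = cardinalsUnbounded (lim-ord L) ; oν = toOrd (proj₁ cν) in
        strongUpTo⇒Q oν (s ν cν (trans-ord oν μ μ∈ _ κ∈)) L (∈⇒⊆ oν μ∈) κ∈

      -- Properness excludes only that the class is a set. The strong cardinals up to α do form a
      -- set, because `QAll` is a formula to which separation applies.
      strongUnbounded : Proper IsStrong → Ord α → ∃[ κ ] (IsStrong κ × α ∈ κ)
      strongUnbounded {α} proper oα = byContra λ none → proper (sep (ordᵈ ∧ᵈ QAllᵈ) (S α) , λ κ → ∈sep ⇔∘ mk⇔
          (λ (_ , o , q) → QAll⇒strong o q)
          (λ s → [ id , (λ h → ⊥-elim (none (κ , s , h))) ]′ (below (toOrd (proj₁ (proj₁ s)))) , toOrd (proj₁ (proj₁ s)) , strong⇒QAll s))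
        where
          below : ∀ {κ} → Ord κ → κ ∈ S α ⊎ α ∈ κ
          below o = [ (λ h → inj₁ (from ∈S (inj₁ h))) , [ (λ h → inj₁ (from ∈S (inj₂ h))) , inj₂ ]′ ]′ (trichotomy o oα)

  open Cardinals public

  -- Products of graphs, downward absoluteness, and sets fixed by an embedding.

  module Products where
    private variable
      n : ℕ
      a b x y z f g A B α β γ δ κ ν : V

    opaque
      vertex-op : Vertex ⟨ A , B ⟩ x ⇔ x ∈ A
      vertex-op {A} {B} {x} = mk⇔ (λ (G , E , h , k) → subst (x ∈_) (sym (pair-inj₁ h)) k) (λ k → A , B , refl , k)

      edge-op : Edge ⟨ A , B ⟩ x y ⇔ ⟨ x , y ⟩ ∈ B
      edge-op {A} {B} {x} {y} = mk⇔ (λ (G , E , h , k) → subst (⟨ x , y ⟩ ∈_) (sym (pair-inj₂ h)) k) (λ k → A , B , refl , k)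

    vertex₀ : D₀ 2 (λ ρ → Vertex (lookup ρ v0) (lookup ρ v1))
    vertex₀ = unpair₀ v0 (v3 ∈₀ v1)

    edge₀ : D₀ 3 (λ ρ → Edge (lookup ρ v0) (lookup ρ v1) (lookup ρ v2))
    edge₀ = unpair₀ v0 (op∈₀ v3 v4 v0)

    vertexᵈ : Def 2 (λ ρ → Vertex (lookup ρ v0) (lookup ρ v1))
    vertexᵈ = D₀⇒D vertex₀

    edgeᵈ : Def 3 (λ ρ → Edge (lookup ρ v0) (lookup ρ v1) (lookup ρ v2))
    edgeᵈ = D₀⇒D edge₀

    FunParts : V → V → Set ℓ
    FunParts f A = (∀ z → z ∈ f → ∃[ x ] ∃[ y ] (z ≡ ⟨ x , y ⟩ × x ∈ A)) ×
      (∀ x → x ∈ A → ∃[ s ] ∃[ t ] (⟨ s , t ⟩ ∈ f × s ≡ x × (∀ s′ t′ → ⟨ s′ , t′ ⟩ ∈ f → s′ ≡ x → t ≡ t′)))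

    opaque
      fun-parts : Fun f A → FunParts f A
      fun-parts F = (λ z z∈ → let (x , y , x∈ , z≡) = proj₁ (isFun F) z z∈ in x , y , z≡ , x∈) ,
          λ x x∈ → let (y , h , un) = proj₂ (isFun F) x x∈ in x , y , h , refl , λ { s t k refl → un k }

      parts-fun : FunParts f A → Fun f A
      parts-fun {f} {A} P = fun ((λ z z∈ → let (x , y , z≡ , x∈) = proj₁ P z z∈ in x , y , x∈ , z≡) , λ x x∈ → value x (proj₂ P x x∈))
        where
          value : ∀ x → ∃[ s ] ∃[ t ] (⟨ s , t ⟩ ∈ f × s ≡ x × (∀ s′ t′ → ⟨ s′ , t′ ⟩ ∈ f → s′ ≡ x → t ≡ t′)) → ∃! _≡_ λ y → ⟨ x , y ⟩ ∈ f
          value x (s , t , h , s≡ , un) = t , subst (λ s → ⟨ s , t ⟩ ∈ f) s≡ h , λ h → un _ _ h refl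

    fun₀ : D₀ 2 (λ ρ → Fun (lookup ρ v0) (lookup ρ v1))
    fun₀ = cast₀ (λ ρ → mk⇔ parts-fun fun-parts)
      (∀∈₀ v0 (unpair₀ v0 (v1 ∈₀ v4)) ∧₀ ∀∈₀ v1 (∃op∈₀ v1 (v1 ≡₀ v2 ∧₀ ∀op∈₀ v3 (v1 ≡₀ v4 ⇒₀ v2 ≡₀ v0))))

    -- Products

    record InProduct (f S : V) : Set ℓ where
      constructor mkInProduct
      field
        ip-fun : Fun f S
        ip-val : ∀ A x → ⟨ A , x ⟩ ∈ f → Vertex A x
    open InProduct public

    record ProductEdge (f g : V) : Set ℓ where
      constructor mkProductEdge
      field pe-val : ∀ A x → ⟨ A , x ⟩ ∈ f → ∀ A′ y → ⟨ A′ , y ⟩ ∈ g → A ≡ A′ → Edge A x y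
    open ProductEdge public

    inProduct₀ : D₀ 2 (λ ρ → InProduct (lookup ρ v0) (lookup ρ v1))
    inProduct₀ = cast₀ (λ ρ → mk⇔ (λ (h , k) → mkInProduct h k) (λ p → ip-fun p , ip-val p)) (fun₀ ∧₀ ∀op∈₀ v0 (vertex₀ ₀[ v1 ∷ v0 ∷ [] ]))

    productEdge₀ : D₀ 2 (λ ρ → ProductEdge (lookup ρ v0) (lookup ρ v1))
    productEdge₀ = cast₀ (λ ρ → mk⇔ mkProductEdge pe-val) (∀op∈₀ v0 (∀op∈₀ v3 (v3 ≡₀ v1 ⇒₀ edge₀ ₀[ v3 ∷ v2 ∷ v0 ∷ [] ])))

    module Product (S : V) where
      opaque
        vertices edges : V
        -- Three unions reach the vertices: x ∈ G, where `G` is an element of `pair G E`, which is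
        -- an element of the coded graph, which is an element of `S`.
        vertices = sep (D₀⇒D inProduct₀ ᵈ[ var v0 ∷ con S ∷ [] ]) (funset S (⋃ (⋃ (⋃ S))))
        edges = sep (∃ᵈ (∃ᵈ (var v2 ≡ᵈ ⟨ var v1 , var v0 ⟩ᵗ ∧ᵈ D₀⇒D productEdge₀ ᵈ[ var v1 ∷ var v0 ∷ [] ]))) (vertices ⊗ vertices)

        ∈vertices : f ∈ vertices ⇔ InProduct f S
        ∈vertices {f} = ∈sep ⇔∘ mk⇔ proj₂ (λ p → from ∈funset (ip-fun p , λ x x∈ →
          let (G , E , h , k) = ip-val p x (app f x) (app∈ (ip-fun p) x∈) in
          from ∈⋃ (G , from ∈⋃ (pair G E , from ∈⋃ (x , x∈ , subst (pair G E ∈_) (sym h) ∈pairʳ) , ∈pairˡ) , k)) , p)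

        ∈edges : ⟨ f , g ⟩ ∈ edges ⇔ (InProduct f S × InProduct g S × ProductEdge f g)
        ∈edges {f} {g} = ∈sep ⇔∘ mk⇔
          (λ (h , a , b , k , p) → let (x , y , x∈ , y∈ , l) = to ∈⊗ h in
            to ∈vertices (subst (_∈ vertices) (sym (pair-inj₁ l)) x∈) , to ∈vertices (subst (_∈ vertices) (sym (pair-inj₂ l)) y∈) ,
            subst₂ ProductEdge (sym (pair-inj₁ k)) (sym (pair-inj₂ k)) p)
          (λ (p , q , r) → from ∈⊗ (f , g , from ∈vertices p , from ∈vertices q , refl) , f , g , refl , r)

        edges⊆ : edges ⊆ vertices ⊗ vertices
        edges⊆ = sep⊆

      product : V
      product = ⟨ vertices , edges ⟩

      opaque
        isProduct : IsProduct S product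
        isProduct =
          (vertices , edges , refl , λ z z∈ → to ∈⊗ (edges⊆ z z∈)) ,
          (λ f → vertex-op ⇔∘ ∈vertices ⇔∘ mk⇔
            (λ p → isFun (ip-fun p) , λ A x _ → ip-val p A x)
            (λ (F , h) → mkInProduct (fun F) λ A x k → h A x (fun-dom (fun F) k) k)) ,
          λ f g → edge-op ⇔∘ ∈edges ⇔∘ mk⇔
            (λ (p , q , r) → from vertex-op (from ∈vertices p) , from vertex-op (from ∈vertices q) , λ A x y _ h k → pe-val r A x h A y k refl)
            (λ (p , q , r) → let p′ = to ∈vertices (to vertex-op p) ; q′ = to ∈vertices (to vertex-op q) in
              p′ , q′ , mkProductEdge λ { A x h A′ y k refl → r A x y (fun-dom (ip-fun p′) h) h k })

    Π₁-down : {φ : Formula n} → IsΠ 1 φ → ∀ (M : V → Set ℓ) → IsTransitive M → ∀ ρ → (∀ i → M (lookup ρ i)) → Sat All φ ρ → Sat M φ ρ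
    Π₁-down (Σ⇒ (Δ₀ p)) M tr ρ m s = from (Sat-Δ₀ M tr p ρ m) s
    Π₁-down (all p) M tr ρ m s = λ x mx → Π₁-down p M tr (x ∷ ρ) (λ { zero → mx ; (suc i) → m i }) (s x tt)

    -- The stage 𝕍 β is taken large enough to contain witnesses for the existential block; the
    -- remaining Π₁ formula goes down to every transitive class containing its parameters.
    Σ₂-down : {φ : Formula n} → IsΣ 2 φ → ∀ ρ → Sat All φ ρ → ∃[ β ] (Ord β ×
      ∀ (M : V → Set ℓ) → IsTransitive M → (∀ x → x ∈ 𝕍 β → M x) → (∀ i → M (lookup ρ i)) → Sat M φ ρ)
    Σ₂-down (Π⇒ p) ρ s = ∅ , ord-∅ , λ M tr _ m → Π₁-down p M tr ρ m s
    Σ₂-down (ex p) ρ (x , _ , s) =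
      let (β , oβ , h) = Σ₂-down p (x ∷ ρ) s
          (α , oα , x∈) = everySetRanked x
          (γ , oγ , α∈ , β∈) = ord-max oα oβ
      in γ , oγ , λ M tr sub m → let mx = sub x (𝕍-mono oγ (∈⇒⊆ oγ α∈) oα x x∈) in
           x , mx , h M tr (λ y y∈ → sub y (𝕍-mono oγ (∈⇒⊆ oγ β∈) oβ y y∈)) λ { zero → mx ; (suc i) → m i }

    opaque
      vecRanked : (ρ : Vec V n) → ∃[ β ] (Ord β × ∀ i → lookup ρ i ∈ 𝕍 β)
      vecRanked []      = ∅ , ord-∅ , λ ()
      vecRanked (x ∷ ρ) =
        let (β , oβ , h) = vecRanked ρ ; (α , oα , x∈) = everySetRanked x ; (γ , oγ , α∈ , β∈) = ord-max oα oβ in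
        γ , oγ , λ { zero → 𝕍-mono oγ (∈⇒⊆ oγ α∈) oα x x∈ ; (suc i) → 𝕍-mono oγ (∈⇒⊆ oγ β∈) oβ _ (h i) }

      -- One function witnesses membership in all stages up to ν. This uniformity is used where a
      -- single existential witness has to serve all pairs of a set.
      inStage-hierarchy : Ord ν → Ord γ → γ ⊆ ν → x ∈ 𝕍 γ → InStage x γ (hierarchy ν)
      inStage-hierarchy {ν} {γ} {x} oν oγ γ⊆ h =
        inStage (coherent-values (inStage-complete oν (𝕍-mono oν γ⊆ oγ x h)))
          (let (δ , δ∈ , s) = to (∈𝕍 oγ) h in δ , 𝕍 δ , hier δ (γ⊆ δ δ∈) , δ∈ , s)
        where
          opaque
            unfolding hierarchy
            hier : ∀ δ → δ ∈ ν → ⟨ δ , 𝕍 δ ⟩ ∈ hierarchy ν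
            hier δ δ∈ = from ∈lam (δ∈ , refl)

    module FixedStages (j M : Class) (elem : IsElementaryEmbedding j M) (tr : IsTransitive (_∈ᶜ M)) {κ : V} (oκ : Ord κ)
      (fixed : ∀ α → α ∈ κ → Elementary.J j M elem tr α ≡ α) where
      open Elementary j M elem tr

      opaque
        J-fixes-stages : ∀ γ → γ ∈ κ → ∀ x → x ⊆ 𝕍 γ → J x ≡ x
        J-fixes-stages = wfInduction (∀ᵈ (⊆ᵈ ᵈ[ var v0 ∷ 𝕍ᵗ (var v1) ∷ [] ] ⇒ᵈ Jᵗ (var v0) ≡ᵈ var v0)) (∈-wf κ) λ γ γ∈ ih x x⊆ →
          let oγ = ord-∈ oκ γ∈
              below : ∀ y → y ∈ 𝕍 γ → J y ≡ y
              below y y∈ = let (δ , δ∈ , s) = to (∈𝕍 oγ) y∈ in ih δ (∈⇒⊆ oκ γ∈ δ δ∈) δ∈ y s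
          in ⊆-antisym
            (λ y y∈ → let y∈γ = subst (λ δ → y ∈ 𝕍 δ) (fixed γ γ∈) (J-𝕍⊆ oγ y (J-⊆ x⊆ y y∈)) in
              from J-∈ (subst (_∈ J x) (sym (below y y∈γ)) y∈))
            (λ y y∈ → subst (_∈ J x) (below y (x⊆ y y∈)) (to J-∈ y∈))

        J-fixes : x ∈ 𝕍 κ → J x ≡ x
        J-fixes {x} x∈ = let (γ , γ∈ , s) = to (∈𝕍 oκ) x∈ in J-fixes-stages γ γ∈ x s

  open Products public

  -- Embeddings at the least strong cardinal above the parameters.

  module LeastStrongs where
    private variable
      n : ℕ
      a b x y z u v X W α γ κ μ ν : V

    opaque
      witness∈ : Lim ν → μ ∈ ν → Witness κ (𝕍 μ) (𝒫 (𝕍 μ)) x → x ∈ 𝕍 ν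
      witness∈ {ν} {μ} L μ∈ W = ⊆𝕍⇒∈ (lim-ord L) (lim-S L _ (lim-S L _ (lim-S L μ μ∈))) λ z z∈ →
          let (a , b , z≡ , a∈ , b∈) = w-pairs W z z∈ in subst (_∈ 𝕍 (S (S (S μ)))) (sym z≡) (op-stage (ord-S oμ) (up a a∈) (up b b∈))
        where
          oμ : Ord μ
          oμ = ord-∈ (lim-ord L) μ∈
          up : ∀ a → a ∈ 𝒫 (𝕍 μ) → a ∈ 𝕍 (S μ)
          up a a∈ = ⊆𝕍⇒∈ (ord-S oμ) self∈S (to ∈𝒫 a∈)

    record Fails (α μ : V) : Set ℓ where
      constructor mkFails
      field
        f-lim : Lim μ
        f-∈   : α ∈ μ
        f-¬Q  : ¬ Q α μ
    open Fails public

    failsᵈ : Def 2 (λ ρ → Fails (lookup ρ v0) (lookup ρ v1))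
    failsᵈ = (D₀⇒D lim₀ ᵈ[ var v1 ∷ [] ] ∧ᵈ var v0 ∈ᵈ var v1 ∧ᵈ ¬ᵈ Qᵈ) redef λ ρ →
      mk⇔ (λ (h , k , l) → mkFails h k l) (λ F → f-lim F , f-∈ F , f-¬Q F)

    -- The least κ > ρ with all Q κ μ. Every α ∈ (ρ , κ) fails some Q α μ with μ < θ, so an
    -- embedding j with critical point κ and V_ν in its target sends θ above ν: otherwise its target
    -- would contain a μ < j(θ) with ¬ Q κ μ.
    module LeastStrong (ρ : V) (oρ : Ord ρ) (κ₀ : V) (oκ₀ : Ord κ₀) (ρ∈κ₀ : ρ ∈ κ₀) (q₀ : QAll κ₀) where

      opaque
        least : ∃[ κ ] (Ord κ × (ρ ∈ κ × QAll κ) × ∀ γ → γ ∈ κ → ¬ (ρ ∈ γ × QAll γ))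
        least = leastOrd {P = λ κ → ρ ∈ κ × QAll κ} (con ρ ∈ᵈ var v0 ∧ᵈ QAllᵈ) oκ₀ (ρ∈κ₀ , q₀)

      κ* : V
      κ* = proj₁ least
      oκ : Ord κ*
      oκ = proj₁ (proj₂ least)
      ρ∈κ : ρ ∈ κ*
      ρ∈κ = proj₁ (proj₁ (proj₂ (proj₂ least)))
      qκ : QAll κ*
      qκ = proj₂ (proj₁ (proj₂ (proj₂ least)))

      strong : IsStrong κ*
      strong = QAll⇒strong oκ qκ

      opaque
        between : V
        between = sep (con ρ ∈ᵈ var v0) κ*

        ∈between : α ∈ between ⇔ (α ∈ κ* × ρ ∈ α)
        ∈between = ∈sep

      opaque
        unfolding least
        failure : ∃[ m ] (Fun m between × ∀ α → α ∈ between → Fails α (app m α))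
        failure = choiceFunction failsᵈ between λ α α∈ → byContra λ none → let (α∈κ , ρ∈α) = to ∈between α∈ in
          proj₂ (proj₂ (proj₂ least)) α α∈κ (ρ∈α , λ μ L α∈μ → byContra λ nq → none (μ , mkFails L α∈μ nq))

        -- K₁ chooses a failure μ for every α strictly between ρ and κ*, K₂ its stage and K₃ the
        -- power set of that stage. With stage and power set supplied as sets, the failure is a
        -- statement that elementarity can carry to the images of these functions.
        K₁ K₂ K₃ : V
        K₁ = proj₁ failure
        K₂ = lam (graph₁ (𝕍ᵗ (appᵗ (con K₁) (var v0)))) between
        K₃ = lam (graph₁ (𝒫ᵗ (𝕍ᵗ (appᵗ (con K₁) (var v0))))) between

        sup : ∃[ σ ] (Ord σ × ∀ z → z ∈ im (graph₁ (appᵗ (con K₁) (var v0))) between → z ∈ σ)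
        sup = ord-sup λ z z∈ → let (α , α∈ , h) = to ∈im z∈ in subst Ord (sym h) (lim-ord (f-lim (proj₂ (proj₂ failure) α α∈)))

      θ : V
      θ = proj₁ sup
      oθ : Ord θ
      oθ = proj₁ (proj₂ sup)

      opaque
        unfolding sup failure
        K₁-spec : ⟨ α , μ ⟩ ∈ K₁ → α ∈ between × Fails α μ × μ ∈ θ
        K₁-spec {α} {μ} h = let
            F = proj₁ (proj₂ failure) ; α∈ = fun-dom F h ; k = app-≡ F h
          in α∈ , subst (Fails α) k (proj₂ (proj₂ failure) α α∈) , subst (_∈ θ) k (proj₂ (proj₂ sup) (app K₁ α) (im∋ α∈))

        K₂-spec : ⟨ α , μ ⟩ ∈ K₁ → ⟨ α , u ⟩ ∈ K₂ → u ≡ 𝕍 μ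
        K₂-spec h k = trans (proj₂ (to ∈lam k)) (cong 𝕍 (app-≡ (proj₁ (proj₂ failure)) h))

        K₂-dom : ⟨ α , u ⟩ ∈ K₂ → ⟨ α , app K₁ α ⟩ ∈ K₁
        K₂-dom h = app∈ (proj₁ (proj₂ failure)) (proj₁ (to ∈lam h))

        K₃-spec : ⟨ α , u ⟩ ∈ K₂ → ⟨ α , v ⟩ ∈ K₃ → v ≡ 𝒫 u
        K₃-spec h k = trans (proj₂ (to ∈lam k)) (cong 𝒫 (sym (proj₂ (to ∈lam h))))

        K-total : α ∈ κ* → ρ ∈ α → (∃[ a ] ∃[ b ] (⟨ a , b ⟩ ∈ K₁ × a ≡ α)) × (∃[ a ] ∃[ b ] (⟨ a , b ⟩ ∈ K₂ × a ≡ α)) ×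
                                    (∃[ a ] ∃[ b ] (⟨ a , b ⟩ ∈ K₃ × a ≡ α))
        K-total {α} α∈κ ρ∈α = let α∈ = from ∈between (α∈κ , ρ∈α) in
          (α , _ , app∈ (proj₁ (proj₂ failure)) α∈ , refl) , (α , _ , from ∈lam (α∈ , refl) , refl) , (α , _ , from ∈lam (α∈ , refl) , refl)

      total₀ : D₀ 5 (λ σ → ∀ α → α ∈ lookup σ v0 → lookup σ v1 ∈ α → (∃[ a ] ∃[ b ] (⟨ a , b ⟩ ∈ lookup σ v2 × a ≡ α)) ×
                            (∃[ a ] ∃[ b ] (⟨ a , b ⟩ ∈ lookup σ v3 × a ≡ α)) × (∃[ a ] ∃[ b ] (⟨ a , b ⟩ ∈ lookup σ v4 × a ≡ α)))
      total₀ = ∀∈₀ v0 (v2 ∈₀ v0 ⇒₀ ∃op∈₀ v3 (v1 ≡₀ v2) ∧₀ ∃op∈₀ v4 (v1 ≡₀ v2) ∧₀ ∃op∈₀ v5 (v1 ≡₀ v2))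

      first₀ : D₀ 2 (λ σ → ∀ a m → ⟨ a , m ⟩ ∈ lookup σ v0 → Lim m × a ∈ m × m ∈ lookup σ v1)
      first₀ = ∀op∈₀ v0 (lim₀ ₀[ v0 ∷ [] ] ∧₀ v1 ∈₀ v0 ∧₀ v0 ∈₀ v3)

      stage⊇₀ : D₀ 4 (λ σ → ∀ a m → ⟨ a , m ⟩ ∈ lookup σ v2 → ∀ a′ u → ⟨ a′ , u ⟩ ∈ lookup σ v3 → a ≡ a′ →
                            InStage (lookup σ v1) m (lookup σ v0) → lookup σ v1 ∈ u)
      stage⊇₀ = ∀op∈₀ v2 (∀op∈₀ v5 (v3 ≡₀ v1 ⇒₀ inStage₀ ₀[ v5 ∷ v2 ∷ v4 ∷ [] ] ⇒₀ v5 ∈₀ v0))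

      stage⊆₀ : D₀ 4 (λ σ → ∀ a m → ⟨ a , m ⟩ ∈ lookup σ v2 → ∀ a′ u → ⟨ a′ , u ⟩ ∈ lookup σ v3 → a ≡ a′ →
                            lookup σ v1 ∈ u → InStage (lookup σ v1) m (lookup σ v0))
      stage⊆₀ = ∀op∈₀ v2 (∀op∈₀ v5 (v3 ≡₀ v1 ⇒₀ v5 ∈₀ v0 ⇒₀ inStage₀ ₀[ v5 ∷ v2 ∷ v4 ∷ [] ]))

      power₀ : D₀ 4 (λ σ → ∀ a u → ⟨ a , u ⟩ ∈ lookup σ v2 → ∀ a′ p → ⟨ a′ , p ⟩ ∈ lookup σ v3 → a ≡ a′ →
                            lookup σ v1 ⊆ u ⇔ lookup σ v1 ∈ p)
      power₀ = ∀op∈₀ v2 (∀op∈₀ v5 (v3 ≡₀ v1 ⇒₀ (⊆₀ ₀[ v5 ∷ v2 ∷ [] ] ⇔₀ v5 ∈₀ v0)))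

      noWitness₀ : D₀ 4 (λ σ → ∀ a u → ⟨ a , u ⟩ ∈ lookup σ v2 → ∀ a′ p → ⟨ a′ , p ⟩ ∈ lookup σ v3 → a ≡ a′ →
                            ¬ Witness a u p (lookup σ v1))
      noWitness₀ = ∀op∈₀ v2 (∀op∈₀ v5 (v3 ≡₀ v1 ⇒₀ ¬₀ witness₀ ₀[ v3 ∷ v2 ∷ v0 ∷ v5 ∷ [] ]))

      module Exceeds (j M : Class) (elem : IsElementaryEmbedding j M) (tr : IsTransitive (_∈ᶜ M))
        (fixed : ∀ α → α ∈ κ* → ⟨ α , α ⟩ ∈ᶜ j) (moved : ¬ ⟨ κ* , κ* ⟩ ∈ᶜ j)
        {ν : V} (Lν : Lim ν) (κ∈ν : κ* ∈ ν) (sub : ∀ x → x ∈ 𝕍 ν → x ∈ᶜ M) where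
        open Elementary j M elem tr

        J-below : ∀ α → α ∈ κ* → J α ≡ α
        J-below α α∈ = sym (to ∈j (fixed α α∈))

        opaque
          κ∈Jκ : κ* ∈ J κ*
          κ∈Jκ = [ id , (λ h → ⊥-elim (moved (from ∈j h))) ]′ (⊆⇒≤ oκ (J-ord oκ) (J-increases κ* oκ))

          second∈M : ∀ {X} → ⟨ x , y ⟩ ∈ J X → y ∈ᶜ M
          second∈M {x} {y} {X} h = tr _ _ (tr _ _ (tr (J X) _ J∈M h) ∈pairʳ) ∈pairʳ

        -- As κ* ∈ J κ* and J ρ = ρ, the images of the three functions are defined at κ*. If J θ
        -- were below ν, then 𝕍 ν ⊆ M would force `U` and `p` to be the true stage of `m` and its
        -- true power set, and would put the witness given by `qκ` into `M`.
        module Values {m U p : V} (h₁ : ⟨ κ* , m ⟩ ∈ J K₁) (h₂ : ⟨ κ* , U ⟩ ∈ J K₂) (h₃ : ⟨ κ* , p ⟩ ∈ J K₃) (Jθ∈ν : J θ ∈ ν) where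
          opaque
            spec : Lim m × κ* ∈ m × m ∈ J θ
            spec = to (J-Δ₀ first₀ (K₁ ∷ θ ∷ [])) (λ a m k → let (_ , F , m∈) = K₁-spec k in f-lim F , f-∈ F , m∈) κ* m h₁

            m∈ν : m ∈ ν
            m∈ν = trans-ord (lim-ord Lν) (J θ) Jθ∈ν m (proj₂ (proj₂ spec))

            om : Ord m
            om = lim-ord (proj₁ spec)

            U≡ : U ≡ 𝕍 m
            U≡ = ⊆-antisym
              (λ x x∈ → let
                  (F , _ , h) = to (J-∀∃ stage⊆₀ (K₁ ∷ K₂ ∷ []))
                    (λ x → hierarchy θ , λ { a m k a′ u k′ refl x∈ → let (_ , F , m∈) = K₁-spec k in
                      inStage-hierarchy oθ (lim-ord (f-lim F)) (∈⇒⊆ oθ m∈) (subst (x ∈_) (K₂-spec k k′) x∈) })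
                    x (tr U x (second∈M h₂) x∈)
                in inStage-sound om (h κ* m h₁ κ* U h₂ refl x∈))
              (λ x x∈ → to (J-∀∀ stage⊇₀ (K₁ ∷ K₂ ∷ []))
                  (λ { x F a m k a′ u k′ refl I → let (_ , F , _) = K₁-spec k in
                     subst (x ∈_) (sym (K₂-spec k k′)) (inStage-sound (lim-ord (f-lim F)) I) })
                  x (hierarchy m) (sub x (𝕍-mono (lim-ord Lν) (∈⇒⊆ (lim-ord Lν) m∈ν) om x x∈)) (sub _ (hierarchy∈ Lν m∈ν))
                  κ* m h₁ κ* U h₂ refl (inStage-complete om x∈))

            power : ∀ y → y ∈ᶜ M → y ⊆ U ⇔ y ∈ p
            power y y∈ = to (J-∀∀ power₀ (K₂ ∷ K₃ ∷ []))
              (λ { y _ a u k a′ p k′ refl → mk⇔ (λ h → subst (y ∈_) (sym (K₃-spec k k′)) (from ∈𝒫 h)) (λ h → to ∈𝒫 (subst (y ∈_) (K₃-spec k k′) h)) })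
              y ∅ y∈ (sub ∅ (pc-∅ (𝕍-pairClosed Lν))) κ* U h₂ κ* p h₃ refl

            p≡ : p ≡ 𝒫 U
            p≡ = ⊆-antisym
              (λ y y∈ → from ∈𝒫 (from (power y (tr p y (second∈M h₃) y∈)) y∈))
              (λ y y∈ → to (power y (sub y (𝕍-⊆ (lim-ord Lν) (𝕍∈𝕍 (lim-ord Lν) m∈ν) (subst (y ⊆_) U≡ (to ∈𝒫 y∈))))) (to ∈𝒫 y∈))

            contradictory : ⊥
            contradictory = let (e , W) = qκ m (proj₁ spec) (proj₁ (proj₂ spec)) in
              to (J-∀∀ noWitness₀ (K₂ ∷ K₃ ∷ []))
                (λ { e _ a u k a′ p k′ refl W → let k″ = K₂-dom k ; u≡ = K₂-spec k″ k in
                   f-¬Q (proj₁ (proj₂ (K₁-spec k″))) (e , subst₂ (λ u p → Witness a u p e) u≡ (trans (K₃-spec k k′) (cong 𝒫 u≡)) W) })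
                e ∅ (sub e (witness∈ Lν m∈ν W)) (sub ∅ (pc-∅ (𝕍-pairClosed Lν))) κ* U h₂ κ* p h₃ refl
                (subst₂ (λ u p → Witness κ* u p e) (sym U≡) (sym (trans p≡ (cong 𝒫 U≡))) W)

        opaque
          exceeds : ν ⊆ J θ
          exceeds = ∉⇒⊆ (J-ord oθ) (lim-ord Lν) λ Jθ∈ν →
            let ((a , m , am , a≡) , (a′ , U , aU , a′≡) , (a″ , p , ap , a″≡)) =
                  to (J-Δ₀ total₀ (κ* ∷ ρ ∷ K₁ ∷ K₂ ∷ K₃ ∷ [])) (λ α → K-total) κ* κ∈Jκ (subst (_∈ κ*) (sym (J-below ρ ρ∈κ)) ρ∈κ)
            in Values.contradictory (subst (λ a → ⟨ a , m ⟩ ∈ J K₁) a≡ am) (subst (λ a → ⟨ a , U ⟩ ∈ J K₂) a′≡ aU)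
                 (subst (λ a → ⟨ a , p ⟩ ∈ J K₃) a″≡ ap) Jθ∈ν

  open LeastStrongs public

  -- From strong cardinals to product reflection.

  module StrongReflection where
    private variable
      n : ℕ
      x y z u v f A B α β γ δ κ ν : V

    opaque
      hom-app : IsHom f A B → Vertex A x → ⟨ x , app f x ⟩ ∈ f
      hom-app {f} {A} {B} {x} ((dom , val) , _) vx = let (y , h , un) = val x vx in
        subst (λ y → ⟨ x , y ⟩ ∈ f) (sym (app-unique (λ y′ h′ → un h′) h)) h

      hom-vertex : IsHom f A B → Vertex A x → Vertex B (app f x)
      hom-vertex {x = x} H vx = proj₁ (proj₂ H) x _ (hom-app H vx)

      hom-edge : IsHom f A B → Vertex A x → Vertex A y → Edge A x y → Edge B (app f x) (app f y)
      hom-edge H vx vy = proj₂ (proj₂ H) _ _ _ _ (hom-app H vx) (hom-app H vy)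

      definable-hom : {F : V → V} (gF : Graph₁ F) → A ≡ ⟨ u , v ⟩ → (∀ x → x ∈ u → Vertex B (F x)) →
        (∀ x y → x ∈ u → y ∈ u → Edge A x y → Edge B (F x) (F y)) → IsHom (lam gF u) A B
      definable-hom {A} {u} {v} {B} {F} gF refl vert edge =
        ((λ z z∈ → let (x , y , x∈ , e) = proj₁ (isFun lam-fun) z z∈ in x , y , from vertex-op x∈ , e) ,
         (λ x vx → proj₂ (isFun lam-fun) x (to vertex-op vx))) ,
        (λ x y h → let (x∈ , y≡) = to ∈lam h in subst (Vertex B) (sym y≡) (vert x x∈)) ,
        λ x x′ y y′ h h′ k → let (x∈ , y≡) = to ∈lam h ; (x′∈ , y′≡) = to ∈lam h′ in
          subst₂ (Edge B) (sym y≡) (sym y′≡) (edge x x′ x∈ x′∈ k)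

    isHomᵈ : Def 3 (λ ρ → IsHom (lookup ρ v0) (lookup ρ v1) (lookup ρ v2))
    isHomᵈ = (∀ᵈ (var v0 ∈ᵈ var v1 ⇒ᵈ ∃ᵈ (∃ᵈ (vertexᵈ ᵈ[ var v4 ∷ var v1 ∷ [] ] ∧ᵈ var v2 ≡ᵈ ⟨ var v1 , var v0 ⟩ᵗ)))
        ∧ᵈ ∀ᵈ (vertexᵈ ᵈ[ var v2 ∷ var v0 ∷ [] ] ⇒ᵈ ∃!ᵈ (⟨ var v1 , var v0 ⟩ᵗ ∈ᵈ var v2)))
      ∧ᵈ ∀ᵈ (∀ᵈ (⟨ var v1 , var v0 ⟩ᵗ ∈ᵈ var v2 ⇒ᵈ vertexᵈ ᵈ[ var v4 ∷ var v0 ∷ [] ]))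
      ∧ᵈ ∀ᵈ (∀ᵈ (∀ᵈ (∀ᵈ (⟨ var v3 , var v1 ⟩ᵗ ∈ᵈ var v4 ⇒ᵈ ⟨ var v2 , var v0 ⟩ᵗ ∈ᵈ var v4 ⇒ᵈ
           edgeᵈ ᵈ[ var v5 ∷ var v3 ∷ var v2 ∷ [] ] ⇒ᵈ edgeᵈ ᵈ[ var v6 ∷ var v1 ∷ var v0 ∷ [] ]))))

    opaque
      limitAbove₄ : Ord α → Ord β → Ord γ → Ord δ → ∃[ ν ] (Lim ν × α ∈ ν × β ∈ ν × γ ∈ ν × δ ∈ ν)
      limitAbove₄ oα oβ oγ oδ =
        let (ε , oε , α∈ , β∈) = ord-max oα oβ ; (ζ , oζ , γ∈ , δ∈) = ord-max oγ oδ ; (η , oη , ε∈ , ζ∈) = ord-max oε oζ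
            (ν , L , η∈) = limitAbove oη
            up = λ {x} → trans-ord (lim-ord L) η η∈ x
        in ν , L , up (trans-ord oη ε ε∈ _ α∈) , up (trans-ord oη ε ε∈ _ β∈) , up (trans-ord oη ζ ζ∈ _ γ∈) , up (trans-ord oη ζ ζ∈ _ δ∈)

    -- For a suitable embedding j, f ↦ j(f)(G) is a homomorphism from the product to G.
    module StrongPRP (C : Class) (Σ₂C : IsΣ 2 (formula C)) (proper : Proper IsStrong) where
      private
        ps : Vec V _
        ps = parameters C
        ranked-ps : ∃[ ρ ] (Ord ρ × ∀ i → lookup ps i ∈ 𝕍 ρ)
        ranked-ps = vecRanked ps
        ρ : V
        ρ = proj₁ ranked-ps
        oρ : Ord ρ
        oρ = proj₁ (proj₂ ranked-ps)
        first : ∃[ κ ] (IsStrong κ × ρ ∈ κ)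
        first = strongUnbounded proper oρ
      open LeastStrong ρ oρ (proj₁ first) (toOrd (proj₁ (proj₁ (proj₁ (proj₂ first))))) (proj₂ (proj₂ first)) (strong⇒QAll (proj₁ (proj₂ first)))

      opaque
        family : V
        family = sep (var v0 ∈ᵈᶜ C) (𝕍 θ)

        ∈family : x ∈ family ⇔ (x ∈ 𝕍 θ × x ∈ᶜ C)
        ∈family = ∈sep

      open Product family

      private
        spread : Fin (suc (arity C)) → Fin (suc (suc (suc (arity C))))
        spread zero    = zero
        spread (suc i) = suc (suc (suc i))

        -- Expresses that `family` contains all elements of 𝕍 θ satisfying the formula of `C`. Its
        -- image under `j` is about J (𝕍 θ) and the same parameters, and so puts `G` into
        -- `J family`.
        collects : Formula (suc (suc (arity C)))
        collects = ∀̇ (v0 ∈̇ v2 ∧̇ rename spread (formula C) ⇒̇ v0 ∈̇ v1)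

        spread-lookup : ∀ (x y z : V) {k} (σ : Vec V k) (f : Fin (suc k) → Fin (suc (suc (suc k)))) →
          f zero ≡ zero → (∀ i → f (suc i) ≡ suc (suc (suc i))) → ∀ i → lookup (x ∷ y ∷ z ∷ σ) (f i) ≡ lookup (x ∷ σ) i
        spread-lookup x y z σ f h k zero    = cong (lookup (x ∷ y ∷ z ∷ σ)) h
        spread-lookup x y z σ f h k (suc i) = cong (lookup (x ∷ y ∷ z ∷ σ)) (k i)

        map-fixed : ∀ {k} {F : V → V} (σ : Vec V k) → (∀ i → F (lookup σ i) ≡ lookup σ i) → map F σ ≡ σ
        map-fixed []      h = refl
        map-fixed (x ∷ σ) h = cong₂ _∷_ (h zero) (map-fixed σ (h ∘ suc))

      module Reflect (G : V) (G∈ : G ∈ᶜ C) (j M : Class) (elem : IsElementaryEmbedding j M) (tr : IsTransitive (_∈ᶜ M))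
        (fixed : ∀ α → α ∈ κ* → ⟨ α , α ⟩ ∈ᶜ j) (moved : ¬ ⟨ κ* , κ* ⟩ ∈ᶜ j)
        {ν : V} (Lν : Lim ν) (κ∈ν : κ* ∈ ν) (sub : ∀ x → x ∈ 𝕍 ν → x ∈ᶜ M)
        (G∈ν : G ∈ 𝕍 ν) (G∈Cᴹ : Sat (_∈ᶜ M) (formula C) (G ∷ ps)) where
        open Elementary j M elem tr
        open Exceeds j M elem tr fixed moved Lν κ∈ν sub
        open FixedStages j M elem tr oκ J-below

        opaque
          ps-fixed : map J ps ≡ ps
          ps-fixed = map-fixed ps λ i → J-fixes (𝕍-mono oκ (∈⇒⊆ oκ ρ∈κ) oρ _ (proj₂ (proj₂ ranked-ps) i))

          G∈J𝕍 : G ∈ J (𝕍 θ)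
          G∈J𝕍 = ⊆J-𝕍 oθ Lν sub exceeds G G∈ν

          G∈Jfamily : G ∈ J family
          G∈Jfamily = subst (λ σ → Sat (_∈ᶜ M) collects (J family ∷ J (𝕍 θ) ∷ σ)) ps-fixed
              (to (J-sat collects (family ∷ 𝕍 θ ∷ ps)) (λ x _ (x∈ , s) → from ∈family (x∈ , from (renamed All x _ _) s)))
              G (sub G G∈ν) (G∈J𝕍 , to (renamed (_∈ᶜ M) G _ _) G∈Cᴹ)
            where
              renamed : ∀ (N : V → Set ℓ) x y z → Sat N (formula C) (x ∷ ps) ⇔ Sat N (rename spread (formula C)) (x ∷ y ∷ z ∷ ps)
              renamed N x y z = Sat-rename N spread (formula C) (x ∷ ps) (x ∷ y ∷ z ∷ ps) (spread-lookup x y z ps spread refl (λ _ → refl))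

          evaluation : V
          evaluation = lam (graph₁ (appᵗ (Jᵗ (var v0)) (con G))) vertices

          J-product : ∀ x → x ∈ vertices → InProduct (J x) (J family)
          J-product x x∈ = to (J-Δ₀ inProduct₀ (x ∷ family ∷ [])) (to ∈vertices x∈)

          at-G : ∀ x → x ∈ vertices → ⟨ G , app (J x) G ⟩ ∈ J x
          at-G x x∈ = app∈ (ip-fun (J-product x x∈)) G∈Jfamily

          evaluation-hom : IsHom evaluation product G
          evaluation-hom = definable-hom (graph₁ (appᵗ (Jᵗ (var v0)) (con G))) refl
            (λ x x∈ → ip-val (J-product x x∈) G _ (at-G x x∈))
            (λ x y x∈ y∈ k → let (_ , _ , r) = to ∈edges (to edge-op k) in
              pe-val (to (J-Δ₀ productEdge₀ (x ∷ y ∷ [])) r) G _ (at-G x x∈) G _ (at-G y y∈) refl)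

      opaque
        reflects : ∀ G → G ∈ᶜ C → ∃[ h ] IsHom h product G
        reflects G G∈ = choose-ν (Σ₂-down Σ₂C (G ∷ ps) G∈) (everySetRanked G)
          where
            module _ {β γ : V} (oβ : Ord β) (oγ : Ord γ) (G∈γ : G ∈ 𝕍 γ)
              (down : ∀ (N : V → Set ℓ) → IsTransitive N → (∀ x → x ∈ 𝕍 β → N x) → (∀ i → N (lookup (G ∷ ps) i)) → Sat N (formula C) (G ∷ ps)) where
              module _ {ν : V} (L : Lim ν) (β∈ : β ∈ ν) (γ∈ : γ ∈ ν) (κ∈ : κ* ∈ ν) (ρ∈ : ρ ∈ ν) where
                to-ν : ∀ {α x} → Ord α → α ∈ ν → x ∈ 𝕍 α → x ∈ 𝕍 ν
                to-ν o h x∈ = 𝕍-mono (lim-ord L) (∈⇒⊆ (lim-ord L) h) o _ x∈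
                use-embedding : (∃[ χ ] (IsCardinal χ × ν ∈ χ)) → ∃[ h ] IsHom h product G
                use-embedding (χ , cχ , ν∈) = with-embedding (toOrd (proj₁ cχ)) (proj₂ strong χ cχ (trans-ord (toOrd (proj₁ cχ)) ν ν∈ κ* κ∈))
                  where
                    with-embedding : Ord χ → IsStrongUpTo χ κ* → ∃[ h ] IsHom h product G
                    with-embedding oχ (j , M , elem , tr , (_ , fixed , moved) , sub) = R.evaluation , R.evaluation-hom
                      where
                        subν : ∀ x → x ∈ 𝕍 ν → x ∈ᶜ M
                        subν x x∈ = sub (𝕍 χ) x (𝕍-stage oχ) (𝕍-mono oχ (∈⇒⊆ oχ ν∈) (lim-ord L) x x∈)
                        parameters∈M : ∀ i → lookup (G ∷ ps) i ∈ᶜ M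
                        parameters∈M zero    = subν G (to-ν oγ γ∈ G∈γ)
                        parameters∈M (suc i) = subν _ (to-ν oρ ρ∈ (proj₂ (proj₂ ranked-ps) i))
                        module R = Reflect G G∈ j M elem tr fixed moved L κ∈ subν (to-ν oγ γ∈ G∈γ)
                          (down (_∈ᶜ M) tr (λ x x∈ → subν x (to-ν oβ β∈ x∈)) parameters∈M)
                done : ∃[ h ] IsHom h product G
                done = use-embedding (cardinalsUnbounded (lim-ord L))
            choose-ν : ∃[ β ] (Ord β × ∀ (N : V → Set ℓ) → IsTransitive N → (∀ x → x ∈ 𝕍 β → N x) → (∀ i → N (lookup (G ∷ ps) i)) → Sat N (formula C) (G ∷ ps)) →
              ∃[ γ ] (Ord γ × G ∈ 𝕍 γ) → ∃[ h ] IsHom h product G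
            choose-ν (β , oβ , down) (γ , oγ , G∈γ) = pick-ν (limitAbove₄ oβ oγ oκ oρ)
              where
                pick-ν : ∃[ ν ] (Lim ν × β ∈ ν × γ ∈ ν × κ* ∈ ν × ρ ∈ ν) → ∃[ h ] IsHom h product G
                pick-ν (ν , L , β∈ , γ∈ , κ∈ , ρ∈) = done oβ oγ G∈γ down L β∈ γ∈ κ∈ ρ∈

      strong⇒PRP′ : ∃[ S ] ((∀ x → x ∈ S → x ∈ᶜ C) × (∀ G → G ∈ᶜ C → ∃[ P ] (IsProduct S P × ∃[ h ] IsHom h P G)))
      strong⇒PRP′ = family , (λ x x∈ → proj₂ (to ∈family x∈)) , λ G G∈ → product , isProduct , reflects G G∈

    strong⇒PRP : Proper IsStrong → PRP (IsΣ 2)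
    strong⇒PRP proper C Γ _ _ = StrongPRP.strong⇒PRP′ C Γ proper

  open StrongReflection public

  -- From product reflection to the semi-weak Vopěnka principle.

  module Sequences where
    private variable
      n : ℕ
      a b d x y z u v A B α β : V

    -- For large β, G_β maps to all members of S, hence to ∏ S, and by reflection to G_{β+1}.
    module RangeReflection (C R : Class) (range : ∀ G → G ∈ᶜ R ⇔ (∃[ α ] ⟨ α , G ⟩ ∈ᶜ C)) (seq : IsGraphSequence C)
      (down : ∀ α β A B → ⟨ α , A ⟩ ∈ᶜ C → ⟨ β , B ⟩ ∈ᶜ C → α ≤ β → ∃[ h ] IsHom h B A) (noUp : NoForwardHom C) where

      ordinal : ⟨ α , A ⟩ ∈ᶜ C → Ord α
      ordinal {α} {A} h = let (x , y , o , e) = proj₁ (proj₁ seq) ⟨ α , A ⟩ h in toOrd (subst IsOrdinal (sym (pair-inj₁ e)) o)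

      opaque
        graph-at : Ord α → ∃[ G ] ⟨ α , G ⟩ ∈ᶜ C
        graph-at o = let (G , h , _) = proj₂ (proj₁ seq) _ (fromOrd o) in G , h

        -- The case α = α of `down` gives an endomorphism of `A`. With two different indices for
        -- `A`, it would be a forward homomorphism.
        index-unique : ⟨ α , A ⟩ ∈ᶜ C → ⟨ β , A ⟩ ∈ᶜ C → α ≡ β
        index-unique {α} {A} {β} h k = [ (λ l → ⊥-elim (noUp α β A A h k l (down α α A A h h (inj₂ refl))))
          , [ id , (λ l → ⊥-elim (noUp β α A A k h l (down β β A A k k (inj₂ refl)))) ]′ ]′ (trichotomy (ordinal h) (ordinal k))

      indices : ∀ s → ∃[ t ] (∀ α → α ∈ t ⇔ (∃[ A ] (A ∈ s × ⟨ α , A ⟩ ∈ᶜ C)))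
      indices s = repl (⟨ var v1 , var v0 ⟩ᵗ ∈ᵈᶜ C) s λ A α β _ → index-unique

      opaque
        -- Replacement along the inverse of the sequence would turn a set of its values into a set
        -- containing all ordinals.
        range-proper : Proper (_∈ᶜ R)
        range-proper (s , h) = ordinals-unbounded λ α o → let (G , k) = graph-at o in
          from (proj₂ (indices s) α) (G , from (h G) (from (range G) (α , k)) , k)

      module Contradiction (F : V) (F⊆ : ∀ x → x ∈ F → x ∈ᶜ R)
        (reflect : ∀ G → G ∈ᶜ R → ∃[ P ] (IsProduct F P × ∃[ h ] IsHom h P G)) where

        opaque
          bound : ∃[ σ ] (Ord σ × ∀ α → α ∈ proj₁ (indices F) → α ∈ σ)
          bound = ord-sup λ α α∈ → let (A , _ , h) = to (proj₂ (indices F) α) α∈ in ordinal h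

        σ : V
        σ = proj₁ bound
        oσ : Ord σ
        oσ = proj₁ (proj₂ bound)

        module Arrow (B u v : V) (B≡ : B ≡ ⟨ u , v ⟩) (hB : ⟨ σ , B ⟩ ∈ᶜ C) (B′ : V) (hB′ : ⟨ S σ , B′ ⟩ ∈ᶜ C)
          (structure : IsStructure B) (P h : V) (isP : IsProduct F P) (hP : IsHom h P B′) where

          opaque
            homs : ∃[ k ] (Fun k F × ∀ A → A ∈ F → IsHom (app k A) B A)
            homs = choiceFunction (isHomᵈ ᵈ[ var v1 ∷ con B ∷ var v0 ∷ [] ]) F λ A A∈ →
              let (α , hA) = to (range A) (F⊆ A A∈) in
              down α σ A B hA hB (inj₁ (proj₂ (proj₂ bound) α (from (proj₂ (indices F) α) (A , A∈ , hA))))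

            valueT : V → Tm 1
            valueT x = appᵗ (appᵗ (con (proj₁ homs)) (var v0)) (con x)

            tuple : V → V
            tuple x = lam (graph₁ (valueT x)) F

            ∈tuple : ⟨ A , y ⟩ ∈ tuple x ⇔ (A ∈ F × y ≡ app (app (proj₁ homs) A) x)
            ∈tuple = ∈lam

            tuple-fun : Fun (tuple x) F
            tuple-fun = lam-fun

            tupleG : Graph₁ tuple
            tupleG = byElements₁ (λ x z → ∈im) (∃ᵈ (var v0 ∈ᵈ con F ∧ᵈ var v1 ≡ᵈ ⟨ var v0 , appᵗ (appᵗ (con (proj₁ homs)) (var v0)) (var v2) ⟩ᵗ))

            tuple-vertex : Vertex B x → Vertex P (tuple x)
            tuple-vertex {x} vx = from (proj₁ (proj₂ isP) (tuple x)) (isFun tuple-fun , λ A y A∈ k →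
              subst (Vertex A) (sym (proj₂ (to ∈tuple k))) (hom-vertex (proj₂ (proj₂ homs) A A∈) vx))

            tuple-edge : Vertex B x → Vertex B y → Edge B x y → Edge P (tuple x) (tuple y)
            tuple-edge {x} {y} vx vy k = from (proj₂ (proj₂ isP) (tuple x) (tuple y)) (tuple-vertex vx , tuple-vertex vy , λ A a b A∈ p q →
              subst₂ (Edge A) (sym (proj₂ (to ∈tuple p))) (sym (proj₂ (to ∈tuple q))) (hom-edge (proj₂ (proj₂ homs) A A∈) vx vy k))

            contradictory : ⊥
            contradictory = noUp σ (S σ) B B′ hB hB′ self∈S (_ , definable-hom (graph₁ (appᵗ (con h) (fn₁ tupleG (var v0)))) B≡
              (λ x x∈ → hom-vertex hP (tuple-vertex (at x x∈)))
              (λ x y x∈ y∈ k → hom-edge hP (tuple-vertex (at x x∈)) (tuple-vertex (at y y∈)) (tuple-edge (at x x∈) (at y y∈) k)))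
              where
                at : ∀ x → x ∈ u → Vertex B x
                at x x∈ = subst (λ B → Vertex B x) (sym B≡) (from vertex-op x∈)

        opaque
          contradiction : ⊥
          contradiction = step (graph-at oσ) (graph-at (ord-S oσ))
            where
              step : ∃[ B ] ⟨ σ , B ⟩ ∈ᶜ C → ∃[ B ] ⟨ S σ , B ⟩ ∈ᶜ C → ⊥
              step (B , hB) (B′ , hB′) = finish (proj₁ (proj₂ seq σ B hB)) (reflect B′ (from (range B′) (S σ , hB′)))
                where
                  finish : IsStructure B → ∃[ P ] (IsProduct F P × ∃[ h ] IsHom h P B′) → ⊥
                  finish st@(u , v , B≡ , _) (P , isP , h , hP) = Arrow.contradictory B u v B≡ hB B′ hB′ st P h isP hP

      PRP⇒⊥ : ∀ {Γ : FormulaClass} → Γ (formula R) → PRP Γ → ⊥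
      PRP⇒⊥ ΓR prp = finish (prp R ΓR (λ x x∈ → let (α , h) = to (range x) x∈ in proj₂ seq α x h) range-proper)
        where
          finish : ∃[ F ] ((∀ x → x ∈ F → x ∈ᶜ R) × (∀ G → G ∈ᶜ R → ∃[ P ] (IsProduct F P × ∃[ h ] IsHom h P G))) → ⊥
          finish (F , F⊆ , reflect) = Contradiction.contradiction F F⊆ reflect

    weaken : Formula n → Formula (suc n)
    weaken = rename suc

    Sat-weaken : (φ : Formula n) (x : V) (ρ : Vec V n) → Sat All φ ρ ⇔ Sat All (weaken φ) (x ∷ ρ)
    Sat-weaken φ x ρ = Sat-rename All suc φ ρ (x ∷ ρ) (λ _ → refl)

    -- Prenexing: ψ does not mention the quantified variable and is recovered from the instance at
    -- ∅, as the universe is not empty.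
    Δ₀∧Π₁ : {ψ φ : Formula n} → IsΔ₀ ψ → IsΠ 1 φ → Σ[ χ ∈ Formula n ] (IsΠ 1 χ × ∀ ρ → Sat All χ ρ ⇔ (Sat All ψ ρ × Sat All φ ρ))
    Δ₀∧Π₁ d (Σ⇒ (Δ₀ p)) = _ , Σ⇒ (Δ₀ (conj d p)) , λ ρ → ⇔-refl
    Δ₀∧Π₁ {ψ = ψ} d (all p) = let (χ , q , h) = Δ₀∧Π₁ (rename-Δ₀ suc d) p in ∀̇ χ , all q , λ ρ → mk⇔
      (λ s → from (Sat-weaken ψ ∅ ρ) (proj₁ (to (h _) (s ∅ tt))) , λ x _ → proj₂ (to (h _) (s x tt)))
      (λ (s , t) x _ → from (h _) (to (Sat-weaken ψ x ρ) s , t x tt))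

    Δ₀∧Σ₂ : {ψ φ : Formula n} → IsΔ₀ ψ → IsΣ 2 φ → Σ[ χ ∈ Formula n ] (IsΣ 2 χ × ∀ ρ → Sat All χ ρ ⇔ (Sat All ψ ρ × Sat All φ ρ))
    Δ₀∧Σ₂ d (Π⇒ p) = let (χ , q , h) = Δ₀∧Π₁ d p in χ , Π⇒ q , h
    Δ₀∧Σ₂ {ψ = ψ} d (ex p) = let (χ , q , h) = Δ₀∧Σ₂ (rename-Δ₀ suc d) p in ∃̇ χ , ex q , λ ρ → mk⇔
      (λ (x , _ , s) → let (s , t) = to (h _) s in from (Sat-weaken ψ x ρ) s , x , tt , t)
      (λ (s , x , _ , t) → x , tt , from (h _) (to (Sat-weaken ψ x ρ) s , t))

    module SequenceRange (C : Class) (Σ₂C : IsΣ 2 (formula C)) where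
      private
        spread : Fin (suc (arity C)) → Fin (suc (suc (suc (arity C))))
        spread zero    = zero
        spread (suc i) = suc (suc (suc i))
        both : Σ[ χ ∈ Formula (suc (suc (suc (arity C)))) ] (IsΣ 2 χ × ∀ ρ → Sat All χ ρ ⇔ (Sat All (Closed.form (isOp₀ v0 v1 v2)) ρ × Sat All (rename spread (formula C)) ρ))
        both = Δ₀∧Σ₂ (Closed.class (isOp₀ v0 v1 v2)) (rename-Σ spread Σ₂C)

      -- G ∈ range iff ∃ α ∃ z (z = ⟨α , G⟩ ∧ z ∈ C).
      sequenceRange : Class
      sequenceRange = record { formula = ∃̇ (∃̇ (proj₁ both)) ; parameters = parameters C }

      sequenceRange-Σ₂ : IsΣ 2 (formula sequenceRange)
      sequenceRange-Σ₂ = ex (ex (proj₁ (proj₂ both)))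

      ∈sequenceRange : ∀ G → G ∈ᶜ sequenceRange ⇔ (∃[ α ] ⟨ α , G ⟩ ∈ᶜ C)
      ∈sequenceRange G = mk⇔
        (λ (α , _ , z , _ , s) → let (e , t) = to (proj₂ (proj₂ both) _) s in α ,
          subst (_∈ᶜ C) (to (Closed.means (isOp₀ v0 v1 v2) _) e) (from (renamed z α) t))
        (λ (α , h) → α , tt , ⟨ α , G ⟩ , tt , from (proj₂ (proj₂ both) _) (from (Closed.means (isOp₀ v0 v1 v2) _) refl , to (renamed ⟨ α , G ⟩ α) h))
        where
          renamed : ∀ z α → z ∈ᶜ C ⇔ Sat All (rename spread (formula C)) (z ∷ α ∷ G ∷ parameters C)
          renamed z α = Sat-rename All spread (formula C) _ _ λ { zero → refl ; (suc i) → refl }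

    PRP⇒SWVP : PRP (IsΣ 2) → SWVP (IsΣ 2)
    PRP⇒SWVP prp (C , Γ , seq , down , noUp) =
      RangeReflection.PRP⇒⊥ C sequenceRange ∈sequenceRange seq down noUp {Γ = IsΣ 2} sequenceRange-Σ₂ prp
      where open SequenceRange C Γ

  open Sequences public

  -- The relational structures and their coding by graphs.

  module Relations where
    private variable
      n : ℕ
      a b c d x y z u w A X Y W q q′ α : V

    -- The relations coded by the graphs: equality, one relation carrying a constant w and the
    -- predicate α ⊆ Y, and the colours.

    Kind : Set
    Kind = Fin 10

    colour : Fin 8 → Colour
    colour v0 = nandᶜ idᵢ
    colour v1 = nandᶜ dupᵢ
    colour v2 = nandᶜ swapᵢ
    colour v3 = nandᶜ fstᵢ
    colour v4 = nandᶜ sndᵢ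
    colour v5 = nandᶜ popᵢ
    colour v6 = existᶜ
    colour v7 = wfᶜ

    colour-onto : ∀ c → ∃[ i ] colour i ≡ c
    colour-onto (nandᶜ idᵢ)   = v0 , refl
    colour-onto (nandᶜ dupᵢ)  = v1 , refl
    colour-onto (nandᶜ swapᵢ) = v2 , refl
    colour-onto (nandᶜ fstᵢ)  = v3 , refl
    colour-onto (nandᶜ sndᵢ)  = v4 , refl
    colour-onto (nandᶜ popᵢ)  = v5 , refl
    colour-onto existᶜ        = v6 , refl
    colour-onto wfᶜ           = v7 , refl

    -- The kind `zero` ties the three copies of a subset together, so that one map acts on all of
    -- them. In the kind `suc zero` the constant appears as its singleton, which has to be mapped to
    -- the singleton of the same `w`.
    RelK : Kind → V → V → V → V → V → V → V → Set ℓ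
    RelK zero          u p α w X Y W = Y ≡ X × W ≡ X
    RelK (suc zero)    u p α w X Y W = X ≡ sing w × W ≡ X × α ⊆ Y
    RelK (suc (suc i)) u p α w X Y W = Rel (colour i) u p X Y W

    relK₀ : ∀ k → D₀ 7 (λ ρ → RelK k (lookup ρ v0) (lookup ρ v1) (lookup ρ v2) (lookup ρ v3) (lookup ρ v4) (lookup ρ v5) (lookup ρ v6))
    relK₀ zero          = v5 ≡₀ v4 ∧₀ v6 ≡₀ v4
    relK₀ (suc zero)    = isPair₀ v4 v3 v3 ∧₀ v6 ≡₀ v4 ∧₀ ⊆₀ ₀[ v2 ∷ v5 ∷ [] ]
    relK₀ (suc (suc i)) = rel₀ (colour i) ₀[ v0 ∷ v1 ∷ v4 ∷ v5 ∷ v6 ∷ [] ]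

    num : ℕ → V
    num zero    = ∅
    num (suc k) = sing (num k)

    num-injective : ∀ i j → num i ≡ num j → i ≡ j
    num-injective zero    zero    h = refl
    num-injective zero    (suc j) h = ⊥-elim (sing≢∅ (sym h))
    num-injective (suc i) zero    h = ⊥-elim (sing≢∅ h)
    num-injective (suc i) (suc j) h = cong suc (num-injective i j (sing-inj h))

    -- One core vertex for each of the three levels and ten kinds, hence 13. In `tagCode` the first
    -- component tells the three constructors apart.
    data Tag : Set where
      core  : Fin 13 → Tag
      level : Fin 3 → Tag
      mid   : Kind → Tag

    tagCode : Tag → V
    tagCode (core i)  = ⟨ num 0 , num (toℕ i) ⟩
    tagCode (level l) = ⟨ num 1 , num (toℕ l) ⟩
    tagCode (mid k)   = ⟨ num 2 , num (toℕ k) ⟩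

    tagCode-injective : ∀ s t → tagCode s ≡ tagCode t → s ≡ t
    tagCode-injective (core i)  (core j)  h = cong core (toℕ-injective (num-injective _ _ (pair-inj₂ h)))
    tagCode-injective (level i) (level j) h = cong level (toℕ-injective (num-injective _ _ (pair-inj₂ h)))
    tagCode-injective (mid i)   (mid j)   h = cong mid (toℕ-injective (num-injective _ _ (pair-inj₂ h)))
    tagCode-injective (core i)  (level j) h = case num-injective 0 1 (pair-inj₁ h) of λ ()
    tagCode-injective (core i)  (mid j)   h = case num-injective 0 2 (pair-inj₁ h) of λ ()
    tagCode-injective (level i) (core j)  h = case num-injective 1 0 (pair-inj₁ h) of λ ()
    tagCode-injective (level i) (mid j)   h = case num-injective 1 2 (pair-inj₁ h) of λ ()
    tagCode-injective (mid i)   (core j)  h = case num-injective 2 0 (pair-inj₁ h) of λ ()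
    tagCode-injective (mid i)   (level j) h = case num-injective 2 1 (pair-inj₁ h) of λ ()

    opaque
      isNum₀ : ∀ k → D₀ 1 (λ ρ → lookup ρ v0 ≡ num k)
      isNum₀ zero    = isEmpty₀
      isNum₀ (suc k) = cast₀
        (λ ρ → mk⇔ (λ (y , y∈ , y≡ , h) → trans (extensionality λ z → mk⇔ (λ z∈ → from ∈sing (h z z∈)) (λ z∈ → subst (_∈ lookup ρ v0) (sym (to ∈sing z∈)) y∈)) (cong sing y≡))
                   (λ e → num k , subst (num k ∈_) (sym e) self∈sing , refl , λ z z∈ → to ∈sing (subst (z ∈_) e z∈)))
        (∃∈₀ v0 (isNum₀ k ₀[ v0 ∷ [] ] ∧₀ ∀∈₀ v1 (v0 ≡₀ v1)))

      isNumPair₀ : ∀ i j → D₀ 1 (λ ρ → lookup ρ v0 ≡ ⟨ num i , num j ⟩)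
      isNumPair₀ i j = cast₀
        (λ ρ → mk⇔ (λ (a , b , e , a≡ , b≡) → trans e (cong₂ ⟨_,_⟩ a≡ b≡)) (λ e → num i , num j , e , refl , refl))
        (unpair₀ v0 (isNum₀ i ₀[ v1 ∷ [] ] ∧₀ isNum₀ j ₀[ v0 ∷ [] ]))

    isTag₀ : ∀ t → D₀ 1 (λ ρ → lookup ρ v0 ≡ tagCode t)
    isTag₀ (core i)  = isNumPair₀ 0 (toℕ i)
    isTag₀ (level i) = isNumPair₀ 1 (toℕ i)
    isTag₀ (mid i)   = isNumPair₀ 2 (toℕ i)

    opaque
      const₀ : {A : Set} → Dec A → D₀ (suc n) (λ _ → Lift ℓ A)
      const₀ (yes a) = cast₀ (λ ρ → mk⇔ (λ _ → lift a) (λ _ → refl)) (v0 ≡₀ v0)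
      const₀ (no n)  = cast₀ (λ ρ → mk⇔ (λ h → ⊥-elim (h refl)) (λ a → ⊥-elim (n (lower a)))) (¬₀ (v0 ≡₀ v0))

      ∃Fin₀ : ∀ {m} {P : Fin m → Vec V (suc n) → Set ℓ} → (∀ i → D₀ (suc n) (P i)) → D₀ (suc n) (λ ρ → ∃[ i ] P i ρ)
      ∃Fin₀ {m = zero}  d = cast₀ (λ ρ → mk⇔ (λ h → ⊥-elim (h refl)) (λ ())) (¬₀ (v0 ≡₀ v0))
      ∃Fin₀ {m = suc m} d = cast₀ (λ ρ → mk⇔ [ (λ p → zero , p) , (λ (i , p) → suc i , p) ]′ (λ { (zero , p) → inj₁ p ; (suc i , p) → inj₂ (i , p) }))
        (d zero ∨₀ ∃Fin₀ (λ i → d (suc i)))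

      ∃Tag₀ : {P : Tag → Vec V (suc n) → Set ℓ} → (∀ t → D₀ (suc n) (P t)) → D₀ (suc n) (λ ρ → ∃[ t ] P t ρ)
      ∃Tag₀ d = cast₀
        (λ ρ → mk⇔ [ (λ (i , p) → core i , p) , [ (λ (i , p) → level i , p) , (λ (i , p) → mid i , p) ]′ ]′
                   (λ { (core i , p) → inj₁ (i , p) ; (level i , p) → inj₂ (inj₁ (i , p)) ; (mid i , p) → inj₂ (inj₂ (i , p)) }))
        (∃Fin₀ (λ i → d (core i)) ∨₀ ∃Fin₀ (λ i → d (level i)) ∨₀ ∃Fin₀ (λ i → d (mid i)))

    -- The coded graphs. A core vertex points to the vertices of one level or one kind; a triple of
    -- kind k related by RelK k points to the copies of its last two entries, and is pointed to by its
    -- first entry.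

    levelCore : Fin 3 → Fin 13
    levelCore v0 = v0
    levelCore v1 = v1
    levelCore v2 = v2

    midCore : Kind → Fin 13
    midCore k = suc (suc (suc k))

    record Triple (k : Kind) (u p α w q : V) : Set ℓ where
      constructor mkTriple
      field
        {X₀ Y₀ W₀} : V
        shape : q ≡ ⟨ X₀ , ⟨ Y₀ , W₀ ⟩ ⟩
        inX   : X₀ ∈ p
        inY   : Y₀ ∈ p
        inW   : W₀ ∈ p
        related : RelK k u p α w X₀ Y₀ W₀

    First Second Third : V → V → Set ℓ
    First q x  = ∃[ a ] ∃[ b ] (q ≡ ⟨ a , b ⟩ × x ≡ a)
    Second q x = ∃[ a ] ∃[ b ] (q ≡ ⟨ a , b ⟩ × ∃[ c ] ∃[ d ] (b ≡ ⟨ c , d ⟩ × x ≡ c))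
    Third q x  = ∃[ a ] ∃[ b ] (q ≡ ⟨ a , b ⟩ × ∃[ c ] ∃[ d ] (b ≡ ⟨ c , d ⟩ × x ≡ d))

    opaque
      first-≡ : First ⟨ a , b ⟩ x → x ≡ a
      first-≡ (a , b , e , h) = trans h (sym (pair-inj₁ e))

      second-≡ : Second ⟨ a , ⟨ b , c ⟩ ⟩ x → x ≡ b
      second-≡ (a , b , e , c , d , e′ , h) = trans h (sym (pair-inj₁ (trans (pair-inj₂ e) e′)))

      third-≡ : Third ⟨ a , ⟨ b , c ⟩ ⟩ x → x ≡ c
      third-≡ (a , b , e , c , d , e′ , h) = trans h (sym (pair-inj₂ (trans (pair-inj₂ e) e′)))

    VertexRel : Tag → V → V → V → V → V → V → Set ℓ
    VertexRel (core i)  u p α w info q = q ≡ info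
    VertexRel (level l) u p α w info q = q ∈ p
    VertexRel (mid k)   u p α w info q = Triple k u p α w q

    EdgeRel : Tag → Tag → V → V → V → V → V → V → V → Set ℓ
    EdgeRel (core i)     (core j)       u p α w info q q′ = q ≡ info × q′ ≡ info × Lift ℓ (CoreEdge i j)
    EdgeRel (core i)     (level l)      u p α w info q q′ = q ≡ info × q′ ∈ p × Lift ℓ (i ≡ levelCore l)
    EdgeRel (core i)     (mid k)        u p α w info q q′ = q ≡ info × Triple k u p α w q′ × Lift ℓ (i ≡ midCore k)
    EdgeRel (level zero) (mid k)        u p α w info q q′ = q ∈ p × Triple k u p α w q′ × First q′ q
    EdgeRel (mid k)      (level v1)     u p α w info q q′ = q′ ∈ p × Triple k u p α w q × Second q q′
    EdgeRel (mid k)      (level v2)     u p α w info q q′ = q′ ∈ p × Triple k u p α w q × Third q q′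
    EdgeRel _            _              u p α w info q q′ = Lift ℓ ⊥

    triple₀ : ∀ k → D₀ 5 (λ ρ → Triple k (lookup ρ v0) (lookup ρ v1) (lookup ρ v2) (lookup ρ v3) (lookup ρ v4))
    triple₀ k = cast₀ (λ ρ → mk⇔ (λ (X , Z , e , Y , W , e′ , i , j , l , r) → mkTriple (trans e (cong ⟨ X ,_⟩ e′)) i j l r)
                                  (λ (mkTriple e i j l r) → _ , _ , e , _ , _ , refl , i , j , l , r))
      (unpair₀ v4 (unpair₀ v0 (v3 ∈₀ v5 ∧₀ v1 ∈₀ v5 ∧₀ v0 ∈₀ v5 ∧₀ relK₀ k ₀[ v4 ∷ v5 ∷ v6 ∷ v7 ∷ v3 ∷ v1 ∷ v0 ∷ [] ])))

    vertexRel₀ : ∀ t → D₀ 6 (λ ρ → VertexRel t (lookup ρ v0) (lookup ρ v1) (lookup ρ v2) (lookup ρ v3) (lookup ρ v4) (lookup ρ v5))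
    vertexRel₀ (core i)  = v5 ≡₀ v4
    vertexRel₀ (level l) = v5 ∈₀ v1
    vertexRel₀ (mid k)   = triple₀ k ₀[ v0 ∷ v1 ∷ v2 ∷ v3 ∷ v5 ∷ [] ]

    edgeRel₀ : ∀ s t → D₀ 7 (λ ρ → EdgeRel s t (lookup ρ v0) (lookup ρ v1) (lookup ρ v2) (lookup ρ v3) (lookup ρ v4) (lookup ρ v5) (lookup ρ v6))
    edgeRel₀ (core i)     (core j)   = v5 ≡₀ v4 ∧₀ v6 ≡₀ v4 ∧₀ const₀ ((j ≟ᶠ next i) ⊎-dec ((i ≟ᶠ v1) ×-dec (j ≟ᶠ v0)))
    edgeRel₀ (core i)     (level l)  = v5 ≡₀ v4 ∧₀ v6 ∈₀ v1 ∧₀ const₀ (i ≟ᶠ levelCore l)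
    edgeRel₀ (core i)     (mid k)    = v5 ≡₀ v4 ∧₀ triple₀ k ₀[ v0 ∷ v1 ∷ v2 ∷ v3 ∷ v6 ∷ [] ] ∧₀ const₀ (i ≟ᶠ midCore k)
    edgeRel₀ (level zero) (mid k)    = v5 ∈₀ v1 ∧₀ triple₀ k ₀[ v0 ∷ v1 ∷ v2 ∷ v3 ∷ v6 ∷ [] ] ∧₀ unpair₀ v6 (v7 ≡₀ v1)
    edgeRel₀ (mid k)      (level v1) = v6 ∈₀ v1 ∧₀ triple₀ k ₀[ v0 ∷ v1 ∷ v2 ∷ v3 ∷ v5 ∷ [] ] ∧₀ unpair₀ v5 (unpair₀ v0 (suc v9 ≡₀ v1))
    edgeRel₀ (mid k)      (level v2) = v6 ∈₀ v1 ∧₀ triple₀ k ₀[ v0 ∷ v1 ∷ v2 ∷ v3 ∷ v5 ∷ [] ] ∧₀ unpair₀ v5 (unpair₀ v0 (suc v9 ≡₀ v0))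
    edgeRel₀ (level zero)    (core j)  = const₀ (no id)
    edgeRel₀ (level zero)    (level l) = const₀ (no id)
    edgeRel₀ (level (suc _)) (core j)  = const₀ (no id)
    edgeRel₀ (level (suc _)) (level l) = const₀ (no id)
    edgeRel₀ (level (suc _)) (mid k)   = const₀ (no id)
    edgeRel₀ (mid k)         (core j)  = const₀ (no id)
    edgeRel₀ (mid k)         (level zero) = const₀ (no id)
    edgeRel₀ (mid k)         (mid j)   = const₀ (no id)

    IsVertex : V → V → V → V → V → V → Set ℓ
    IsVertex u p α w info x = ∃[ t ] ∃[ c ] ∃[ q ] (x ≡ ⟨ c , q ⟩ × c ≡ tagCode t × VertexRel t u p α w info q)

    IsEdge : V → V → V → V → V → V → V → Set ℓ
    IsEdge u p α w info x y = ∃[ s ] ∃[ t ] ∃[ c ] ∃[ q ] (x ≡ ⟨ c , q ⟩ × c ≡ tagCode s ×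
      ∃[ c′ ] ∃[ q′ ] (y ≡ ⟨ c′ , q′ ⟩ × c′ ≡ tagCode t × EdgeRel s t u p α w info q q′))

    isVertex₀ : D₀ 6 (λ ρ → IsVertex (lookup ρ v0) (lookup ρ v1) (lookup ρ v2) (lookup ρ v3) (lookup ρ v4) (lookup ρ v5))
    isVertex₀ = ∃Tag₀ λ t → unpair₀ v5 (isTag₀ t ₀[ v1 ∷ [] ] ∧₀ vertexRel₀ t ₀[ v2 ∷ v3 ∷ v4 ∷ v5 ∷ v6 ∷ v0 ∷ [] ])

    isEdge₀ : D₀ 7 (λ ρ → IsEdge (lookup ρ v0) (lookup ρ v1) (lookup ρ v2) (lookup ρ v3) (lookup ρ v4) (lookup ρ v5) (lookup ρ v6))
    isEdge₀ = ∃Tag₀ λ s → ∃Tag₀ λ t → unpair₀ v5 (isTag₀ s ₀[ v1 ∷ [] ] ∧₀ unpair₀ v8 (isTag₀ t ₀[ v1 ∷ [] ] ∧₀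
      edgeRel₀ s t ₀[ v4 ∷ v5 ∷ v6 ∷ v7 ∷ v8 ∷ v2 ∷ v0 ∷ [] ]))

  open Relations public

  -- Analysis of a homomorphism between coded graphs.

  module Coding where
    private variable
      n : ℕ
      a b c x y z u v w f g A X Y W q q′ α : V

    opaque
      edge⇒vertexˡ : ∀ s t {u p α w info q q′} → EdgeRel s t u p α w info q q′ → VertexRel s u p α w info q
      edge⇒vertexˡ (core i)     (core j)   (h , _) = h
      edge⇒vertexˡ (core i)     (level l)  (h , _) = h
      edge⇒vertexˡ (core i)     (mid k)    (h , _) = h
      edge⇒vertexˡ (level zero) (mid k)    (h , _) = h
      edge⇒vertexˡ (mid k)      (level v1) (_ , h , _) = h
      edge⇒vertexˡ (mid k)      (level v2) (_ , h , _) = h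

      edge⇒vertexʳ : ∀ s t {u p α w info q q′} → EdgeRel s t u p α w info q q′ → VertexRel t u p α w info q′
      edge⇒vertexʳ (core i)     (core j)   (_ , h , _) = h
      edge⇒vertexʳ (core i)     (level l)  (_ , h , _) = h
      edge⇒vertexʳ (core i)     (mid k)    (_ , h , _) = h
      edge⇒vertexʳ (level zero) (mid k)    (_ , h , _) = h
      edge⇒vertexʳ (mid k)      (level v1) (h , _) = h
      edge⇒vertexʳ (mid k)      (level v2) (h , _) = h

    vertex : Tag → V → V
    vertex t q = ⟨ tagCode t , q ⟩

    record GraphOf (u p α w info g : V) : Set ℓ where
      constructor mkGraphOf
      field
        {V₀ E₀}  : V
        g≡       : g ≡ ⟨ V₀ , E₀ ⟩
        ∈V₀      : ∀ x → x ∈ V₀ ⇔ IsVertex u p α w info x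
        ∈E₀      : ∀ z → z ∈ E₀ ⇔ (∃[ x ] ∃[ y ] (z ≡ ⟨ x , y ⟩ × IsEdge u p α w info x y))
    open GraphOf

    module Coded {u p α w info g : V} (G : GraphOf u p α w info g) where
      opaque
        isVertex : Vertex g x ⇔ IsVertex u p α w info x
        isVertex {x} = ≡-⇔ (cong (λ g → Vertex g x) (g≡ G)) ⇔∘ vertex-op ⇔∘ ∈V₀ G x

        isEdge : Edge g x y ⇔ IsEdge u p α w info x y
        isEdge {x} {y} = ≡-⇔ (cong (λ g → Edge g x y) (g≡ G)) ⇔∘ edge-op ⇔∘ ∈E₀ G ⟨ x , y ⟩ ⇔∘ mk⇔
          (λ (a , b , e , h) → subst₂ (IsEdge u p α w info) (sym (pair-inj₁ e)) (sym (pair-inj₂ e)) h) (λ h → x , y , refl , h)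

        vertex⁺ : ∀ t → VertexRel t u p α w info q → Vertex g (vertex t q)
        vertex⁺ t h = from isVertex (t , _ , _ , refl , refl , h)

        vertex⁻ : Vertex g x → ∃[ t ] ∃[ q ] (x ≡ vertex t q × VertexRel t u p α w info q)
        vertex⁻ h = let (t , c , q , e , c≡ , r) = to isVertex h in t , q , trans e (cong ⟨_, q ⟩ c≡) , r

        edge⁺ : ∀ s t → EdgeRel s t u p α w info q q′ → Edge g (vertex s q) (vertex t q′)
        edge⁺ s t h = from isEdge (s , t , _ , _ , refl , refl , _ , _ , refl , refl , h)

        edge⁻ : ∀ s t → Edge g (vertex s q) (vertex t q′) → EdgeRel s t u p α w info q q′
        edge⁻ {q} {q′} s t h = let (s′ , t′ , c , r , e , c≡ , c′ , r′ , e′ , c′≡ , k) = to isEdge h in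
          retag (tagCode-injective s′ s (sym (trans (pair-inj₁ e) c≡))) (tagCode-injective t′ t (sym (trans (pair-inj₁ e′) c′≡)))
            (sym (pair-inj₂ e)) (sym (pair-inj₂ e′)) k
          where
            retag : ∀ {s′ t′ r r′} → s′ ≡ s → t′ ≡ t → r ≡ q → r′ ≡ q′ → EdgeRel s′ t′ u p α w info r r′ → EdgeRel s t u p α w info q q′
            retag refl refl refl refl k = k

        graph : IsGraph g
        graph = (V₀ G , E₀ G , g≡ G , λ z z∈ → let (x , y , e , s , t , c , q , e₁ , c≡ , c′ , q′ , e₂ , c′≡ , k) = to (∈E₀ G z) z∈ in
            x , y , from (∈V₀ G x) (s , c , q , e₁ , c≡ , edge⇒vertexˡ s t k) , from (∈V₀ G y) (t , c′ , q′ , e₂ , c′≡ , edge⇒vertexʳ s t k) , e) ,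
          vertex (core zero) info , vertex⁺ (core zero) refl

      vertex-tag : ∀ {t} → Vertex g (vertex t q) → VertexRel t u p α w info q
      vertex-tag {q} {t} h = let (s , r , e , k) = vertex⁻ h in retag (tagCode-injective s t (sym (pair-inj₁ e))) (sym (pair-inj₂ e)) k
        where
          retag : ∀ {s r} → s ≡ t → r ≡ q → VertexRel s u p α w info r → VertexRel t u p α w info q
          retag refl refl k = k

    module HomAnalysis {u p α w info g u′ p′ α′ w′ info′ g′ h : V} (G : GraphOf u p α w info g) (G′ : GraphOf u′ p′ α′ w′ info′ g′)
      (H : IsHom h g g′) where
      private
        module S = Coded G
        module T = Coded G′

      F : V → V
      F = app h

      E′ : Tag → Tag → V → V → Set ℓ
      E′ s t q q′ = EdgeRel s t u′ p′ α′ w′ info′ q q′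

      opaque
        -- A core vertex starts arbitrarily long walks. Outside the core the longest walks have two
        -- edges, from level 0 through a triple to level 1 or 2, so three edges suffice to force the
        -- image into the core.
        core-image : ∀ i → ∃[ j ] F (vertex (core i) info) ≡ vertex (core j) info′
        core-image i = from-walk (tagged i) (tagged (next i)) (tagged (next (next i))) (tagged (next (next (next i)))) (forward i) (forward (next i)) (forward (next (next i)))
          where
            cv₀ : Fin 13 → V
            cv₀ i = vertex (core i) info
            cv : ∀ i → Vertex g (cv₀ i)
            cv i = S.vertex⁺ (core i) refl
            tagged : ∀ i → ∃[ t ] ∃[ q ] (F (cv₀ i) ≡ vertex t q × VertexRel t u′ p′ α′ w′ info′ q)
            tagged i = T.vertex⁻ (hom-vertex H (cv i))
            forward : ∀ i → Edge g′ (F (cv₀ i)) (F (cv₀ (next i)))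
            forward i = hom-edge H (cv i) (cv (next i)) (S.edge⁺ (core i) (core (next i)) (refl , refl , lift (inj₁ refl)))
            no-walk : ∀ t₀ t₁ t₂ t₃ {q₀ q₁ q₂ q₃} → VertexRel t₀ u′ p′ α′ w′ info′ q₀ → E′ t₀ t₁ q₀ q₁ → E′ t₁ t₂ q₁ q₂ → E′ t₂ t₃ q₂ q₃ →
              ∃[ j ] vertex t₀ q₀ ≡ vertex (core j) info′
            no-walk (core j) _ _ _ refl _ _ _ = j , refl
            no-walk (level zero) (mid k) (level v1) (core _) _ _ _ (lift ())
            no-walk (level zero) (mid k) (level v1) (level _) _ _ _ (lift ())
            no-walk (level zero) (mid k) (level v1) (mid _) _ _ _ (lift ())
            no-walk (level zero) (mid k) (level v2) (core _) _ _ _ (lift ())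
            no-walk (level zero) (mid k) (level v2) (level _) _ _ _ (lift ())
            no-walk (level zero) (mid k) (level v2) (mid _) _ _ _ (lift ())
            no-walk (mid k) (level v1) (core _) _ _ _ (lift ()) _
            no-walk (mid k) (level v1) (level _) _ _ _ (lift ()) _
            no-walk (mid k) (level v1) (mid _) _ _ _ (lift ()) _
            no-walk (mid k) (level v2) (core _) _ _ _ (lift ()) _
            no-walk (mid k) (level v2) (level _) _ _ _ (lift ()) _
            no-walk (mid k) (level v2) (mid _) _ _ _ (lift ()) _
            from-walk : ∀ {x₀ x₁ x₂ x₃} →
              ∃[ t ] ∃[ q ] (x₀ ≡ vertex t q × VertexRel t u′ p′ α′ w′ info′ q) → ∃[ t ] ∃[ q ] (x₁ ≡ vertex t q × VertexRel t u′ p′ α′ w′ info′ q) →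
              ∃[ t ] ∃[ q ] (x₂ ≡ vertex t q × VertexRel t u′ p′ α′ w′ info′ q) → ∃[ t ] ∃[ q ] (x₃ ≡ vertex t q × VertexRel t u′ p′ α′ w′ info′ q) →
              Edge g′ x₀ x₁ → Edge g′ x₁ x₂ → Edge g′ x₂ x₃ → ∃[ j ] x₀ ≡ vertex (core j) info′
            from-walk (t₀ , q₀ , refl , r) (t₁ , q₁ , refl , _) (t₂ , q₂ , refl , _) (t₃ , q₃ , refl , _) e₀ e₁ e₂ =
              no-walk t₀ t₁ t₂ t₃ r (T.edge⁻ t₀ t₁ e₀) (T.edge⁻ t₁ t₂ e₁) (T.edge⁻ t₂ t₃ e₂)

        core-fixed : ∀ i → F (vertex (core i) info) ≡ vertex (core i) info′
        core-fixed i = trans (proj₂ (core-image i)) (cong (λ j → vertex (core j) info′) (core-rigid σ preserve i))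
          where
            σ : Fin 13 → Fin 13
            σ i = proj₁ (core-image i)
            preserve : ∀ i j → CoreEdge i j → CoreEdge (σ i) (σ j)
            preserve i j e = lower (proj₂ (proj₂ (T.edge⁻ (core (σ i)) (core (σ j)) (subst₂ (Edge g′) (proj₂ (core-image i)) (proj₂ (core-image j))
              (hom-edge H (S.vertex⁺ (core i) refl) (S.vertex⁺ (core j) refl) (S.edge⁺ (core i) (core j) (refl , refl , lift e)))))))

        marked : ∀ i t → VertexRel t u p α w info q → EdgeRel (core i) t u p α w info info q →
          ∃[ s ] ∃[ r ] (F (vertex t q) ≡ vertex s r × E′ (core i) s info′ r)
        marked {q} i t v k = let
            (s , r , e , _) = T.vertex⁻ (hom-vertex H (S.vertex⁺ t v))
          in s , r , e , T.edge⁻ (core i) s (subst₂ (Edge g′) (core-fixed i) e (hom-edge H (S.vertex⁺ (core i) refl) (S.vertex⁺ t v) (S.edge⁺ (core i) t k)))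

        image-edge : ∀ s t {q q′ s′ r t′ r′} → EdgeRel s t u p α w info q q′ → F (vertex s q) ≡ vertex s′ r → F (vertex t q′) ≡ vertex t′ r′ → E′ s′ t′ r r′
        image-edge s t {s′ = s′} {t′ = t′} k e e′ = T.edge⁻ s′ t′ (subst₂ (Edge g′) e e′
          (hom-edge H (S.vertex⁺ s (edge⇒vertexˡ s t k)) (S.vertex⁺ t (edge⇒vertexʳ s t k)) (S.edge⁺ s t k)))

        diagonal : X ∈ p → Triple zero u p α w ⟨ X , ⟨ X , X ⟩ ⟩
        diagonal X∈ = mkTriple refl X∈ X∈ X∈ (refl , refl)

        to-mid : ∀ {k q X} → X ∈ p → Triple k u p α w q → First q X → EdgeRel (level zero) (mid k) u p α w info X q
        to-mid X∈ t f = X∈ , t , f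

        -- The marking by core vertex 0 leaves level 0 or core vertex 1. In the second case the
        -- image of the diagonal triple would be a successor of both core vertices 1 and 3, and
        -- there is no such vertex.
        level₀-image : X ∈ p → ∃[ r ] (F (vertex (level zero) X) ≡ vertex (level zero) r × r ∈ p′)
        level₀-image {X} X∈ = analyse (marked v0 (level zero) X∈ (refl , X∈ , lift refl)) (marked v3 (mid zero) (diagonal X∈) (refl , diagonal X∈ , lift refl))
          where
            analyse : ∃[ s ] ∃[ r ] (F (vertex (level zero) X) ≡ vertex s r × E′ (core v0) s info′ r) →
              ∃[ s ] ∃[ r ] (F (vertex (mid zero) ⟨ X , ⟨ X , X ⟩ ⟩) ≡ vertex s r × E′ (core v3) s info′ r) →
              ∃[ r ] (F (vertex (level zero) X) ≡ vertex (level zero) r × r ∈ p′)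
            analyse (level zero , r , e , _ , r∈ , _) _ = r , e , r∈
            analyse (level (suc zero) , r , e , _ , _ , lift ()) _
            analyse (level (suc (suc zero)) , r , e , _ , _ , lift ()) _
            analyse (mid k , r , e , _ , _ , lift ()) _
            analyse (core j , r , e , _ , _ , lift k) (s , r′ , e′ , k′) = ⊥-elim (bad j s k k′ (image-edge (level zero) (mid zero) {s′ = core j} {t′ = s} (to-mid X∈ (diagonal X∈) (_ , _ , refl , refl)) e e′))
              where
                bad : ∀ j s {r r′} → CoreEdge v0 j → E′ (core v3) s info′ r′ → E′ (core j) s r r′ → ⊥
                bad .(next v0) (core .(next v3)) (inj₁ refl) (_ , _ , lift (inj₁ refl)) (_ , _ , lift (inj₁ ()))
                bad .(next v0) (core .(next v3)) (inj₁ refl) (_ , _ , lift (inj₁ refl)) (_ , _ , lift (inj₂ (_ , ())))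
                bad .(next v0) (core s) (inj₁ refl) (_ , _ , lift (inj₂ (() , _)))
                bad .(next v0) (level zero) (inj₁ refl) (_ , _ , lift ())
                bad .(next v0) (level (suc zero)) (inj₁ refl) (_ , _ , lift ())
                bad .(next v0) (level (suc (suc zero))) (inj₁ refl) (_ , _ , lift ())
                bad .(next v0) (mid k) (inj₁ refl) _ (_ , _ , lift ())
                bad j s (inj₂ (() , _))

        e : V → V
        e X = π₂ (F (vertex (level zero) X))

        level₀ : X ∈ p → F (vertex (level zero) X) ≡ vertex (level zero) (e X) × e X ∈ p′
        level₀ X∈ = let (r , k , r∈) = level₀-image X∈ ; r≡ = sym (trans (cong π₂ k) π₂-pair) in
          trans k (cong (vertex (level zero)) r≡) , subst (_∈ p′) r≡ r∈

        -- The image has an incoming edge from level 0, so it is a triple; its marking by the core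
        -- fixes the kind, and the edge determines its first entry.
        mid-image : ∀ k {q} → Triple k u p α w q → ∃[ r ] (F (vertex (mid k) q) ≡ vertex (mid k) r × Triple k u′ p′ α′ w′ r × (∀ X → First q X → First r (e X)))
        mid-image k {q} t = analyse (marked (midCore k) (mid k) t (refl , t , lift refl))
          where
            first-edge : ∀ {s r X} → F (vertex (mid k) q) ≡ vertex s r → First q X → E′ (level zero) s (e X) r
            first-edge {s = s} {X = X} h f = image-edge (level zero) (mid k) {s′ = level zero} {t′ = s} (to-mid (inFirst t f) t f) (proj₁ (level₀ (inFirst t f))) h
              where
                inFirst : Triple k u p α w q → First q X → X ∈ p
                inFirst (mkTriple refl i _ _ _) f = subst (_∈ p) (sym (first-≡ f)) i
            some-first : ∃[ X ] First q X
            some-first = firstOf t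
              where
                firstOf : Triple k u p α w q → ∃[ X ] First q X
                firstOf (mkTriple shape _ _ _ _) = _ , _ , _ , shape , refl
            analyse : ∃[ s ] ∃[ r ] (F (vertex (mid k) q) ≡ vertex s r × E′ (core (midCore k)) s info′ r) →
              ∃[ r ] (F (vertex (mid k) q) ≡ vertex (mid k) r × Triple k u′ p′ α′ w′ r × (∀ X → First q X → First r (e X)))
            analyse (mid k′ , r , h , _ , t′ , lift i) = r , trans h (cong (λ k → vertex (mid k) r) (sym k≡)) , subst (λ k → Triple k u′ p′ α′ w′ r) (sym k≡) t′ ,
                λ X f → proj₂ (proj₂ (first-edge {mid k′} h f))
              where
                k≡ : k ≡ k′
                k≡ = suc-injective (suc-injective (suc-injective i))
            analyse (core j , r , h , _) = ⊥-elim (lower (first-edge {core j} h (proj₂ some-first)))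
            analyse (level l , r , h , _) = ⊥-elim (lower (first-edge {level l} h (proj₂ some-first)))

        -- The diagonal triple of kind `zero` on `X` is again mapped to a diagonal triple, whose
        -- first entry is `e X`. Its edges to levels 1 and 2 make the other copies follow.
        later-image : ∀ (l : Fin 2) → X ∈ p → F (vertex (level (suc l)) X) ≡ vertex (level (suc l)) (e X)
        later-image {X} l X∈ = analyse l (marked (levelCore (suc l)) (level (suc l)) X∈ (refl , X∈ , lift refl)) (mid-image zero (diagonal X∈))
          where
            analyse : ∀ (l : Fin 2) → ∃[ s ] ∃[ r ] (F (vertex (level (suc l)) X) ≡ vertex s r × E′ (core (levelCore (suc l))) s info′ r) →
              ∃[ r ] (F (vertex (mid zero) ⟨ X , ⟨ X , X ⟩ ⟩) ≡ vertex (mid zero) r × Triple zero u′ p′ α′ w′ r × (∀ Y → First ⟨ X , ⟨ X , X ⟩ ⟩ Y → First r (e Y))) →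
              F (vertex (level (suc l)) X) ≡ vertex (level (suc l)) (e X)
            analyse zero (s , r , h , m) (r′ , h′ , t , f) = second s m h (image-edge (mid zero) (level v1) {s′ = mid zero} {t′ = s} (X∈ , diagonal X∈ , (_ , _ , refl , _ , _ , refl , refl)) h′ h) t (f X (_ , _ , refl , refl))
              where
                second : ∀ s {r r′} → E′ (core v1) s info′ r → F (vertex (level v1) X) ≡ vertex s r → E′ (mid zero) s r′ r →
                  Triple zero u′ p′ α′ w′ r′ → First r′ (e X) → F (vertex (level v1) X) ≡ vertex (level v1) (e X)
                second (level (suc zero)) _ h (_ , _ , k) (mkTriple refl _ _ _ (y , _)) f = trans h (cong (vertex (level v1)) (trans (second-≡ k) (trans y (sym (first-≡ f)))))
                second (level (suc (suc zero))) (_ , _ , lift ()) _ _ _ _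
            analyse (suc zero) (s , r , h , m) (r′ , h′ , t , f) = third s m h (image-edge (mid zero) (level v2) {s′ = mid zero} {t′ = s} (X∈ , diagonal X∈ , (_ , _ , refl , _ , _ , refl , refl)) h′ h) t (f X (_ , _ , refl , refl))
              where
                third : ∀ s {r r′} → E′ (core v2) s info′ r → F (vertex (level v2) X) ≡ vertex s r → E′ (mid zero) s r′ r →
                  Triple zero u′ p′ α′ w′ r′ → First r′ (e X) → F (vertex (level v2) X) ≡ vertex (level v2) (e X)
                third (level (suc (suc zero))) _ h (_ , _ , k) (mkTriple refl _ _ _ (_ , z)) f = trans h (cong (vertex (level v2)) (trans (third-≡ k) (trans z (sym (first-≡ f)))))
                third (level (suc zero)) (_ , _ , lift ()) _ _ _ _

        mid-value : ∀ k {X Y W} → X ∈ p → Y ∈ p → W ∈ p → RelK k u p α w X Y W →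
          F (vertex (mid k) ⟨ X , ⟨ Y , W ⟩ ⟩) ≡ vertex (mid k) ⟨ e X , ⟨ e Y , e W ⟩ ⟩ × RelK k u′ p′ α′ w′ (e X) (e Y) (e W)
        mid-value k {X} {Y} {W} X∈ Y∈ W∈ r = analyse (mid-image k t)
          where
            t : Triple k u p α w ⟨ X , ⟨ Y , W ⟩ ⟩
            t = mkTriple refl X∈ Y∈ W∈ r
            analyse : ∃[ r ] (F (vertex (mid k) ⟨ X , ⟨ Y , W ⟩ ⟩) ≡ vertex (mid k) r × Triple k u′ p′ α′ w′ r × (∀ Z → First ⟨ X , ⟨ Y , W ⟩ ⟩ Z → First r (e Z))) →
              F (vertex (mid k) ⟨ X , ⟨ Y , W ⟩ ⟩) ≡ vertex (mid k) ⟨ e X , ⟨ e Y , e W ⟩ ⟩ × RelK k u′ p′ α′ w′ (e X) (e Y) (e W)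
            analyse (_ , h , mkTriple refl _ _ _ r′ , f) = finish
                (first-≡ (f X (_ , _ , refl , refl)))
                (second-≡ (proj₂ (proj₂ (image-edge (mid k) (level v1) {s′ = mid k} {t′ = level v1} (Y∈ , t , (_ , _ , refl , _ , _ , refl , refl)) h (later-image v0 Y∈)))))
                (third-≡ (proj₂ (proj₂ (image-edge (mid k) (level v2) {s′ = mid k} {t′ = level v2} (W∈ , t , (_ , _ , refl , _ , _ , refl , refl)) h (later-image v1 W∈)))))
                h r′
              where
                finish : ∀ {X′ Y′ W′} → e X ≡ X′ → e Y ≡ Y′ → e W ≡ W′ → F (vertex (mid k) ⟨ X , ⟨ Y , W ⟩ ⟩) ≡ vertex (mid k) ⟨ X′ , ⟨ Y′ , W′ ⟩ ⟩ →
                  RelK k u′ p′ α′ w′ X′ Y′ W′ → F (vertex (mid k) ⟨ X , ⟨ Y , W ⟩ ⟩) ≡ vertex (mid k) ⟨ e X , ⟨ e Y , e W ⟩ ⟩ × RelK k u′ p′ α′ w′ (e X) (e Y) (e W)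
                finish refl refl refl h r = h , r

      opaque
        unfolding e
        eG : Graph₁ e
        eG = graph₁ (π₂ᵗ (appᵗ (con h) ⟨ con (tagCode (level zero)) , var v0 ⟩ᵗ))

    opaque
      hom-determined : ∀ {u p α w info g u′ p′ α′ w′ info′ g′ h k} (G : GraphOf u p α w info g) (G′ : GraphOf u′ p′ α′ w′ info′ g′)
        (H : IsHom h g g′) (K : IsHom k g g′) → (∀ X → X ∈ p → HomAnalysis.e G G′ H X ≡ HomAnalysis.e G G′ K X) → h ≡ k
      hom-determined {u} {p} {α} {w} {info} {g} {g′ = g′} {h = h} {k} G G′ H K same = fun-ext (fun (vertexFun H)) (fun (vertexFun K)) λ x x∈ → values (V.vertex⁻ (from V.isVertex (to (∈V₀ G x) x∈)))
        where
          module V = Coded G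
          module L = HomAnalysis G G′ H
          module R = HomAnalysis G G′ K
          vertexFun : ∀ {h} → IsHom h g g′ → IsFunction (_∈ h) (_∈ V₀ G)
          vertexFun (F , _) = (λ z z∈ → let (x , y , vx , e) = proj₁ F z z∈ in x , y , from (∈V₀ G x) (to V.isVertex vx) , e) ,
            (λ x x∈ → proj₂ F x (from V.isVertex (to (∈V₀ G x) x∈)))
          values : ∀ {x} → ∃[ t ] ∃[ q ] (x ≡ vertex t q × VertexRel t u p α w info q) → app h x ≡ app k x
          values (core i , q , refl , refl) = trans (L.core-fixed i) (sym (R.core-fixed i))
          values (level zero , q , refl , q∈) = trans (proj₁ (L.level₀ q∈)) (trans (cong (vertex (level zero)) (same q q∈)) (sym (proj₁ (R.level₀ q∈))))
          values (level (suc l) , q , refl , q∈) = trans (L.later-image l q∈) (trans (cong (vertex (level (suc l))) (same q q∈)) (sym (R.later-image l q∈)))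
          values (mid k′ , q , refl , mkTriple {X} {Y} {W} refl X∈ Y∈ W∈ r) = trans (proj₁ (L.mid-value k′ X∈ Y∈ W∈ r))
            (trans (cong (vertex (mid k′)) (cong₂ ⟨_,_⟩ (same X X∈) (cong₂ ⟨_,_⟩ (same Y Y∈) (same W W∈)))) (sym (proj₁ (R.mid-value k′ X∈ Y∈ W∈ r))))

  open Coding public

  -- Existence of the coded graphs and homomorphisms induced by preserving maps.

  module Homomorphisms where
    private variable
      n : ℕ
      a b c d x y z u w f g A X Y W q q′ α : V

    opaque
      num∈ : ∀ {u} → PairClosed u → ∀ k → num k ∈ u
      num∈ pc zero    = pc-∅ pc
      num∈ pc (suc k) = pc-pair pc (num∈ pc k) (num∈ pc k)

      tagCode∈ : ∀ {u} → PairClosed u → ∀ t → tagCode t ∈ u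
      tagCode∈ pc (core i)  = op∈ pc (num∈ pc 0) (num∈ pc (toℕ i))
      tagCode∈ pc (level i) = op∈ pc (num∈ pc 1) (num∈ pc (toℕ i))
      tagCode∈ pc (mid i)   = op∈ pc (num∈ pc 2) (num∈ pc (toℕ i))

      payload∈ : ∀ {N u p α w info} → PairClosed N → p ∈ N → info ∈ N → ∀ t → VertexRel t u p α w info q → q ∈ N
      payload∈ pc p∈ i∈ (core _) h = subst (_∈ _) (sym h) i∈
      payload∈ pc p∈ i∈ (level _) h = pc-tr pc _ p∈ _ h
      payload∈ pc p∈ i∈ (mid k) (mkTriple shape X∈ Y∈ W∈ _) =
        subst (_∈ _) (sym shape) (op∈ pc (pc-tr pc _ p∈ _ X∈) (op∈ pc (pc-tr pc _ p∈ _ Y∈) (pc-tr pc _ p∈ _ W∈)))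

      isVertex∈ : ∀ {N u p α w info} → PairClosed N → p ∈ N → info ∈ N → IsVertex u p α w info x → x ∈ N
      isVertex∈ pc p∈ i∈ (t , c , q , x≡ , c≡ , h) = subst (_∈ _) (sym (trans x≡ (cong ⟨_, q ⟩ c≡))) (op∈ pc (tagCode∈ pc t) (payload∈ pc p∈ i∈ t h))

      graphExists : ∀ u p α w info → ∃[ g ] GraphOf u p α w info g
      graphExists u p α w info = build (everySetRanked ⟨ p , info ⟩)
        where
          build : ∃[ β ] (Ord β × ⟨ p , info ⟩ ∈ 𝕍 β) → ∃[ g ] GraphOf u p α w info g
          build (β , oβ , h) = within (limitAbove oβ)
            where
              within : ∃[ ν ] (Lim ν × β ∈ ν) → ∃[ g ] GraphOf u p α w info g
              within (ν , L , β∈) = ⟨ vs , es ⟩ , mkGraphOf refl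
                  (λ x → ∈sep ⇔∘ mk⇔ proj₂ (λ k → isVertex∈ pc p∈ i∈ k , k))
                  (λ z → ∈sep ⇔∘ mk⇔ proj₂ (λ k → edge∈ z k , k))
                where
                  pc : PairClosed (𝕍 ν)
                  pc = 𝕍-pairClosed L
                  pi∈ : ⟨ p , info ⟩ ∈ 𝕍 ν
                  pi∈ = 𝕍-mono (lim-ord L) (∈⇒⊆ (lim-ord L) β∈) oβ _ h
                  p∈ : p ∈ 𝕍 ν
                  p∈ = opˡ pc pi∈
                  i∈ : info ∈ 𝕍 ν
                  i∈ = opʳ pc pi∈
                  vs es : V
                  vs = sep (D₀⇒D isVertex₀ ᵈ[ con u ∷ con p ∷ con α ∷ con w ∷ con info ∷ var v0 ∷ [] ]) (𝕍 ν)
                  es = sep (∃ᵈ (∃ᵈ (var v2 ≡ᵈ ⟨ var v1 , var v0 ⟩ᵗ ∧ᵈ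
                         D₀⇒D isEdge₀ ᵈ[ con u ∷ con p ∷ con α ∷ con w ∷ con info ∷ var v1 ∷ var v0 ∷ [] ]))) (𝕍 ν)
                  edge∈ : ∀ z → ∃[ x ] ∃[ y ] (z ≡ ⟨ x , y ⟩ × IsEdge u p α w info x y) → z ∈ 𝕍 ν
                  edge∈ z (x , y , z≡ , s , t , c , q , x≡ , c≡ , c′ , q′ , y≡ , c′≡ , k) = subst (_∈ 𝕍 ν) (sym z≡)
                    (op∈ pc (isVertex∈ pc p∈ i∈ (s , c , q , x≡ , c≡ , edge⇒vertexˡ s t k)) (isVertex∈ pc p∈ i∈ (t , c′ , q′ , y≡ , c′≡ , edge⇒vertexʳ s t k)))

      graphUnique : ∀ {u p α w info g g′} → GraphOf u p α w info g → GraphOf u p α w info g′ → g ≡ g′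
      graphUnique G G′ = trans (GraphOf.g≡ G) (trans (cong₂ ⟨_,_⟩
        (extensionality λ x → GraphOf.∈V₀ G x ⇔∘ ⇔-sym (GraphOf.∈V₀ G′ x)) (extensionality λ z → GraphOf.∈E₀ G z ⇔∘ ⇔-sym (GraphOf.∈E₀ G′ z))) (sym (GraphOf.g≡ G′)))

    module Induced {u p α w info g u′ p′ α′ w′ info′ g′ : V} (G : GraphOf u p α w info g) (G′ : GraphOf u′ p′ α′ w′ info′ g′)
      {e : V → V} (gE : Graph₁ e) (into : ∀ X → X ∈ p → e X ∈ p′)
      (preserves : ∀ k {X Y W} → X ∈ p → Y ∈ p → W ∈ p → RelK k u p α w X Y W → RelK k u′ p′ α′ w′ (e X) (e Y) (e W)) where
      private
        module S = Coded G
        module T = Coded G′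

      -- num 0, num 1, num 2 are the first entries of the codes of core, level and mid tags.
      onPayload : V → V → V → Set ℓ
      onPayload s q q′ = (s ≡ num 0 × q′ ≡ info′) ⊎ (s ≡ num 1 × q′ ≡ e q) ⊎
        (s ≡ num 2 × q′ ≡ ⟨ e (π₁ q) , ⟨ e (π₁ (π₂ q)) , e (π₂ (π₂ q)) ⟩ ⟩)

      onPayloadᵈ : Def 3 (λ ρ → onPayload (lookup ρ v0) (lookup ρ v1) (lookup ρ v2))
      onPayloadᵈ = (var v0 ≡ᵈ con (num 0) ∧ᵈ var v2 ≡ᵈ con info′) ∨ᵈ (var v0 ≡ᵈ con (num 1) ∧ᵈ var v2 ≡ᵈ fn₁ gE (var v1)) ∨ᵈ
        (var v0 ≡ᵈ con (num 2) ∧ᵈ var v2 ≡ᵈ ⟨ fn₁ gE (π₁ᵗ (var v1)) , ⟨ fn₁ gE (π₁ᵗ (π₂ᵗ (var v1))) , fn₁ gE (π₂ᵗ (π₂ᵗ (var v1))) ⟩ᵗ ⟩ᵗ)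

      image : Tag → V → V
      image (core i)  q = info′
      image (level l) q = e q
      image (mid k)   q = ⟨ e (π₁ q) , ⟨ e (π₁ (π₂ q)) , e (π₂ (π₂ q)) ⟩ ⟩

      -- The homomorphism must be cut out by one formula, so the case distinction on tags in `image`
      -- is replaced by conditions on projections. The two agree by `corresponds-value` and
      -- `corresponds-image`.
      record Corresponds (x y : V) : Set ℓ where
        constructor mkCorresponds
        field
          sameTag : π₁ y ≡ π₁ x
          isPair  : y ≡ ⟨ π₁ y , π₂ y ⟩
          payload : onPayload (π₁ (π₁ x)) (π₂ x) (π₂ y)
      open Corresponds

      correspondsᵈ : Def 2 (λ ρ → Corresponds (lookup ρ v0) (lookup ρ v1))
      correspondsᵈ = (π₁ᵗ (var v1) ≡ᵈ π₁ᵗ (var v0) ∧ᵈ var v1 ≡ᵈ ⟨ π₁ᵗ (var v1) , π₂ᵗ (var v1) ⟩ᵗ ∧ᵈ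
          onPayloadᵈ ᵈ[ π₁ᵗ (π₁ᵗ (var v0)) ∷ π₂ᵗ (var v0) ∷ π₂ᵗ (var v1) ∷ [] ])
        redef λ ρ → mk⇔ (λ (h , k , l) → mkCorresponds h k l) (λ C → sameTag C , isPair C , payload C)

      opaque
        payload-value : ∀ t {q q′} → onPayload (π₁ (tagCode t)) q q′ → q′ ≡ image t q
        payload-value (core i) (inj₁ (_ , h)) = h
        payload-value (core i) (inj₂ (inj₁ (h , _))) = case num-injective 0 1 (trans (sym π₁-pair) h) of λ ()
        payload-value (core i) (inj₂ (inj₂ (h , _))) = case num-injective 0 2 (trans (sym π₁-pair) h) of λ ()
        payload-value (level l) (inj₁ (h , _)) = case num-injective 1 0 (trans (sym π₁-pair) h) of λ ()
        payload-value (level l) (inj₂ (inj₁ (_ , h))) = h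
        payload-value (level l) (inj₂ (inj₂ (h , _))) = case num-injective 1 2 (trans (sym π₁-pair) h) of λ ()
        payload-value (mid k) (inj₁ (h , _)) = case num-injective 2 0 (trans (sym π₁-pair) h) of λ ()
        payload-value (mid k) (inj₂ (inj₁ (h , _))) = case num-injective 2 1 (trans (sym π₁-pair) h) of λ ()
        payload-value (mid k) (inj₂ (inj₂ (_ , h))) = h

        payload-image : ∀ t q → onPayload (π₁ (tagCode t)) q (image t q)
        payload-image (core i) q = inj₁ (π₁-pair , refl)
        payload-image (level l) q = inj₂ (inj₁ (π₁-pair , refl))
        payload-image (mid k) q = inj₂ (inj₂ (π₁-pair , refl))

        corresponds-value : ∀ t {q y} → Corresponds (vertex t q) y → y ≡ vertex t (image t q)
        corresponds-value t {q} {y} C = trans (isPair C) (cong₂ ⟨_,_⟩ (trans (sameTag C) π₁-pair)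
          (payload-value t (subst₂ (λ a b → onPayload (π₁ a) b (π₂ y)) π₁-pair π₂-pair (payload C))))

        corresponds-image : ∀ t q → Corresponds (vertex t q) (vertex t (image t q))
        corresponds-image t q = mkCorresponds (trans π₁-pair (sym π₁-pair)) (cong₂ ⟨_,_⟩ (sym π₁-pair) (sym π₂-pair))
          (subst (onPayload (π₁ (π₁ (vertex t q))) (π₂ (vertex t q))) (sym π₂-pair)
            (subst₂ (λ a b → onPayload (π₁ a) b (image t q)) (sym π₁-pair) (sym π₂-pair) (payload-image t q)))

        triple-image : ∀ k {X Y W} → image (mid k) ⟨ X , ⟨ Y , W ⟩ ⟩ ≡ ⟨ e X , ⟨ e Y , e W ⟩ ⟩
        triple-image k = cong₂ ⟨_,_⟩ (cong e π₁-pair) (cong₂ ⟨_,_⟩ (cong e (trans (cong π₁ π₂-pair) π₁-pair)) (cong e (trans (cong π₂ π₂-pair) π₂-pair)))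

        triple⁺ : ∀ k {q} → Triple k u p α w q → Triple k u′ p′ α′ w′ (image (mid k) q)
        triple⁺ k (mkTriple refl X∈ Y∈ W∈ r) = mkTriple (triple-image k) (into _ X∈) (into _ Y∈) (into _ W∈) (preserves k X∈ Y∈ W∈ r)

        image-vertex : ∀ t {q} → VertexRel t u p α w info q → VertexRel t u′ p′ α′ w′ info′ (image t q)
        image-vertex (core i)  h = refl
        image-vertex (level l) h = into _ h
        image-vertex (mid k)   h = triple⁺ k h

        first⁺ : ∀ k {q x} → First q x → First (image (mid k) q) (e x)
        first⁺ k (a , b , refl , refl) = _ , _ , refl , cong e (sym π₁-pair)
        second⁺ : ∀ k {q x} → Second q x → Second (image (mid k) q) (e x)
        second⁺ k (a , b , refl , c , d , refl , refl) = _ , _ , refl , _ , _ , refl , cong e (sym (trans (cong π₁ π₂-pair) π₁-pair))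
        third⁺ : ∀ k {q x} → Third q x → Third (image (mid k) q) (e x)
        third⁺ k (a , b , refl , c , d , refl , refl) = _ , _ , refl , _ , _ , refl , cong e (sym (trans (cong π₂ π₂-pair) π₂-pair))

        image-edge : ∀ s t {q q′} → EdgeRel s t u p α w info q q′ → EdgeRel s t u′ p′ α′ w′ info′ (image s q) (image t q′)
        image-edge (core i)     (core j)   (_ , _ , h) = refl , refl , h
        image-edge (core i)     (level l)  (_ , h , k) = refl , into _ h , k
        image-edge (core i)     (mid k)    (_ , h , l) = refl , triple⁺ k h , l
        image-edge (level zero) (mid k)    (h , t , f) = into _ h , triple⁺ k t , first⁺ k f
        image-edge (mid k)      (level v1) (h , t , f) = into _ h , triple⁺ k t , second⁺ k f
        image-edge (mid k)      (level v2) (h , t , f) = into _ h , triple⁺ k t , third⁺ k f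

      private
        vs vs′ : V
        vs = GraphOf.V₀ G
        vs′ = GraphOf.V₀ G′

      opaque
        induced : V
        induced = sep (∃ᵈ (∃ᵈ (var v2 ≡ᵈ ⟨ var v1 , var v0 ⟩ᵗ ∧ᵈ correspondsᵈ ᵈ[ var v1 ∷ var v0 ∷ [] ]))) (vs ⊗ vs′)

        ∈induced : ⟨ x , y ⟩ ∈ induced ⇔ (x ∈ vs × y ∈ vs′ × Corresponds x y)
        ∈induced {x} {y} = ∈sep ⇔∘ mk⇔
          (λ (h , a , b , k , C) → let (a′ , b′ , a∈ , b∈ , k′) = to ∈⊗ h in
            subst (_∈ vs) (sym (pair-inj₁ k′)) a∈ , subst (_∈ vs′) (sym (pair-inj₂ k′)) b∈ , subst₂ Corresponds (sym (pair-inj₁ k)) (sym (pair-inj₂ k)) C)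
          (λ (h , k , C) → from ∈⊗ (x , y , h , k , refl) , x , y , refl , C)

        induced-pair : z ∈ induced → ∃[ x ] ∃[ y ] (x ∈ vs × z ≡ ⟨ x , y ⟩)
        induced-pair h = let (x , y , x∈ , _ , e) = to ∈⊗ (proj₁ (to ∈sep h)) in x , y , x∈ , e

        ∈vs : x ∈ vs ⇔ Vertex g x
        ∈vs {x} = GraphOf.∈V₀ G x ⇔∘ ⇔-sym S.isVertex

        induced-hom : IsHom induced g g′
        induced-hom =
            ((λ z h → let (x , y , x∈ , k) = induced-pair h in x , y , to ∈vs x∈ , k) , λ x vx → value x (S.vertex⁻ vx)) ,
            (λ x y h → let (_ , y∈ , _) = to ∈induced h in from T.isVertex (to (GraphOf.∈V₀ G′ y) y∈)) ,
            λ x x′ y y′ h h′ k → edge (S.vertex⁻ (to ∈vs (proj₁ (to ∈induced h)))) (S.vertex⁻ (to ∈vs (proj₁ (to ∈induced h′))))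
              (proj₂ (proj₂ (to ∈induced h))) (proj₂ (proj₂ (to ∈induced h′))) k
          where
            value : ∀ x → ∃[ t ] ∃[ q ] (x ≡ vertex t q × VertexRel t u p α w info q) → ∃! _≡_ λ y → ⟨ x , y ⟩ ∈ induced
            value _ (t , q , refl , r) = vertex t (image t q) ,
              from ∈induced (from ∈vs (S.vertex⁺ t r) , from (GraphOf.∈V₀ G′ _) (to T.isVertex (T.vertex⁺ t (image-vertex t r))) , corresponds-image t q) ,
              λ h → sym (corresponds-value t (proj₂ (proj₂ (to ∈induced h))))
            edge : ∀ {x x′ y y′} → ∃[ t ] ∃[ q ] (x ≡ vertex t q × VertexRel t u p α w info q) → ∃[ t ] ∃[ q ] (x′ ≡ vertex t q × VertexRel t u p α w info q) →
              Corresponds x y → Corresponds x′ y′ → Edge g x x′ → Edge g′ y y′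
            edge (s , q , refl , _) (t , q′ , refl , _) C C′ k = subst₂ (Edge g′) (sym (corresponds-value s C)) (sym (corresponds-value t C′))
              (T.edge⁺ s t (image-edge s t (S.edge⁻ s t k)))

  open Homomorphisms public

  -- Levels closed under failures of strongness, and their Π₁ description.

  module Levels where
    private variable
      n : ℕ
      a x y u v f A W α β γ κ μ ν : V

    -- The least ordinal satisfying a definable relation, or ∅.
    module LeastSuch {R : V → V → Set ℓ} (dR : Def 2 (λ ρ → R (lookup ρ v0) (lookup ρ v1))) where

      record Least (α x : V) : Set ℓ where
        constructor mkLeast
        field chosen : (Ord α × R x α × ∀ γ → γ ∈ α → ¬ R x γ) ⊎ (α ≡ ∅ × ¬ (∃[ β ] (Ord β × R x β)))

      leastᵈ : Def 2 (λ ρ → Least (lookup ρ v0) (lookup ρ v1))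
      leastᵈ = ((ordᵈ ᵈ[ var v0 ∷ [] ] ∧ᵈ dR ᵈ[ var v1 ∷ var v0 ∷ [] ] ∧ᵈ ∀ᵈ (var v0 ∈ᵈ var v1 ⇒ᵈ ¬ᵈ (dR ᵈ[ var v2 ∷ var v0 ∷ [] ])))
          ∨ᵈ (var v0 ≡ᵈ con ∅ ∧ᵈ ¬ᵈ ∃ᵈ (ordᵈ ᵈ[ var v0 ∷ [] ] ∧ᵈ dR ᵈ[ var v2 ∷ var v0 ∷ [] ])))
        redef λ ρ → mk⇔ mkLeast Least.chosen

      private
        unique : ∀ {α β x} → Least α x → Least β x → α ≡ β
        unique (mkLeast (inj₁ (oα , rα , mα))) (mkLeast (inj₁ (oβ , rβ , mβ))) =
          [ (λ h → ⊥-elim (mβ _ h rα)) , [ id , (λ h → ⊥-elim (mα _ h rβ)) ]′ ]′ (trichotomy oα oβ)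
        unique (mkLeast (inj₁ (oα , rα , _))) (mkLeast (inj₂ (_ , n))) = ⊥-elim (n (_ , oα , rα))
        unique (mkLeast (inj₂ (_ , n))) (mkLeast (inj₁ (oβ , rβ , _))) = ⊥-elim (n (_ , oβ , rβ))
        unique (mkLeast (inj₂ (h , _))) (mkLeast (inj₂ (k , _))) = trans h (sym k)

        exists : ∀ x → ∃[ α ] Least α x
        exists x = [ (λ (β , oβ , r) → let (α , oα , rα , m) = leastOrd {P = R x} (dR ᵈ[ con x ∷ var v0 ∷ [] ]) oβ r in α , mkLeast (inj₁ (oα , rα , m)))
                   , (λ n → ∅ , mkLeast (inj₂ (refl , n))) ]′ (lem (∃[ β ] (Ord β × R x β)))

      opaque
        private
          function : Σ[ F ∈ (V → V) ] (Graph₁ F × ∀ x → Least (F x) x)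
          function = describe leastᵈ λ x → let (α , h) = exists x in α , h , unique h

        leastSuch : V → V
        leastSuch = proj₁ function

        leastSuchG : Graph₁ leastSuch
        leastSuchG = proj₁ (proj₂ function)

        leastSuch-ord : Ord (leastSuch x)
        leastSuch-ord {x} = [ proj₁ , (λ (h , _) → subst Ord (sym h) ord-∅) ]′ (Least.chosen (proj₂ (proj₂ function) x))

        leastSuch-holds : Ord β → R x β → R x (leastSuch x)
        leastSuch-holds {β} {x} o r = [ (λ (_ , h , _) → h) , (λ (_ , n) → ⊥-elim (n (β , o , r))) ]′ (Least.chosen (proj₂ (proj₂ function) x))

    -- Levels: the ordinals λ above α closed under the failures of strongness from ρ on.

    record Admissible (ρ ρ⁺ α lev : V) : Set ℓ where
      constructor mkAdmissible
      field
        ad-lim  : Lim lev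
        ad-α    : α ∈ lev
        ad-ρ⁺   : ρ⁺ ∈ lev
        ad-fail : ∀ κ → κ ∈ lev → ρ ⊆ κ → ∃[ μ ] (μ ∈ lev × Fails κ μ)
    open Admissible public

    admissibleᵈ : Def 4 (λ σ → Admissible (lookup σ v0) (lookup σ v1) (lookup σ v2) (lookup σ v3))
    admissibleᵈ = (D₀⇒D lim₀ ᵈ[ var v3 ∷ [] ] ∧ᵈ var v2 ∈ᵈ var v3 ∧ᵈ var v1 ∈ᵈ var v3 ∧ᵈ
        ∀ᵈ (var v0 ∈ᵈ var v4 ⇒ᵈ ⊆ᵈ ᵈ[ var v1 ∷ var v0 ∷ [] ] ⇒ᵈ ∃ᵈ (var v0 ∈ᵈ var v5 ∧ᵈ failsᵈ ᵈ[ var v1 ∷ var v0 ∷ [] ])))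
      redef λ σ → mk⇔ (λ (h , k , l , m) → mkAdmissible h k l m) (λ A → ad-lim A , ad-α A , ad-ρ⁺ A , ad-fail A)

    record LevelOf (ρ ρ⁺ α lev : V) : Set ℓ where
      constructor mkLevel
      field
        admissible : Admissible ρ ρ⁺ α lev
        minimal    : ∀ ν → ν ∈ lev → ¬ Admissible ρ ρ⁺ α ν
    open LevelOf public

    opaque
      level-unique : ∀ {ρ ρ⁺ lev lev′} → LevelOf ρ ρ⁺ α lev → LevelOf ρ ρ⁺ α lev′ → lev ≡ lev′
      level-unique L L′ = [ (λ h → ⊥-elim (minimal L′ _ h (admissible L))) , [ id , (λ h → ⊥-elim (minimal L _ h (admissible L′))) ]′ ]′
        (trichotomy (lim-ord (ad-lim (admissible L))) (lim-ord (ad-lim (admissible L′))))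

      -- Every ordinal κ ⊇ ρ has a least failure. A limit above α and ρ⁺ that is closed under this
      -- function is admissible, and the least admissible ordinal is taken.
      level-exists : ∀ {ρ ρ⁺} → Ord ρ⁺ → (∀ κ → Ord κ → ρ ⊆ κ → ¬ QAll κ) → Ord α → ∃[ lev ] LevelOf ρ ρ⁺ α lev
      level-exists {α} {ρ} {ρ⁺} oρ⁺ none oα = start (ord-max oα oρ⁺)
        where
          open LeastSuch {Fails} failsᵈ
          fails-somewhere : ∀ κ → Ord κ → ρ ⊆ κ → Fails κ (leastSuch κ)
          fails-somewhere κ oκ h = byContra λ n → none κ oκ h λ μ L κ∈ → byContra λ nq →
            n (leastSuch-holds (lim-ord L) (mkFails L κ∈ nq))
          start : ∃[ γ ] (Ord γ × α ∈ γ × ρ⁺ ∈ γ) → ∃[ lev ] LevelOf ρ ρ⁺ α lev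
          start (γ , oγ , α∈ , ρ⁺∈) = close (closedLimit leastSuchG (λ x _ → leastSuch-ord) oγ)
            where
              close : ∃[ σ ] (Lim σ × γ ∈ σ × ∀ ξ → ξ ∈ σ → leastSuch ξ ∈ σ) → ∃[ lev ] LevelOf ρ ρ⁺ α lev
              close (σ , L , γ∈ , closed-σ) = least-level (leastOrd {P = Admissible ρ ρ⁺ α} (admissibleᵈ ᵈ[ con ρ ∷ con ρ⁺ ∷ con α ∷ var v0 ∷ [] ]) (lim-ord L)
                  (mkAdmissible L (trans-ord (lim-ord L) γ γ∈ α α∈) (trans-ord (lim-ord L) γ γ∈ ρ⁺ ρ⁺∈)
                    λ κ κ∈ h → leastSuch κ , closed-σ κ κ∈ , fails-somewhere κ (ord-∈ (lim-ord L) κ∈) h))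
                where
                  least-level : ∃[ β ] (Ord β × Admissible ρ ρ⁺ α β × ∀ γ → γ ∈ β → ¬ Admissible ρ ρ⁺ α γ) → ∃[ lev ] LevelOf ρ ρ⁺ α lev
                  least-level (β , _ , A , m) = β , mkLevel A m

    -- Admissibility evaluated in u = V_λ with its hierarchy f, a Δ₀ notion.

    record NoWitness (κ v u : V) : Set ℓ where
      constructor mkNoWitness
      field noWitness : ∀ q → q ∈ u → (∀ t → t ∈ u → t ∈ q ⇔ t ⊆ v) → ∀ e → e ∈ u → ¬ Witness κ v q e

    noWitness₀ : D₀ 3 (λ σ → NoWitness (lookup σ v0) (lookup σ v1) (lookup σ v2))
    noWitness₀ = cast₀ (λ σ → mk⇔ mkNoWitness NoWitness.noWitness)
      (∀∈₀ v2 (∀∈₀ v3 (v0 ∈₀ v1 ⇔₀ ⊆₀ ₀[ v0 ∷ v3 ∷ [] ]) ⇒₀ ∀∈₀ v3 (¬₀ witness₀ ₀[ v2 ∷ v3 ∷ v1 ∷ v0 ∷ [] ])))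

    record LocallyAdmissible (ρ ρ⁺ α f u lev : V) : Set ℓ where
      constructor mkLocally
      field
        lo-lim  : Lim lev
        lo-α    : α ∈ lev
        lo-ρ⁺   : ρ⁺ ∈ lev
        lo-fail : ∀ κ → κ ∈ lev → ρ ⊆ κ → ∃[ μ ] ∃[ v ] (⟨ μ , v ⟩ ∈ f × μ ∈ lev × Lim μ × κ ∈ μ × NoWitness κ v u)
    open LocallyAdmissible

    locally₀ : D₀ 6 (λ σ → LocallyAdmissible (lookup σ v0) (lookup σ v1) (lookup σ v2) (lookup σ v3) (lookup σ v4) (lookup σ v5))
    locally₀ = cast₀ (λ σ → mk⇔ (λ (h , k , l , m) → mkLocally h k l m) (λ A → lo-lim A , lo-α A , lo-ρ⁺ A , lo-fail A))
      (lim₀ ₀[ v5 ∷ [] ] ∧₀ v2 ∈₀ v5 ∧₀ v1 ∈₀ v5 ∧₀ ∀∈₀ v5 (⊆₀ ₀[ v1 ∷ v0 ∷ [] ] ⇒₀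
        ∃op∈₀ v4 (v1 ∈₀ v8 ∧₀ lim₀ ₀[ v1 ∷ [] ] ∧₀ v2 ∈₀ v1 ∧₀ noWitness₀ ₀[ v2 ∷ v0 ∷ v7 ∷ [] ])))

    opaque
      unfolding hierarchy
      ∈hierarchy : ⟨ μ , v ⟩ ∈ hierarchy ν ⇔ (μ ∈ ν × v ≡ 𝕍 μ)
      ∈hierarchy = ∈lam

      hierarchy-fun : Fun (hierarchy ν) ν
      hierarchy-fun = lam-fun

    opaque
      -- The limit stage 𝕍 ν contains 𝒫 (𝕍 μ) and every witness for μ ∈ ν, so the search inside 𝕍 ν
      -- is exhaustive.
      noWitness⇔ : Lim ν → μ ∈ ν → NoWitness κ (𝕍 μ) (𝕍 ν) ⇔ (¬ Q κ μ)
      noWitness⇔ {ν} {μ} {κ} L μ∈ = mk⇔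
        (λ (mkNoWitness h) (e , W) → h (𝒫 (𝕍 μ)) (𝒫∈lim L v∈) (λ t _ → ∈𝒫) e (witness∈ L μ∈ W) W)
        (λ n → mkNoWitness λ q q∈ h e e∈ W → n (e , subst (λ q → Witness κ (𝕍 μ) q e) (⊆-antisym
          (λ t t∈ → from ∈𝒫 (to (h t (𝕍-trans (lim-ord L) q q∈ t t∈)) t∈))
          (λ t t∈ → from (h t (𝕍-⊆ (lim-ord L) v∈ (to ∈𝒫 t∈))) (to ∈𝒫 t∈))) W))
        where
          v∈ : 𝕍 μ ∈ 𝕍 ν
          v∈ = 𝕍∈𝕍 (lim-ord L) μ∈

      locally⇔ : ∀ {ρ ρ⁺ lev} → Lim ν → lev ⊆ ν → LocallyAdmissible ρ ρ⁺ α (hierarchy ν) (𝕍 ν) lev ⇔ Admissible ρ ρ⁺ α lev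
      locally⇔ {ν} {α} {ρ} {ρ⁺} {lev} L sub = mk⇔
        (λ A → mkAdmissible (lo-lim A) (lo-α A) (lo-ρ⁺ A) λ κ κ∈ h → forth (lo-fail A κ κ∈ h))
        (λ A → mkLocally (ad-lim A) (ad-α A) (ad-ρ⁺ A) λ κ κ∈ h → back (ad-fail A κ κ∈ h))
        where
          forth : ∀ {κ} → ∃[ μ ] ∃[ v ] (⟨ μ , v ⟩ ∈ hierarchy ν × μ ∈ lev × Lim μ × κ ∈ μ × NoWitness κ v (𝕍 ν)) → ∃[ μ ] (μ ∈ lev × Fails κ μ)
          forth {κ} (μ , v , h , μ∈ , Lμ , κ∈ , n) = μ , μ∈ , mkFails Lμ κ∈
            (to (noWitness⇔ L (sub μ μ∈)) (subst (λ v → NoWitness κ v (𝕍 ν)) (proj₂ (to ∈hierarchy h)) n))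
          back : ∀ {κ} → ∃[ μ ] (μ ∈ lev × Fails κ μ) → ∃[ μ ] ∃[ v ] (⟨ μ , v ⟩ ∈ hierarchy ν × μ ∈ lev × Lim μ × κ ∈ μ × NoWitness κ v (𝕍 ν))
          back (μ , μ∈ , F) = μ , 𝕍 μ , from ∈hierarchy (sub μ μ∈ , refl) , μ∈ , f-lim F , f-∈ F , from (noWitness⇔ L (sub μ μ∈)) (f-¬Q F)

    -- The data determined by α; `Correct y` quantified over all y is a Π₁ definition of it.

    record Correct (y ρ ρ⁺ α lev f u p : V) : Set ℓ where
      constructor mkCorrect
      field
        co-ord     : Ord α
        co-level   : LocallyAdmissible ρ ρ⁺ α f u lev
        co-minimal : ∀ ν → ν ∈ lev → ¬ LocallyAdmissible ρ ρ⁺ α f u ν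
        co-fun     : Fun f lev
        co-values  : ∀ β v → ⟨ β , v ⟩ ∈ f → y ∈ v ⇔ (∃[ γ ] ∃[ t ] (⟨ γ , t ⟩ ∈ f × γ ∈ β × y ⊆ t))
        co-top     : y ∈ u ⇔ (∃[ γ ] ∃[ t ] (⟨ γ , t ⟩ ∈ f × γ ∈ lev × y ⊆ t))
        co-power   : y ∈ p ⇔ y ⊆ u
    open Correct

    correct₀ : D₀ 8 (λ σ → Correct (lookup σ v0) (lookup σ v1) (lookup σ v2) (lookup σ v3) (lookup σ v4) (lookup σ v5) (lookup σ v6) (lookup σ v7))
    correct₀ = cast₀ (λ σ → mk⇔ (λ (h₁ , h₂ , h₃ , h₄ , h₅ , h₆ , h₇) → mkCorrect h₁ h₂ h₃ h₄ h₅ h₆ h₇)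
                                 (λ C → co-ord C , co-level C , co-minimal C , co-fun C , co-values C , co-top C , co-power C))
      (ord₀ ₀[ v3 ∷ [] ] ∧₀ locally₀ ₀[ v1 ∷ v2 ∷ v3 ∷ v5 ∷ v6 ∷ v4 ∷ [] ] ∧₀ ∀∈₀ v4 (¬₀ locally₀ ₀[ v2 ∷ v3 ∷ v4 ∷ v6 ∷ v7 ∷ v0 ∷ [] ])
       ∧₀ fun₀ ₀[ v5 ∷ v4 ∷ [] ] ∧₀ ∀op∈₀ v5 (v2 ∈₀ v0 ⇔₀ ∃op∈₀ v7 (v1 ∈₀ v3 ∧₀ ⊆₀ ₀[ v4 ∷ v0 ∷ [] ]))
       ∧₀ (v0 ∈₀ v6 ⇔₀ ∃op∈₀ v5 (v1 ∈₀ v6 ∧₀ ⊆₀ ₀[ v2 ∷ v0 ∷ [] ])) ∧₀ (v0 ∈₀ v7 ⇔₀ ⊆₀ ₀[ v0 ∷ v6 ∷ [] ]))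

    record Data (ρ ρ⁺ α lev f u p : V) : Set ℓ where
      constructor mkData
      field
        da-ord   : Ord α
        da-level : LevelOf ρ ρ⁺ α lev
        da-f     : f ≡ hierarchy lev
        da-u     : u ≡ 𝕍 lev
        da-p     : p ≡ 𝒫 u
    open Data public

    opaque
      -- As y varies, the clauses about y become the recursion equations of a stage and the
      -- definition of a power set. Uniqueness of stages then identifies `f` and `u`, and local
      -- admissibility becomes admissibility.
      correct⇔ : ∀ {ρ ρ⁺ lev p} → (∀ y → Correct y ρ ρ⁺ α lev f u p) ⇔ Data ρ ρ⁺ α lev f u p
      correct⇔ {α} {f} {u} {ρ} {ρ⁺} {lev} {p} = mk⇔ (λ h → forth h (stage h) (values h)) back
        where
          lim : (∀ y → Correct y ρ ρ⁺ α lev f u p) → Lim lev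
          lim h = lo-lim (co-level (h ∅))
          reorder : ∀ {β y} → (∃[ γ ] ∃[ t ] (⟨ γ , t ⟩ ∈ f × γ ∈ β × y ⊆ t)) ⇔ (∃[ γ ] ∃[ t ] (γ ∈ β × ⟨ γ , t ⟩ ∈ f × y ⊆ t))
          reorder = ∃-⇔ λ γ → ∃-⇔ λ t → mk⇔ (λ (h , k , l) → k , h , l) (λ (h , k , l) → k , h , l)
          isStage : (∀ y → Correct y ρ ρ⁺ α lev f u p) → IsStage lev u
          isStage h = f , isFun (co-fun (h ∅)) , (λ β v k x → co-values (h x) β v k ⇔∘ reorder) , λ x → co-top (h x) ⇔∘ reorder
          stage : (∀ y → Correct y ρ ρ⁺ α lev f u p) → u ≡ 𝕍 lev
          stage h = stage≡𝕍 (lim-ord (lim h)) (isStage h)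
          values : (∀ y → Correct y ρ ρ⁺ α lev f u p) → f ≡ hierarchy lev
          values h = fun-ext (co-fun (h ∅)) hierarchy-fun λ β β∈ → let k = app∈ (co-fun (h ∅)) β∈ in
            trans (stage-values (lim-ord (lim h)) (isStage h) f (isFun (co-fun (h ∅))) (λ β v k x → co-values (h x) β v k ⇔∘ reorder) β (app f β) β∈ k)
                  (sym (app-≡ hierarchy-fun (from ∈hierarchy (β∈ , refl))))
          forth : (∀ y → Correct y ρ ρ⁺ α lev f u p) → u ≡ 𝕍 lev → f ≡ hierarchy lev → Data ρ ρ⁺ α lev f u p
          forth h refl refl = mkData (co-ord (h ∅)) (mkLevel (to (locally⇔ (lim h) ⊆-refl) (co-level (h ∅)))
              λ ν ν∈ A → co-minimal (h ∅) ν ν∈ (from (locally⇔ (lim h) (∈⇒⊆ (lim-ord (lim h)) ν∈)) A)) refl refl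
            (extensionality λ y → co-power (h y) ⇔∘ ⇔-sym ∈𝒫)
          back : Data ρ ρ⁺ α lev f u p → ∀ y → Correct y ρ ρ⁺ α lev f u p
          back (mkData o Lv refl refl refl) y = mkCorrect o (from (locally⇔ L ⊆-refl) (admissible Lv))
              (λ ν ν∈ A → minimal Lv ν ν∈ (to (locally⇔ L (∈⇒⊆ (lim-ord L) ν∈)) A)) hierarchy-fun
              (λ β v h → let (β∈ , v≡) = to ∈hierarchy h in ≡-⇔ (cong (y ∈_) v≡) ⇔∘ ∈𝕍 (ord-∈ (lim-ord L) β∈) ⇔∘ mk⇔
                (λ (γ , γ∈ , s) → γ , 𝕍 γ , from ∈hierarchy (trans-ord (lim-ord L) β β∈ γ γ∈ , refl) , γ∈ , s)
                (λ (γ , t , k , γ∈ , s) → γ , γ∈ , subst (y ⊆_) (proj₂ (to ∈hierarchy k)) s))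
              (∈𝕍 (lim-ord L) ⇔∘ mk⇔
                (λ (γ , γ∈ , s) → γ , 𝕍 γ , from ∈hierarchy (γ∈ , refl) , γ∈ , s)
                (λ (γ , t , k , γ∈ , s) → γ , γ∈ , subst (y ⊆_) (proj₂ (to ∈hierarchy k)) s))
              ∈𝒫
            where
              L : Lim lev
              L = ad-lim (admissible Lv)

  open Levels public

  -- Π₁ definitions of the sequence and of its range.

  module Definability where
    private variable
      x y α g : V

    -- Stored in the core vertices of the graph, this record makes all the data of the construction
    -- accessible from the graph by bounded quantifiers.
    infoOf : V → V → V → V → V → V
    infoOf α lev f u p = ⟨ α , ⟨ lev , ⟨ f , ⟨ u , p ⟩ ⟩ ⟩ ⟩

    record Inner (y VV EE i α lev f u p ρ ρ⁺ c : V) : Set ℓ where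
      constructor mkInner
      field
        in-correct : Correct y ρ ρ⁺ α lev f u p
        in-vertex  : y ∈ VV ⇔ IsVertex u p α c i y
        in-edge    : y ∈ EE ⇔ (∃[ x ] ∃[ x′ ] (y ≡ ⟨ x , x′ ⟩ × IsEdge u p α c i x x′))
    open Inner

    inner₀ : D₀ 12 (λ σ → Inner (lookup σ v0) (lookup σ v1) (lookup σ v2) (lookup σ v3) (lookup σ v4) (lookup σ v5) (lookup σ v6) (lookup σ v7)
      (lookup σ v8) (lookup σ v9) (lookup σ (# 10)) (lookup σ (# 11)))
    inner₀ = cast₀ (λ σ → mk⇔ (λ (h , k , l) → mkInner h k l) (λ I → in-correct I , in-vertex I , in-edge I))
      (correct₀ ₀[ v0 ∷ v9 ∷ # 10 ∷ v4 ∷ v5 ∷ v6 ∷ v7 ∷ v8 ∷ [] ]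
       ∧₀ (v0 ∈₀ v1 ⇔₀ isVertex₀ ₀[ v7 ∷ v8 ∷ v4 ∷ # 11 ∷ v3 ∷ v0 ∷ [] ])
       ∧₀ (v0 ∈₀ v2 ⇔₀ unpair₀ v0 (isEdge₀ ₀[ v9 ∷ # 10 ∷ v6 ∷ # 13 ∷ v5 ∷ v1 ∷ v0 ∷ [] ])))

    IsCore₀ : V → Set ℓ
    IsCore₀ t = ∃[ s ] ∃[ i ] (t ≡ ⟨ s , i ⟩ × s ≡ tagCode (core zero))

    -- In the sequence the index α is compared with the one recorded in the graph; in its range it is not.
    Index : Bool → V → V → Set ℓ
    Index true  a α = a ≡ α
    Index false a α = a ≡ a

    index₀ : ∀ b → D₀ 2 (λ σ → Index b (lookup σ v0) (lookup σ v1))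
    index₀ true  = v0 ≡₀ v1
    index₀ false = v0 ≡₀ v0

    -- The data are extracted anew for every y. The uniqueness of the vertex with the tag of core
    -- vertex 0 ensures that all extractions yield the same data (`transfer`).
    Body : Bool → V → V → V → V → V → V → Set ℓ
    Body b y g α ρ ρ⁺ c = ∃[ VV ] ∃[ EE ] (g ≡ ⟨ VV , EE ⟩ × ∃[ t ] (t ∈ VV × (∀ t′ → t′ ∈ VV → IsCore₀ t′ → t′ ≡ t) ×
      ∃[ s ] ∃[ i ] (t ≡ ⟨ s , i ⟩ × s ≡ tagCode (core zero) × ∃[ a ] ∃[ i₁ ] (i ≡ ⟨ a , i₁ ⟩ × Index b a α ×
      ∃[ lev ] ∃[ i₂ ] (i₁ ≡ ⟨ lev , i₂ ⟩ × ∃[ f ] ∃[ i₃ ] (i₂ ≡ ⟨ f , i₃ ⟩ × ∃[ u ] ∃[ p ] (i₃ ≡ ⟨ u , p ⟩ ×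
      Inner y VV EE i a lev f u p ρ ρ⁺ c)))))))

    body₀ : ∀ b → D₀ 6 (λ σ → Body b (lookup σ v0) (lookup σ v1) (lookup σ v2) (lookup σ v3) (lookup σ v4) (lookup σ v5))
    body₀ b = unpair₀ v1 (∃∈₀ v1 (∀∈₀ v2 (unpair₀ v0 (isTag₀ (core zero) ₀[ v1 ∷ [] ]) ⇒₀ v0 ≡₀ v1) ∧₀
      unpair₀ v0 (isTag₀ (core zero) ₀[ v1 ∷ [] ] ∧₀ unpair₀ v0 (index₀ b ₀[ v1 ∷ v9 ∷ [] ] ∧₀
      unpair₀ v0 (unpair₀ v0 (unpair₀ v0
        (inner₀ ₀[ # 13 ∷ # 12 ∷ # 11 ∷ # 8 ∷ # 7 ∷ # 5 ∷ # 3 ∷ # 1 ∷ # 0 ∷ # 16 ∷ # 17 ∷ # 18 ∷ [] ])))))))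

    record Unpacked (g VV EE α lev f u p : V) : Set ℓ where
      constructor mkUnpacked
      field
        un-g      : g ≡ ⟨ VV , EE ⟩
        un-core   : vertex (core zero) (infoOf α lev f u p) ∈ VV
        un-unique : ∀ t → t ∈ VV → IsCore₀ t → t ≡ vertex (core zero) (infoOf α lev f u p)
    open Unpacked

    module Definition (ρ ρ⁺ c : V) where

      record Unfolding (b : Bool) (y g α : V) : Set ℓ where
        constructor mkUnfolding
        field
          {VV EE a lev f u p} : V
          unpacked : Unpacked g VV EE a lev f u p
          index    : Index b a α
          inner    : Inner y VV EE (infoOf a lev f u p) a lev f u p ρ ρ⁺ c
      open Unfolding

      opaque
        body⇔ : ∀ b {y g α} → Body b y g α ρ ρ⁺ c ⇔ Unfolding b y g α
        body⇔ b = mk⇔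
          (λ { (VV , EE , g≡ , _ , t∈ , un , s , i , refl , refl , a , i₁ , refl , h , lev , i₂ , refl , f , i₃ , refl , u , p , refl , I) →
               mkUnfolding (mkUnpacked g≡ t∈ un) h I })
          (λ { (mkUnfolding (mkUnpacked g≡ t∈ un) h I) → _ , _ , g≡ , _ , t∈ , un , _ , _ , refl , refl , _ , _ , refl , h , _ , _ , refl , _ , _ , refl , _ , _ , refl , I })

        transfer : ∀ {g VV EE a lev f u p VV′ EE′ a′ lev′ f′ u′ p′ y} → Unpacked g VV EE a lev f u p → Unpacked g VV′ EE′ a′ lev′ f′ u′ p′ →
          Inner y VV′ EE′ (infoOf a′ lev′ f′ u′ p′) a′ lev′ f′ u′ p′ ρ ρ⁺ c → Inner y VV EE (infoOf a lev f u p) a lev f u p ρ ρ⁺ c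
        transfer {VV = VV} {EE} {a} {lev} {f} {u} {p} {VV′} {EE′} {a′} {lev′} {f′} {u′} {p′} U U′ I = substitute (pair-inj₁ g≡) (pair-inj₂ g≡)
            (pair-inj₁ i≡) (pair-inj₁ i₁≡) (pair-inj₁ i₂≡) (pair-inj₁ i₃≡) (pair-inj₂ i₃≡) I
          where
            g≡ : ⟨ VV , EE ⟩ ≡ ⟨ VV′ , EE′ ⟩
            g≡ = trans (sym (un-g U)) (un-g U′)
            i≡ : infoOf a lev f u p ≡ infoOf a′ lev′ f′ u′ p′
            i≡ = pair-inj₂ (un-unique U′ _ (subst (_ ∈_) (pair-inj₁ g≡) (un-core U)) (_ , _ , refl , refl))
            i₁≡ : ⟨ lev , ⟨ f , ⟨ u , p ⟩ ⟩ ⟩ ≡ ⟨ lev′ , ⟨ f′ , ⟨ u′ , p′ ⟩ ⟩ ⟩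
            i₁≡ = pair-inj₂ i≡
            i₂≡ : ⟨ f , ⟨ u , p ⟩ ⟩ ≡ ⟨ f′ , ⟨ u′ , p′ ⟩ ⟩
            i₂≡ = pair-inj₂ i₁≡
            i₃≡ : ⟨ u , p ⟩ ≡ ⟨ u′ , p′ ⟩
            i₃≡ = pair-inj₂ i₂≡
            substitute : ∀ {y VV EE a lev f u p VV′ EE′ a′ lev′ f′ u′ p′} → VV ≡ VV′ → EE ≡ EE′ → a ≡ a′ → lev ≡ lev′ → f ≡ f′ → u ≡ u′ → p ≡ p′ →
              Inner y VV′ EE′ (infoOf a′ lev′ f′ u′ p′) a′ lev′ f′ u′ p′ ρ ρ⁺ c → Inner y VV EE (infoOf a lev f u p) a lev f u p ρ ρ⁺ c
            substitute refl refl refl refl refl refl refl I = I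

      record InSequence (α g : V) : Set ℓ where
        constructor mkInSequence
        field
          {lev f u p} : V
          dat         : Data ρ ρ⁺ α lev f u p
          isGraphOf   : GraphOf u p α c (infoOf α lev f u p) g

      opaque
        -- The data extracted for y = ∅ serve as reference, and `transfer` moves the statements for
        -- all other y to them.
        unfoldings⇒ : ∀ b {g α} → (∀ y → Unfolding b y g α) → ∃[ a ] (Index b a α × InSequence a g)
        unfoldings⇒ b h = let h₀ = h ∅ in a h₀ , index h₀ , from-inner (unpacked h₀) λ y → transfer (unpacked h₀) (unpacked (h y)) (inner (h y))
          where
            from-inner : ∀ {g VV EE a lev f u p} → Unpacked g VV EE a lev f u p → (∀ y → Inner y VV EE (infoOf a lev f u p) a lev f u p ρ ρ⁺ c) → InSequence a g
            from-inner U I = mkInSequence (to correct⇔ (λ y → in-correct (I y))) (mkGraphOf (un-g U) (λ x → in-vertex (I x)) (λ z → in-edge (I z)))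

        ⇒unfoldings : ∀ b {g α a} → Index b a α → InSequence a g → ∀ y → Unfolding b y g α
        ⇒unfoldings b h (mkInSequence D G) y = mkUnfolding
          (mkUnpacked (GraphOf.g≡ G) (from (GraphOf.∈V₀ G _) (core zero , _ , _ , refl , refl , refl))
            λ { t t∈ (s , i , refl , refl) → cong (vertex (core zero)) (Coded.vertex-tag G {t = core zero} (from (Coded.isVertex G) (to (GraphOf.∈V₀ G _) t∈))) })
          h (mkInner (from correct⇔ D y) (GraphOf.∈V₀ G y) (GraphOf.∈E₀ G y))

      opaque
        sequenceBody₀ : D₀ 5 (λ σ → ∃[ α ] ∃[ g ] (lookup σ v1 ≡ ⟨ α , g ⟩ × Body true (lookup σ v0) g α (lookup σ v2) (lookup σ v3) (lookup σ v4)))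
        sequenceBody₀ = unpair₀ v1 (body₀ true ₀[ v2 ∷ v0 ∷ v1 ∷ v4 ∷ v5 ∷ v6 ∷ [] ])

        rangeBody₀ : D₀ 5 (λ σ → Body false (lookup σ v0) (lookup σ v1) (lookup σ v1) (lookup σ v2) (lookup σ v3) (lookup σ v4))
        rangeBody₀ = body₀ false ₀[ v0 ∷ v1 ∷ v1 ∷ v2 ∷ v3 ∷ v4 ∷ [] ]

      graphs graphRange : Class
      graphs     = record { formula = ∀̇ (Closed.form sequenceBody₀) ; parameters = ρ ∷ ρ⁺ ∷ c ∷ [] }
      graphRange = record { formula = ∀̇ (Closed.form rangeBody₀) ; parameters = ρ ∷ ρ⁺ ∷ c ∷ [] }

      graphs-Π₁ : IsΠ 1 (formula graphs)
      graphs-Π₁ = all (Σ⇒ (Δ₀ (Closed.class sequenceBody₀)))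

      graphRange-Π₁ : IsΠ 1 (formula graphRange)
      graphRange-Π₁ = all (Σ⇒ (Δ₀ (Closed.class rangeBody₀)))

      opaque
        graphs-pairs : x ∈ᶜ graphs → ∃[ α ] ∃[ g ] (x ≡ ⟨ α , g ⟩)
        graphs-pairs h = let (α , g , e , _) = to (Closed.means sequenceBody₀ _) (h ∅ tt) in α , g , e

        ∈graphs : ⟨ α , g ⟩ ∈ᶜ graphs ⇔ InSequence α g
        ∈graphs {α} {g} = mk⇔
          (λ h → located (unfoldings⇒ true λ y → to (body⇔ true) (unpair (to (Closed.means sequenceBody₀ _) (h y tt)))))
          (λ S y _ → from (Closed.means sequenceBody₀ _) (α , g , refl , from (body⇔ true) (⇒unfoldings true refl S y)))
          where
            unpair : ∀ {y} → ∃[ α′ ] ∃[ g′ ] (⟨ α , g ⟩ ≡ ⟨ α′ , g′ ⟩ × Body true y g′ α′ ρ ρ⁺ c) → Body true y g α ρ ρ⁺ c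
            unpair {y} (α′ , g′ , e , B) = subst₂ (λ g α → Body true y g α ρ ρ⁺ c) (sym (pair-inj₂ e)) (sym (pair-inj₁ e)) B
            located : ∃[ a ] (a ≡ α × InSequence a g) → InSequence α g
            located (_ , refl , S) = S

        ∈graphRange : ∀ g → g ∈ᶜ graphRange ⇔ (∃[ α ] ⟨ α , g ⟩ ∈ᶜ graphs)
        ∈graphRange g = mk⇔
          (λ h → let (a , _ , S) = unfoldings⇒ false {α = g} λ y → to (body⇔ false) (to (Closed.means rangeBody₀ _) (h y tt)) in a , from ∈graphs S)
          (λ (α , h) y _ → from (Closed.means rangeBody₀ _) (from (body⇔ false) (⇒unfoldings false {α = g} refl (to ∈graphs h) y)))

      opaque
        isGraphSequence : Ord ρ⁺ → (∀ κ → Ord κ → ρ ⊆ κ → ¬ QAll κ) → IsGraphSequence graphs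
        isGraphSequence oρ⁺ none =
          ((λ z h → let (α , g , e) = graphs-pairs h in α , g , fromOrd (da-ord (InSequence.dat (to ∈graphs (subst (_∈ᶜ graphs) e h)))) , e) ,
            λ α o → existence α (toOrd o) (level-exists {ρ = ρ} {ρ⁺} oρ⁺ none (toOrd o))) ,
          λ α g h → Coded.graph (InSequence.isGraphOf (to ∈graphs h))
          where
            same : ∀ {α g g′} → InSequence α g → InSequence α g′ → g ≡ g′
            same {g = g} {g′} (mkInSequence {lev} (mkData _ L refl refl refl) G) (mkInSequence {lev′} (mkData _ L′ refl refl refl) G′) =
              identify {lev = lev} {lev′} {g} {g′} (level-unique L L′) G G′
              where
                identify : ∀ {α lev lev′ g g′} → lev ≡ lev′ → GraphOf (𝕍 lev) (𝒫 (𝕍 lev)) α c (infoOf α lev (hierarchy lev) (𝕍 lev) (𝒫 (𝕍 lev))) g →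
                  GraphOf (𝕍 lev′) (𝒫 (𝕍 lev′)) α c (infoOf α lev′ (hierarchy lev′) (𝕍 lev′) (𝒫 (𝕍 lev′))) g′ → g ≡ g′
                identify refl G G′ = graphUnique G G′
            existence : ∀ α → Ord α → ∃[ lev ] LevelOf ρ ρ⁺ α lev → ∃! _≡_ λ g → ⟨ α , g ⟩ ∈ᶜ graphs
            existence α o (lev , L) = let (g , G) = graphExists (𝕍 lev) (𝒫 (𝕍 lev)) α c (infoOf α lev (hierarchy lev) (𝕍 lev) (𝒫 (𝕍 lev)))
                                          S = mkInSequence (mkData o L refl refl refl) G in
              g , from ∈graphs S , λ h → same S (to ∈graphs h)

  open Definability public

  -- Ladders of cofinal sequences and the exclusion of critical points.

  module Ladders where
    private variable
      n : ℕ
      x y z X Y W α β κ : V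

    record Cofinal (g η : V) : Set ℓ where
      constructor mkCofinal
      field
        cof-fun : Fun g Z
        cof-val : ∀ n → n ∈ Z → app g n ∈ η
        cof-sup : ∀ ξ → ξ ∈ η → ∃[ n ] (n ∈ Z × ξ ∈ app g n)
    open Cofinal

    cofinalᵈ : Def 2 (λ σ → Cofinal (lookup σ v0) (lookup σ v1))
    cofinalᵈ = (funᵈ ᵈ[ var v0 ∷ con Z ∷ [] ] ∧ᵈ ∀ᵈ (var v0 ∈ᵈ con Z ⇒ᵈ appᵗ (var v1) (var v0) ∈ᵈ var v2)
        ∧ᵈ ∀ᵈ (var v0 ∈ᵈ var v2 ⇒ᵈ ∃ᵈ (var v0 ∈ᵈ con Z ∧ᵈ var v1 ∈ᵈ appᵗ (var v2) (var v0))))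
      redef λ σ → mk⇔ (λ (h , k , l) → mkCofinal h k l) (λ C → cof-fun C , cof-val C , cof-sup C)

    -- The domain is S ρ because the supremum to which the ladder is applied in `LadderFixed` may be
    -- ρ itself.
    record IsLadder (ρ L : V) : Set ℓ where
      constructor mkLadder
      field
        ladder-fun : Fun L (S ρ)
        ladder-cof : ∀ η → η ∈ S ρ → ∃[ g ] Cofinal g η → Cofinal (app L η) η
    open IsLadder

    opaque
      ladderExists : ∀ ρ → ∃[ L ] IsLadder ρ L
      ladderExists ρ = wrap (choiceFunction {R = λ η g → ∃[ g ] Cofinal g η → Cofinal g η}
          (∃ᵈ (cofinalᵈ ᵈ[ var v0 ∷ var v1 ∷ [] ]) ⇒ᵈ cofinalᵈ ᵈ[ var v1 ∷ var v0 ∷ [] ]) (S ρ)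
          λ η _ → [ (λ (g , C) → g , λ _ → C) , (λ none → ∅ , λ h → ⊥-elim (none h)) ]′ (lem (∃[ g ] Cofinal g η)))
        where
          wrap : ∃[ L ] (Fun L (S ρ) × ∀ η → η ∈ S ρ → ∃[ g ] Cofinal g η → Cofinal (app L η) η) → ∃[ L ] IsLadder ρ L
          wrap (L , F , h) = L , mkLadder F h

    module Numerals (j M : Class) (elem : IsElementaryEmbedding j M) (tr : IsTransitive (_∈ᶜ M)) where
      open Elementary j M elem tr

      opaque
        J-sing : J (sing x) ≡ sing (J x)
        J-sing {x} = to (J-Δ₀ (isPair₀ v0 v1 v1) (sing x ∷ x ∷ [])) refl

        J-numeral : ∀ n → n ∈ Z → J n ≡ n
        J-numeral = Z-induction (Jᵗ (var v0) ≡ᵈ var v0) J-∅ λ n _ h → trans J-sing (cong sing h)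

        numeral-cases₀ : D₀ 1 (λ σ → ∀ m → m ∈ lookup σ v0 → m ≡ ∅ ⊎ ∃[ k ] (k ∈ lookup σ v0 × m ≡ sing k))
        numeral-cases₀ = ∀∈₀ v0 (isEmpty₀ ₀[ v0 ∷ [] ] ∨₀ ∃∈₀ v1 (isPair₀ v1 v0 v0))

        -- That each numeral is ∅ or the singleton of a numeral is Δ₀ and passes to `J Z`; since J Z
        -- consists of actual sets, ∈-induction in V reduces each of them to ∅.
        JZ⊆Z : J Z ⊆ Z
        JZ⊆Z = ∈-induction (var v0 ∈ᵈ con (J Z) ⇒ᵈ var v0 ∈ᵈ con Z) λ m ih m∈ →
          [ (λ e → subst (_∈ Z) (sym e) ∅∈Z) , (λ (k , k∈ , e) → subst (_∈ Z) (sym e) (sing∈Z (ih k (subst (k ∈_) (sym e) self∈sing) k∈))) ]′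
            (to (J-Δ₀ numeral-cases₀ (Z ∷ [])) (λ m → Z-cases) m m∈)

        function₀ : D₀ 1 (λ σ → ∀ a b → ⟨ a , b ⟩ ∈ lookup σ v0 → ∀ a′ b′ → ⟨ a′ , b′ ⟩ ∈ lookup σ v0 → a ≡ a′ → b ≡ b′)
        function₀ = ∀op∈₀ v0 (∀op∈₀ v2 (v3 ≡₀ v1 ⇒₀ v2 ≡₀ v0))

        J-function : ∀ {f A a b b′} → Fun f A → ⟨ a , b ⟩ ∈ J f → ⟨ a , b′ ⟩ ∈ J f → b ≡ b′
        J-function {f} F h h′ = to (J-Δ₀ function₀ (f ∷ []))
          (λ { a b h a b′ h′ refl → trans (sym (app-≡ F h)) (app-≡ F h′) }) _ _ h _ _ h′ refl

        J-app : ∀ {f A x y} → Fun f A → x ∈ A → J x ≡ y → ⟨ y , J (app f x) ⟩ ∈ J f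
        J-app {f} F x∈ refl = subst (_∈ J f) J-op (to J-∈ (app∈ F x∈))

    -- An embedding fixing a ladder on ρ has no critical point κ below ρ: let β be the supremum of
    -- κ, J κ, J (J κ), …. The sequence L(β) is fixed pointwise, but no ordinal in the interval from
    -- κ to β is fixed.
    module LadderFixed (j M : Class) (elem : IsElementaryEmbedding j M) (tr : IsTransitive (_∈ᶜ M)) {ρ L : V} (oρ : Ord ρ) (ladder : IsLadder ρ L)
      (Jρ : Elementary.J j M elem tr ρ ≡ ρ) (JL : Elementary.J j M elem tr L ≡ L)
      {κ : V} (κ∈ρ : κ ∈ ρ) (moved : Elementary.J j M elem tr κ ≢ κ) where
      open Elementary j M elem tr
      open Numerals j M elem tr
      open Iterate κ JG

      private
        K : V → V
        K n = app sequence n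

        Kᵗ : Tm n → Tm n
        Kᵗ t = appᵗ (con sequence) t

      opaque
        oκ : Ord κ
        oκ = ord-∈ oρ κ∈ρ

        K∈ρ : ∀ n → n ∈ Z → K n ∈ ρ
        K∈ρ = Z-induction (Kᵗ (var v0) ∈ᵈ con ρ) (subst (_∈ ρ) (sym at-∅) κ∈ρ)
          λ n n∈ h → subst₂ _∈_ (sym (at-sing n∈)) Jρ (to J-∈ h)

        increasing : ∀ n → n ∈ Z → K n ∈ J (K n)
        increasing = Z-induction (Kᵗ (var v0) ∈ᵈ Jᵗ (Kᵗ (var v0)))
          (subst (λ x → x ∈ J x) (sym at-∅) ([ id , (λ h → ⊥-elim (moved (sym h))) ]′ (⊆⇒≤ oκ (J-ord oκ) (J-increases κ oκ))))
          λ n n∈ h → subst (λ x → x ∈ J x) (sym (at-sing n∈)) (to J-∈ h)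

        K-step : ∀ n → n ∈ Z → K n ∈ K (sing n)
        K-step n n∈ = subst (K n ∈_) (sym (at-sing n∈)) (increasing n n∈)

        limit : V
        limit = ⋃ (im (graph₁ (Kᵗ (var v0))) Z)

        ∈limit : x ∈ limit ⇔ (∃[ n ] (n ∈ Z × x ∈ K n))
        ∈limit {x} = ∈⋃ ⇔∘ mk⇔ (λ (y , y∈ , h) → let (n , n∈ , e) = to ∈im y∈ in n , n∈ , subst (x ∈_) e h) (λ (n , n∈ , h) → K n , im∋ n∈ , h)

        o-limit : Ord limit
        o-limit = ord-⋃ λ z z∈ → let (n , n∈ , e) = to ∈im z∈ in subst Ord (sym e) (ord-∈ oρ (K∈ρ n n∈))

        K∈limit : ∀ n → n ∈ Z → K n ∈ limit
        K∈limit n n∈ = from ∈limit (sing n , sing∈Z n∈ , K-step n n∈)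

        limit∈ : limit ∈ S ρ
        limit∈ = ⊆⇒∈S o-limit oρ λ x h → let (n , n∈ , k) = to ∈limit h in trans-ord oρ (K n) (K∈ρ n n∈) x k

        covered₀ : D₀ 3 (λ σ → ∀ x → x ∈ lookup σ v0 → ∃[ m ] ∃[ b ] (⟨ m , b ⟩ ∈ lookup σ v1 × m ∈ lookup σ v2 × x ∈ b))
        covered₀ = ∀∈₀ v0 (∃op∈₀ v2 (v1 ∈₀ v5 ∧₀ v2 ∈₀ v0))

        -- `J` moves each term of the sequence to the next one and adds no indices, as J Z ⊆ Z; a
        -- shifted sequence has the same supremum.
        J-limit : J limit ≡ limit
        J-limit = ⊆-antisym (λ x h → bounded (to (J-Δ₀ covered₀ (limit ∷ sequence ∷ Z ∷ []))
              (λ x h → let (n , n∈ , k) = to ∈limit h in n , K n , app∈ sequenceFun n∈ , n∈ , k) x h)) (J-increases limit o-limit)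
          where
            bounded : ∀ {x} → ∃[ m ] ∃[ b ] (⟨ m , b ⟩ ∈ J sequence × m ∈ J Z × x ∈ b) → x ∈ limit
            bounded {x} (m , b , h , m∈ , k) = from ∈limit (sing m , sing∈Z m∈Z , subst (x ∈_) (trans (J-function sequenceFun h
                (J-app sequenceFun m∈Z (J-numeral m m∈Z))) (sym (at-sing m∈Z))) k)
              where
                m∈Z : m ∈ Z
                m∈Z = JZ⊆Z m m∈

        rungs : V
        rungs = app L limit

        rungs-cofinal : Cofinal rungs limit
        rungs-cofinal = ladder-cof ladder limit limit∈ (sequence , mkCofinal sequenceFun K∈limit λ ξ h → to ∈limit h)

        J-rungs : J rungs ≡ rungs
        J-rungs = sym (app-≡ (ladder-fun ladder) (subst (⟨ limit , J rungs ⟩ ∈_) JL (J-app (ladder-fun ladder) limit∈ J-limit)))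

        J-rung : ∀ n → n ∈ Z → J (app rungs n) ≡ app rungs n
        J-rung n n∈ = sym (app-≡ (cof-fun rungs-cofinal) (subst (⟨ n , J (app rungs n) ⟩ ∈_) J-rungs (J-app (cof-fun rungs-cofinal) n∈ (J-numeral n n∈))))

        contradictory : ⊥
        contradictory = aboveκ (cof-sup rungs-cofinal κ (subst (_∈ limit) at-∅ (K∈limit ∅ ∅∈Z)))
          where
            aboveκ : ∃[ n ] (n ∈ Z × κ ∈ app rungs n) → ⊥
            aboveκ (n , n∈ , h) = ∈-irrefl (all-below ξ (cof-val rungs-cofinal n n∈))
              where
                ξ : V
                ξ = app rungs n
                below : ∀ m → m ∈ Z → K m ∈ ξ
                below = Z-induction (Kᵗ (var v0) ∈ᵈ con ξ) (subst (_∈ ξ) (sym at-∅) h)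
                  λ m m∈ k → subst₂ _∈_ (sym (at-sing m∈)) (J-rung n n∈) (to J-∈ k)
                all-below : limit ⊆ ξ
                all-below x k = let (m , m∈ , l) = to ∈limit k in trans-ord (ord-∈ o-limit (cof-val rungs-cofinal n n∈)) (K m) (below m m∈) x l

    -- The ordinal ρ⁺ bounds the rank of the pair of ρ and L. Levels exceed ρ⁺, so this constant of
    -- the coded structures belongs to each 𝕍 λ.
    record Parameters (ρ ρ⁺ L : V) : Set ℓ where
      constructor mkParameters
      field
        pa-ρ      : Ord ρ
        pa-ρ⁺     : Ord ρ⁺
        pa-ladder : IsLadder ρ L
        pa-∈      : ⟨ ρ , L ⟩ ∈ 𝕍 ρ⁺
    open Parameters public

    -- A homomorphism yields an elementary embedding fixing every ordinal below the target level: a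
    -- critical point below ρ is excluded by the ladder, one above ρ by the closure of the level
    -- under failures of strongness.
    module HomEmbedding {ρ ρ⁺ L : V} (pa : Parameters ρ ρ⁺ L) {α lev info g α′ lev′ info′ g′ h : V}
      (lvl : LevelOf ρ ρ⁺ α lev) (lvl′ : LevelOf ρ ρ⁺ α′ lev′)
      (G : GraphOf (𝕍 lev) (𝒫 (𝕍 lev)) α ⟨ ρ , L ⟩ info g) (G′ : GraphOf (𝕍 lev′) (𝒫 (𝕍 lev′)) α′ ⟨ ρ , L ⟩ info′ g′) (H : IsHom h g g′) where
      open HomAnalysis G G′ H using (e; eG; level₀; mid-value) public

      private
        u u′ c : V
        u = 𝕍 lev
        u′ = 𝕍 lev′
        c = ⟨ ρ , L ⟩
        lim : Lim lev
        lim = ad-lim (admissible lvl)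
        lim′ : Lim lev′
        lim′ = ad-lim (admissible lvl′)

      opaque
        e-good : Good u u′ e
        e-good = record { e-⊆ = λ X⊆ → to ∈𝒫 (proj₂ (level₀ (from ∈𝒫 X⊆))) ; e-rel = λ c X⊆ Y⊆ W⊆ r → rel (colour-onto c) X⊆ Y⊆ W⊆ r }
          where
            rel : ∀ {c X Y W} → ∃[ i ] colour i ≡ c → X ⊆ u → Y ⊆ u → W ⊆ u → Rel c u (𝒫 u) X Y W → Rel c u′ (𝒫 u′) (e X) (e Y) (e W)
            rel (i , refl) X⊆ Y⊆ W⊆ r = proj₂ (mid-value (suc (suc i)) (from ∈𝒫 X⊆) (from ∈𝒫 Y⊆) (from ∈𝒫 W⊆) r)

      private
        module T = Transitive u u′ (𝕍-pairClosed lim) (𝕍-pairClosed lim′) e eG e-good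
      open Elementary T.j T.M T.j-elementary T.M-transitive
      open Numerals T.j T.M T.j-elementary T.M-transitive using (J-sing)

      opaque
        restricts : X ⊆ u → x ∈ u′ → x ∈ J X ⇔ x ∈ e X
        restricts {X} {x} X⊆ x∈ = ≡-⇔ (cong (x ∈_) (to T.∈j (from ∈j refl))) ⇔∘ T.J-restricts X⊆ x∈

        index⊆ : ∀ {α lev} → LevelOf ρ ρ⁺ α lev → α ⊆ 𝕍 lev
        index⊆ {α} {lev} l x x∈ = ord⊆𝕍 lev (lim-ord (ad-lim (admissible l))) x
          (trans-ord (lim-ord (ad-lim (admissible l))) α (ad-α (admissible l)) x x∈)

        c∈ : ∀ {α lev} → LevelOf ρ ρ⁺ α lev → c ∈ 𝕍 lev
        c∈ {lev = lev} l = 𝕍-mono o (∈⇒⊆ o (ad-ρ⁺ (admissible l))) (pa-ρ⁺ pa) c (pa-∈ pa)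
          where
            o : Ord lev
            o = lim-ord (ad-lim (admissible l))

        sing-c∈ : sing c ∈ 𝒫 u
        sing-c∈ = from ∈𝒫 λ x x∈ → subst (_∈ u) (sym (to ∈sing x∈)) (c∈ lvl)

        constant-kept : α ⊆ Y → Y ⊆ u → e (sing c) ≡ sing c × α′ ⊆ e Y
        constant-kept {Y} α⊆ Y⊆ = let (h , _ , k) = proj₂ (mid-value (suc zero) sing-c∈ (from ∈𝒫 Y⊆) sing-c∈ (refl , refl , α⊆)) in h , k

        -- The singleton of `c` is preserved exactly, so `c` belongs to its image under `e`, hence
        -- to J (sing c) = sing (J c).
        Jc : J c ≡ c
        Jc = sym (to ∈sing (subst (c ∈_) J-sing (from (restricts (to ∈𝒫 sing-c∈) (c∈ lvl′))
          (subst (c ∈_) (sym (proj₁ (constant-kept ⊆-refl (index⊆ lvl)))) self∈sing))))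

        Jρ : J ρ ≡ ρ
        Jρ = pair-inj₁ (trans (sym J-op) Jc)

        JL : J L ≡ L
        JL = pair-inj₂ (trans (sym J-op) Jc)

        fixed : ∀ ξ → ξ ∈ lev′ → J ξ ≡ ξ
        fixed ξ ξ∈ = byContra λ n → critical (leastOrd {P = λ ξ → ξ ∈ lev′ × J ξ ≢ ξ}
            (var v0 ∈ᵈ con lev′ ∧ᵈ ¬ᵈ (Jᵗ (var v0) ≡ᵈ var v0)) (ord-∈ o′ ξ∈) (ξ∈ , n))
          where
            o′ : Ord lev′
            o′ = lim-ord lim′
            critical : ∃[ κ ] (Ord κ × (κ ∈ lev′ × J κ ≢ κ) × ∀ γ → γ ∈ κ → ¬ (γ ∈ lev′ × J γ ≢ γ)) → ⊥
            critical (κ , oκ , (κ∈ , moved) , min) =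
                [ (λ κ∈ρ → LadderFixed.contradictory T.j T.M T.j-elementary T.M-transitive (pa-ρ pa) (pa-ladder pa) Jρ JL κ∈ρ moved)
                , (λ h → high ([ (λ { refl → ⊥-elim (moved Jρ) }) , ∈⇒⊆ oκ ]′ h)) ]′ (trichotomy oκ (pa-ρ pa))
              where
                high : ρ ⊆ κ → ⊥
                high ρ⊆ = refute (ad-fail (admissible lvl′) κ κ∈ ρ⊆)
                  where
                    refute : ∃[ μ ] (μ ∈ lev′ × Fails κ μ) → ⊥
                    refute (μ , μ∈ , F) = f-¬Q F (embedding⇒Q T.j T.M T.j-elementary T.M-transitive (f-lim F)
                      (λ x x∈ → T.u′⊆M x (𝕍-mono o′ (∈⇒⊆ o′ μ∈) (lim-ord (f-lim F)) x x∈)) (f-∈ F)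
                      (λ γ γ∈ → from ∈j (byContra λ n → min γ γ∈ (trans-ord o′ κ κ∈ γ γ∈ , λ k → n (sym k))))
                      (λ k → moved (sym (to ∈j k))))

        -- With all ordinals below λ′ fixed, `J` is the identity on 𝕍 λ′. Thus x ∈ X and x ∈ J X
        -- agree there, and J X agrees with e X.
        trace : X ⊆ u → x ∈ e X ⇔ (x ∈ u′ × x ∈ X)
        trace {X} {x} X⊆ = mk⇔
            (λ h → let x∈ = to ∈𝒫 (proj₂ (level₀ (from ∈𝒫 X⊆))) x h in x∈ , from (kept x∈) (from (restricts X⊆ x∈) h))
            (λ (x∈ , h) → to (restricts X⊆ x∈) (to (kept x∈) h))
          where
            open FixedStages T.j T.M T.j-elementary T.M-transitive (lim-ord lim′) fixed
            kept : x ∈ u′ → x ∈ X ⇔ x ∈ J X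
            kept x∈ = J-∈ ⇔∘ ≡-⇔ (cong (_∈ J X) (J-fixes x∈))

        -- The predicate α ⊆ Y holds of Y = α, so α′ ⊆ e α. For α ∈ α′ this gives α ∈ e α, and
        -- `trace` yields α ∈ α.
        no-forward : ¬ α ∈ α′
        no-forward h = ∈-irrefl (proj₂ (to (trace (index⊆ lvl)) (proj₂ (constant-kept ⊆-refl (index⊆ lvl)) α h)))

    opaque
      -- A level of β is admissible for every α ≤ β, and the level of α is the least admissible
      -- ordinal.
      level-mono : ∀ {ρ ρ⁺ lev lev′} → α ≤ β → LevelOf ρ ρ⁺ α lev → LevelOf ρ ρ⁺ β lev′ → lev ⊆ lev′
      level-mono {α} {β} {ρ} {ρ⁺} {lev} {lev′} h l l′ = ∉⇒⊆ o′ (lim-ord (ad-lim (admissible l))) λ k → minimal l lev′ k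
          (mkAdmissible (ad-lim A′) (index h) (ad-ρ⁺ A′) (ad-fail A′))
        where
          A′ : Admissible ρ ρ⁺ β lev′
          A′ = admissible l′
          o′ : Ord lev′
          o′ = lim-ord (ad-lim A′)
          index : α ≤ β → α ∈ lev′
          index (inj₁ k) = trans-ord o′ β (ad-α A′) α k
          index (inj₂ refl) = ad-α A′

    Sat-total : (D : V → Set ℓ) → (∀ x → D x) → (φ : Formula n) (σ : Vec V n) → Sat All φ σ ⇔ Sat D φ σ
    Sat-total D t (i ∈̇ k) σ = ⇔-refl
    Sat-total D t (i ≐ k) σ = ⇔-refl
    Sat-total D t (¬̇ φ) σ = ¬-⇔ (Sat-total D t φ σ)
    Sat-total D t (φ ∧̇ ψ) σ = ×-⇔ (Sat-total D t φ σ) (Sat-total D t ψ σ)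
    Sat-total D t (φ ∨̇ ψ) σ = ⊎-⇔ (Sat-total D t φ σ) (Sat-total D t ψ σ)
    Sat-total D t (φ ⇒̇ ψ) σ = →-⇔ (Sat-total D t φ σ) (Sat-total D t ψ σ)
    Sat-total D t (∀̇ φ) σ = mk⇔ (λ h x _ → to (Sat-total D t φ _) (h x tt)) (λ h x _ → from (Sat-total D t φ _) (h x (t x)))
    Sat-total D t (∃̇ φ) σ = mk⇔ (λ (x , _ , h) → x , t x , to (Sat-total D t φ _) h) (λ (x , _ , h) → x , tt , from (Sat-total D t φ _) h)

    opaque
      -- The backward homomorphism sends X to X ∩ 𝕍 λ. Its preservation of the colours is the case
      -- of the identity embedding in `Restriction`.
      universe identity : Class
      universe = record { formula = v0 ≐ v0 ; parameters = [] }
      identity = Def⇒Class (∃ᵈ (var v1 ≡ᵈ ⟨ var v0 , var v0 ⟩ᵗ))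

      ∈universe : ∀ x → x ∈ᶜ universe
      ∈universe x = refl

      ∈identity : z ∈ᶜ identity ⇔ (∃[ x ] z ≡ ⟨ x , x ⟩)
      ∈identity {z} = ∈Def⇒Class (∃ᵈ (var v1 ≡ᵈ ⟨ var v0 , var v0 ⟩ᵗ)) z

      identity-value : ⟨ x , y ⟩ ∈ᶜ identity → x ≡ y
      identity-value h = let (a , e) = to ∈identity h in trans (pair-inj₁ e) (sym (pair-inj₂ e))

      identity-elementary : IsElementaryEmbedding identity universe
      identity-elementary =
          ((λ z h → let (x , e) = to ∈identity h in x , x , tt , e) , λ x _ → x , from ∈identity (x , refl) , identity-value) ,
          (λ x y _ → ∈universe y) ,
          λ φ σ τ h → ≡-⇔ (cong (Sat All φ) (same h)) ⇔∘ Sat-total _ ∈universe φ τ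
        where
          same : ∀ {n} {σ τ : Vec V n} → Pointwise (λ x y → ⟨ x , y ⟩ ∈ᶜ identity) σ τ → σ ≡ τ
          same []       = refl
          same (h ∷ hs) = cong₂ _∷_ (identity-value h) (same hs)

    module Backward {ρ ρ⁺ L : V} (pa : Parameters ρ ρ⁺ L) {α lev info g β lev′ info′ g′ : V} (α≤β : α ≤ β) (oβ : Ord β)
      (lvl : LevelOf ρ ρ⁺ α lev) (lvl′ : LevelOf ρ ρ⁺ β lev′)
      (G : GraphOf (𝕍 lev) (𝒫 (𝕍 lev)) α ⟨ ρ , L ⟩ info g) (G′ : GraphOf (𝕍 lev′) (𝒫 (𝕍 lev′)) β ⟨ ρ , L ⟩ info′ g′) where

      private
        u u′ c : V
        u = 𝕍 lev
        u′ = 𝕍 lev′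
        c = ⟨ ρ , L ⟩
        lim : Lim lev
        lim = ad-lim (admissible lvl)
        lim′ : Lim lev′
        lim′ = ad-lim (admissible lvl′)
        tr : IsTransitive (_∈ᶜ universe)
        tr x y _ _ = ∈universe y
        module I = Elementary identity universe identity-elementary tr

      opaque
        J-identity : I.J x ≡ x
        J-identity = sym (identity-value (from I.∈j refl))

        cover : u ⊆ I.J u′
        cover x x∈ = subst (x ∈_) (sym J-identity) (𝕍-mono (lim-ord lim′) (level-mono α≤β lvl lvl′) (lim-ord lim) x x∈)

      open Restriction identity universe identity-elementary tr lim′ lim (λ x _ → ∈universe x) cover

      opaque
        restrict : x ∈ restriction X ⇔ (x ∈ u × x ∈ X)
        restrict {x} {X} = ∈restriction ⇔∘ ×-⇔ ⇔-refl (≡-⇔ (cong (x ∈_) J-identity))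

        preserves : ∀ k {X Y W} → X ∈ 𝒫 u′ → Y ∈ 𝒫 u′ → W ∈ 𝒫 u′ → RelK k u′ (𝒫 u′) β c X Y W →
          RelK k u (𝒫 u) α c (restriction X) (restriction Y) (restriction W)
        preserves zero _ _ _ (h , k) = cong restriction h , cong restriction k
        preserves (suc zero) {X} {Y} _ _ _ (h , k , β⊆) = trans (cong restriction h) kept , cong restriction k ,
            λ x x∈ → from restrict (ord⊆𝕍 lev (lim-ord lim) x (trans-ord (lim-ord lim) α (ad-α (admissible lvl)) x x∈) , β⊆ x (≤⇒⊆ oβ α≤β x x∈))
          where
            c∈ : c ∈ u
            c∈ = 𝕍-mono (lim-ord lim) (∈⇒⊆ (lim-ord lim) (ad-ρ⁺ (admissible lvl))) (pa-ρ⁺ pa) c (pa-∈ pa)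
            kept : restriction (sing c) ≡ sing c
            kept = ⊆-antisym (λ x h → proj₂ (to restrict h)) (λ x h → from restrict (subst (_∈ u) (sym (to ∈sing h)) c∈ , h))
        preserves (suc (suc i)) X∈ Y∈ W∈ r = restriction-rel (colour i) (to ∈𝒫 X∈) (to ∈𝒫 Y∈) (to ∈𝒫 W∈) r

        backward : ∃! _≡_ λ h → IsHom h g′ g
        backward = _ , hom , λ H → hom-determined G′ G hom H λ X X∈ → extensionality λ x →
            HomEmbedding.trace pa lvl′ lvl G′ G hom (to ∈𝒫 X∈) ⇔∘ ⇔-sym (HomEmbedding.trace pa lvl′ lvl G′ G H (to ∈𝒫 X∈))
          where
            hom : IsHom (Induced.induced G′ G restrictionG (λ X _ → from ∈𝒫 λ x h → proj₁ (to restrict h)) preserves) g′ g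
            hom = Induced.induced-hom G′ G restrictionG (λ X _ → from ∈𝒫 λ x h → proj₁ (to restrict h)) preserves

  open Ladders public

  -- The counterexample without a proper class of strong cardinals, and the equivalences.

  module Equivalences where
    private variable
      α β : V
      A B : V

    module Counterexample (notProper : ¬ Proper IsStrong) where

      opaque
        strongBound : ∃[ ρ ] (Ord ρ × ∀ κ → Ord κ → ρ ⊆ κ → ¬ QAll κ)
        strongBound = bounded (byContra notProper)
          where
            bounded : ∃[ s ] (∀ x → x ∈ s ⇔ IsStrong x) → ∃[ ρ ] (Ord ρ × ∀ κ → Ord κ → ρ ⊆ κ → ¬ QAll κ)
            bounded (s , h) = strict (ord-sup λ z z∈ → toOrd (proj₁ (proj₁ (to (h z) z∈))))
              where
                strict : ∃[ σ ] (Ord σ × ∀ z → z ∈ s → z ∈ σ) → ∃[ ρ ] (Ord ρ × ∀ κ → Ord κ → ρ ⊆ κ → ¬ QAll κ)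
                strict (ρ , oρ , k) = ρ , oρ , λ κ oκ ρ⊆ q → ∈-irrefl (ρ⊆ κ (k κ (from (h κ) (QAll⇒strong oκ q))))

        parameters-exist : ∃[ ρ ] ∃[ ρ⁺ ] ∃[ L ] (Parameters ρ ρ⁺ L × ∀ κ → Ord κ → ρ ⊆ κ → ¬ QAll κ)
        parameters-exist = choose strongBound
          where
            choose : ∃[ ρ ] (Ord ρ × ∀ κ → Ord κ → ρ ⊆ κ → ¬ QAll κ) → ∃[ ρ ] ∃[ ρ⁺ ] ∃[ L ] (Parameters ρ ρ⁺ L × ∀ κ → Ord κ → ρ ⊆ κ → ¬ QAll κ)
            choose (ρ , oρ , none) = rank (ladderExists ρ)
              where
                rank : ∃[ L ] IsLadder ρ L → ∃[ ρ ] ∃[ ρ⁺ ] ∃[ L ] (Parameters ρ ρ⁺ L × ∀ κ → Ord κ → ρ ⊆ κ → ¬ QAll κ)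
                rank (L , l) = let (ρ⁺ , oρ⁺ , c∈) = everySetRanked ⟨ ρ , L ⟩ in ρ , ρ⁺ , L , mkParameters oρ oρ⁺ l c∈ , none

      ρ ρ⁺ L : V
      ρ = proj₁ parameters-exist
      ρ⁺ = proj₁ (proj₂ parameters-exist)
      L = proj₁ (proj₂ (proj₂ parameters-exist))
      pa : Parameters ρ ρ⁺ L
      pa = proj₁ (proj₂ (proj₂ (proj₂ parameters-exist)))

      open Definition ρ ρ⁺ ⟨ ρ , L ⟩ public

      opaque
        sequence : IsGraphSequence graphs
        sequence = isGraphSequence (pa-ρ⁺ pa) (proj₂ (proj₂ (proj₂ (proj₂ parameters-exist))))

        uniqueDown : ∀ α β A B → ⟨ α , A ⟩ ∈ᶜ graphs → ⟨ β , B ⟩ ∈ᶜ graphs → α ≤ β → ∃! _≡_ λ h → IsHom h B A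
        uniqueDown α β A B hA hB α≤β = analyse (to ∈graphs hA) (to ∈graphs hB)
          where
            analyse : InSequence α A → InSequence β B → ∃! _≡_ λ h → IsHom h B A
            analyse (mkInSequence (mkData _ l refl refl refl) G) (mkInSequence (mkData oβ l′ refl refl refl) G′) = Backward.backward pa α≤β oβ l l′ G G′

        down : ∀ α β A B → ⟨ α , A ⟩ ∈ᶜ graphs → ⟨ β , B ⟩ ∈ᶜ graphs → α ≤ β → ∃[ h ] IsHom h B A
        down α β A B hA hB α≤β = let (h , H , _) = uniqueDown α β A B hA hB α≤β in h , H

        noForward : NoForwardHom graphs
        noForward α β A B hA hB α∈β (h , H) = analyse (to ∈graphs hA) (to ∈graphs hB)
          where
            analyse : InSequence α A → InSequence β B → ⊥
            analyse (mkInSequence (mkData _ l refl refl refl) G) (mkInSequence (mkData _ l′ refl refl refl) G′) = HomEmbedding.no-forward pa l l′ G G′ H α∈β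

      WVP⇒⊥ : WVP (IsΠ 1) → ⊥
      WVP⇒⊥ wvp = wvp (graphs , graphs-Π₁ , sequence , uniqueDown , noForward)

      PRP⇒⊥ : PRP (IsΠ 1) → ⊥
      PRP⇒⊥ = RangeReflection.PRP⇒⊥ graphs graphRange ∈graphRange sequence down noForward {Γ = IsΠ 1} graphRange-Π₁

    PRP-Σ₂⇒Π₁ : PRP (IsΣ 2) → PRP (IsΠ 1)
    PRP-Σ₂⇒Π₁ prp C γ = prp C (Π⇒ γ)

    SWVP-Σ₂⇒Π₁ : SWVP (IsΣ 2) → SWVP (IsΠ 1)
    SWVP-Σ₂⇒Π₁ swvp (C , γ , h) = swvp (C , Π⇒ γ , h)

    WVP-Σ₂⇒Π₁ : WVP (IsΣ 2) → WVP (IsΠ 1)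
    WVP-Σ₂⇒Π₁ wvp (C , γ , h) = wvp (C , Π⇒ γ , h)

    SWVP⇒WVP : ∀ (Γ : FormulaClass) → SWVP Γ → WVP Γ
    SWVP⇒WVP Γ swvp (C , γ , seq , down , noUp) =
      swvp (C , γ , seq , (λ α β A B hA hB h → let (k , K , _) = down α β A B hA hB h in k , K) , noUp)

    PRP⇒strong : PRP (IsΠ 1) → Proper IsStrong
    PRP⇒strong prp bounded = Counterexample.PRP⇒⊥ (λ proper → proper bounded) prp

    WVP⇒strong : WVP (IsΠ 1) → Proper IsStrong
    WVP⇒strong wvp bounded = Counterexample.WVP⇒⊥ (λ proper → proper bounded) wvp

    strong⇒SWVP : Proper IsStrong → SWVP (IsΣ 2)
    strong⇒SWVP = PRP⇒SWVP ∘ strong⇒PRP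

    equivalences :
      (Proper IsStrong ⇔ PRP (IsΣ 2)) × (Proper IsStrong ⇔ PRP (IsΠ 1)) × (Proper IsStrong ⇔ SWVP (IsΣ 2)) ×
      (Proper IsStrong ⇔ SWVP (IsΠ 1)) × (Proper IsStrong ⇔ WVP (IsΣ 2)) × (Proper IsStrong ⇔ WVP (IsΠ 1))
    equivalences =
      mk⇔ strong⇒PRP (PRP⇒strong ∘ PRP-Σ₂⇒Π₁) ,
      mk⇔ (PRP-Σ₂⇒Π₁ ∘ strong⇒PRP) PRP⇒strong ,
      mk⇔ strong⇒SWVP (WVP⇒strong ∘ SWVP⇒WVP (IsΠ 1) ∘ SWVP-Σ₂⇒Π₁) ,
      mk⇔ (SWVP-Σ₂⇒Π₁ ∘ strong⇒SWVP) (WVP⇒strong ∘ SWVP⇒WVP (IsΠ 1)) ,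
      mk⇔ (SWVP⇒WVP (IsΣ 2) ∘ strong⇒SWVP) (WVP⇒strong ∘ WVP-Σ₂⇒Π₁) ,
      mk⇔ (SWVP⇒WVP (IsΠ 1) ∘ SWVP-Σ₂⇒Π₁ ∘ strong⇒SWVP) WVP⇒strong

  open Equivalences public

theorem5p12 : ∀ {ℓ} → ExcludedMiddle ℓ → (𝒱 : ZFCModel ℓ) →
    let open SetTheory 𝒱 in
    (Proper IsStrong ⇔ PRP (IsΣ 2)) ×
    (Proper IsStrong ⇔ PRP (IsΠ 1)) ×
    (Proper IsStrong ⇔ SWVP (IsΣ 2)) ×
    (Proper IsStrong ⇔ SWVP (IsΠ 1)) ×
    (Proper IsStrong ⇔ WVP (IsΣ 2)) ×
    (Proper IsStrong ⇔ WVP (IsΠ 1))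
theorem5p12 em 𝒱 = Theory.equivalences em 𝒱
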